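{- There is an algorithm that, given any strings $A$ and $B$ of length $n$ and a string $P$ of length $r$, solves the STR-IC-LCS problem (that is, computes an STR-IC-LCS of $A$, $B$ and $P$) in $O(nr/\log r+n(n-\ell'+1))$ time and $O((\ell'+1)(n-\ell'+1))$ space, where $\ell'$ is the length of an STR-IC-LCS of $A$, $B$ and $P$.
   Context: Strings are over an alphabet $\Sigma$. A subsequence of a string is obtained by deleting zero or more characters; a substring is a contiguous block; a common subsequence of $A$ and $B$ is a string that is a subsequence of both. A string $Z$ is an STR-IC-LCS of $A$ and $B$ including $P$ (an STR-IC-LCS of $A$, $B$ and $P$) if $Z$ is a longest string such that (1) $P$ is a substring of $Z$ and (2) $Z$ is a common subsequence of $A$ and $B$. If no such string exists, the solution is by convention $Z=\bot$ with $|\bot|=-1$. The STR-IC-LCS problem is: given $A,B$ of length $n$ and $P$, compute an STR-IC-LCS of $A$, $B$ and $P$. It is assumed that $r=|P|\le n$ (otherwise there is no solution). Time and working space are measured in the usual word RAM model (word size $\log_2 n$, space counted in words). -}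

module Defs where

open import Data.Bool.Base using (Bool; if_then_else_)
open import Data.Fin.Base using (Fin; toℕ)
open import Data.Integer.Base as ℤ using (ℤ; +_; -1ℤ; 1ℤ)
open import Data.List.Base using (List; []; _∷_; _∷ʳ_; length; map; head; drop)
open import Data.List.Relation.Binary.Infix.Heterogeneous using (Infix)
open import Data.List.Relation.Binary.Sublist.Propositional using (_⊆_)
open import Data.Maybe.Base using (Maybe; just; nothing; maybe′)
open import Data.Nat.Base
open import Data.Nat.DivMod using (_/_; _%_)
open import Data.Nat.Logarithm using (⌊log₂_⌋)
open import Data.Nat.Properties using (m^n≢0)
open import Data.Product.Base using (_×_)
open import Data.Vec.Functional using (Vector; updateAt)
open import Function.Base using (const; _∘_)
open import Relation.Binary.PropositionalEquality.Core using (_≡_)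
open import Relation.Nullary.Negation.Core using (¬_)

------------------------------------------------------------------------
-- STR-IC-LCS

module _ {Σ : Set} where

  CommonSubsequence : (A B Z : List Σ) → Set
  CommonSubsequence A B Z = Z ⊆ A × Z ⊆ B

  Substring : (P Z : List Σ) → Set
  Substring = Infix _≡_

  Candidate : (A B P Z : List Σ) → Set
  Candidate A B P Z = Substring P Z × CommonSubsequence A B Z

  -- `nothing` plays the role of ⊥.
  IsSTR-IC-LCS : (A B P : List Σ) → Maybe (List Σ) → Set
  IsSTR-IC-LCS A B P (just Z) =
    Candidate A B P Z × (∀ Z′ → Candidate A B P Z′ → length Z′ ≤ length Z)
  IsSTR-IC-LCS A B P nothing  = ∀ Z′ → ¬ Candidate A B P Z′

  ∣_∣⊥ : Maybe (List Σ) → ℤ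
  ∣ Z ∣⊥ = maybe′ (λ z → + length z) -1ℤ Z

------------------------------------------------------------------------
-- Word RAM

-- The input strings are read-only, one character per word.
data Tape : Set where
  tapeA tapeB tapeP : Tape

Input : Set
Input = Tape → List ℕ

encode : ∀ {σ} → (A B P : List (Fin σ)) → Input
encode A B P tapeA = map toℕ A
encode A B P tapeB = map toℕ B
encode A B P tapeP = map toℕ P

data ArithOp : Set where
  add sub mul div and or xor shl shr : ArithOp

data Comparison : Set where
  lt eq : Comparison

data Instr (k : ℕ) : Set where
  literal : (dst : Fin k) (c : ℕ) → Instr k
  arith   : (o : ArithOp) (dst x y : Fin k) → Instr k
  load    : (dst addr : Fin k) → Instr k
  store   : (addr src : Fin k) → Instr k
  size    : (dst : Fin k) (τ : Tape) → Instr k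
  read    : (dst : Fin k) (τ : Tape) (idx : Fin k) → Instr k
  jump    : (target : ℕ) → Instr k
  jumpIf  : (p : Comparison) (x y : Fin k) (target : ℕ) → Instr k
  emit    : (src : Fin k) → Instr k   -- append a word to the write-only output
  accept  : Instr k                   -- halt; the answer is the emitted string
  reject  : Instr k                   -- halt; the answer is ⊥

record Program : Set where
  field
    registers : ℕ
    code      : List (Instr registers)

open Program public

record Config (k : ℕ) : Set where
  constructor config
  field
    pc   : ℕ
    regs : Vector ℕ k
    mem  : ℕ → ℕ
    out  : List ℕ
    -- Least s such that all addresses accessed so far lie in {0, …, s - 1}.
    used : ℕ

data State (k : ℕ) : Set where
  running : Config k → State k
  halted  : (answer : Maybe (List ℕ)) (used : ℕ) → State k

-- Operations on words of w bits; arithmetic is modulo 2 ^ w.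
module Word (w : ℕ) where

  trunc : ℕ → ℕ
  trunc x = _%_ x (2 ^ w) {{m^n≢0 2 w}}

  bitwise : (ℕ → ℕ → ℕ) → ℕ → ℕ → ℕ
  bitwise f = go w
    where
    go : ℕ → ℕ → ℕ → ℕ
    go zero    x y = 0
    go (suc i) x y = f (x % 2) (y % 2) + 2 * go i (x / 2) (y / 2)

  -- Division by zero yields zero.
  quotient : ℕ → ℕ → ℕ
  quotient x zero    = 0
  quotient x (suc y) = x / suc y

  ⟦_⟧ : ArithOp → ℕ → ℕ → ℕ
  ⟦ add ⟧ x y = trunc (x + y)
  ⟦ sub ⟧ x y = trunc (x + (2 ^ w ∸ y))
  ⟦ mul ⟧ x y = trunc (x * y)
  ⟦ div ⟧ x y = quotient x y
  ⟦ and ⟧ = bitwise _⊓_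
  ⟦ or  ⟧ = bitwise _⊔_
  ⟦ xor ⟧ = bitwise ∣_-_∣
  ⟦ shl ⟧ x y = trunc (x * 2 ^ y)
  ⟦ shr ⟧ x y = _/_ x (2 ^ y) {{m^n≢0 2 y}}

compareWords : Comparison → ℕ → ℕ → Bool
compareWords lt x y = x <ᵇ y
compareWords eq x y = x ≡ᵇ y

-- Reading past the end of an input string yields zero.
charAt : List ℕ → ℕ → ℕ
charAt xs i = maybe′ (λ x → x) 0 (head (drop i xs))

_[_≔_] : (ℕ → ℕ) → ℕ → ℕ → ℕ → ℕ
(m [ a ≔ v ]) b = if b ≡ᵇ a then v else m b

module _ (w : ℕ) (input : Input) where

  open Word w

  exec : ∀ {k} → Instr k → Config k → State k
  exec {k} instr (config pc regs mem out used) = go instr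
    where
    set : Fin k → ℕ → State k
    set dst v =
      running (config (suc pc) (updateAt regs dst (const v)) mem out used)

    go : Instr k → State k
    go (literal dst c) = set dst (trunc c)
    go (arith o dst x y) = set dst (⟦ o ⟧ (regs x) (regs y))
    go (load dst addr) =
      running (config (suc pc) (updateAt regs dst (const (mem (regs addr)))) mem
                      out (used ⊔ suc (regs addr)))
    go (store addr src) =
      running (config (suc pc) regs (mem [ regs addr ≔ regs src ])
                      out (used ⊔ suc (regs addr)))
    go (size dst τ) = set dst (trunc (length (input τ)))
    go (read dst τ idx) = set dst (trunc (charAt (input τ) (regs idx)))
    go (jump target) = running (config target regs mem out used)
    go (jumpIf p x y target) =
      running (config (if compareWords p (regs x) (regs y) then target else suc pc)
                      regs mem out used)
    go (emit src) = running (config (suc pc) regs mem (out ∷ʳ regs src) used)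
    go accept = halted (just out) used
    go reject = halted nothing used

  -- A program counter outside the code never halts.
  step : (M : Program) → State (registers M) → State (registers M)
  step M (running γ) =
    maybe′ (λ instr → exec instr γ) (running γ) (head (drop (Config.pc γ) (code M)))
  step M (halted a s) = halted a s

  initial : (M : Program) → State (registers M)
  initial M = running (config 0 (const 0) (const 0) [] 0)

  runFor : (M : Program) → ℕ → State (registers M)
  runFor M zero    = initial M
  runFor M (suc t) = step M (runFor M t)

-- Working space is the registers together with the memory words addressed.
record Computes (M : Program) (w : ℕ) (input : Input)
                (answer : Maybe (List ℕ)) (time space : ℕ) : Set where
  field
    used   : ℕ
    halts  : runFor w input M time ≡ halted answer used
    space≡ : space ≡ registers M + used

-- κ · Θ(log n) bits for an alphabet of size n ^ O(1); the ⊔ makes sure that a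
-- character of an arbitrary alphabet Fin σ fits in a word.
wordSize : (κ σ n : ℕ) → ℕ
wordSize κ σ n = κ * suc ⌊log₂ (n ⊔ σ) ⌋

------------------------------------------------------------------------
-- Complexity bounds

-- suc ⌊log₂ r ⌋ is Θ(log r) for r ≥ 2, and stays positive for r ≤ 1.
timeBound : (n r : ℕ) (ℓ′ : ℤ) → ℤ
timeBound n r ℓ′ =
  + (n * r / suc ⌊log₂ r ⌋) ℤ.+ + n ℤ.* (+ n ℤ.- ℓ′ ℤ.+ 1ℤ)

spaceBound : (n : ℕ) (ℓ′ : ℤ) → ℤ
spaceBound n ℓ′ = (ℓ′ ℤ.+ 1ℤ) ℤ.* (+ n ℤ.- ℓ′ ℤ.+ 1ℤ)

-- x ≤ c · (f + 1): the + 1 matters only where f vanishes (the time bound at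
-- n = 0 and the space bound at ℓ′ = -1), since 1 ≤ f elsewhere.
_≤_·O[_] : ℕ → ℕ → ℤ → Set
x ≤ c ·O[ f ] = + x ℤ.≤ + c ℤ.* (f ℤ.+ 1ℤ)

{-# OPTIONS --safe #-}

-- Whether P is a subsequence of both A and B is decided greedily in constant space; if not, the answer is ⊥.
-- Otherwise let eA(i) be the end of the shortest window of A that starts at i and contains P, and similarly
-- eB(j). Let F(i,j) be the length of a longest common subsequence of the suffixes A[i..] and B[j..], and
-- G(i,j) that of a longest common subsequence of the form X P Y. Both satisfy the recurrence of longest
-- common subsequences, except that G(i,j) may also start with P and continue as F(eA(i),eB(j)).
--
-- Windows: P is cut into O(r / log r) blocks of about ½ log r characters, after renaming the characters
-- of the texts by their rank in P. The set of the partial matches that are still alive inside a block is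
-- kept in one word and advanced over the text in O(1) steps per character, with a table for the bitwise
-- conjunction. This finds the ends of the minimal windows, and on the reversed text their starts; the k-th
-- start belongs to the k-th end.
--
-- Tables: only the cells within distance κ of the diagonal are computed, row by row and in place; row i of G
-- needs no row of F but eA(i), which is non-decreasing in i. Solutions are lists in a heap that share their
-- tails. A solution leaving out at most κ characters of A stays within the band, so κ is doubled until the
-- value found proves itself optimal, which happens before κ exceeds 2(n - ℓ′) + 1. A row creates at most
-- min(O(κ), ℓ′ + 1) nodes, because a new node has to improve on the values to its right in the same row.
-- Either bound is used where it is the better one: n · min(n - ℓ′ + 1, ℓ′ + 1) = O((ℓ′ + 1)(n - ℓ′ + 1)).
--
-- The program is written with structured commands that carry their cost, and translated to RAM code; a loop
-- whose body's cost varies is paid from a credit that is part of its invariant.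

module Submission where

open import Data.Bool.Base using (Bool; true; false; T; if_then_else_; not; _∧_; _∨_)
open import Data.List.Base using (List; []; _∷_; _++_; length; drop)
open import Data.Nat.Base hiding (less)
open import Data.Nat.Properties
open import Data.Product.Base using (Σ-syntax; ∃; ∃-syntax; _×_; _,_; proj₁; proj₂)
open import Data.Sum.Base using (_⊎_; inj₁; inj₂)
open import Relation.Binary.PropositionalEquality hiding ([_])
open import Relation.Nullary using (Dec; ¬_; yes; no; contradiction)
import Defs
open Defs using (Input; Tape; tapeA; tapeB; tapeP; charAt)

-- A solution of length ℓ′ gives (ℓ′ + 1)(n - ℓ′ + 1) ≥ n + 1, so arrays of linear length are free
-- once a solution exists. For ⊥ the space bound is constant: that answer has to be settled in
-- registers. Only the heap can be superlinear; it is emptied whenever κ is doubled, so its size is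
-- governed by one value of κ, while the times add up geometrically. The alphabet may be huge, which
-- rules out arrays indexed by characters and forces the renaming; sorting and searching may cost
-- O(r / log r) per character. The block length comes from the table for the conjunction, whose 4 ^
-- b entries for blocks of length b must be O(r). Cells are not specified by exact recurrences. Each
-- is empty or holds a genuine candidate, and it is at least as good as every candidate that leaves
-- out few characters; off the band, older values stay genuine. F is computed only behind the first
-- windows of A and B: there P followed by a candidate of F is a candidate of the problem, so the
-- optimum caps the values of F. The optimum is known to the proof but not to the program; it fixes
-- the memory limit in advance.

-- Polynomial inequalities over ℕ by reflection

module Linear where

  open import Data.Fin.Base using (Fin; toℕ)
  open import Data.List.Properties using (≡-dec)
  open import Data.Maybe.Base using (Maybe; just; nothing; is-just)
  open import Data.Vec.Base using (Vec; lookup; allFin) renaming (map to mapᵛ)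
  open import Data.Vec.N-ary using (N-ary; ∀ⁿ; curryⁿ; _$ⁿ_)

  infixl 6 _:+_
  infixl 7 _:*_
  infix 4 _:≤_ _:<_
  infix 3 _∙_
  infix 1 _⊢_

  data Poly (k : ℕ) : Set where
    ‵   : Fin k → Poly k
    #_  : ℕ → Poly k
    _:+_ _:*_ : Poly k → Poly k → Poly k
    ↑_ : Poly k → Poly k

  -- Polynomial inequality `e ∙ a :≤ b`, read as a ≤ b to be used with the multiplier e.
  record Ineq (k : ℕ) : Set where
    constructor ineq
    field
      scale lower upper : Poly k

  _:≤_ _:<_ : ∀ {k} → Poly k → Poly k → Ineq k
  a :≤ b = ineq (# 1) a b
  a :< b = ineq (# 1) (↑ a) b

  _∙_ : ∀ {k} → Poly k → Ineq k → Ineq k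
  e ∙ ineq _ a b = ineq e a b

  record Problem (k : ℕ) : Set where
    constructor _⊢_
    field
      hypotheses : List (Ineq k)
      goal       : Ineq k

  Monomial : Set
  Monomial = List ℕ

  Normal : Set
  Normal = List (ℕ × Monomial)

  -- Sorted variables make equal monomials syntactically equal. The terms of a sum stay unsorted,
  -- because `addTerm` and `removeTerm` search for them.
  insertVar : ℕ → Monomial → Monomial
  insertVar x []      = x ∷ []
  insertVar x (y ∷ m) with x <ᵇ y
  ... | true  = x ∷ y ∷ m
  ... | false = y ∷ insertVar x m

  timesMonomial : Monomial → Monomial → Monomial
  timesMonomial []      m′ = m′
  timesMonomial (x ∷ m) m′ = insertVar x (timesMonomial m m′)

  addTerm : ℕ → Monomial → Normal → Normal
  addTerm c m [] = (c , m) ∷ []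
  addTerm c m ((c′ , m′) ∷ p) with ≡-dec _≟_ m m′
  ... | yes _ = (c + c′ , m′) ∷ p
  ... | no  _ = (c′ , m′) ∷ addTerm c m p

  plus : Normal → Normal → Normal
  plus []            q = q
  plus ((c , m) ∷ p) q = addTerm c m (plus p q)

  timesTerm : ℕ → Monomial → Normal → Normal
  timesTerm c m []              = []
  timesTerm c m ((c′ , m′) ∷ p) = addTerm (c * c′) (timesMonomial m m′) (timesTerm c m p)

  times : Normal → Normal → Normal
  times []            q = []
  times ((c , m) ∷ p) q = plus (timesTerm c m q) (times p q)

  normalise : ∀ {k} → Poly k → Normal
  normalise (‵ x)    = (1 , toℕ x ∷ []) ∷ []
  normalise (# c)    = (c , []) ∷ []
  normalise (a :+ b) = plus (normalise a) (normalise b)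
  normalise (a :* b) = times (normalise a) (normalise b)
  normalise (↑ a)    = addTerm 1 [] (normalise a)

  -- Coefficientwise subtraction. Failure means only that this certificate does not work, not that
  -- the inequality is false.
  removeTerm : ℕ → Monomial → Normal → Maybe Normal
  removeTerm zero m p = just p
  removeTerm (suc c) m [] = nothing
  removeTerm (suc c) m ((c′ , m′) ∷ p) with ≡-dec _≟_ m m′
  ... | no  _ with removeTerm (suc c) m p
  ...   | just p′ = just ((c′ , m′) ∷ p′)
  ...   | nothing = nothing
  removeTerm (suc c) m ((c′ , m′) ∷ p) | yes _ with suc c ≤? c′
  ... | yes _ = just ((c′ ∸ suc c , m′) ∷ p)
  ... | no  _ = nothing

  remove : Normal → Normal → Maybe Normal
  remove []            p = just p
  remove ((c , m) ∷ q) p with removeTerm c m p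
  ... | just p′ = remove q p′
  ... | nothing = nothing

  module _ (ρ : ℕ → ℕ) where

    ⟦_⟧ᵐ : Monomial → ℕ
    ⟦ [] ⟧ᵐ    = 1
    ⟦ x ∷ m ⟧ᵐ = ρ x * ⟦ m ⟧ᵐ

    ⟦_⟧ⁿ : Normal → ℕ
    ⟦ [] ⟧ⁿ          = 0
    ⟦ (c , m) ∷ p ⟧ⁿ = c * ⟦ m ⟧ᵐ + ⟦ p ⟧ⁿ

    private
      swap* : ∀ a b c → a * (b * c) ≡ b * (a * c)
      swap* a b c = trans (sym (*-assoc a b c)) (trans (cong (_* c) (*-comm a b)) (*-assoc b a c))

      swap+ : ∀ a b c → a + (b + c) ≡ b + (a + c)
      swap+ a b c = trans (sym (+-assoc a b c)) (trans (cong (_+ c) (+-comm a b)) (+-assoc b a c))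

    insertVar-sound : ∀ x m → ⟦ insertVar x m ⟧ᵐ ≡ ρ x * ⟦ m ⟧ᵐ
    insertVar-sound x []      = refl
    insertVar-sound x (y ∷ m) with x <ᵇ y
    ... | true  = refl
    ... | false = trans (cong (ρ y *_) (insertVar-sound x m)) (swap* (ρ y) (ρ x) ⟦ m ⟧ᵐ)

    timesMonomial-sound : ∀ m m′ → ⟦ timesMonomial m m′ ⟧ᵐ ≡ ⟦ m ⟧ᵐ * ⟦ m′ ⟧ᵐ
    timesMonomial-sound []      m′ = sym (+-identityʳ _)
    timesMonomial-sound (x ∷ m) m′ =
      trans (insertVar-sound x (timesMonomial m m′))
            (trans (cong (ρ x *_) (timesMonomial-sound m m′)) (sym (*-assoc (ρ x) _ _)))

    addTerm-sound : ∀ c m p → ⟦ addTerm c m p ⟧ⁿ ≡ c * ⟦ m ⟧ᵐ + ⟦ p ⟧ⁿ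
    addTerm-sound c m [] = refl
    addTerm-sound c m ((c′ , m′) ∷ p) with ≡-dec _≟_ m m′
    ... | yes refl = trans (cong (_+ ⟦ p ⟧ⁿ) (*-distribʳ-+ ⟦ m ⟧ᵐ c c′)) (+-assoc (c * ⟦ m ⟧ᵐ) _ _)
    ... | no  _    = trans (cong (c′ * ⟦ m′ ⟧ᵐ +_) (addTerm-sound c m p)) (swap+ (c′ * ⟦ m′ ⟧ᵐ) (c * ⟦ m ⟧ᵐ) ⟦ p ⟧ⁿ)

    plus-sound : ∀ p q → ⟦ plus p q ⟧ⁿ ≡ ⟦ p ⟧ⁿ + ⟦ q ⟧ⁿ
    plus-sound []            q = refl
    plus-sound ((c , m) ∷ p) q =
      trans (addTerm-sound c m (plus p q))
            (trans (cong (c * ⟦ m ⟧ᵐ +_) (plus-sound p q)) (sym (+-assoc (c * ⟦ m ⟧ᵐ) _ _)))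

    timesTerm-sound : ∀ c m p → ⟦ timesTerm c m p ⟧ⁿ ≡ c * ⟦ m ⟧ᵐ * ⟦ p ⟧ⁿ
    timesTerm-sound c m []              = sym (*-zeroʳ (c * ⟦ m ⟧ᵐ))
    timesTerm-sound c m ((c′ , m′) ∷ p) = begin
      ⟦ addTerm (c * c′) (timesMonomial m m′) (timesTerm c m p) ⟧ⁿ
        ≡⟨ addTerm-sound (c * c′) (timesMonomial m m′) (timesTerm c m p) ⟩
      c * c′ * ⟦ timesMonomial m m′ ⟧ᵐ + ⟦ timesTerm c m p ⟧ⁿ
        ≡⟨ cong₂ _+_ (cong (c * c′ *_) (timesMonomial-sound m m′)) (timesTerm-sound c m p) ⟩
      c * c′ * (⟦ m ⟧ᵐ * ⟦ m′ ⟧ᵐ) + c * ⟦ m ⟧ᵐ * ⟦ p ⟧ⁿ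
        ≡⟨ cong (_+ c * ⟦ m ⟧ᵐ * ⟦ p ⟧ⁿ) ([m*n]*[o*p]≡[m*o]*[n*p] c c′ ⟦ m ⟧ᵐ ⟦ m′ ⟧ᵐ) ⟩
      c * ⟦ m ⟧ᵐ * (c′ * ⟦ m′ ⟧ᵐ) + c * ⟦ m ⟧ᵐ * ⟦ p ⟧ⁿ
        ≡⟨ *-distribˡ-+ (c * ⟦ m ⟧ᵐ) (c′ * ⟦ m′ ⟧ᵐ) ⟦ p ⟧ⁿ ⟨
      c * ⟦ m ⟧ᵐ * (c′ * ⟦ m′ ⟧ᵐ + ⟦ p ⟧ⁿ) ∎
      where open ≡-Reasoning

    times-sound : ∀ p q → ⟦ times p q ⟧ⁿ ≡ ⟦ p ⟧ⁿ * ⟦ q ⟧ⁿ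
    times-sound []            q = refl
    times-sound ((c , m) ∷ p) q =
      trans (plus-sound (timesTerm c m q) (times p q))
            (trans (cong₂ _+_ (timesTerm-sound c m q) (times-sound p q))
                   (sym (*-distribʳ-+ ⟦ q ⟧ⁿ (c * ⟦ m ⟧ᵐ) ⟦ p ⟧ⁿ)))

    removeTerm-sound : ∀ c m p p′ → removeTerm c m p ≡ just p′ → ⟦ p ⟧ⁿ ≡ c * ⟦ m ⟧ᵐ + ⟦ p′ ⟧ⁿ
    removeTerm-sound zero m p .p refl = refl
    removeTerm-sound (suc c) m ((c′ , m′) ∷ p) p′ e with ≡-dec _≟_ m m′
    removeTerm-sound (suc c) m ((c′ , m′) ∷ p) p′ e | no _ with removeTerm (suc c) m p in eq
    removeTerm-sound (suc c) m ((c′ , m′) ∷ p) _ refl | no _ | just p″ =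
      trans (cong (c′ * ⟦ m′ ⟧ᵐ +_) (removeTerm-sound (suc c) m p p″ eq)) (swap+ (c′ * ⟦ m′ ⟧ᵐ) (suc c * ⟦ m ⟧ᵐ) ⟦ p″ ⟧ⁿ)
    removeTerm-sound (suc c) m ((c′ , .m) ∷ p) p′ e | yes refl with suc c ≤? c′
    removeTerm-sound (suc c) m ((c′ , .m) ∷ p) _ refl | yes refl | yes le =
      trans (cong (λ x → x * ⟦ m ⟧ᵐ + ⟦ p ⟧ⁿ) (sym (m+[n∸m]≡n le)))
            (trans (cong (_+ ⟦ p ⟧ⁿ) (*-distribʳ-+ ⟦ m ⟧ᵐ (suc c) (c′ ∸ suc c)))
                   (+-assoc (suc c * ⟦ m ⟧ᵐ) _ _))

    remove-sound : ∀ q p → T (is-just (remove q p)) → ⟦ q ⟧ⁿ ≤ ⟦ p ⟧ⁿ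
    remove-sound []            p t = z≤n
    remove-sound ((c , m) ∷ q) p t with removeTerm c m p in eq
    ... | just p′ = subst (c * ⟦ m ⟧ᵐ + ⟦ q ⟧ⁿ ≤_) (sym (removeTerm-sound c m p p′ eq))
                          (+-monoʳ-≤ (c * ⟦ m ⟧ᵐ) (remove-sound q p′ t))

  module _ {k : ℕ} where

    ⟦_⟧ : Poly k → Vec ℕ k → ℕ
    ⟦ ‵ x ⟧    ρ = lookup ρ x
    ⟦ # c ⟧    ρ = c
    ⟦ a :+ b ⟧ ρ = ⟦ a ⟧ ρ + ⟦ b ⟧ ρ
    ⟦ a :* b ⟧ ρ = ⟦ a ⟧ ρ * ⟦ b ⟧ ρ
    ⟦ ↑ a ⟧    ρ = suc (⟦ a ⟧ ρ)

    Holds : Ineq k → Vec ℕ k → Set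
    Holds (ineq _ a b) ρ = ⟦ a ⟧ ρ ≤ ⟦ b ⟧ ρ

    Entails : List (Ineq k) → Ineq k → Vec ℕ k → Set
    Entails []       g ρ = Holds g ρ
    Entails (h ∷ hs) g ρ = Holds h ρ → Entails hs g ρ

    lowers uppers : List (Ineq k) → Poly k
    lowers []                = # 0
    lowers (ineq e a b ∷ hs) = e :* a :+ lowers hs
    uppers []                = # 0
    uppers (ineq e a b ∷ hs) = e :* b :+ uppers hs

    -- Adding up the hypotheses gives the goal, up to monomials with nonnegative coefficients.
    follows : Problem k → Bool
    follows (hs ⊢ ineq _ a b) =
      is-just (remove (normalise (a :+ uppers hs)) (normalise (b :+ lowers hs)))

  nth : ∀ {k} → Vec ℕ k → ℕ → ℕ
  nth Vec.[]      i       = 0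
  nth (x Vec.∷ ρ) zero    = x
  nth (x Vec.∷ ρ) (suc i) = nth ρ i

  module _ {k : ℕ} (ρ : Vec ℕ k) where

    nth-lookup : ∀ {k} (ρ : Vec ℕ k) (x : Fin k) → nth ρ (toℕ x) ≡ lookup ρ x
    nth-lookup (x Vec.∷ ρ) Fin.zero    = refl
    nth-lookup (x Vec.∷ ρ) (Fin.suc i) = nth-lookup ρ i

    normalise-sound : ∀ (e : Poly k) → ⟦ nth ρ ⟧ⁿ (normalise e) ≡ ⟦ e ⟧ ρ
    normalise-sound (‵ x)    = trans (+-identityʳ _) (trans (+-identityʳ _)
                                 (trans (*-identityʳ _) (nth-lookup ρ x)))
    normalise-sound (# c)    = trans (+-identityʳ _) (*-identityʳ c)
    normalise-sound (a :+ b) = trans (plus-sound (nth ρ) (normalise a) (normalise b))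
                                 (cong₂ _+_ (normalise-sound a) (normalise-sound b))
    normalise-sound (a :* b) = trans (times-sound (nth ρ) (normalise a) (normalise b))
                                 (cong₂ _*_ (normalise-sound a) (normalise-sound b))
    normalise-sound (↑ a)    = trans (addTerm-sound (nth ρ) 1 [] (normalise a))
                                 (cong suc (normalise-sound a))

    entails : ∀ hs (g : Ineq k) →
              (⟦ lowers hs ⟧ ρ ≤ ⟦ uppers hs ⟧ ρ → Holds g ρ) → Entails hs g ρ
    entails []                g f = f z≤n
    entails (ineq e a b ∷ hs) g f h =
      entails hs g λ hs′ → f (+-mono-≤ (*-monoʳ-≤ (⟦ e ⟧ ρ) h) hs′)

    -- Comparing coefficients gives a + `uppers` ≤ b + `lowers` for all values; the hypotheses,
    -- scaled and added up, give `lowers` ≤ `uppers`, and then `uppers` cancels.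
    follows-sound : ∀ hs (g : Ineq k) → T (follows (hs ⊢ g)) → Entails hs g ρ
    follows-sound hs g@(ineq _ a b) t = entails hs g λ h →
      +-cancelʳ-≤ (⟦ uppers hs ⟧ ρ) (⟦ a ⟧ ρ) (⟦ b ⟧ ρ)
        (≤-trans (subst₂ _≤_ (normalise-sound (a :+ uppers hs)) (normalise-sound (b :+ lowers hs))
                    (remove-sound (nth ρ) (normalise (a :+ uppers hs)) (normalise (b :+ lowers hs)) t))
                 (+-monoʳ-≤ (⟦ b ⟧ ρ) h))

  curryᵈ : ∀ {k} (F : Vec ℕ k → Set) → (∀ ρ → F ρ) → ∀ⁿ k (curryⁿ F)
  curryᵈ {zero}  F f = f Vec.[]
  curryᵈ {suc k} F f = λ x → curryᵈ (λ ρ → F (x Vec.∷ ρ)) (λ ρ → f (x Vec.∷ ρ))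

  instantiate : ∀ k → N-ary k (Poly k) (Problem k) → Problem k
  instantiate k f = f $ⁿ mapᵛ ‵ (allFin k)

  -- The certificate is checked by evaluating closed syntax, so `t` is inferred at every use; the
  -- caller writes down the shape of the problem and its multipliers, followed by the values and the
  -- proofs of the hypotheses.
  lin : ∀ k (f : N-ary k (Poly k) (Problem k)) → let hs ⊢ g = instantiate k f in
        {t : T (follows (instantiate k f))} → ∀ⁿ k (curryⁿ (Entails hs g))
  lin k f {t} = let hs ⊢ g = instantiate k f in curryᵈ (Entails hs g) (λ ρ → follows-sound ρ hs g t)

open Linear using (lin; _:+_; _:*_; _:≤_; _:<_; _⊢_; _∙_; ↑_) renaming (#_ to ‵_)

-- A structured language with costs and its program logic

module Language where

  open import Data.Empty using (⊥)
  open import Data.Fin.Base using (Fin)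
  open import Data.List.Base using (_∷ʳ_)
  open import Data.Maybe.Base using (Maybe)
  open import Data.Unit.Base using (⊤; tt)
  open Defs

  -- Array a is stored at the addresses congruent to a modulo `arrays`.

  variables arrays temporaries : ℕ
  variables   = 48
  arrays      = 11
  temporaries = 8

  data Op : Set where
    plus times quot monus less equal : Op

  infixl 6 _⊕_ _⊖_
  infixl 7 _⊛_ _⊘_
  infix  5 _⋖_ _≐_
  infixr 4 _&&_
  infix  3 _:=_ _[_]:=_
  infixr 2 _⨾_

  data Exp : Set where
    #_   : ℕ → Exp
    v    : ℕ → Exp
    bin  : Op → Exp → Exp → Exp
    ld   : ℕ → Exp → Exp
    rd   : Tape → Exp → Exp
    sz   : Tape → Exp
    ite  : Exp → Exp → Exp → Exp
    _&&_ : Exp → Exp → Exp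

  pattern _⊕_ a b = bin plus a b
  pattern _⊛_ a b = bin times a b
  pattern _⊘_ a b = bin quot a b
  pattern _⊖_ a b = bin monus a b
  pattern _⋖_ a b = bin less a b
  pattern _≐_ a b = bin equal a b

  data Cmd : Set where
    _:=_    : ℕ → Exp → Cmd
    _[_]:=_ : ℕ → Exp → Exp → Cmd
    put    : Exp → Cmd
    _⨾_    : Cmd → Cmd → Cmd
    cond   : Exp → Cmd → Cmd → Cmd
    while  : Exp → Cmd → Cmd
    skip   : Cmd

  -- The number of instructions generated, which also bounds the time. `monus` and the comparisons
  -- are compiled with a conditional jump.
  opCost : Op → ℕ
  opCost plus  = 1
  opCost times = 1
  opCost quot  = 1
  opCost _     = 4

  costE : Exp → ℕ
  costE (# c)       = 1
  costE (v x)       = 2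
  costE (bin o a b) = costE a + costE b + opCost o
  costE (ld a e)    = costE e + 5
  costE (rd τ e)    = costE e + 1
  costE (sz τ)      = 1
  costE (ite c a b) = costE c + (costE a + costE b) + 3
  costE (a && b)    = costE a + costE b + 4

  depth : Exp → ℕ
  depth (# c)       = 1
  depth (v x)       = 2
  depth (bin o a b) = depth a ⊔ suc (depth b)
  depth (ld a e)    = depth e ⊔ 2
  depth (rd τ e)    = depth e
  depth (sz τ)      = 1
  depth (ite c a b) = (depth c ⊔ 2) ⊔ (depth a ⊔ depth b)
  depth (a && b)    = depth a ⊔ (2 ⊔ depth b)

  -- One temporary is kept in reserve: in an array assignment the value is evaluated while the
  -- address waits in the first temporary.
  shallow : Exp → Bool
  shallow e = suc (depth e) ≤ᵇ temporaries

  record Store : Set where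
    constructor stored
    field
      env : ℕ → ℕ
      arr : ℕ → ℕ → ℕ
      out : List ℕ

  open Store public

  update : (ℕ → ℕ → ℕ) → ℕ → ℕ → ℕ → ℕ → ℕ → ℕ
  update α a i x a′ = if a′ ≡ᵇ a then α a [ i ≔ x ] else α a′

  ≔-hit : ∀ (m : ℕ → ℕ) a x → (m [ a ≔ x ]) a ≡ x
  ≔-hit m a x with a ≡ᵇ a | ≡⇒≡ᵇ a a refl
  ... | true | _ = refl

  ≔-miss : ∀ (m : ℕ → ℕ) {a b} x → b ≢ a → (m [ a ≔ x ]) b ≡ m b
  ≔-miss m {a} {b} x ne with b ≡ᵇ a in eq
  ... | true  = contradiction (≡ᵇ⇒≡ b a (subst T (sym eq) tt)) ne
  ... | false = refl

  writesV : Cmd → ℕ → Bool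
  writesV (y := e)      x = x ≡ᵇ y
  writesV (c ⨾ d)      x = writesV c x ∨ writesV d x
  writesV (cond e c d) x = writesV c x ∨ writesV d x
  writesV (while e c)  x = writesV c x
  writesV _            x = false

  writesA : Cmd → ℕ → Bool
  writesA (b [ i ]:= e) a = a ≡ᵇ b
  writesA (c ⨾ d)      a = writesA c a ∨ writesA d a
  writesA (cond e c d) a = writesA c a ∨ writesA d a
  writesA (while e c)  a = writesA c a
  writesA _            a = false

  emits : Cmd → Bool
  emits (put e)      = true
  emits (c ⨾ d)      = emits c ∨ emits d
  emits (cond e c d) = emits c ∨ emits d
  emits (while e c)  = emits c
  emits _            = false

  -- Frame condition. What a command cannot change is read off its text, so the implicit arguments
  -- are found by evaluation at each use.
  record Same (c : Cmd) (s s′ : Store) : Set where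
    field
      varₛ : ∀ x {_ : T (not (writesV c x))} → env s′ x ≡ env s x
      arrₛ : ∀ a {_ : T (not (writesA c a))} i → arr s′ a i ≡ arr s a i
      outₛ : {_ : T (not (emits c))} → out s′ ≡ out s

  open Same public

  same-refl : ∀ {c s} → Same c s s
  same-refl = record { varₛ = λ _ → refl ; arrₛ = λ _ _ → refl ; outₛ = refl }

  same-trans : ∀ {c s₁ s₂ s₃} → Same c s₁ s₂ → Same c s₂ s₃ → Same c s₁ s₃
  same-trans p q = record
    { varₛ = λ x {t} → trans (varₛ q x {t}) (varₛ p x {t})
    ; arrₛ = λ a {t} i → trans (arrₛ q a {t} i) (arrₛ p a {t} i)
    ; outₛ = λ {t} → trans (outₛ q {t}) (outₛ p {t}) }

  record Machine : Set where
    constructor machine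
    field
      w lim : ℕ
      input : Input

  module Semantics (mc : Machine) where

    open Machine mc

    W : ℕ
    W = 2 ^ w

    evalOp : Op → ℕ → ℕ → ℕ
    evalOp plus  x y = x + y
    evalOp times x y = x * y
    evalOp quot  x y = Word.quotient w x y
    evalOp monus x y = x ∸ y
    evalOp less  x y = if x <ᵇ y then 1 else 0
    evalOp equal x y = if x ≡ᵇ y then 1 else 0

    ⟦_⟧ : Exp → Store → ℕ
    ⟦ # c ⟧       σ = c
    ⟦ v x ⟧       σ = env σ x
    ⟦ bin o a b ⟧ σ = evalOp o (⟦ a ⟧ σ) (⟦ b ⟧ σ)
    ⟦ ld a e ⟧    σ = arr σ a (⟦ e ⟧ σ)
    ⟦ rd τ e ⟧    σ = charAt (input τ) (⟦ e ⟧ σ)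
    ⟦ sz τ ⟧      σ = length (input τ)
    ⟦ ite c a b ⟧ σ = if ⟦ c ⟧ σ ≡ᵇ 0 then ⟦ b ⟧ σ else ⟦ a ⟧ σ
    ⟦ a && b ⟧    σ = if ⟦ a ⟧ σ ≡ᵇ 0 then 0 else ⟦ b ⟧ σ

    -- Tests as propositions, so that invariants meet `<` and `≡` rather than the numbers 0 and 1.
    True False : Exp → Store → Set
    True (a ⋖ b)  σ = ⟦ a ⟧ σ < ⟦ b ⟧ σ
    True (a ≐ b)  σ = ⟦ a ⟧ σ ≡ ⟦ b ⟧ σ
    True (a && b) σ = True a σ × True b σ
    True e        σ = ⟦ e ⟧ σ ≢ 0
    False (a ⋖ b)  σ = ⟦ b ⟧ σ ≤ ⟦ a ⟧ σ
    False (a ≐ b)  σ = ⟦ a ⟧ σ ≢ ⟦ b ⟧ σ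
    False (a && b) σ = False a σ ⊎ (True a σ × False b σ)
    False e        σ = ⟦ e ⟧ σ ≡ 0

    okOp : Op → ℕ → ℕ → Set
    okOp plus  x y = x + y < W
    okOp times x y = x * y < W
    okOp _     x y = ⊤

    -- Arithmetic is unbounded in this semantics. These conditions make it agree with words:
    -- literals are below 256 ≤ 2 ^ w, sums and products do not overflow, and array indices stay
    -- below `lim`.
    ok : Exp → Store → Set
    ok (# c)       σ = T (c <ᵇ 256)
    ok (v x)       σ = T (x <ᵇ variables)
    ok (bin o a b) σ = ok a σ × ok b σ × okOp o (⟦ a ⟧ σ) (⟦ b ⟧ σ)
    ok (ld a e)    σ = T (a <ᵇ arrays) × ok e σ × ⟦ e ⟧ σ < lim
    ok (rd τ e)    σ = ok e σ
    ok (sz τ)      σ = ⊤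
    ok (ite c a b) σ = ok c σ × (True c σ → ok a σ) × (False c σ → ok b σ)
    ok (a && b)    σ = ok a σ × (True a σ → ok b σ)

    decide : ∀ e σ → (True e σ × ⟦ e ⟧ σ ≢ 0) ⊎ (False e σ × ⟦ e ⟧ σ ≡ 0)
    decide (a ⋖ b) σ with ⟦ a ⟧ σ <ᵇ ⟦ b ⟧ σ in eq
    ... | true  = inj₁ (<ᵇ⇒< _ _ (subst T (sym eq) tt) , λ ())
    ... | false = inj₂ (≮⇒≥ (λ lt → subst T eq (<⇒<ᵇ lt)) , refl)
    decide (a ≐ b) σ with ⟦ a ⟧ σ ≡ᵇ ⟦ b ⟧ σ in eq
    ... | true  = inj₁ (≡ᵇ⇒≡ _ _ (subst T (sym eq) tt) , λ ())
    ... | false = inj₂ ((λ e → subst T eq (≡⇒≡ᵇ _ _ e)) , refl)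
    decide (a && b) σ with decide a σ
    ... | inj₂ (f , p) rewrite p = inj₂ (inj₁ f , refl)
    ... | inj₁ (t , p) with ⟦ a ⟧ σ
    ... | zero  = contradiction refl p
    ... | suc _ with decide b σ
    ... | inj₁ (t′ , q) = inj₁ ((t , t′) , q)
    ... | inj₂ (f′ , q) = inj₂ (inj₂ (t , f′) , q)
    decide e@(# _)       σ with ⟦ e ⟧ σ
    ... | zero  = inj₂ (refl , refl)
    ... | suc _ = inj₁ ((λ ()) , λ ())
    decide e@(v _)       σ with ⟦ e ⟧ σ
    ... | zero  = inj₂ (refl , refl)
    ... | suc _ = inj₁ ((λ ()) , λ ())
    decide e@(bin plus _ _)       σ with ⟦ e ⟧ σ
    ... | zero  = inj₂ (refl , refl)
    ... | suc _ = inj₁ ((λ ()) , λ ())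
    decide e@(bin times _ _)       σ with ⟦ e ⟧ σ
    ... | zero  = inj₂ (refl , refl)
    ... | suc _ = inj₁ ((λ ()) , λ ())
    decide e@(bin quot _ _)       σ with ⟦ e ⟧ σ
    ... | zero  = inj₂ (refl , refl)
    ... | suc _ = inj₁ ((λ ()) , λ ())
    decide e@(bin monus _ _)       σ with ⟦ e ⟧ σ
    ... | zero  = inj₂ (refl , refl)
    ... | suc _ = inj₁ ((λ ()) , λ ())
    decide e@(ld _ _)       σ with ⟦ e ⟧ σ
    ... | zero  = inj₂ (refl , refl)
    ... | suc _ = inj₁ ((λ ()) , λ ())
    decide e@(rd _ _)       σ with ⟦ e ⟧ σ
    ... | zero  = inj₂ (refl , refl)
    ... | suc _ = inj₁ ((λ ()) , λ ())
    decide e@(sz _)       σ with ⟦ e ⟧ σ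
    ... | zero  = inj₂ (refl , refl)
    ... | suc _ = inj₁ ((λ ()) , λ ())
    decide e@(ite _ _ _)       σ with ⟦ e ⟧ σ
    ... | zero  = inj₂ (refl , refl)
    ... | suc _ = inj₁ ((λ ()) , λ ())

    data Exec : Cmd → Store → Store → ℕ → Set where
      assign : ∀ {x e σ} → T (shallow e ∧ (x <ᵇ variables)) → ok e σ →
               Exec (x := e) σ (stored (env σ [ x ≔ ⟦ e ⟧ σ ]) (arr σ) (out σ)) (costE e + 2)
      write  : ∀ {a i e σ} → T (shallow i ∧ (shallow e ∧ (a <ᵇ arrays))) → ok i σ → ok e σ → ⟦ i ⟧ σ < lim →
               Exec (a [ i ]:= e) σ (stored (env σ) (update (arr σ) a (⟦ i ⟧ σ) (⟦ e ⟧ σ)) (out σ))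
                    (costE i + costE e + 5)
      put    : ∀ {e σ} → T (shallow e) → ok e σ →
               Exec (put e) σ (stored (env σ) (arr σ) (out σ ∷ʳ ⟦ e ⟧ σ)) (costE e + 1)
      skip   : ∀ {σ} → Exec skip σ σ 0
      seq    : ∀ {c d σ σ′ σ″ t u} → Exec c σ σ′ t → Exec d σ′ σ″ u → Exec (c ⨾ d) σ σ″ (t + u)
      then′  : ∀ {e c d σ σ′ t} → T (shallow e) → ok e σ → ⟦ e ⟧ σ ≢ 0 → Exec c σ σ′ t →
               Exec (cond e c d) σ σ′ (costE e + (t + 3))
      else′  : ∀ {e c d σ σ′ t} → T (shallow e) → ok e σ → ⟦ e ⟧ σ ≡ 0 → Exec d σ σ′ t →
               Exec (cond e c d) σ σ′ (costE e + (t + 3))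
      done   : ∀ {e c σ} → T (shallow e) → ok e σ → ⟦ e ⟧ σ ≡ 0 → Exec (while e c) σ σ (costE e + 2)
      again  : ∀ {e c σ σ′ σ″ t u} → T (shallow e) → ok e σ → ⟦ e ⟧ σ ≢ 0 → Exec c σ σ′ t →
               Exec (while e c) σ′ σ″ u → Exec (while e c) σ σ″ (costE e + (3 + t + u))

    private
      ∨-falseˡ : ∀ {a b} → T (not (a ∨ b)) → T (not a)
      ∨-falseˡ {false} _ = tt
      ∨-falseʳ : ∀ {a b} → T (not (a ∨ b)) → T (not b)
      ∨-falseʳ {false} t = t

      if-not : ∀ {ℓ} {A : Set ℓ} {b} {x y : A} → T (not b) → (if b then x else y) ≡ y
      if-not {b = false} _ = refl

    same-seq : ∀ {c d σ₁ σ₂ σ₃} → Same c σ₁ σ₂ → Same d σ₂ σ₃ → Same (c ⨾ d) σ₁ σ₃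
    same-seq {c} {d} p q = record
      { varₛ = λ x {t} → trans (varₛ q x {∨-falseʳ {writesV c x} t}) (varₛ p x {∨-falseˡ {writesV c x} t})
      ; arrₛ = λ a {t} i → trans (arrₛ q a {∨-falseʳ {writesA c a} t} i) (arrₛ p a {∨-falseˡ {writesA c a} t} i)
      ; outₛ = λ {t} → trans (outₛ q {∨-falseʳ {emits c} t}) (outₛ p {∨-falseˡ {emits c} t}) }

    exec-same : ∀ {c σ σ′ t} → Exec c σ σ′ t → Same c σ σ′
    exec-same (assign _ _) = record
      { varₛ = λ x {t} → if-not t ; arrₛ = λ _ _ → refl ; outₛ = refl }
    exec-same (write {a} {i′} {e} {σ} _ _ _ _) = record
      { varₛ = λ _ → refl ; arrₛ = λ a′ {t} i → cong (λ f → f i) (if-not {b = a′ ≡ᵇ a} {arr σ a [ ⟦ i′ ⟧ σ ≔ ⟦ e ⟧ σ ]} {arr σ a′} t) ; outₛ = refl }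
    exec-same (put _ _) = record { varₛ = λ _ → refl ; arrₛ = λ _ _ → refl ; outₛ = λ {} }
    exec-same skip = same-refl
    exec-same (seq x y) = same-seq (exec-same x) (exec-same y)
    exec-same (then′ {c = c} _ _ _ x) = let p = exec-same x in record
      { varₛ = λ y {t} → varₛ p y {∨-falseˡ {writesV c y} t}
      ; arrₛ = λ a {t} → arrₛ p a {∨-falseˡ {writesA c a} t}
      ; outₛ = λ {t} → outₛ p {∨-falseˡ {emits c} t} }
    exec-same (else′ {c = c} _ _ _ x) = let p = exec-same x in record
      { varₛ = λ y {t} → varₛ p y {∨-falseʳ {writesV c y} t}
      ; arrₛ = λ a {t} → arrₛ p a {∨-falseʳ {writesA c a} t}
      ; outₛ = λ {t} → outₛ p {∨-falseʳ {emits c} t} }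
    exec-same (done _ _ _) = same-refl
    exec-same (again _ _ _ x y) = let p = exec-same x ; q = exec-same y in record
      { varₛ = λ z {t} → trans (varₛ q z {t}) (varₛ p z {t})
      ; arrₛ = λ a {t} i → trans (arrₛ q a {t} i) (arrₛ p a {t} i)
      ; outₛ = λ {t} → trans (outₛ q {t}) (outₛ p {t}) }

    -- A triple of total correctness with a time bound; `trace` is a finite derivation, so
    -- termination is part of it.
    record Ends (c : Cmd) (σ : Store) (t : ℕ) (Q : Store → Set) : Set where
      constructor ends
      field
        {final} : Store
        {steps} : ℕ
        trace   : Exec c σ final steps
        bound   : steps ≤ t
        post    : Q final

    cost : Cmd → ℕ
    cost (x := e)      = costE e + 2
    cost (a [ i ]:= e) = costE i + costE e + 5
    cost (put e)      = costE e + 1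
    cost (c ⨾ d)      = cost c + cost d
    cost (cond e c d) = costE e + (cost c + cost d + 3)
    cost (while e c)  = 0
    cost skip         = 0

    -- Loops are excluded here: `Loop` and `iterate` deal with them, while each loop-free stretch is
    -- discharged in one piece by `straight` or `prefix`.
    wp : Cmd → (Store → Set) → Store → Set
    wp (x := e)      Q σ = ok e σ × Q (stored (env σ [ x ≔ ⟦ e ⟧ σ ]) (arr σ) (out σ))
    wp (a [ i ]:= e) Q σ = ok i σ × ok e σ × ⟦ i ⟧ σ < lim ×
                          Q (stored (env σ) (update (arr σ) a (⟦ i ⟧ σ) (⟦ e ⟧ σ)) (out σ))
    wp (put e)      Q σ = ok e σ × Q (stored (env σ) (arr σ) (out σ ∷ʳ ⟦ e ⟧ σ))
    wp (c ⨾ d)      Q σ = wp c (wp d Q) σ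
    wp (cond e c d) Q σ = ok e σ × (True e σ → wp c Q σ) × (False e σ → wp d Q σ)
    wp (while e c)  Q σ = ⊥
    wp skip         Q σ = Q σ

    formed : Cmd → Bool
    formed (x := e)      = shallow e ∧ (x <ᵇ variables)
    formed (a [ i ]:= e) = shallow i ∧ (shallow e ∧ (a <ᵇ arrays))
    formed (put e)      = shallow e
    formed (c ⨾ d)      = formed c ∧ formed d
    formed (cond e c d) = shallow e ∧ (formed c ∧ formed d)
    formed (while e c)  = false
    formed skip         = true

    private
      ∧ˡ : ∀ {a b} → T (a ∧ b) → T a
      ∧ˡ {true} _ = tt
      ∧ʳ : ∀ {a b} → T (a ∧ b) → T b
      ∧ʳ {true} t = t

    straight′ : ∀ c {Q σ} → T (formed c) → wp c Q σ → Ends c σ (cost c) Q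
    straight′ (x := e)      f (o , q)             = ends (assign f o) ≤-refl q
    straight′ (a [ i ]:= e) f (o , o′ , l , q)    = ends (write f o o′ l) ≤-refl q
    straight′ (put e)      f (o , q)             = ends (put f o) ≤-refl q
    straight′ skip         f q                   = ends skip ≤-refl q
    straight′ (c ⨾ d)      f p with straight′ c (∧ˡ {formed c} f) p
    ... | ends x b p′ with straight′ d (∧ʳ {formed c} f) p′
    ... | ends x′ b′ q = ends (seq x x′) (+-mono-≤ b b′) q
    straight′ (cond e c d) {σ = σ} f (o , p , p′) with decide e σ
    ... | inj₁ (t , nz) with straight′ c (∧ˡ {formed c} (∧ʳ {shallow e} f)) (p t)
    ... | ends x b q = ends (then′ (∧ˡ {shallow e} f) o nz x)
                         (+-monoʳ-≤ (costE e) (+-monoˡ-≤ 3 (≤-trans b (m≤m+n _ _)))) q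
    straight′ (cond e c d) {σ = σ} f (o , p , p′) | inj₂ (t , z)
      with straight′ d (∧ʳ {formed c} (∧ʳ {shallow e} f)) (p′ t)
    ... | ends x b q = ends (else′ (∧ˡ {shallow e} f) o z x)
                         (+-monoʳ-≤ (costE e) (+-monoˡ-≤ 3 (≤-trans b (m≤n+m _ (cost c))))) q

    -- Costs are rounded up to a numeral and the comparison is evaluated, which keeps the time
    -- bounds short.
    straight : ∀ c {k Q σ} {_ : T (formed c)} {_ : T (cost c ≤ᵇ k)} → wp c Q σ → Ends c σ k Q
    straight c {k} {_} {_} {f} {l} q with straight′ c f q
    ... | ends x b q = ends x (≤-trans b (≤ᵇ⇒≤ (cost c) k l)) q

    prefix : ∀ k c {d u Q σ} {_ : T (formed c)} {_ : T (cost c ≤ᵇ k)} → wp c (λ σ′ → Ends d σ′ u Q) σ →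
             Ends (c ⨾ d) σ (k + u) Q
    prefix k c {_} {_} {_} {_} {f} {l} q with straight′ c f q
    ... | ends x b (ends x′ b′ q) = ends (seq x x′) (+-mono-≤ (≤-trans b (≤ᵇ⇒≤ (cost c) k l)) b′) q

    within : ∀ {c σ t u Q} → t ≤ u → Ends c σ t Q → Ends c σ u Q
    within l (ends x b q) = ends x (≤-trans b l) q

    weaken : ∀ {c σ t P Q} → (∀ σ′ → P σ′ → Q σ′) → Ends c σ t P → Ends c σ t Q
    weaken f (ends x b q) = ends x b (f _ q)

    framed : ∀ {c σ t Q} → Ends c σ t Q → Ends c σ t (λ σ′ → Q σ′ × Same c σ σ′)
    framed (ends x b q) = ends x b (q , exec-same x)

    infixr 2 _then_
    _then_ : ∀ {c d σ t u P Q} → Ends c σ t P → (∀ {σ′} → P σ′ → Same c σ σ′ → Ends d σ′ u Q) →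
             Ends (c ⨾ d) σ (t + u) Q
    ends x b p then k with k p (exec-same x)
    ... | ends x′ b′ q = ends (seq x x′) (+-mono-≤ b b′) q

    branch : ∀ {e c d σ t Q} {_ : T (shallow e)} → ok e σ →
             (True e σ → Ends c σ t Q) → (False e σ → Ends d σ t Q) →
             Ends (cond e c d) σ (costE e + (t + 3)) Q
    branch {e} {σ = σ} {_} {_} {f} o p p′ with decide e σ
    branch {e} {_} {_} {σ} {_} {_} {f} o p p′ | inj₁ (t , nz) with p t
    ... | ends x b q = ends (then′ f o nz x) (+-monoʳ-≤ (costE e) (+-monoˡ-≤ 3 b)) q
    branch {e} {_} {_} {σ} {_} {_} {f} o p p′ | inj₂ (t , z) with p′ t
    ... | ends x b q = ends (else′ f o z x) (+-monoʳ-≤ (costE e) (+-monoˡ-≤ 3 b)) q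

    -- The index of the invariant is the time still available for the iterations.
    module Loop (e : Exp) (c : Cmd) {shallow-e : T (shallow e)} (σ₀ : Store) (I : ℕ → Store → Set) (Q : Store → Set)
      (exit : ∀ τ σ → Same c σ₀ σ → I τ σ → False e σ → Q σ)
      (fine : ∀ τ σ → Same c σ₀ σ → I τ σ → ok e σ)
      (body : ∀ τ σ → Same c σ₀ σ → I τ σ → True e σ →
              Σ[ t ∈ ℕ ] Σ[ τ′ ∈ ℕ ] costE e + (3 + t) + τ′ ≤ τ × Ends c σ t (I τ′)) where

      private
        go : ∀ n τ σ → τ ≤ n → Same c σ₀ σ → I τ σ → Ends (while e c) σ (τ + (costE e + 2)) Q
        go n τ σ τ≤n sm inv with decide e σ
        go n τ σ τ≤n sm inv | inj₂ (f , z) =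
          ends (done shallow-e (fine τ σ sm inv) z) (m≤n+m _ τ) (exit τ σ sm inv f)
        go n τ σ τ≤n sm inv | inj₁ (t , nz) with body τ σ sm inv t
        -- An iteration uses up at least the cost of its test, so the credit bounds the depth of the
        -- recursion.
        go zero τ σ τ≤n sm inv | inj₁ (t , nz) | T , τ′ , l , _ =
          contradiction (≤-trans (≤-trans (m≤n+m 1 (costE e)) (+-monoʳ-≤ (costE e) (s≤s z≤n)))
                          (≤-trans (m≤m+n _ τ′) (≤-trans l τ≤n))) λ ()
        go (suc n) τ σ τ≤n sm inv | inj₁ (t , nz) | T , τ′ , l , ends {σ′} {u} x b inv′
          with go n τ′ σ′ (s≤s⁻¹ (≤-trans (s≤s (≤-trans (m≤n+m τ′ (2 + T)) ≤-refl))
                 (≤-trans (m≤n+m _ (costE e)) (≤-trans (≤-reflexive (sym (+-assoc (costE e) (3 + T) τ′))) (≤-trans l τ≤n)))))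
                 (same-trans sm (exec-same x)) inv′
        ... | ends {σ″} {u′} y b′ q = ends (again shallow-e (fine τ σ sm inv) nz x y) le q
          where
          le : costE e + (3 + u + u′) ≤ τ + (costE e + 2)
          le = begin
            costE e + (3 + u + u′)                 ≤⟨ +-monoʳ-≤ (costE e) (+-mono-≤ (+-monoʳ-≤ 3 b) b′) ⟩
            costE e + (3 + T + (τ′ + (costE e + 2)))
              ≡⟨ cong (costE e +_) (sym (+-assoc (3 + T) τ′ (costE e + 2))) ⟩
            costE e + (3 + T + τ′ + (costE e + 2)) ≡⟨ sym (+-assoc (costE e) (3 + T + τ′) (costE e + 2)) ⟩
            costE e + (3 + T + τ′) + (costE e + 2) ≡⟨ cong (_+ (costE e + 2)) (sym (+-assoc (costE e) (3 + T) τ′)) ⟩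
            costE e + (3 + T) + τ′ + (costE e + 2) ≤⟨ +-monoˡ-≤ (costE e + 2) l ⟩
            τ + (costE e + 2) ∎
            where open ≤-Reasoning

      loop : ∀ τ → I τ σ₀ → Ends (while e c) σ₀ (τ + (costE e + 2)) Q
      loop τ inv = go τ τ σ₀ ≤-refl same-refl inv

    -- The index of the invariant bounds the number of the remaining iterations.
    iterate : ∀ e c {shallow-e : T (shallow e)} {cheap : T (costE e ≤ᵇ 37)} {σ₀} (I : ℕ → Store → Set) {Q t} m →
      (∀ m σ → Same c σ₀ σ → I m σ → ok e σ) →
      (∀ m σ → Same c σ₀ σ → I m σ → False e σ → Q σ) →
      (∀ m σ → Same c σ₀ σ → I m σ → True e σ →
         Σ[ m′ ∈ ℕ ] m′ < m × Ends c σ t (I m′)) →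
      I m σ₀ → Ends (while e c) σ₀ (m * (40 + t) + 40) Q
    -- A test costs at most 37 and the jumps around the body 3 more: hence the uniform 40 per round.
    iterate e c {sh} {cheap} {σ₀} I {Q} {t} m fine exit body inv = within
      (+-mono-≤ (*-monoʳ-≤ m (≤-trans (≤-reflexive (sym (+-assoc (costE e) 3 t)))
        (+-monoˡ-≤ t (+-monoˡ-≤ 3 (≤ᵇ⇒≤ (costE e) 37 cheap)))))
        (+-mono-≤ (≤ᵇ⇒≤ (costE e) 37 cheap) (≤ᵇ⇒≤ 2 3 tt)))
      (Loop.loop e c {sh} σ₀ (λ τ σ → Σ[ m ∈ ℕ ] m * k ≡ τ × I m σ) Q
        (λ _ σ sm (m , _ , i) → exit m σ sm i)
        (λ _ σ sm (m , _ , i) → fine m σ sm i)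
        (λ { .(m * k) σ sm (m , refl , i) tr →
             let (m′ , l , en) = body m σ sm i tr in
             t , m′ * k , *-monoˡ-≤ k l , weaken (λ _ i′ → m′ , refl , i′) en })
        (m * k) (m , refl , inv))
      where k = costE e + (3 + t)

    atMost : ∀ m {c σ Q a b} a′ b′ {_ : T (a ≤ᵇ a′)} {_ : T (b ≤ᵇ b′)} → Ends c σ (m * a + b) Q → Ends c σ (m * a′ + b′) Q
    atMost m {a = a} {b} a′ b′ {l} {l′} = within (+-mono-≤ (*-monoʳ-≤ m (≤ᵇ⇒≤ a a′ l)) (≤ᵇ⇒≤ b b′ l′))

  -- Every array has length at most lim; 16 N + 16 cells suffice for all arrays but the heap.
  record Space : Set where
    constructor space
    field
      mc : Machine
    open Machine mc public
    field
      N     : ℕ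
      room  : 16 * N + 16 ≤ lim
      lim<W : lim < 2 ^ w

    small : ∀ {x} → x ≤ 16 * N + 16 → x < 2 ^ w
    small l = ≤-<-trans (≤-trans l room) lim<W

    loosen : ∀ {x} → x ≤ 16 * N + 15 → x ≤ 16 * N + 16
    loosen l = ≤-trans l (+-monoʳ-≤ (16 * N) (n≤1+n 15))

    room′ : ∀ {x} → x ≤ 16 * N + 15 → x < lim
    room′ l = <-≤-trans (s≤s l) (≤-trans (≤-reflexive (sym (+-suc (16 * N) 15))) room)

-- Natural numbers and division

module Arithmetic where

  open import Data.Nat.DivMod using (_/_; _%_; m≡m%n+[m/n]*n; m%n<n; m<n⇒m/n≡0; +-distrib-/-∣ʳ; m*n/n≡m)
  open import Data.Nat.Divisibility using (n∣m*n)
  open Defs using (module Word)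

  -- The variant of loops that advance by more than one: it decreases even if the new position y
  -- overshoots the limit m.
  ∸-shrink : ∀ {m x y} → x < m → x < y → m ∸ y < m ∸ x
  ∸-shrink {m} {x} {y} x<m x<y with y ≤? m
  ... | yes y≤m = ∸-monoʳ-< x<y y≤m
  ... | no y≰m = subst (_< m ∸ x) (sym (m≤n⇒m∸n≡0 (<⇒≤ (≰⇒> y≰m)))) (m<n⇒0<n∸m x<m)

  n<2^n : ∀ k → k < 2 ^ k
  n<2^n zero    = s≤s z≤n
  n<2^n (suc k) = ≤-trans (s≤s (n<2^n k)) (≤-trans (+-monoˡ-≤ (2 ^ k) (≤-trans (s≤s z≤n) (n<2^n k)))
                    (≤-reflexive (cong (2 ^ k +_) (sym (+-identityʳ _)))))

  -- The language has quotients but no remainders; parities are computed in this form.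
  remainder : ∀ x → x ∸ 2 * (x / 2) ≡ x % 2
  remainder x = trans (cong (_∸ 2 * (x / 2)) (m≡m%n+[m/n]*n x 2))
    (trans (cong (λ y → x % 2 + x / 2 * 2 ∸ y) (*-comm 2 (x / 2))) (m+n∸n≡m (x % 2) (x / 2 * 2)))

  module Division (w : ℕ) where

    open Word w using (quotient)

    quotient-≤ : ∀ z B → quotient z B * B ≤ z
    quotient-≤ z zero    = z≤n
    quotient-≤ z (suc B) = ≤-trans (m≤n+m _ (z % suc B)) (≤-reflexive (sym (m≡m%n+[m/n]*n z (suc B))))

    quotient-rest : ∀ z B → 0 < B → z ∸ quotient z B * B < B
    quotient-rest z (suc B) _ = subst (_< suc B) (sym (trans (cong (_∸ z / suc B * suc B) (m≡m%n+[m/n]*n z (suc B)))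
      (m+n∸n≡m (z % suc B) (z / suc B * suc B)))) (m%n<n z (suc B))

    quotient-unique : ∀ a c B → c < B → quotient (a * B + c) B ≡ a
    quotient-unique a c (suc B) l = trans (cong (_/ suc B) (+-comm (a * suc B) c))
      (trans (+-distrib-/-∣ʳ c (n∣m*n a)) (cong₂ _+_ (m<n⇒m/n≡0 l) (m*n/n≡m a (suc B))))

    quotient-< : ∀ z B C → z < C * B → quotient z B < C
    quotient-< z B C l = *-cancelʳ-< B (quotient z B) C (≤-<-trans (quotient-≤ z B) l)

-- Compilation to RAM code and its correctness

module Compilation where

  open import Data.Fin.Base using (Fin; toℕ)
  open import Data.List.Base using (_∷ʳ_; head)
  open import Data.List.Properties using (length-++)
  open import Data.Maybe.Base using (Maybe; just; nothing; maybe′)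
  open import Data.Nat.DivMod using (_mod_; _%_; [m+kn]%n≡m%n; m<n⇒m%n≡m; m%n<n; [m+n]%n≡m%n; m/n≤m)
  open import Data.Unit.Base using (⊤; tt)
  open import Data.Vec.Functional using (Vector; updateAt)
  open import Data.Vec.Functional.Properties using (updateAt-updates; updateAt-minimal)
  open import Function.Base using (const)
  open Defs
  open Language

  size# : ℕ
  size# = variables + temporaries

  -- Reduction modulo the number of registers turns numbers into registers without a proof;
  -- `reg-injective` recovers distinctness in the range that matters.
  reg tmp : ℕ → Fin size#
  reg x = x mod size#
  tmp d = reg (variables + d)

  private
    Code : Set
    Code = List (Instr size#)

  opCode : Op → ℕ → ℕ → Code
  opCode plus  d p = arith add (tmp d) (tmp d) (tmp (suc d)) ∷ []
  opCode times d p = arith mul (tmp d) (tmp d) (tmp (suc d)) ∷ []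
  opCode quot  d p = arith div (tmp d) (tmp d) (tmp (suc d)) ∷ []
  opCode monus d p = jumpIf lt (tmp d) (tmp (suc d)) (3 + p) ∷ arith sub (tmp d) (tmp d) (tmp (suc d)) ∷
                     jump (4 + p) ∷ literal (tmp d) 0 ∷ []
  opCode less  d p = jumpIf lt (tmp d) (tmp (suc d)) (3 + p) ∷ literal (tmp d) 0 ∷
                     jump (4 + p) ∷ literal (tmp d) 1 ∷ []
  opCode equal d p = jumpIf eq (tmp d) (tmp (suc d)) (3 + p) ∷ literal (tmp d) 0 ∷
                     jump (4 + p) ∷ literal (tmp d) 1 ∷ []

  -- End addresses are computed apart from the code, because forward jumps need their targets while
  -- the code is generated.
  endE : Exp → ℕ → ℕ
  endE (# c)       p = 1 + p
  endE (v x)       p = 2 + p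
  endE (bin o a b) p = opCost o + endE b (endE a p)
  endE (ld a e)    p = 5 + endE e p
  endE (rd τ e)    p = 1 + endE e p
  endE (sz τ)      p = 1 + p
  endE (ite c a b) p = endE b (1 + endE a (2 + endE c p))
  endE (a && b)    p = endE b (2 + endE a p)

  -- With interleaved arrays the program text contains no bound on their lengths: indices below
  -- `lim` lead to addresses below `lim * arrays`, whatever `lim` is.
  address : ℕ → ℕ → Code
  address a d = literal (tmp (suc d)) arrays ∷ arith mul (tmp d) (tmp d) (tmp (suc d)) ∷
                literal (tmp (suc d)) a ∷ arith add (tmp d) (tmp d) (tmp (suc d)) ∷ []

  -- The value ends up in temporary `d`, and the temporaries below are left alone. The RAM cannot
  -- copy a register directly; adding 0 does it.
  codeE : Exp → ℕ → ℕ → Code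
  codeE (# c)       d p = literal (tmp d) c ∷ []
  codeE (v x)       d p = literal (tmp d) 0 ∷ arith add (tmp d) (reg x) (tmp d) ∷ []
  codeE (bin o a b) d p = codeE a d p ++ (codeE b (suc d) (endE a p) ++ opCode o d (endE b (endE a p)))
  codeE (ld a e)    d p = codeE e d p ++ (address a d ++ load (tmp d) (tmp d) ∷ [])
  codeE (rd τ e)    d p = codeE e d p ++ read (tmp d) τ (tmp d) ∷ []
  codeE (sz τ)      d p = size (tmp d) τ ∷ []
  codeE (ite c a b) d p =
    codeE c d p ++ (literal (tmp (suc d)) 0 ∷ jumpIf eq (tmp d) (tmp (suc d)) (1 + endE a pa) ∷
      (codeE a d pa ++ (jump (endE b (1 + endE a pa)) ∷ codeE b d (1 + endE a pa))))
    where pa = 2 + endE c p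
  codeE (a && b)    d p =
    codeE a d p ++ (literal (tmp (suc d)) 0 ∷ jumpIf eq (tmp d) (tmp (suc d)) (endE b (2 + endE a p)) ∷
      codeE b d (2 + endE a p))

  endC : Cmd → ℕ → ℕ
  endC (x := e)      p = 2 + endE e p
  endC (a [ i ]:= e) p = 1 + endE e (4 + endE i p)
  endC (put e)       p = 1 + endE e p
  endC (c ⨾ d)       p = endC d (endC c p)
  endC (cond e c d)  p = endC d (1 + endC c (2 + endE e p))
  endC (while e c)   p = 1 + endC c (2 + endE e p)
  endC skip          p = p

  codeC : Cmd → ℕ → Code
  codeC (x := e)      p = codeE e 0 p ++ (literal (tmp 1) 0 ∷ arith add (reg x) (tmp 0) (tmp 1) ∷ [])
  codeC (a [ i ]:= e) p = codeE i 0 p ++ (address a 0 ++ (codeE e 1 (4 + endE i p) ++ store (tmp 0) (tmp 1) ∷ []))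
  codeC (put e)       p = codeE e 0 p ++ emit (tmp 0) ∷ []
  codeC (c ⨾ d)       p = codeC c p ++ codeC d (endC c p)
  codeC (cond e c d)  p =
    codeE e 0 p ++ (literal (tmp 1) 0 ∷ jumpIf eq (tmp 0) (tmp 1) (1 + endC c pc) ∷
      (codeC c pc ++ (jump (endC d (1 + endC c pc)) ∷ codeC d (1 + endC c pc))))
    where pc = 2 + endE e p
  codeC (while e c)   p =
    codeE e 0 p ++ (literal (tmp 1) 0 ∷ jumpIf eq (tmp 0) (tmp 1) (1 + endC c pc) ∷
      (codeC c pc ++ jump p ∷ []))
    where pc = 2 + endE e p
  codeC skip          p = []

  private
    length-++′ : ∀ (xs ys : Code) p {q r} → length xs + p ≡ q → length ys + q ≡ r → length (xs ++ ys) + p ≡ r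
    length-++′ xs ys p refl e = trans (cong (_+ p) (trans (length-++ xs) (+-comm (length xs) (length ys))))
                                  (trans (+-assoc (length ys) (length xs) p) e)

  length-op : ∀ o d p → length (opCode o d p) ≡ opCost o
  length-op plus d p = refl
  length-op times d p = refl
  length-op quot d p = refl
  length-op monus d p = refl
  length-op less d p = refl
  length-op equal d p = refl

  length-E : ∀ e d p → length (codeE e d p) + p ≡ endE e p
  length-E (# c)       d p = refl
  length-E (v x)       d p = refl
  length-E (bin o a b) d p =
    length-++′ (codeE a d p) _ p (length-E a d p)
      (length-++′ (codeE b (suc d) _) _ _ (length-E b (suc d) _) (cong (_+ _) (length-op o d _)))
  length-E (ld a e)    d p = length-++′ (codeE e d p) _ p (length-E e d p) refl
  length-E (rd τ e)    d p = length-++′ (codeE e d p) _ p (length-E e d p) refl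
  length-E (sz τ)      d p = refl
  length-E (ite c a b) d p =
    length-++′ (codeE c d p) _ p (length-E c d p)
      (trans (cong suc (sym (+-suc _ _))) (trans (sym (+-suc _ _))
        (length-++′ (codeE a d _) _ _ (length-E a d _)
          (trans (sym (+-suc _ _)) (length-E b d _)))))
  length-E (a && b)    d p =
    length-++′ (codeE a d p) _ p (length-E a d p)
      (trans (cong suc (sym (+-suc _ _))) (trans (sym (+-suc _ _)) (length-E b d _)))

  length-C : ∀ c p → length (codeC c p) + p ≡ endC c p
  length-C (x := e)      p = length-++′ (codeE e 0 p) _ p (length-E e 0 p) refl
  length-C (a [ i ]:= e) p =
    length-++′ (codeE i 0 p) _ p (length-E i 0 p)
      (length-++′ (address a 0) (codeE e 1 (4 + endE i p) ++ store (tmp 0) (tmp 1) ∷ []) (endE i p) refl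
        (length-++′ (codeE e 1 (4 + endE i p)) (store (tmp 0) (tmp 1) ∷ []) (4 + endE i p) (length-E e 1 _) refl))
  length-C (put e)       p = length-++′ (codeE e 0 p) _ p (length-E e 0 p) refl
  length-C (c ⨾ d)       p = length-++′ (codeC c p) _ p (length-C c p) (length-C d _)
  length-C (cond e c d)  p =
    length-++′ (codeE e 0 p) _ p (length-E e 0 p)
      (trans (cong suc (sym (+-suc _ _))) (trans (sym (+-suc _ _))
        (length-++′ (codeC c _) _ _ (length-C c _)
          (trans (sym (+-suc _ _)) (length-C d _)))))
  length-C (while e c)   p =
    length-++′ (codeE e 0 p) _ p (length-E e 0 p)
      (trans (cong suc (sym (+-suc _ _))) (trans (sym (+-suc _ _))
        (length-++′ (codeC c _) _ _ (length-C c _) refl)))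
  length-C skip          p = refl

  At : Code → ℕ → Code → Set
  At cs p []       = ⊤
  At cs p (i ∷ is) = head (drop p cs) ≡ just i × At cs (suc p) is

  at-++ : ∀ {cs} p xs {ys} → At cs p (xs ++ ys) → At cs p xs × At cs (length xs + p) ys
  at-++ p []       h       = tt , h
  at-++ {cs} p (x ∷ xs) {ys} (h , hs) with at-++ (suc p) xs hs
  ... | h₁ , h₂ = (h , h₁) , subst (λ q → At cs q ys) (+-suc (length xs) p) h₂

  -- The head is moved to the end of the prefix, which keeps the code as a whole fixed during the
  -- induction.
  at-suffix : ∀ pre xs → At (pre ++ xs) (length pre) xs
  at-suffix pre []       = tt
  at-suffix pre (x ∷ xs) = look pre , subst₂ (λ c q → At c q xs) (assoc pre) (len pre) (at-suffix (pre ∷ʳ x) xs)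
    where
    look : ∀ pre → head (drop (length pre) (pre ++ x ∷ xs)) ≡ just x
    look []        = refl
    look (_ ∷ pre) = look pre
    assoc : ∀ pre → (pre ∷ʳ x) ++ xs ≡ pre ++ x ∷ xs
    assoc []        = refl
    assoc (y ∷ pre) = cong (y ∷_) (assoc pre)
    len : ∀ pre → length (pre ∷ʳ x) ≡ suc (length pre)
    len []        = refl
    len (_ ∷ pre) = cong suc (len pre)

  at-E : ∀ {cs} e d p {ys} → At cs p (codeE e d p ++ ys) → At cs p (codeE e d p) × At cs (endE e p) ys
  at-E {cs} e d p {ys} h with at-++ p (codeE e d p) h
  ... | h₁ , h₂ = h₁ , subst (λ q → At cs q ys) (length-E e d p) h₂

  at-C : ∀ {cs} c p {ys} → At cs p (codeC c p ++ ys) → At cs p (codeC c p) × At cs (endC c p) ys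
  at-C {cs} c p {ys} h with at-++ p (codeC c p) h
  ... | h₁ , h₂ = h₁ , subst (λ q → At cs q ys) (length-C c p) h₂

  reg-injective : ∀ {i j} → i < size# → j < size# → reg i ≡ reg j → i ≡ j
  reg-injective {i} {j} i< j< e = begin
    i               ≡⟨ m<n⇒m%n≡m i< ⟨
    i % size#       ≡⟨ toℕ-mod i ⟨
    toℕ (i mod size#) ≡⟨ cong toℕ e ⟩
    toℕ (j mod size#) ≡⟨ toℕ-mod j ⟩
    j % size#       ≡⟨ m<n⇒m%n≡m j< ⟩
    j               ∎
    where
    open ≡-Reasoning
    toℕ-mod : ∀ i → toℕ (i mod size#) ≡ i % size#
    toℕ-mod i = toℕ-fromℕ< (m%n<n i size#)
      where open import Data.Fin.Properties using (toℕ-fromℕ<)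

  record Mach : Set where
    constructor mach
    field
      rs : Vector ℕ size#
      mm : ℕ → ℕ
      os : List ℕ
      us : ℕ

  open Mach

  setR : Fin size# → ℕ → Mach → Mach
  setR x a (mach r m o u) = mach (updateAt r x (const a)) m o u

  conf : ℕ → Mach → Config size#
  conf p (mach r m o u) = config p r m o u

  private
    depth≥1 : ∀ e → 1 ≤ depth e
    depth≥1 (# c) = ≤-refl
    depth≥1 (v x) = s≤s z≤n
    depth≥1 (bin o a b) = ≤-trans (depth≥1 a) (m≤m⊔n _ _)
    depth≥1 (ld a e) = ≤-trans (depth≥1 e) (m≤m⊔n _ _)
    depth≥1 (rd τ e) = depth≥1 e
    depth≥1 (sz τ) = ≤-refl
    depth≥1 (ite c a b) = ≤-trans (depth≥1 c) (≤-trans (m≤m⊔n _ 2) (m≤m⊔n _ _))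
    depth≥1 (a && b) = ≤-trans (depth≥1 a) (m≤m⊔n _ _)

  record Hardware : Set where
    constructor hardware
    field
      mc : Machine
    open Machine mc public
    field
      256≤W : 256 ≤ 2 ^ w
      chars : ∀ τ i → charAt (input τ) i < 2 ^ w
      sizes : ∀ τ → length (input τ) < 2 ^ w
      room  : lim * arrays ≤ 2 ^ w

  module Simulation (hw : Hardware) (cs : Code) where

    open Hardware hw
    open Semantics mc
    open Word w using (trunc)

    program : Program
    program = record { registers = size# ; code = cs }

    -- `runFor` adds steps at the end, whereas following the code needs them at the front;
    -- `runFor-advance` reconciles the two.
    advance : ℕ → Defs.State size# → Defs.State size#
    advance zero    st = st
    advance (suc t) st = advance t (step w input program st)

    advance-+ : ∀ t u st → advance (t + u) st ≡ advance u (advance t st)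
    advance-+ zero    u st = refl
    advance-+ (suc t) u st = advance-+ t u _

    runFor-advance : ∀ t → runFor w input program t ≡ advance t (initial w input program)
    runFor-advance zero    = refl
    runFor-advance (suc t) = trans (cong (step w input program) (runFor-advance t)) (shift t _)
      where
      shift : ∀ t st → step w input program (advance t st) ≡ advance t (step w input program st)
      shift zero    st = refl
      shift (suc t) st = shift t _

    record Run (p : ℕ) (μ : Mach) (n q : ℕ) (P : Mach → Set) : Set where
      constructor run
      field
        {time} : ℕ
        {end}  : Mach
        fast   : time ≤ n
        ran    : advance time (running (conf p μ)) ≡ running (conf q end)
        holds  : P end

    stop : ∀ {p μ P} → P μ → Run p μ 0 p P
    stop x = run z≤n refl x

    infixr 2 _⟫_
    _⟫_ : ∀ {p μ n q P n′ q′ P′} → Run p μ n q P → (∀ {μ′} → P μ′ → Run q μ′ n′ q′ P′) → Run p μ (n + n′) q′ P′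
    run {t} f r x ⟫ k with k x
    ... | run {t′} f′ r′ x′ = run (+-mono-≤ f f′) (trans (advance-+ t t′ _) (trans (cong (advance t′) r) r′)) x′

    faster : ∀ {p μ n n′ q P} → n ≤ n′ → Run p μ n q P → Run p μ n′ q P
    faster l (run f r x) = run (≤-trans f l) r x

    instr : ∀ {p i p′ μ μ′ n q P} → head (drop p cs) ≡ just i → exec w input i (conf p μ) ≡ running (conf p′ μ′) →
            Run p′ μ′ n q P → Run p μ (suc n) q P
    instr {p} {i} {μ = μ} h e (run {t} f r x) =
      run (s≤s f) (trans (cong (advance t)
        (trans (cong (maybe′ (λ i → exec w input i (conf p μ)) (running (conf p μ))) h) e)) r) x

    trunc-small : ∀ {x} → x < W → trunc x ≡ x
    trunc-small l = m<n⇒m%n≡m {{m^n≢0 2 w}} l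

    -- Stored values are kept below 2 ^ w, so that loading them and copying them by an addition is
    -- exact.
    record Sim (σ : Store) (μ : Mach) : Set where
      field
        sim-var   : ∀ x → x < variables → rs μ (reg x) ≡ env σ x
        sim-arr   : ∀ a i → a < arrays → mm μ (i * arrays + a) ≡ arr σ a i
        sim-out   : os μ ≡ out σ
        sim-used  : us μ ≤ lim * arrays
        small-var : ∀ x → x < variables → env σ x < W
        small-arr : ∀ a i → a < arrays → arr σ a i < W
    open Sim

    private
      var≢tmp : ∀ {x d} → x < variables → d < temporaries → reg x ≢ tmp d
      var≢tmp {x} {d} x< d< e =
        <⇒≢ (≤-trans x< (m≤m+n variables d))
          (reg-injective (≤-trans x< (m≤m+n variables temporaries)) (+-monoʳ-< variables d<) e)

      tmp≢tmp : ∀ {d d′} → d < d′ → d′ < temporaries → tmp d ≢ tmp d′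
      tmp≢tmp {d} {d′} l d′< e = <⇒≢ l (+-cancelˡ-≡ variables d d′
        (reg-injective (+-monoʳ-< variables (<-trans l d′<)) (+-monoʳ-< variables d′<) e))

    -- The machine simulates σ, and the temporaries below d are those of μ₀.
    record Good (σ : Store) (d : ℕ) (μ₀ μ : Mach) : Set where
      constructor good
      field
        sim   : Sim σ μ
        below : ∀ d′ → d′ < d → rs μ (tmp d′) ≡ rs μ₀ (tmp d′)
    open Good

    get : ∀ x {a} μ → rs (setR x a μ) x ≡ a
    get x μ = updateAt-updates x (rs μ)

    get-other : ∀ {x y a} μ → y ≢ x → rs (setR x a μ) y ≡ rs μ y
    get-other {x} {y} μ n = updateAt-minimal y x (rs μ) n

    set-tmp : ∀ {σ d d′ a μ₀ μ} → d ≤ d′ → d′ < temporaries → Good σ d μ₀ μ → Good σ d μ₀ (setR (tmp d′) a μ)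
    set-tmp {μ = μ} l d′< g = good
      (record { sim-var = λ x x< → trans (get-other μ (var≢tmp x< d′<)) (sim-var (sim g) x x<)
              ; sim-arr = sim-arr (sim g) ; sim-out = sim-out (sim g) ; sim-used = sim-used (sim g)
              ; small-var = small-var (sim g) ; small-arr = small-arr (sim g) })
      (λ e e< → trans (get-other μ (tmp≢tmp (<-≤-trans e< l) d′<)) (below g e e<))

    record Value (σ : Store) (d : ℕ) (μ₀ : Mach) (x : ℕ) (μ : Mach) : Set where
      constructor value
      field
        isgood : Good σ d μ₀ μ
        result : rs μ (tmp d) ≡ x
        small  : x < W
    open Value

    private
      1<W : 1 < W
      1<W = ≤-trans (s≤s (s≤s z≤n)) 256≤W

      if-true : ∀ {ℓ} {A : Set ℓ} {b} {x y : A} → T b → (if b then x else y) ≡ x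
      if-true {b = true} _ = refl

      if-false : ∀ {ℓ} {A : Set ℓ} {b} {x y : A} → ¬ T b → (if b then x else y) ≡ y
      if-false {b = false} _ = refl
      if-false {b = true} n = contradiction tt n

      chain : ∀ {σ d μ₀ μ₁ μ} → Good σ d μ₀ μ₁ → Good σ d μ₁ μ → Good σ d μ₀ μ
      chain g h = good (sim h) (λ e e< → trans (below h e e<) (below g e e<))

      lower : ∀ {σ d d′ μ₀ μ} → d ≤ d′ → Good σ d′ μ₀ μ → Good σ d μ₀ μ
      lower l g = good (sim g) (λ e e< → below g e (<-≤-trans e< l))

    jumps : ∀ {p q c x y n r P} μ {i j} → rs μ x ≡ i → rs μ y ≡ j → head (drop p cs) ≡ just (jumpIf c x y q) →
            T (compareWords c i j) → Run q μ n r P → Run p μ (suc n) r P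
    jumps {p} {q} {c} μ refl refl h t k =
      instr h (cong (λ z → running (conf z μ)) (if-true t)) k

    falls : ∀ {p q c x y n r P} μ {i j} → rs μ x ≡ i → rs μ y ≡ j → head (drop p cs) ≡ just (jumpIf c x y q) →
            ¬ T (compareWords c i j) → Run (suc p) μ n r P → Run p μ (suc n) r P
    falls {p} {q} {c} μ refl refl h t k =
      instr h (cong (λ z → running (conf z μ)) (if-false t)) k

    private
      -- The machine adds the complement of y; the surplus 2 ^ w disappears in the truncation.
      sub-spec : ∀ {x y} → y ≤ x → x < W → trunc (x + (W ∸ y)) ≡ x ∸ y
      sub-spec {x} {y} y≤x x<W = begin
        trunc (x + (W ∸ y))           ≡⟨ cong (λ z → trunc (z + (W ∸ y))) (sym (m∸n+n≡m y≤x)) ⟩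
        trunc (x ∸ y + y + (W ∸ y))   ≡⟨ cong trunc (+-assoc (x ∸ y) y (W ∸ y)) ⟩
        trunc (x ∸ y + (y + (W ∸ y))) ≡⟨ cong (λ z → trunc (x ∸ y + z)) (m+[n∸m]≡n (<⇒≤ (≤-<-trans y≤x x<W))) ⟩
        trunc (x ∸ y + W)             ≡⟨ [m+n]%n≡m%n (x ∸ y) W {{m^n≢0 2 w}} ⟩
        trunc (x ∸ y)                 ≡⟨ trunc-small (≤-<-trans (m∸n≤m x y) x<W) ⟩
        x ∸ y ∎
        where open ≡-Reasoning

      quotient-small : ∀ x y → x < W → Word.quotient w x y < W
      quotient-small x zero    l = ≤-trans (s≤s z≤n) 1<W
      quotient-small x (suc y) l = ≤-<-trans (m/n≤m x (suc y)) l

    op-correct : ∀ o {σ d p μ₀ μ x y} → suc d < temporaries → At cs p (opCode o d p) →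
                 Good σ d μ₀ μ → rs μ (tmp d) ≡ x → rs μ (tmp (suc d)) ≡ y → x < W → y < W → okOp o x y →
                 Run p μ (opCost o) (opCost o + p) (Value σ d μ₀ (evalOp o x y))
    op-correct plus {d = d} {μ = μ} d< (h , _) g refl refl lx ly l =
      instr h refl (stop (value (set-tmp ≤-refl (<⇒≤ d<) g) (trans (get (tmp d) μ) (trunc-small l)) l))
    op-correct times {d = d} {μ = μ} d< (h , _) g refl refl lx ly l =
      instr h refl (stop (value (set-tmp ≤-refl (<⇒≤ d<) g) (trans (get (tmp d) μ) (trunc-small l)) l))
    op-correct quot {d = d} {μ = μ} {x} {y} d< (h , _) g refl refl lx ly l =
      instr h refl (stop (value (set-tmp ≤-refl (<⇒≤ d<) g) (get (tmp d) μ) (quotient-small x y lx)))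
    op-correct monus {d = d} {μ = μ} {x} {y} d< (h₁ , h₂ , h₃ , h₄ , _) g ex ey lx ly l with x <? y
    ... | yes x<y = faster (s≤s (s≤s z≤n)) (jumps μ ex ey h₁ (<⇒<ᵇ x<y) (instr h₄ refl (stop
            (value (set-tmp ≤-refl (<⇒≤ d<) g)
                   (trans (get (tmp d) μ) (trans (trunc-small (≤-<-trans z≤n lx)) (sym (m≤n⇒m∸n≡0 (<⇒≤ x<y)))))
                   (≤-<-trans (m∸n≤m x y) lx)))))
    ... | no x≮y = faster (s≤s (s≤s (s≤s z≤n))) (falls μ ex ey h₁ (λ t → x≮y (<ᵇ⇒< x y t)) (instr h₂ refl
            (instr h₃ refl (stop
            (value (set-tmp ≤-refl (<⇒≤ d<) g)
                   (trans (get (tmp d) μ) (trans (cong₂ (λ a b → trunc (a + (W ∸ b))) ex ey) (sub-spec (≮⇒≥ x≮y) lx)))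
                   (≤-<-trans (m∸n≤m x y) lx))))))
    op-correct less {d = d} {μ = μ} {x} {y} d< (h₁ , h₂ , h₃ , h₄ , _) g ex ey lx ly l with x <ᵇ y in eq
    ... | true = faster (s≤s (s≤s z≤n)) (jumps μ ex ey h₁ (subst T (sym eq) tt) (instr h₄ refl (stop
            (value (set-tmp ≤-refl (<⇒≤ d<) g) (trans (get (tmp d) μ) (trunc-small 1<W)) 1<W))))
    ... | false = faster (s≤s (s≤s (s≤s z≤n))) (falls μ ex ey h₁ (subst T eq) (instr h₂ refl
            (instr h₃ refl (stop
            (value (set-tmp ≤-refl (<⇒≤ d<) g) (trans (get (tmp d) μ) (trunc-small (≤-<-trans z≤n lx))) (≤-<-trans z≤n lx))))))
    op-correct equal {d = d} {μ = μ} {x} {y} d< (h₁ , h₂ , h₃ , h₄ , _) g ex ey lx ly l with x ≡ᵇ y in eq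
    ... | true = faster (s≤s (s≤s z≤n)) (jumps μ ex ey h₁ (subst T (sym eq) tt) (instr h₄ refl (stop
            (value (set-tmp ≤-refl (<⇒≤ d<) g) (trans (get (tmp d) μ) (trunc-small 1<W)) 1<W))))
    ... | false = faster (s≤s (s≤s (s≤s z≤n))) (falls μ ex ey h₁ (subst T eq) (instr h₂ refl
            (instr h₃ refl (stop
            (value (set-tmp ≤-refl (<⇒≤ d<) g) (trans (get (tmp d) μ) (trunc-small (≤-<-trans z≤n lx))) (≤-<-trans z≤n lx))))))

    private
      cell< : ∀ {i a} → i < lim → a < arrays → i * arrays + a < lim * arrays
      cell< {i} {a} i< a< = begin-strict
        i * arrays + a       <⟨ +-monoʳ-< (i * arrays) a< ⟩
        i * arrays + arrays  ≡⟨ +-comm (i * arrays) arrays ⟩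
        suc i * arrays       ≤⟨ *-monoˡ-≤ arrays i< ⟩
        lim * arrays         ∎
        where open ≤-Reasoning

      nonzero : ∀ {x} → x ≢ 0 → ¬ T (x ≡ᵇ 0)
      nonzero {x} n t = n (≡ᵇ⇒≡ x 0 t)

    address-correct : ∀ a {σ d p μ₀ μ i n q P} → suc d < temporaries → At cs p (address a d) → a < arrays → i < lim →
                      Value σ d μ₀ i μ →
                      (∀ {μ′} → Value σ d μ₀ (i * arrays + a) μ′ → Run (4 + p) μ′ n q P) →
                      Run p μ (4 + n) q P
    address-correct a {σ} {d} {p} {μ₀} {μ} {i} d< (h₁ , h₂ , h₃ , h₄ , _) a< i< V k =
      instr h₁ refl (instr h₂ refl (instr h₃ refl (instr h₄ refl (k
        (value (set-tmp ≤-refl (<⇒≤ d<) (set-tmp (n≤1+n d) d< (set-tmp ≤-refl (<⇒≤ d<)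
                 (set-tmp (n≤1+n d) d< (isgood V)))))
               (trans (get (tmp d) μ₃) (trans (cong trunc (cong₂ _+_ first (trans (get (tmp (suc d)) μ₂) (trunc-small a<W))))
                 (trunc-small total)))
               total)))))
      where
      μ₁ = setR (tmp (suc d)) (trunc arrays) μ
      μ₂ = setR (tmp d) (trunc (rs μ₁ (tmp d) * rs μ₁ (tmp (suc d)))) μ₁
      μ₃ = setR (tmp (suc d)) (trunc a) μ₂
      d≢ : tmp d ≢ tmp (suc d)
      d≢ = tmp≢tmp ≤-refl d<
      total : i * arrays + a < W
      total = <-≤-trans (cell< i< a<) room
      na<W : arrays < W
      na<W = ≤-trans (≤ᵇ⇒≤ (suc arrays) 256 tt) 256≤W
      a<W : a < W
      a<W = <-trans a< na<W
      first : rs μ₃ (tmp d) ≡ i * arrays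
      first = trans (get-other μ₂ d≢) (trans (get (tmp d) μ₁) (trans (cong trunc (cong₂ _*_
                (trans (get-other μ d≢) (result V)) (trans (get (tmp (suc d)) μ) (trunc-small na<W))))
                (trunc-small (≤-<-trans (m≤m+n _ a) total))))

    private
      touch : ∀ {σ d μ₀ μ x} → x < lim * arrays → Good σ d μ₀ μ →
              Good σ d μ₀ (mach (rs μ) (mm μ) (os μ) (us μ ⊔ suc x))
      touch l (good s b) = good (record { sim-var = sim-var s ; sim-arr = sim-arr s ; sim-out = sim-out s
                              ; sim-used = ⊔-lub (sim-used s) l
                              ; small-var = small-var s ; small-arr = small-arr s }) b

    expr-correct : ∀ e {σ d p μ} → depth e + d ≤ temporaries → At cs p (codeE e d p) → Sim σ μ → ok e σ →
                   Run p μ (costE e) (endE e p) (Value σ d μ (⟦ e ⟧ σ))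
    expr-correct (# c) {d = d} {μ = μ} d< (h , _) s o =
      instr h refl (stop (value (set-tmp ≤-refl d< (good s λ _ _ → refl)) (trans (get (tmp d) μ) (trunc-small l)) l))
      where l = <-≤-trans (<ᵇ⇒< c 256 o) 256≤W
    expr-correct (v x) {σ} {d} {μ = μ} d< (h₁ , h₂ , _) s o =
      instr h₁ refl (instr h₂ refl (stop (value
        (set-tmp ≤-refl (<⇒≤ d<) (set-tmp ≤-refl (<⇒≤ d<) (good s λ _ _ → refl)))
        (trans (get (tmp d) (setR (tmp d) (trunc 0) μ)) (trans (cong trunc (cong₂ _+_
           (trans (get-other μ (var≢tmp x< (<⇒≤ d<))) (sim-var s x x<))
           (trans (get (tmp d) μ) (trunc-small (≤-<-trans z≤n 1<W)))))
           (trans (cong trunc (+-identityʳ _)) (trunc-small (small-var s x x<)))))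
        (small-var s x x<))))
      where x< = <ᵇ⇒< x variables o
    expr-correct (bin o a b) {σ} {d} {p} {μ} d< h s (oa , ob , oo) =
      faster (≤-reflexive (sym (+-assoc (costE a) (costE b) (opCost o))))
      (expr-correct a (≤-trans (+-monoˡ-≤ d (m≤m⊔n (depth a) _)) d<) (proj₁ h₁) s oa ⟫ λ {μ₁} V →
      (expr-correct b (≤-trans (≤-reflexive (+-suc (depth b) d)) db) (proj₁ h₂) (sim (isgood V)) ob ⟫ λ {μ₂} V′ →
      op-correct o (≤-trans (s≤s (s≤s (m≤n+m d _))) db₁) (proj₂ h₂)
        (chain (isgood V) (lower (n≤1+n d) (isgood V′)))
        -- The second operand was evaluated one temporary higher, so the first is still in place.
        (trans (below (isgood V′) d ≤-refl) (result V)) (result V′) (small V) (small V′) oo))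
      where
      h₁ = at-E a d p h
      h₂ = at-E b (suc d) (endE a p) (proj₂ h₁)
      db : suc (depth b) + d ≤ temporaries
      db = ≤-trans (+-monoˡ-≤ d (m≤n⊔m (depth a) (suc (depth b)))) d<
      db₁ : suc (1 + (0 + d)) ≤ temporaries
      db₁ = ≤-trans (+-monoˡ-≤ d (s≤s (depth≥1 b))) db
    expr-correct (ld a e) {σ} {d} {p} {μ} d< h s (oa , oe , l) =
      expr-correct e (≤-trans (+-monoˡ-≤ d (m≤m⊔n (depth e) _)) d<) (proj₁ h₁) s oe ⟫ λ {μ₁} V →
      address-correct a dd (proj₁ h₂) a< l V λ {μ₂} V′ →
      instr (proj₁ (proj₂ h₂)) refl (stop (value
        (set-tmp ≤-refl (<⇒≤ dd) (touch (subst (_< lim * arrays) (sym (result V′)) (cell< l a<)) (isgood V′)))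
        (trans (get (tmp d) (mach (rs μ₂) (mm μ₂) (os μ₂) (us μ₂)))
          (trans (cong (mm μ₂) (result V′)) (sim-arr (sim (isgood V′)) a (⟦ e ⟧ σ) a<)))
        (small-arr s a (⟦ e ⟧ σ) a<)))
      where
      a< = <ᵇ⇒< a arrays oa
      h₁ = at-E e d p h
      h₂ = at-++ {cs} (endE e p) (address a d) (proj₂ h₁)
      dd : suc d < temporaries
      dd = ≤-trans (+-monoˡ-≤ d (m≤n⊔m (depth e) 2)) d<
    expr-correct (rd τ e) {σ} {d} {p} {μ} d< h s oe =
      expr-correct e d< (proj₁ h₁) s oe ⟫ λ {μ₁} V →
      instr (proj₁ (proj₂ h₁)) refl (stop (value
        (set-tmp ≤-refl (≤-trans (+-monoˡ-≤ d (depth≥1 e)) d<) (isgood V))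
        (trans (get (tmp d) μ₁) (trans (cong (λ z → trunc (charAt (input τ) z)) (result V)) (trunc-small (chars τ (⟦ e ⟧ σ)))))
        (chars τ (⟦ e ⟧ σ))))
      where
      h₁ = at-E e d p h
    expr-correct (sz τ) {d = d} {μ = μ} d< (h , _) s o =
      instr h refl (stop (value (set-tmp ≤-refl d< (good s λ _ _ → refl)) (trans (get (tmp d) μ) (trunc-small (sizes τ))) (sizes τ)))
    expr-correct (ite c a b) {σ} {d} {p} {μ} d< h s (oc , oa , ob) =
      faster (≤-reflexive (sym (trans (+-assoc (costE c) _ 3) (cong (costE c +_) (+-comm _ 3)))))
      (expr-correct c (≤-trans (+-monoˡ-≤ d (≤-trans (m≤m⊔n (depth c) 2) (m≤m⊔n _ _))) d<) (proj₁ h₁) s oc ⟫ λ {μ₁} V →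
        instr (proj₁ (proj₂ h₁)) refl (split V))
      where
      h₁ = at-E c d p h
      h₂ = at-E a d (2 + endE c p) (proj₂ (proj₂ (proj₂ h₁)))
      pb = 1 + endE a (2 + endE c p)
      dd : suc d < temporaries
      dd = ≤-trans (+-monoˡ-≤ d (≤-trans (m≤n⊔m (depth c) 2) (m≤m⊔n _ _))) d<
      split : ∀ {μ₁} → Value σ d μ (⟦ c ⟧ σ) μ₁ →
              Run (1 + endE c p) (setR (tmp (suc d)) (trunc 0) μ₁) (suc (suc (costE a + costE b)))
                  (endE (ite c a b) p) (Value σ d μ (⟦ ite c a b ⟧ σ))
      split {μ₁} V with decide c σ
      ... | inj₁ (t , nz) = falls _ (trans (get-other μ₁ (tmp≢tmp ≤-refl dd)) (result V))
              (trans (get (tmp (suc d)) μ₁) (trunc-small (≤-<-trans z≤n 1<W))) (proj₁ (proj₂ (proj₂ h₁))) (nonzero nz)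
              (faster (≤-trans (≤-reflexive (+-comm (costE a) 1)) (s≤s (m≤m+n _ _)))
                (expr-correct a (≤-trans (+-monoˡ-≤ d (≤-trans (m≤m⊔n (depth a) _) (m≤n⊔m (depth c ⊔ 2) _))) d<)
                   (proj₁ h₂) (sim (set-tmp (n≤1+n d) dd (isgood V))) (oa t) ⟫ λ {μ₂} V′ →
                 instr (proj₁ (proj₂ h₂)) refl (stop (value
                   (chain (set-tmp (n≤1+n d) dd (isgood V)) (isgood V′))
                   (trans (result V′) (sym (if-false (nonzero nz)))) (subst (_< W) (sym (if-false (nonzero nz))) (small V′))))))
      ... | inj₂ (f , z) = jumps _ (trans (get-other μ₁ (tmp≢tmp ≤-refl dd)) (result V))
              (trans (get (tmp (suc d)) μ₁) (trunc-small (≤-<-trans z≤n 1<W))) (proj₁ (proj₂ (proj₂ h₁))) (≡⇒≡ᵇ _ _ z)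
              (faster (≤-trans (≤-reflexive (+-identityʳ _)) (≤-trans (m≤n+m _ (costE a)) (n≤1+n _)))
                (expr-correct b (≤-trans (+-monoˡ-≤ d (≤-trans (m≤n⊔m (depth a) _) (m≤n⊔m (depth c ⊔ 2) _))) d<)
                   (proj₂ (proj₂ h₂)) (sim (set-tmp (n≤1+n d) dd (isgood V))) (ob f) ⟫ λ {μ₂} V′ →
                 stop (value
                   (chain (set-tmp (n≤1+n d) dd (isgood V)) (isgood V′))
                   (trans (result V′) (sym (if-true (≡⇒≡ᵇ _ _ z)))) (subst (_< W) (sym (if-true (≡⇒≡ᵇ _ _ z))) (small V′)))))
    expr-correct (a && b) {σ} {d} {p} {μ} d< h s (oa , ob) =
      faster (≤-trans (+-monoʳ-≤ (costE a) (≤-trans (≤-reflexive (+-comm 2 (costE b))) (+-monoʳ-≤ (costE b) {2} {4} (s≤s (s≤s z≤n)))))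
                 (≤-reflexive (sym (+-assoc (costE a) (costE b) 4))))
      (expr-correct a (≤-trans (+-monoˡ-≤ d (m≤m⊔n (depth a) _)) d<) (proj₁ h₁) s oa ⟫ λ {μ₁} V →
        instr (proj₁ (proj₂ h₁)) refl (split V))
      where
      h₁ = at-E a d p h
      dd : suc d < temporaries
      dd = ≤-trans (+-monoˡ-≤ d (≤-trans (m≤m⊔n 2 (depth b)) (m≤n⊔m (depth a) _))) d<
      split : ∀ {μ₁} → Value σ d μ (⟦ a ⟧ σ) μ₁ →
              Run (1 + endE a p) (setR (tmp (suc d)) (trunc 0) μ₁) (suc (costE b))
                  (endE (a && b) p) (Value σ d μ (⟦ a && b ⟧ σ))
      split {μ₁} V with decide a σ
      ... | inj₁ (t , nz) = falls _ (trans (get-other μ₁ (tmp≢tmp ≤-refl dd)) (result V))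
              (trans (get (tmp (suc d)) μ₁) (trunc-small (≤-<-trans z≤n 1<W))) (proj₁ (proj₂ (proj₂ h₁))) (nonzero nz)
              (faster (≤-reflexive (+-identityʳ _))
                (expr-correct b (≤-trans (+-monoˡ-≤ d (≤-trans (m≤n⊔m 2 (depth b)) (m≤n⊔m (depth a) _))) d<)
                   (proj₂ (proj₂ (proj₂ h₁))) (sim (set-tmp (n≤1+n d) dd (isgood V))) (ob t) ⟫ λ {μ₂} V′ →
                 stop (value
                   (chain (set-tmp (n≤1+n d) dd (isgood V)) (isgood V′))
                   (trans (result V′) (sym (if-false (nonzero nz)))) (subst (_< W) (sym (if-false (nonzero nz))) (small V′)))))
      ... | inj₂ (f , z) = jumps _ (trans (get-other μ₁ (tmp≢tmp ≤-refl dd)) (result V))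
              (trans (get (tmp (suc d)) μ₁) (trunc-small (≤-<-trans z≤n 1<W))) (proj₁ (proj₂ (proj₂ h₁))) (≡⇒≡ᵇ _ _ z)
              (faster z≤n (stop (value (set-tmp (n≤1+n d) dd (isgood V))
                (trans (get-other μ₁ (tmp≢tmp ≤-refl dd)) (trans (result V) (trans z (sym (if-true (≡⇒≡ᵇ _ _ z))))))
                (subst (_< W) (sym (if-true (≡⇒≡ᵇ _ _ z))) (≤-<-trans z≤n 1<W)))))

    private
      -- Modulo `arrays` an address yields its array as the remainder and the index as the quotient.
      decode : ∀ {i a j b} → a < arrays → b < arrays → i * arrays + a ≡ j * arrays + b → i ≡ j × a ≡ b
      decode {i} {a} {j} {b} a< b< e = *-cancelʳ-≡ i j arrays (+-cancelʳ-≡ a _ _ (trans e (cong (j * arrays +_) (sym ab)))) , ab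
        where
        modulo : ∀ i a → a < arrays → (i * arrays + a) % arrays ≡ a
        modulo i a a< = trans (cong (_% arrays) (+-comm (i * arrays) a)) (trans ([m+kn]%n≡m%n a i arrays) (m<n⇒m%n≡m a<))
        ab : a ≡ b
        ab = trans (sym (modulo i a a<)) (trans (cong (_% arrays) e) (modulo j b b<))

      update-hit : ∀ (α : ℕ → ℕ → ℕ) a i x → update α a i x a i ≡ x
      update-hit α a i x = trans (cong (λ f → f i) (if-true {x = α a [ i ≔ x ]} (≡⇒≡ᵇ a a refl))) (≔-hit (α a) i x)

      update-index : ∀ (α : ℕ → ℕ → ℕ) a {i j} x → j ≢ i → update α a i x a j ≡ α a j
      update-index α a {i} {j} x n = trans (cong (λ f → f j) (if-true {x = α a [ i ≔ x ]} (≡⇒≡ᵇ a a refl))) (≔-miss (α a) x n)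

      update-array : ∀ (α : ℕ → ℕ → ℕ) {a b} i j x → b ≢ a → update α a i x b j ≡ α b j
      update-array α {a} {b} i j x n = cong (λ f → f j) (if-false {x = α a [ i ≔ x ]} (λ t → n (≡ᵇ⇒≡ b a t)))

    store-sim : ∀ {σ μ a i x} → a < arrays → i < lim → x < W → Sim σ μ →
      Sim (stored (env σ) (update (arr σ) a i x) (out σ))
          (mach (rs μ) (mm μ [ i * arrays + a ≔ x ]) (os μ) (us μ ⊔ suc (i * arrays + a)))
    store-sim {σ} {μ} {a} {i} {x} a< i< x< s = record
      { sim-var = sim-var s
      ; sim-arr = arrs
      ; sim-out = sim-out s
      ; sim-used = ⊔-lub (sim-used s) (cell< i< a<)
      ; small-var = small-var s
      ; small-arr = smalls }
      where
      arrs : ∀ b j → b < arrays → (mm μ [ i * arrays + a ≔ x ]) (j * arrays + b) ≡ update (arr σ) a i x b j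
      arrs b j b< with b ≟ a
      ... | no ne = trans (≔-miss (mm μ) x λ e → ne (proj₂ (decode {j} {b} {i} {a} b< a< e)))
                      (trans (sim-arr s b j b<) (sym (update-array (arr σ) i j x ne)))
      ... | yes refl with j ≟ i
      ... | no ne = trans (≔-miss (mm μ) x λ e → ne (proj₁ (decode {j} {b} {i} {a} b< a< e)))
                      (trans (sim-arr s b j b<) (sym (update-index (arr σ) a x ne)))
      ... | yes refl = trans (≔-hit (mm μ) _ x) (sym (update-hit (arr σ) a i x))
      smalls : ∀ b j → b < arrays → update (arr σ) a i x b j < W
      smalls b j b< with b ≟ a
      ... | no ne = subst (_< W) (sym (update-array (arr σ) i j x ne)) (small-arr s b j b<)
      ... | yes refl with j ≟ i
      ... | no ne = subst (_< W) (sym (update-index (arr σ) a x ne)) (small-arr s b j b<)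
      ... | yes refl = subst (_< W) (sym (update-hit (arr σ) a i x)) x<

    assign-sim : ∀ {σ μ x a} → x < variables → a < W → Sim σ μ →
      Sim (stored (env σ [ x ≔ a ]) (arr σ) (out σ)) (setR (reg x) a μ)
    assign-sim {σ} {μ} {x} {a} x< a< s = record
      { sim-var = vars ; sim-arr = sim-arr s ; sim-out = sim-out s ; sim-used = sim-used s
      ; small-var = smalls ; small-arr = small-arr s }
      where
      vars : ∀ y → y < variables → rs (setR (reg x) a μ) (reg y) ≡ (env σ [ x ≔ a ]) y
      vars y y< with y ≟ x
      ... | yes refl = trans (get (reg x) μ) (sym (≔-hit (env σ) x a))
      ... | no ne = trans (get-other μ (λ e → ne (reg-injective (≤-trans y< (m≤m+n _ _)) (≤-trans x< (m≤m+n _ _)) e)))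
                      (trans (sim-var s y y<) (sym (≔-miss (env σ) a ne)))
      smalls : ∀ y → y < variables → (env σ [ x ≔ a ]) y < W
      smalls y y< with y ≟ x
      ... | yes refl = subst (_< W) (sym (≔-hit (env σ) x a)) a<
      ... | no ne = subst (_< W) (sym (≔-miss (env σ) a ne)) (small-var s y y<)

    private
      ∧-l : ∀ {a b} → T (a ∧ b) → T a
      ∧-l {true} _ = tt
      ∧-r : ∀ {a b} → T (a ∧ b) → T b
      ∧-r {true} t = t

      flat : ∀ e → T (shallow e) → depth e + 0 ≤ temporaries
      flat e t = ≤-trans (≤-reflexive (+-identityʳ _)) (≤-trans (n≤1+n _) (≤ᵇ⇒≤ (suc (depth e)) temporaries t))

      flat1 : ∀ e → T (shallow e) → depth e + 1 ≤ temporaries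
      flat1 e t = ≤-trans (≤-reflexive (+-comm _ 1)) (≤ᵇ⇒≤ (suc (depth e)) temporaries t)

      1<tmps : 1 < temporaries
      1<tmps = s≤s (s≤s z≤n)

    test-correct : ∀ e {σ p q μ n r P} → T (shallow e) →
      At cs p (codeE e 0 p) → At cs (endE e p) (literal (tmp 1) 0 ∷ jumpIf eq (tmp 0) (tmp 1) q ∷ []) → Sim σ μ → ok e σ →
      (⟦ e ⟧ σ ≢ 0 → ∀ {μ′} → Sim σ μ′ → Run (2 + endE e p) μ′ n r P) →
      (⟦ e ⟧ σ ≡ 0 → ∀ {μ′} → Sim σ μ′ → Run q μ′ n r P) →
      Run p μ (costE e + (2 + n)) r P
    test-correct e {σ} {p} sh h (h₁ , h₂ , _) s o f g =
      expr-correct e (flat e sh) h s o ⟫ λ {μ₁} V → instr h₁ refl (split V)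
      where
      split : ∀ {μ₁} → Value σ 0 _ (⟦ e ⟧ σ) μ₁ → Run (1 + endE e p) (setR (tmp 1) (trunc 0) μ₁) _ _ _
      split {μ₁} V with ⟦ e ⟧ σ ≟ 0
      ... | no nz = falls _ (trans (get-other {a = trunc 0} μ₁ (tmp≢tmp {0} {1} ≤-refl 1<tmps)) (result V))
                     (trans (get (tmp 1) μ₁) (trunc-small (≤-<-trans z≤n 1<W))) h₂ (nonzero nz)
                     (f nz (sim (set-tmp z≤n 1<tmps (isgood V))))
      ... | yes z = jumps _ (trans (get-other {a = trunc 0} μ₁ (tmp≢tmp {0} {1} ≤-refl 1<tmps)) (result V))
                     (trans (get (tmp 1) μ₁) (trunc-small (≤-<-trans z≤n 1<W))) h₂ (≡⇒≡ᵇ _ _ z)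
                     (g z (sim (set-tmp z≤n 1<tmps (isgood V))))

    -- The induction is on the execution, not on the command: the remaining rounds of a loop are a
    -- smaller derivation, run from the same place in the code.
    cmd-correct : ∀ {c σ σ′ t} → Exec c σ σ′ t → ∀ {p μ} → At cs p (codeC c p) → Sim σ μ →
                  Run p μ t (endC c p) (Sim σ′)
    cmd-correct (assign {x} {e} {σ} wf o) {p} {μ} h s =
      expr-correct e (flat e (∧-l wf)) (proj₁ h₁) s o ⟫ λ {μ₁} V →
      instr (proj₁ (proj₂ h₁)) refl (instr (proj₁ (proj₂ (proj₂ h₁))) refl (stop
        (subst (λ a → Sim _ (setR (reg x) a (setR (tmp 1) (trunc 0) μ₁))) (sym (eqn V))
          (assign-sim x< (small V) (sim (set-tmp z≤n 1<tmps (isgood V)))))))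
      where
      h₁ = at-E e 0 p h
      x< : x < variables
      x< = <ᵇ⇒< x variables (∧-r {shallow e} wf)
      eqn : ∀ {μ₁} → Value σ 0 μ (⟦ e ⟧ σ) μ₁ →
            trunc (rs (setR (tmp 1) (trunc 0) μ₁) (tmp 0) + rs (setR (tmp 1) (trunc 0) μ₁) (tmp 1)) ≡ ⟦ e ⟧ σ
      eqn {μ₁} V = trans (cong trunc (trans (cong₂ _+_
                     (trans (get-other {a = trunc 0} μ₁ (tmp≢tmp {0} {1} ≤-refl 1<tmps)) (result V))
                     (trans (get (tmp 1) μ₁) (trunc-small (≤-<-trans z≤n 1<W)))) (+-identityʳ _))) (trunc-small (small V))
    cmd-correct (write {a} {i} {e} {σ} wf oi oe l) {p} {μ} h s =
      faster (≤-reflexive (lemma (costE i) (costE e)))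
      (expr-correct i (flat i (∧-l wf)) (proj₁ h₁) s oi ⟫ λ {μ₁} V →
       address-correct a {n = costE e + 1} 1<tmps (proj₁ h₂) a< l V λ {μ₂} V′ →
       (expr-correct e (flat1 e she) (proj₁ h₃) (sim (isgood V′)) oe ⟫ λ {μ₃} V″ →
        let index = trans (below (isgood V″) 0 (s≤s z≤n)) (result V′) in
        instr (proj₁ (proj₂ h₃)) refl (stop
          (subst₂ (λ z y → Sim _ (mach (rs μ₃) (mm μ₃ [ z ≔ y ]) (os μ₃) (us μ₃ ⊔ suc z))) (sym index) (sym (result V″))
            (store-sim a< l (small V″) (sim (isgood V″)))))))
      where
      she : T (shallow e)
      she = ∧-l (∧-r {shallow i} wf)
      a< : a < arrays
      a< = <ᵇ⇒< a arrays (∧-r {shallow e} (∧-r {shallow i} wf))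
      h₁ = at-E i 0 p h
      h₂ = at-++ {cs} (endE i p) (address a 0) (proj₂ h₁)
      h₃ = at-E e 1 (4 + endE i p) (proj₂ h₂)
      lemma : ∀ x y → x + (4 + (y + 1)) ≡ x + y + 5
      lemma x y = trans (cong (x +_) (trans (+-comm 4 (y + 1)) (+-assoc y 1 4))) (sym (+-assoc x y 5))
    cmd-correct (put {e} {σ} sh o) {p} {μ} h s =
      expr-correct e (flat e sh) (proj₁ h₁) s o ⟫ λ {μ₁} V →
      instr (proj₁ (proj₂ h₁)) refl (stop (let s₁ = sim (isgood V) in record
        { sim-var = sim-var s₁ ; sim-arr = sim-arr s₁ ; sim-out = cong₂ _∷ʳ_ (sim-out s₁) (result V)
        ; sim-used = sim-used s₁ ; small-var = small-var s₁ ; small-arr = small-arr s₁ }))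
      where h₁ = at-E e 0 p h
    cmd-correct skip h s = stop s
    cmd-correct (seq {c} {d} x y) {p} h s =
      cmd-correct x (proj₁ h₁) s ⟫ λ s₁ → cmd-correct y (proj₂ h₁) s₁
      where h₁ = at-C c p h
    cmd-correct (then′ {e} {c} {d} {t = t} sh o nz x) {p} h s =
      faster (≤-reflexive (cong (costE e +_) (+-comm 3 t)))
      (test-correct e {n = suc t} sh (proj₁ h₁) (proj₁ (proj₂ h₁) , proj₁ (proj₂ (proj₂ h₁)) , tt) s o
        (λ _ s₁ → faster (≤-reflexive (+-comm t 1)) (cmd-correct x (proj₁ h₂) s₁ ⟫ λ s₂ → instr (proj₁ (proj₂ h₂)) refl (stop s₂)))
        (λ z → contradiction z nz))
      where
      h₁ = at-E e 0 p h
      h₂ = at-C c (2 + endE e p) (proj₂ (proj₂ (proj₂ h₁)))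
    cmd-correct (else′ {e} {c} {d} {t = t} sh o z x) {p} h s =
      faster (≤-reflexive (cong (costE e +_) (+-comm 3 t)))
      (test-correct e {n = suc t} sh (proj₁ h₁) (proj₁ (proj₂ h₁) , proj₁ (proj₂ (proj₂ h₁)) , tt) s o
        (λ nz → contradiction z nz)
        (λ _ s₁ → faster (n≤1+n t) (cmd-correct x (proj₂ (proj₂ h₂)) s₁)))
      where
      h₁ = at-E e 0 p h
      h₂ = at-C c (2 + endE e p) (proj₂ (proj₂ (proj₂ h₁)))
    cmd-correct (done {e} {c} sh o z) {p} h s =
      test-correct e {n = 0} sh (proj₁ h₁) (proj₁ (proj₂ h₁) , proj₁ (proj₂ (proj₂ h₁)) , tt) s o
        (λ nz → contradiction z nz)
        (λ _ s₁ → stop s₁)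
      where
      h₁ = at-E e 0 p h
    cmd-correct (again {e} {c} {t = t} {u} sh o nz x y) {p} h s =
      test-correct e {n = suc (t + u)} sh (proj₁ h₁) (proj₁ (proj₂ h₁) , proj₁ (proj₂ (proj₂ h₁)) , tt) s o
        (λ _ s₁ → faster (≤-reflexive (+-suc t u)) (cmd-correct x (proj₁ h₂) s₁ ⟫ λ s₂ →
           instr (proj₁ (proj₂ h₂)) refl (cmd-correct y h s₂)))
        (λ z → contradiction z nz)
      where
      h₁ = at-E e 0 p h
      h₂ = at-C c (2 + endE e p) (proj₂ (proj₂ (proj₂ h₁)))

  blank : Store
  blank = stored (λ _ → 0) (λ _ _ → 0) []

  -- The variable `flag` tells whether the answer is the emitted string or ⊥.
  assemble : Cmd → ℕ → Program
  assemble c flag = record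
    { registers = size#
    ; code = codeC c 0 ++ (literal (tmp 0) 0 ∷ jumpIf eq (reg flag) (tmp 0) (3 + endC c 0) ∷ accept ∷ reject ∷ []) }

  answer : ℕ → List ℕ → Maybe (List ℕ)
  answer zero    xs = nothing
  answer (suc _) xs = just xs

  module _ (hw : Hardware) where

    open Hardware hw
    open Semantics mc

    -- The three additional steps load 0, test the flag and halt.
    assemble-correct : ∀ {c flag t Q} → flag < variables → Ends c blank t Q →
      ∃[ σ ] ∃[ time ] ∃[ used ] (Q σ × time ≤ t + 3 × used ≤ lim * arrays ×
        runFor w input (assemble c flag) time ≡ halted (answer (env σ flag) (out σ)) used)
    assemble-correct {c} {flag} {t} flag< (ends {σ} x b q) with cmd-correct x (proj₁ here) start
      where
      tail : List (Instr size#)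
      tail = literal (tmp 0) 0 ∷ jumpIf eq (reg flag) (tmp 0) (3 + endC c 0) ∷ accept ∷ reject ∷ []
      open Simulation hw (codeC c 0 ++ tail)
      here = at-C c 0 {tail} (at-suffix [] (codeC c 0 ++ tail))
      start : Sim blank (mach (λ _ → 0) (λ _ → 0) [] 0)
      start = record { sim-var = λ _ _ → refl ; sim-arr = λ _ _ _ → refl ; sim-out = refl ; sim-used = z≤n
                     ; small-var = λ _ _ → positive ; small-arr = λ _ _ _ → positive }
        where positive = ≤-trans (s≤s z≤n) 256≤W
    ... | Simulation.run {u} {μ} fast ran s = σ , u + 3 , us μ , q , +-monoˡ-≤ 3 (≤-trans fast b) , S.Sim.sim-used s ,
      trans (S.runFor-advance (u + 3)) (trans (S.advance-+ u 3 _) (trans (cong (S.advance 3) ran) last))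
      where
      tail : List (Instr size#)
      tail = literal (tmp 0) 0 ∷ jumpIf eq (reg flag) (tmp 0) (3 + endC c 0) ∷ accept ∷ reject ∷ []
      module S = Simulation hw (codeC c 0 ++ tail)
      here = at-C c 0 {tail} (at-suffix [] (codeC c 0 ++ tail))
      h₁ = proj₁ (proj₂ here)
      h₂ = proj₁ (proj₂ (proj₂ here))
      h₃ = proj₁ (proj₂ (proj₂ (proj₂ here)))
      h₄ = proj₁ (proj₂ (proj₂ (proj₂ (proj₂ here))))
      μ₁ : Mach
      μ₁ = setR (tmp 0) (Word.trunc w 0) μ
      fetch : ∀ {p i} μ → head (drop p (codeC c 0 ++ tail)) ≡ just i →
              step w input S.program (running (conf p μ)) ≡ exec w input i (conf p μ)
      fetch {p} μ h = cong (maybe′ (λ i → exec w input i (conf p μ)) (running (conf p μ))) h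
      flag≢tmp : reg flag ≢ tmp 0
      flag≢tmp e = <⇒≢ flag< (trans (reg-injective {flag} {variables + 0} (≤-trans flag< (m≤m+n _ _)) (≤ᵇ⇒≤ _ size# tt) e) refl)
      zero-tmp : rs μ₁ (tmp 0) ≡ 0
      zero-tmp = trans (S.get (tmp 0) μ) (S.trunc-small (≤-trans (s≤s z≤n) 256≤W))
      flag-val : rs μ₁ (reg flag) ≡ env σ flag
      flag-val = trans (S.get-other {a = Word.trunc w 0} μ flag≢tmp) (S.Sim.sim-var s flag flag<)
      p = endC c 0
      third : ∀ f z → z ≡ 0 →
              step w input S.program (running (conf (if f ≡ᵇ z then 3 + p else 2 + p) μ₁)) ≡ halted (answer f (out σ)) (us μ)
      third zero    _ refl = fetch {3 + p} μ₁ h₄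
      third (suc f) _ refl = trans (fetch {2 + p} μ₁ h₃) (cong (λ o → halted (just o) (us μ)) (S.Sim.sim-out s))
      last : S.advance 3 (running (conf p μ)) ≡ halted (answer (env σ flag) (out σ)) (us μ)
      last = trans (cong (λ z → step w input S.program (step w input S.program z)) (fetch {p} μ h₁))
               (trans (cong (step w input S.program) (fetch {1 + p} μ₁ h₂))
                 (trans (third _ _ zero-tmp) (cong (λ f → halted (answer f (out σ)) (us μ)) flag-val)))

-- Sets of small numbers as binary numerals

module BitVectors where

  open import Data.Nat.DivMod using (_/_; _%_; m≡m%n+[m/n]*n; m%n<n; +-distrib-/-∣ʳ; m*n/n≡m; m<n⇒m/n≡0; [m+kn]%n≡m%n; m<n⇒m%n≡m)
  open import Data.Nat.Divisibility using (n∣m*n)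

  bit : Bool → ℕ
  bit true  = 1
  bit false = 0

  bit<2 : ∀ b → bit b < 2
  bit<2 true  = ≤-refl
  bit<2 false = s≤s z≤n

  -- Splitting off the highest digit suits masks that grow at the top; `val-cons` splits off the
  -- lowest one, as shifts and halves require.
  val : ℕ → (ℕ → Bool) → ℕ
  val zero    f = 0
  val (suc m) f = val m f + bit (f m) * 2 ^ m

  val-< : ∀ m f → val m f < 2 ^ m
  val-< zero    f = ≤-refl
  val-< (suc m) f with f m
  ... | true  = lin 2 (λ v p → (v :< p) ∷ [] ⊢ v :+ (p :+ ‵ 0) :< p :+ (p :+ ‵ 0)) (val m f) (2 ^ m) (val-< m f)
  ... | false = lin 2 (λ v p → (v :< p) ∷ [] ⊢ v :+ ‵ 0 :< p :+ (p :+ ‵ 0)) (val m f) (2 ^ m) (val-< m f)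

  val-cong : ∀ m {f g} → (∀ x → x < m → f x ≡ g x) → val m f ≡ val m g
  val-cong zero    h = refl
  val-cong (suc m) h = cong₂ (λ a b → a + bit b * 2 ^ m) (val-cong m (λ x l → h x (<-trans l ≤-refl))) (h m ≤-refl)

  val-zero : ∀ m → val m (λ _ → false) ≡ 0
  val-zero zero    = refl
  val-zero (suc m) = trans (+-identityʳ _) (val-zero m)

  val-cons : ∀ m f → val (suc m) f ≡ bit (f 0) + 2 * val m (λ x → f (suc x))
  val-cons zero    f = trans (*-identityʳ _) (sym (+-identityʳ _))
  val-cons (suc m) f = trans (cong (_+ bit (f (suc m)) * 2 ^ suc m) (val-cons m f)) (≡-lemma (bit (f 0)) (val m (λ x → f (suc x))) (bit (f (suc m))) (2 ^ m))
    where
    ≡-lemma : ∀ a v b p → a + 2 * v + b * (2 * p) ≡ a + 2 * (v + b * p)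
    ≡-lemma a v b p = ≤-antisym
      (lin 4 (λ a v b p → [] ⊢ a :+ ‵ 2 :* v :+ b :* (‵ 2 :* p) :≤ a :+ ‵ 2 :* (v :+ b :* p)) a v b p)
      (lin 4 (λ a v b p → [] ⊢ a :+ ‵ 2 :* (v :+ b :* p) :≤ a :+ ‵ 2 :* v :+ b :* (‵ 2 :* p)) a v b p)

  half-cons : ∀ a v → a < 2 → (a + 2 * v) / 2 ≡ v
  half-cons a v l = begin
    (a + 2 * v) / 2     ≡⟨ cong (λ z → (a + z) / 2) (*-comm 2 v) ⟩
    (a + v * 2) / 2     ≡⟨ +-distrib-/-∣ʳ a (n∣m*n v) ⟩
    a / 2 + v * 2 / 2   ≡⟨ cong₂ _+_ (m<n⇒m/n≡0 l) (m*n/n≡m v 2) ⟩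
    v ∎
    where open ≡-Reasoning

  parity-cons : ∀ a v → a < 2 → (a + 2 * v) % 2 ≡ a
  parity-cons a v l = trans (cong (λ z → (a + z) % 2) (*-comm 2 v)) (trans ([m+kn]%n≡m%n a v 2) (m<n⇒m%n≡m l))

  val-half : ∀ m f → val (suc m) f / 2 ≡ val m (λ x → f (suc x))
  val-half m f = trans (cong (_/ 2) (val-cons m f)) (half-cons (bit (f 0)) (val m (λ x → f (suc x))) (bit<2 (f 0)))

  val-parity : ∀ m f → val (suc m) f % 2 ≡ bit (f 0)
  val-parity m f = trans (cong (_% 2) (val-cons m f)) (parity-cons (bit (f 0)) (val m (λ x → f (suc x))) (bit<2 (f 0)))

  -- Bitwise conjunction of k digits by arithmetic, in the recursion by which the table is filled.
  conj : ℕ → ℕ → ℕ → ℕ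
  conj zero    x y = 0
  conj (suc k) x y = (x % 2) * (y % 2) + 2 * conj k (x / 2) (y / 2)

  conj-0 : ∀ k y → conj k 0 y ≡ 0
  conj-0 zero    y = refl
  conj-0 (suc k) y = cong (2 *_) (conj-0 k (y / 2))

  conj-val : ∀ k m (f g : ℕ → Bool) → m ≤ k → conj k (val m f) (val m g) ≡ val m (λ x → f x ∧ g x)
  conj-val k       zero    f g l = conj-0 k 0
  conj-val (suc k) (suc m) f g (s≤s l) = begin
    (val (suc m) f % 2) * (val (suc m) g % 2) + 2 * conj k (val (suc m) f / 2) (val (suc m) g / 2)
      ≡⟨ cong₂ (λ a b → a + 2 * b) (cong₂ _*_ (val-parity m f) (val-parity m g))
           (cong₂ (conj k) (val-half m f) (val-half m g)) ⟩
    bit (f 0) * bit (g 0) + 2 * conj k (val m (λ x → f (suc x))) (val m (λ x → g (suc x)))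
      ≡⟨ cong₂ (λ a b → a + 2 * b) (bit-∧ (f 0) (g 0)) (conj-val k m (λ x → f (suc x)) (λ x → g (suc x)) l) ⟩
    bit (f 0 ∧ g 0) + 2 * val m (λ x → f (suc x) ∧ g (suc x))
      ≡⟨ sym (val-cons m (λ x → f x ∧ g x)) ⟩
    val (suc m) (λ x → f x ∧ g x) ∎
    where
    open ≡-Reasoning
    bit-∧ : ∀ a b → bit a * bit b ≡ bit (a ∧ b)
    bit-∧ true  true  = refl
    bit-∧ true  false = refl
    bit-∧ false _     = refl

  -- Filling the table by halves produces one digit more than its entries are specified with; for x
  -- < 2 ^ k this digit is 0.
  conj-suc : ∀ k x y → x < 2 ^ k → conj (suc k) x y ≡ conj k x y
  conj-suc zero    zero    y l = refl
  conj-suc zero    (suc x) y (s≤s ())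
  conj-suc (suc k) x y l = cong (λ z → (x % 2) * (y % 2) + 2 * z) (conj-suc k (x / 2) (y / 2) half<)
    where
    half< : x / 2 < 2 ^ k
    half< = *-cancelʳ-< 2 (x / 2) (2 ^ k) (≤-<-trans (≤-trans (m≤n+m (x / 2 * 2) (x % 2)) (≤-reflexive (sym (m≡m%n+[m/n]*n x 2))))
              (<-≤-trans l (≤-reflexive (*-comm 2 (2 ^ k)))))

  private
    interchange : ∀ a b c d → (a + b) + (c + d) ≡ (a + c) + (b + d)
    interchange a b c d = trans (+-assoc a b (c + d)) (trans (cong (a +_) (trans (sym (+-assoc b c d))
      (trans (cong (_+ d) (+-comm b c)) (+-assoc c b d)))) (sym (+-assoc a c (b + d))))

  val-split : ∀ m (f g : ℕ → Bool) → val m (λ x → f x ∧ g x) + val m (λ x → f x ∧ not (g x)) ≡ val m f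
  val-split zero    f g = refl
  val-split (suc m) f g = trans (interchange (val m (λ x → f x ∧ g x)) _ _ _)
    (cong₂ _+_ (val-split m f g) (trans (sym (*-distribʳ-+ (2 ^ m) (bit (f m ∧ g m)) _)) (cong (_* 2 ^ m) (lemma (f m) (g m)))))
    where
    lemma : ∀ a b → bit (a ∧ b) + bit (a ∧ not b) ≡ bit a
    lemma true  true  = refl
    lemma true  false = refl
    lemma false _     = refl

  -- Subtracting a subset causes no borrows, so a set difference is a difference of numbers.
  val-minus : ∀ m (f g : ℕ → Bool) → val m f ∸ val m (λ x → f x ∧ g x) ≡ val m (λ x → f x ∧ not (g x))
  val-minus m f g = trans (cong (_∸ val m (λ x → f x ∧ g x)) (sym (val-split m f g)))
                          (m+n∸m≡n (val m (λ x → f x ∧ g x)) _)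

  val-union : ∀ m (f g : ℕ → Bool) → val m f + val m g ≡ val m (λ x → f x ∨ g x) + val m (λ x → f x ∧ g x)
  val-union zero    f g = refl
  val-union (suc m) f g = trans (interchange (val m f) _ _ _)
    (trans (cong₂ _+_ (val-union m f g)
      (trans (sym (*-distribʳ-+ (2 ^ m) (bit (f m)) (bit (g m))))
        (trans (cong (_* 2 ^ m) (lemma (f m) (g m))) (*-distribʳ-+ (2 ^ m) (bit (f m ∨ g m)) (bit (f m ∧ g m))))))
      (interchange (val m (λ x → f x ∨ g x)) (val m (λ x → f x ∧ g x)) _ _))
    where
    lemma : ∀ a b → bit a + bit b ≡ bit (a ∨ b) + bit (a ∧ b)
    lemma true  true  = refl
    lemma true  false = refl
    lemma false true  = refl
    lemma false false = refl

  -- Inclusion and exclusion: given conjunctions, a union costs one addition and one subtraction.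
  -- Conjunction is the one operation that has to be tabulated.
  val-or : ∀ m (f g : ℕ → Bool) → val m f + val m g ∸ val m (λ x → f x ∧ g x) ≡ val m (λ x → f x ∨ g x)
  val-or m f g = trans (cong (_∸ val m (λ x → f x ∧ g x)) (val-union m f g)) (m+n∸n≡m _ (val m (λ x → f x ∧ g x)))

  -- With `val-top-true`, a comparison with 2 ^ m tests the highest digit.
  val-top-false : ∀ m f → f m ≡ false → val (suc m) f < 2 ^ m
  val-top-false m f e rewrite e | +-identityʳ (val m f) = val-< m f

  val-top-true : ∀ m f → f m ≡ true → val (suc m) f ≡ val m f + 2 ^ m
  val-top-true m f e rewrite e = cong (val m f +_) (+-identityʳ (2 ^ m))

  shift : (ℕ → Bool) → ℕ → Bool
  shift f zero    = false
  shift f (suc x) = f x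

  val-double : ∀ m f → val m f + val m f ≡ val (suc m) (shift f)
  val-double m f = trans (cong (val m f +_) (sym (+-identityʳ _))) (sym (val-cons m (shift f)))

  set0 : (ℕ → Bool) → ℕ → Bool
  set0 f zero    = true
  set0 f (suc x) = f (suc x)

  -- Halving discards the lowest digit whatever it was, so it can be set without being tested.
  val-set0 : ∀ m f → 1 + 2 * (val (suc m) f / 2) ≡ val (suc m) (set0 f)
  val-set0 m f = trans (cong (λ z → 1 + 2 * z) (val-half m f)) (sym (val-cons m (set0 f)))

  conj-≤ : ∀ k x y → conj k x y ≤ x
  conj-≤ zero    x y = z≤n
  conj-≤ (suc k) x y = begin
    (x % 2) * (y % 2) + 2 * conj k (x / 2) (y / 2)
      ≤⟨ +-mono-≤ (*-monoʳ-≤ (x % 2) (s≤s⁻¹ (m%n<n y 2))) (*-monoʳ-≤ 2 (conj-≤ k (x / 2) (y / 2))) ⟩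
    x % 2 * 1 + 2 * (x / 2)  ≡⟨ cong₂ _+_ (*-identityʳ (x % 2)) (*-comm 2 (x / 2)) ⟩
    x % 2 + x / 2 * 2        ≡⟨ m≡m%n+[m/n]*n x 2 ⟨
    x ∎
    where open ≤-Reasoning

-- Embeddings of P into a text, minimal windows and reversal

module Embeddings where

  open import Data.Unit.Base using (tt)

  module Embedding (P T : ℕ → ℕ) where

    -- P[p..q) is a subsequence of T[i..j).
    data Emb : ℕ → ℕ → ℕ → ℕ → Set where
      end : ∀ {p i j} → i ≤ j → Emb p p i j
      miss : ∀ {p q i j} → Emb p q (suc i) j → Emb p q i j
      hit : ∀ {p q i j} → P p ≡ T i → Emb (suc p) q (suc i) j → Emb p q i j

    emb-i≤j : ∀ {p q i j} → Emb p q i j → i ≤ j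
    emb-i≤j (end l)   = l
    emb-i≤j (miss e)   = <⇒≤ (emb-i≤j e)
    emb-i≤j (hit _ e) = <⇒≤ (emb-i≤j e)

    emb-p≤q : ∀ {p q i j} → Emb p q i j → p ≤ q
    emb-p≤q (end l)   = ≤-refl
    emb-p≤q (miss e)   = emb-p≤q e
    emb-p≤q (hit _ e) = <⇒≤ (emb-p≤q e)

    emb-length : ∀ {p q i j} → Emb p q i j → q + i ≤ j + p
    emb-length {p} {i = i} {j} (end l) = ≤-trans (+-monoʳ-≤ p l) (≤-reflexive (+-comm p j))
    emb-length {q = q} {i} (miss e) = ≤-trans (+-monoʳ-≤ q (n≤1+n i)) (emb-length e)
    emb-length {p} {q} {i} {j} (hit _ e) = s≤s⁻¹ (≤-trans (≤-reflexive (sym (+-suc q i))) (≤-trans (emb-length e) (≤-reflexive (+-suc j p))))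

    right : ∀ {p q i j j′} → j ≤ j′ → Emb p q i j → Emb p q i j′
    right l (end m)   = end (≤-trans m l)
    right l (miss e)   = miss (right l e)
    right l (hit x e) = hit x (right l e)

    left : ∀ {p q i j} k → Emb p q (k + i) j → Emb p q i j
    left zero    e = e
    left {p} {q} {i} {j} (suc k) e = miss (left k (subst (λ z → Emb p q z j) (sym (+-suc k i)) e))

    left≤ : ∀ {p q i i′ j} → i′ ≤ i → Emb p q i j → Emb p q i′ j
    left≤ {p} {q} {i} {i′} {j} l e = left (i ∸ i′) (subst (λ z → Emb p q z j) (sym (m∸n+n≡m l)) e)

    -- Embeddings are built from the left, while the matching automaton extends them at the right;
    -- `snoc`, `init` and `unsnoc` mediate.
    snoc : ∀ {p q i j} → Emb p q i j → P q ≡ T j → Emb p (suc q) i (suc j)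
    snoc (end l)   x = left≤ l (hit x (end ≤-refl))
    snoc (miss e)   x = miss (snoc e x)
    snoc (hit y e) x = hit y (snoc e x)

    init : ∀ {p q i j} → p ≤ q → Emb p (suc q) i j → Emb p q i j
    init l (end m)   = contradiction l (<⇒≱ ≤-refl)
    init l (miss e)   = miss (init l e)
    init {p} {q} l (hit x e) with p ≟ q
    ... | yes refl = end (<⇒≤ (emb-i≤j e))
    ... | no ne = hit x (init (≤∧≢⇒< l ne) e)

    unsnoc : ∀ {p q i j} → p ≤ q → Emb p (suc q) i (suc j) → Emb p (suc q) i j ⊎ (P q ≡ T j × Emb p q i j)
    unsnoc l (end m) = contradiction l (<⇒≱ ≤-refl)
    unsnoc l (miss e) with unsnoc l e
    ... | inj₁ f = inj₁ (miss f)
    ... | inj₂ (x , f) = inj₂ (x , miss f)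
    unsnoc {p} {q} {i} {j} l (hit x e) with p ≟ q
    ... | no ne with unsnoc (≤∧≢⇒< l ne) e
    ... | inj₁ f = inj₁ (hit x f)
    ... | inj₂ (y , f) = inj₂ (y , hit x f)
    unsnoc {p} {q} {i} {j} l (hit x e) | yes refl with i ≟ j
    ... | yes refl = inj₂ (x , end ≤-refl)
    ... | no ne = inj₁ (hit x (end (≤∧≢⇒< (s≤s⁻¹ (emb-i≤j e)) ne)))

    -- One more than the last i such that P[0..q) is a subsequence of T[i..j); 0 if there is none.
    latest : ℕ → ℕ → ℕ
    latest zero    j       = suc j
    latest (suc q) zero    = 0
    latest (suc q) (suc j) = if P q ≡ᵇ T j then latest q j else latest (suc q) j

    latest-sound : ∀ q j {i} → i < latest q j → Emb 0 q i j
    latest-sound zero    j       l = end (s≤s⁻¹ l)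
    latest-sound (suc q) (suc j) l with P q ≡ᵇ T j in eq
    ... | true  = snoc (latest-sound q j l) (≡ᵇ⇒≡ _ _ (subst Data.Bool.Base.T (sym eq) tt))
    ... | false = right (n≤1+n j) (latest-sound (suc q) j l)

    -- Matching the last character of P as late as possible loses no start: an embedding that avoids
    -- a matching T j can give up its last hit and use T j instead.
    latest-complete : ∀ q j {i} → Emb 0 q i j → i < latest q j
    latest-complete zero    j e = s≤s (emb-i≤j e)
    latest-complete (suc q) zero e = contradiction e (none z≤n)
      where
      none : ∀ {p q i} → p ≤ q → ¬ Emb p (suc q) i 0
      none l (end _) = contradiction l (<⇒≱ ≤-refl)
      none l (miss e) = contradiction (emb-i≤j e) λ ()
      none l (hit _ e) = contradiction (emb-i≤j e) λ ()
    latest-complete (suc q) (suc j) e with P q ≡ᵇ T j in eq | unsnoc z≤n e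
    ... | true  | inj₁ f = latest-complete q j (init z≤n f)
    ... | true  | inj₂ (_ , f) = latest-complete q j f
    ... | false | inj₁ f = latest-complete (suc q) j f
    ... | false | inj₂ (x , _) = contradiction (≡⇒≡ᵇ _ _ x) (subst (λ b → ¬ Data.Bool.Base.T b) (sym eq) (λ ()))

    private
      below : ∀ {a b} → (∀ {i} → i < a → i < b) → a ≤ b
      below {zero}  f = z≤n
      below {suc a} f = f ≤-refl

    latest-suc : ∀ q j → latest (suc q) j ≤ latest q j
    latest-suc q j = below (λ l → latest-complete q j (init z≤n (latest-sound (suc q) j l)))

    latest-mono : ∀ q {j j′} → j ≤ j′ → latest q j ≤ latest q j′
    latest-mono q {j} {j′} l = below (λ k → latest-complete q j′ (right l (latest-sound q j k)))

    latest-≤ : ∀ q j → latest q j ≤ suc j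
    latest-≤ q j = below (λ l → s≤s (emb-i≤j (latest-sound q j l)))

    -- `arrives q j`: j is the end of a minimal window for P[0..q);
    -- `waits q j`: a greedy matching has matched exactly q characters after reading j of them.
    previous : ℕ → ℕ → ℕ
    previous q zero    = 0
    previous q (suc j) = latest q j

    arrives waits stays : ℕ → ℕ → Bool
    arrives q j = previous q j <ᵇ latest q j
    waits   q j = latest (suc q) j <ᵇ latest q j
    stays q zero    = false
    stays q (suc j) = waits q j ∧ not (P q ≡ᵇ T j)

    private
      <ᵇ-irrefl : ∀ x → (x <ᵇ x) ≡ false
      <ᵇ-irrefl zero    = refl
      <ᵇ-irrefl (suc x) = <ᵇ-irrefl x

      <ᵇ-true : ∀ {x y} → x < y → (x <ᵇ y) ≡ true
      <ᵇ-true {zero}  {suc y} l = refl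
      <ᵇ-true {suc x} {suc y} l = <ᵇ-true (s≤s⁻¹ l)

      <ᵇ-false : ∀ {x y} → y ≤ x → (x <ᵇ y) ≡ false
      <ᵇ-false {x}     {zero}  l = refl
      <ᵇ-false {suc x} {suc y} l = <ᵇ-false (s≤s⁻¹ l)

      <ᵇ-split : ∀ {a b c} → a ≤ b → b ≤ c → (a <ᵇ c) ≡ (b <ᵇ c) ∨ (a <ᵇ b)
      <ᵇ-split {a} {b} {c} ab bc with b <? c
      ... | yes l rewrite <ᵇ-true l = <ᵇ-true (≤-<-trans ab l)
      ... | no nl rewrite <ᵇ-false {b} {c} (≮⇒≥ nl) = cong (a <ᵇ_) (≤-antisym (≮⇒≥ nl) bc)

      ∨-false : ∀ b → b ≡ b ∨ false
      ∨-false true  = refl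
      ∨-false false = refl

    -- The numbers `latest (suc q) (suc j)`, `latest q j`, `latest q (suc j)` are nondecreasing. A
    -- gap between the outer ones lies in the upper half, which is an arrival, or in the lower half,
    -- which is the gap that makes q wait at j if T j does not match, and closed if it does.
    waits-split : ∀ q j → waits q j ≡ arrives q j ∨ stays q j
    waits-split q zero = ∨-false _
    waits-split q (suc j) with P q ≡ᵇ T j
    ... | true  = trans (∨-false _) (cong (arrives q (suc j) ∨_) (sym (∧-false (waits q j))))
      where
      ∧-false : ∀ b → b ∧ false ≡ false
      ∧-false true = refl
      ∧-false false = refl
    ... | false = trans (<ᵇ-split (latest-suc q j) (latest-mono q (n≤1+n j))) (cong (arrives q (suc j) ∨_) (sym (∧-true (waits q j))))
      where
      ∧-true : ∀ b → b ∧ true ≡ b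
      ∧-true true = refl
      ∧-true false = refl

    -- With `waits-split`, the transition rule of a nondeterministic automaton whose active states
    -- are the lengths q that wait.
    arrives-suc : ∀ q j → arrives (suc q) (suc j) ≡ waits q j ∧ (P q ≡ᵇ T j)
    arrives-suc q j with P q ≡ᵇ T j
    ... | true  = ∧-true (waits q j)
      where
      ∧-true : ∀ b → b ≡ b ∧ true
      ∧-true true = refl
      ∧-true false = refl
    ... | false = trans (<ᵇ-irrefl (latest (suc q) j)) (sym (∧-false (waits q j)))
      where
      ∧-false : ∀ b → b ∧ false ≡ false
      ∧-false true = refl
      ∧-false false = refl

    arrives-start : ∀ j → arrives 0 j ≡ true
    arrives-start zero    = refl
    arrives-start (suc j) = <ᵇ-true (n<1+n (suc j))

  open Embedding using (Emb; end; miss; hit)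

  -- A `hit` at the front becomes a `snoc` at the end of the reversal.
  reverse-emb : ∀ {P T P′ T′ : ℕ → ℕ} {r n} →
    (∀ x → x < r → P′ (r ∸ suc x) ≡ P x) → (∀ x → x < n → T′ (n ∸ suc x) ≡ T x) →
    ∀ {p q i j} → q ≤ r → j ≤ n → Emb P T p q i j → Emb P′ T′ (r ∸ q) (r ∸ p) (n ∸ j) (n ∸ i)
  reverse-emb {n = n} hP hT q≤r j≤n (end l) = end (∸-monoʳ-≤ n l)
  reverse-emb {P} {T} {P′} {T′} {r} {n} hP hT {i = i} q≤r j≤n (miss e) =
    Embedding.right P′ T′ (∸-monoʳ-≤ n (n≤1+n i)) (reverse-emb {P} {T} hP hT q≤r j≤n e)
  reverse-emb {P} {T} {P′} {T′} {r} {n} hP hT {p} {q} {i} {j} q≤r j≤n (hit x e) =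
    subst₂ (λ a b → Emb P′ T′ (r ∸ q) a (n ∸ j) b) (shift p<r) (shift i<n)
      (Embedding.snoc P′ T′ (reverse-emb {P} {T} hP hT q≤r j≤n e)
        (trans (hP p p<r) (trans x (sym (hT i i<n)))))
    where
    p<r = ≤-trans (Embedding.emb-p≤q P T e) q≤r
    i<n = ≤-trans (Embedding.emb-i≤j P T e) j≤n
    shift : ∀ {x m} → x < m → suc (m ∸ suc x) ≡ m ∸ x
    shift {x} {m} l = sym (+-∸-assoc 1 l)

  -- T′ and P′ are the reversals of T[0..n) and P[0..r).
  module Reversal (P T P′ T′ : ℕ → ℕ) (r n : ℕ)
    (hP : ∀ x → x < r → P′ (r ∸ suc x) ≡ P x) (hT : ∀ x → x < n → T′ (n ∸ suc x) ≡ T x) where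

    private
      module E = Embedding P T
      module E′ = Embedding P′ T′

      flip : ∀ {F F′ : ℕ → ℕ} {m} → (∀ x → x < m → F′ (m ∸ suc x) ≡ F x) → ∀ x → x < m → F (m ∸ suc x) ≡ F′ x
      flip {F} {F′} {m} h x l = trans (sym (h (m ∸ suc x) lt)) (cong F′ eq)
        where
        lt : m ∸ suc x < m
        lt = ∸-monoʳ-< {m} {suc x} {0} (s≤s z≤n) l
        eq : m ∸ suc (m ∸ suc x) ≡ x
        eq = trans (cong (m ∸_) (sym (+-∸-assoc 1 l))) (m∸[m∸n]≡n (<⇒≤ l))

    emb-reverse : ∀ {i j} → j ≤ n → Emb P T 0 r i j → Emb P′ T′ 0 r (n ∸ j) (n ∸ i)
    emb-reverse {i} {j} j≤n e =
      subst (λ z → Emb P′ T′ z r (n ∸ j) (n ∸ i)) (n∸n≡0 r) (reverse-emb hP hT ≤-refl j≤n e)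

    emb-unreverse : ∀ {i j} → i ≤ n → j ≤ n → Emb P′ T′ 0 r (n ∸ j) (n ∸ i) → Emb P T 0 r i j
    emb-unreverse {i} {j} i≤n j≤n e =
      subst (λ z → Emb P T z r i j) (n∸n≡0 r)
        (subst₂ (Emb P T (r ∸ r) r) (m∸[m∸n]≡n i≤n) (m∸[m∸n]≡n j≤n)
          (reverse-emb (flip hP) (flip hT) ≤-refl (m∸n≤m n i) e))

    private
      positive : ∀ {x y} → (x <ᵇ y) ≡ true → x < y
      positive {x} {y} e = <ᵇ⇒< x y (subst Data.Bool.Base.T (sym e) tt)

      isTrue : ∀ {x y} → x < y → (x <ᵇ y) ≡ true
      isTrue {zero}  {suc y} l = refl
      isTrue {suc x} {suc y} l = isTrue (s≤s⁻¹ l)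

    -- The value i + 1 excludes windows within the first j characters that start after i. Read
    -- backwards, no window from n - j on ends before n - i, but one ends there, so `latest` of the
    -- reversal rises at n - i.
    latest⇒arrives : ∀ {i j} → j ≤ n → E.latest r j ≡ suc i → E′.arrives r (n ∸ i) ≡ true
    latest⇒arrives {i} {j} j≤n e = isTrue (≤-<-trans (before i<j refl) (E′.latest-complete r (n ∸ i) (emb-reverse j≤n emb)))
      where
      emb = E.latest-sound r j (≤-reflexive (sym e))
      i<j = E.emb-i≤j emb
      before : i ≤ j → ∀ {m} → n ∸ i ≡ m → E′.previous r m ≤ n ∸ j
      before i≤j {zero}  eq = z≤n
      before i≤j {suc m} eq = ≮⇒≥ λ l → <-irrefl refl (≤-trans (E.latest-complete r j
        (emb-unreverse i<n j≤n (subst (Emb P′ T′ 0 r (n ∸ j)) m≡ (E′.latest-sound r m l)))) (≤-reflexive e))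
        where
        i<n : suc i ≤ n
        i<n = m∸n≢0⇒n<m (λ z → contradiction (trans (sym eq) z) λ ())
        m≡ : m ≡ n ∸ suc i
        m≡ = suc-injective (trans (sym eq) (+-∸-assoc 1 i<n))

    arrives⇒latest : ∀ {i} → i ≤ n → E′.arrives r (n ∸ i) ≡ true → ∃[ j ] (j ≤ n × E.latest r j ≡ suc i)
    arrives⇒latest {i} i≤n a = j , m∸n≤m n k , ≤-antisym (≮⇒≥ upper) lower
      where
      -- Starts below k sufficed already before position n - i; k itself becomes possible exactly
      -- there, so its mirror image is the end that belongs to i.
      k = E′.previous r (n ∸ i)
      emb′ = E′.latest-sound r (n ∸ i) (positive a)
      k≤n : k ≤ n
      k≤n = ≤-trans (E′.emb-i≤j emb′) (m∸n≤m n i)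
      j = n ∸ k
      k≡ : n ∸ j ≡ k
      k≡ = m∸[m∸n]≡n k≤n
      lower : i < E.latest r j
      lower = E.latest-complete r j (emb-unreverse i≤n (m∸n≤m n k) (subst (λ z → Emb P′ T′ 0 r z (n ∸ i)) (sym k≡) emb′))
      upper : ¬ suc i < E.latest r j
      upper l = <-irrefl refl (subst (_< E′.latest r (n ∸ suc i)) k≡′
        (E′.latest-complete r (n ∸ suc i) (emb-reverse (m∸n≤m n k) emb)))
        where
        emb = E.latest-sound r j l
        k≡′ : n ∸ j ≡ E′.latest r (n ∸ suc i)
        k≡′ = trans k≡ (cong (E′.previous r) (+-∸-assoc 1 (≤-trans (E.emb-i≤j emb) (m∸n≤m n k))))

    -- A last start in the reversed text, read backwards. The value 0, by which `latest` says that
    -- there is no window, turns into n + 1.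
    earliest : ℕ → ℕ
    earliest i = suc n ∸ E′.latest r (n ∸ i)

    earliest-sound : ∀ {i j} → i ≤ n → j ≤ n → earliest i ≤ j → Emb P T 0 r i j
    earliest-sound {i} {j} i≤n j≤n l = emb-unreverse i≤n j≤n (E′.latest-sound r (n ∸ i)
      (≤-trans (≤-reflexive (sym (+-∸-assoc 1 j≤n))) (m≤n+o⇒m∸n≤o (suc n) j
        (≤-trans (m≤n+m∸n (suc n) (E′.latest r (n ∸ i)))
          (≤-trans (+-monoʳ-≤ (E′.latest r (n ∸ i)) l) (≤-reflexive (+-comm _ j)))))))

    earliest-complete : ∀ {i j} → j ≤ n → Emb P T 0 r i j → earliest i ≤ j
    earliest-complete {i} {j} j≤n e = m≤n+o⇒m∸n≤o (suc n) (E′.latest r (n ∸ i)) (begin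
      suc n                       ≡⟨ cong suc (sym (m∸n+n≡m j≤n)) ⟩
      suc (n ∸ j) + j             ≤⟨ +-monoˡ-≤ j (E′.latest-complete r (n ∸ i) (emb-reverse j≤n e)) ⟩
      E′.latest r (n ∸ i) + j     ∎)
      where open ≤-Reasoning

    earliest-≤ : ∀ {i} → earliest i ≤ suc n
    earliest-≤ {i} = m∸n≤m (suc n) (E′.latest r (n ∸ i))

    earliest-mono : ∀ {i i′} → i ≤ i′ → i′ ≤ n → earliest i ≤ earliest i′
    earliest-mono {i} {i′} l i′≤n with earliest i′ ≤? n
    ... | yes e≤n = earliest-complete e≤n (E.left≤ l (earliest-sound i′≤n e≤n ≤-refl))
    ... | no ne = ≤-trans (earliest-≤ {i}) (≰⇒> ne)

  module Mirror (P T : ℕ → ℕ) (r n : ℕ) where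

    Pʳ Tʳ : ℕ → ℕ
    Pʳ x = P (r ∸ suc x)
    Tʳ x = T (n ∸ suc x)

    mirror : ∀ {m x} → x < m → m ∸ suc (m ∸ suc x) ≡ x
    mirror {m} {x} l = trans (cong (m ∸_) (sym (+-∸-assoc 1 l))) (m∸[m∸n]≡n (<⇒≤ l))

    mirror< : ∀ {m x} → x < m → m ∸ suc x < m
    mirror< {m} {x} l = ∸-monoʳ-< {m} {suc x} {0} (s≤s z≤n) l

    open Reversal P T Pʳ Tʳ r n (λ x l → cong P (mirror l)) (λ x l → cong T (mirror l)) public
      using (earliest; earliest-sound; earliest-complete; earliest-≤; earliest-mono)

-- Candidates of the two tables and their lists in memory

module Candidate-systems where

  open import Data.Empty using (⊥)
  open import Data.List.Relation.Binary.Sublist.Propositional using (_⊆_; []; _∷_; _∷ʳ_; minimum)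
  open import Data.List.Relation.Binary.Sublist.Propositional.Properties using (length-mono-≤)
  open import Data.List.Properties using (length-drop; length-++)
  open Embeddings
  open Embedding using (Emb; end; miss; hit)

  drop-cons : ∀ (xs : List ℕ) i → i < length xs → drop i xs ≡ charAt xs i ∷ drop (suc i) xs
  drop-cons (x ∷ xs) zero    l = refl
  drop-cons (x ∷ xs) (suc i) l = drop-cons xs i (s≤s⁻¹ l)

  drop-nil : ∀ (xs : List ℕ) i → length xs ≤ i → drop i xs ≡ []
  drop-nil []       zero    l = refl
  drop-nil []       (suc i) l = refl
  drop-nil (x ∷ xs) (suc i) l = drop-nil xs i (s≤s⁻¹ l)

  drop-view : ∀ (xs : List ℕ) i {y ys} → drop i xs ≡ y ∷ ys → i < length xs × charAt xs i ≡ y × drop (suc i) xs ≡ ys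
  drop-view (x ∷ xs) zero    refl = s≤s z≤n , refl , refl
  drop-view (x ∷ xs) (suc i) e with drop-view xs i e
  ... | l , c , d = s≤s l , c , d
  drop-view []       zero    ()
  drop-view []       (suc i) ()

  skip-⊆ : ∀ {xs} {ys : List ℕ} i → xs ⊆ drop (suc i) ys → xs ⊆ drop i ys
  skip-⊆ {ys = ys} i s with i <? length ys
  ... | yes l = subst (_ ⊆_) (sym (drop-cons ys i l)) (charAt ys i ∷ʳ s)
  ... | no nl = subst (_ ⊆_) (trans (drop-nil ys (suc i) (m≤n⇒m≤1+n (≮⇒≥ nl))) (sym (drop-nil ys i (≮⇒≥ nl)))) s

  take-⊆ : ∀ {xs} {ys : List ℕ} i → i < length ys → xs ⊆ drop (suc i) ys → charAt ys i ∷ xs ⊆ drop i ys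
  take-⊆ {xs} {ys} i l s = subst (charAt ys i ∷ xs ⊆_) (sym (drop-cons ys i l)) (refl ∷ s)

  data Uncons (x : ℕ) (xs ys : List ℕ) (i : ℕ) : Set where
    skipped : x ∷ xs ⊆ drop (suc i) ys → Uncons x xs ys i
    taken   : charAt ys i ≡ x → xs ⊆ drop (suc i) ys → Uncons x xs ys i

  uncons-⊆ : ∀ {x xs ys} i → x ∷ xs ⊆ drop i ys → i < length ys × Uncons x xs ys i
  uncons-⊆ {x} {xs} {ys} i s with drop i ys in eq
  uncons-⊆ {x} {xs} {ys} i (y ∷ʳ s) | _ with drop-view ys i eq
  ... | l , c , d = l , skipped (subst (_ ⊆_) (sym d) s)
  uncons-⊆ {x} {xs} {ys} i (refl ∷ s) | _ with drop-view ys i eq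
  ... | l , c , d = l , taken c (subst (_ ⊆_) (sym d) s)

  drop-⊆ : ∀ {xs} {ys : List ℕ} {i j} → i ≤ j → xs ⊆ drop j ys → xs ⊆ drop i ys
  drop-⊆ {xs} {ys} {i} {j} l s = go (j ∸ i) (subst (λ z → xs ⊆ drop z ys) (sym (m∸n+n≡m l)) s)
    where
    go : ∀ k → xs ⊆ drop (k + i) ys → xs ⊆ drop i ys
    go zero    s = s
    go (suc k) s = go k (skip-⊆ (k + i) s)

  ⊆-length : ∀ {xs ys : List ℕ} i → xs ⊆ drop i ys → i ≤ length ys → length xs + i ≤ length ys
  ⊆-length {xs} {ys} i s l = ≤-trans (+-monoˡ-≤ i (≤-trans (length-mono-≤ s) (≤-reflexive (length-drop i ys))))
    (≤-reflexive (m∸n+n≡m l))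

  module _ (P T : List ℕ) where

    emb-⊆ : ∀ {p i j Y} → Emb (charAt P) (charAt T) p (length P) i j → p ≤ length P → j ≤ length T → Y ⊆ drop j T →
            drop p P ++ Y ⊆ drop i T
    emb-⊆ {Y = Y} (end l) p≤ j≤ s = subst (λ z → z ++ Y ⊆ _) (sym (drop-nil P (length P) ≤-refl)) (drop-⊆ l s)
    emb-⊆ {i = i} (miss e) p≤ j≤ s = skip-⊆ i (emb-⊆ e p≤ j≤ s)
    emb-⊆ {p} {i} {j} {Y} (hit x e) p≤ j≤ s =
      subst (λ z → z ++ Y ⊆ drop i T) (sym (drop-cons P p p<))
        (subst (λ c → c ∷ drop (suc p) P ++ Y ⊆ drop i T) (sym x) (take-⊆ i i< (emb-⊆ e p< j≤ s)))
      where
      p< = Embedding.emb-p≤q (charAt P) (charAt T) e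
      i< = ≤-trans (Embedding.emb-i≤j (charAt P) (charAt T) e) j≤

    -- The part of the sublist that spells P ends at some j, and the rest lies behind it. `m` counts
    -- what is left of P, and the counter of `go` what is left of T.
    ⊆-emb : ∀ m {p i Y} → p + m ≡ length P → i ≤ length T → drop p P ++ Y ⊆ drop i T →
            ∃[ j ] (Emb (charAt P) (charAt T) p (length P) i j × j ≤ length T × Y ⊆ drop j T)
    ⊆-emb zero {p} {i} {Y} e i≤ s =
      i , subst (λ q → Emb (charAt P) (charAt T) p q i i) p≡ (end ≤-refl) , i≤ ,
      subst (λ z → z ++ Y ⊆ drop i T) (drop-nil P p (≤-reflexive (sym p≡))) s
      where
      p≡ : p ≡ length P
      p≡ = trans (sym (+-identityʳ p)) e
    ⊆-emb (suc m) {p} {i} {Y} e i≤ s = go (length T) (≤-trans (m≤n+m _ i) (≤-reflexive (+-comm i _))) i≤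
        (subst (λ z → z ++ Y ⊆ drop i T) (drop-cons P p p<) s)
      where
      p< : p < length P
      p< = ≤-trans (s≤s (m≤m+n p m)) (≤-reflexive (trans (sym (+-suc p m)) e))
      go : ∀ k {i} → length T ≤ k + i → i ≤ length T → charAt P p ∷ drop (suc p) P ++ Y ⊆ drop i T →
           ∃[ j ] (Emb (charAt P) (charAt T) p (length P) i j × j ≤ length T × Y ⊆ drop j T)
      go k {i} l i≤ s with uncons-⊆ i s
      ... | i< , taken x s′ with ⊆-emb m (trans (sym (+-suc p m)) e) i< s′
      ... | j , e′ , j≤ , s″ = j , hit (sym x) e′ , j≤ , s″
      go zero    {i} l i≤ s | i< , skipped s′ = contradiction i< (≤⇒≯ l)
      go (suc k) {i} l i≤ s | i< , skipped s′ with go k (≤-trans l (≤-reflexive (sym (+-suc k i)))) i< s′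
      ... | j , e′ , j≤ , s″ = j , miss e′ , j≤ , s″

  -- What the loop for one row has to know about candidates, so that F and G can share it. `size`
  -- leaves out P, whose length is `len`; thus a jump from G to F copies the value unchanged. `Jump`
  -- collects the candidates that begin with P.
  record System (a b : ℕ → ℕ) (n i : ℕ) : Set₁ where
    field
      D      : Set
      size   : D → ℕ
      cons   : ℕ → D → D
      len    : ℕ
      Cand   : ℕ → ℕ → D → Set
      Jump   : ℕ → D → Set
      Den    : (ℕ → ℕ) → (ℕ → ℕ) → ℕ → ℕ → D → Set
      size-cons : ∀ c d → size (cons c d) ≡ suc (size d)
      skipA  : ∀ {j d} → Cand (suc i) j d → Cand i j d
      skipB  : ∀ {j d} → Cand i (suc j) d → Cand i j d
      match  : ∀ {j d} → a i ≡ b j → Cand (suc i) (suc j) d → Cand i j (cons (a i) d)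
      cases  : ∀ {j d} → Cand i j d → Cand (suc i) j d ⊎ Cand i (suc j) d ⊎
               (a i ≡ b j × ∃[ d′ ] (size d ≡ suc (size d′) × Cand (suc i) (suc j) d′)) ⊎ Jump j d
      boundA : ∀ {j d} → Cand i j d → size d + len + i ≤ n
      boundB : ∀ {j d} → Cand i j d → size d + len + j ≤ n
      den-mono : ∀ {nc np nc′ np′ h h′ p d} → h ≤ h′ → (∀ q → q < h → nc′ q ≡ nc q) → (∀ q → q < h → np′ q ≡ np q) →
                 Den nc np h p d → Den nc′ np′ h′ p d
      den-cons : ∀ {nc np h p q c d} → 0 < p → p < h → nc p ≡ suc c → np p ≡ q → Den nc np h q d →
                 Den nc np h p (cons c d)

  -- Linked lists in the heap; node 0 is the empty list.
  data DenF (nc np : ℕ → ℕ) (h : ℕ) : ℕ → List ℕ → Set where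
    nil : DenF nc np h 0 []
    add : ∀ {p q c Y} → 0 < p → p < h → nc p ≡ suc c → np p ≡ q → DenF nc np h q Y → DenF nc np h p (c ∷ Y)

  -- The node with content 0 marks the place of P.
  data DenG (nc np : ℕ → ℕ) (h : ℕ) : ℕ → List ℕ × List ℕ → Set where
    mark : ∀ {p q Y} → 0 < p → p < h → nc p ≡ 0 → np p ≡ q → DenF nc np h q Y → DenG nc np h p ([] , Y)
    add  : ∀ {p q c X Y} → 0 < p → p < h → nc p ≡ suc c → np p ≡ q → DenG nc np h q (X , Y) → DenG nc np h p (c ∷ X , Y)

  denF-mono : ∀ {nc np nc′ np′ h h′ p d} → h ≤ h′ → (∀ q → q < h → nc′ q ≡ nc q) → (∀ q → q < h → np′ q ≡ np q) →
              DenF nc np h p d → DenF nc′ np′ h′ p d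
  denF-mono l e f nil = nil
  denF-mono l e f (add z p< x y d) = add z (<-≤-trans p< l) (trans (e _ p<) x) (trans (f _ p<) y) (denF-mono l e f d)

  denG-mono : ∀ {nc np nc′ np′ h h′ p d} → h ≤ h′ → (∀ q → q < h → nc′ q ≡ nc q) → (∀ q → q < h → np′ q ≡ np q) →
              DenG nc np h p d → DenG nc′ np′ h′ p d
  denG-mono l e f (mark z p< x y d) = mark z (<-≤-trans p< l) (trans (e _ p<) x) (trans (f _ p<) y) (denF-mono l e f d)
  denG-mono l e f (add z p< x y d) = add z (<-≤-trans p< l) (trans (e _ p<) x) (trans (f _ p<) y) (denG-mono l e f d)

  module Candidates (A B P : List ℕ) (n : ℕ) (lenA : length A ≡ n) (lenB : length B ≡ n) where

    CandF : ℕ → ℕ → List ℕ → Set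
    CandF i j Y = (i ≤ n × Y ⊆ drop i A) × (j ≤ n × Y ⊆ drop j B)

    CandG : ℕ → ℕ → List ℕ × List ℕ → Set
    CandG i j (X , Y) = CandF i j (X ++ P ++ Y)

    private
      a = charAt A
      b = charAt B

      <A : ∀ {i} → i < n → i < length A
      <A l = <-≤-trans l (≤-reflexive (sym lenA))
      <B : ∀ {i} → i < n → i < length B
      <B l = <-≤-trans l (≤-reflexive (sym lenB))
      A< : ∀ {i} → i < length A → i < n
      A< l = <-≤-trans l (≤-reflexive lenA)
      B< : ∀ {i} → i < length B → i < n
      B< l = <-≤-trans l (≤-reflexive lenB)

    f-skipA : ∀ {i j Y} → CandF (suc i) j Y → CandF i j Y
    f-skipA {i} ((l , s) , q) = (<⇒≤ l , skip-⊆ i s) , q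

    f-skipB : ∀ {i j Y} → CandF i (suc j) Y → CandF i j Y
    f-skipB {j = j} (q , l , s) = q , <⇒≤ l , skip-⊆ j s

    f-match : ∀ {i j Y} → a i ≡ b j → CandF (suc i) (suc j) Y → CandF i j (a i ∷ Y)
    f-match {i} {j} e ((l , s) , l′ , s′) =
      (<⇒≤ l , take-⊆ i (<A l) s) , <⇒≤ l′ , subst (λ c → c ∷ _ ⊆ drop j B) (sym e) (take-⊆ j (<B l′) s′)

    f-boundA : ∀ {i j Y} → CandF i j Y → length Y + i ≤ n
    f-boundA {i} ((l , s) , _) = subst (_ ≤_) lenA (⊆-length i s (subst (i ≤_) (sym lenA) l))

    f-boundB : ∀ {i j Y} → CandF i j Y → length Y + j ≤ n
    f-boundB {j = j} (_ , l , s) = subst (_ ≤_) lenB (⊆-length j s (subst (j ≤_) (sym lenB) l))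

    -- If one text passes over its character, the other side can stay as it is. Otherwise both texts
    -- use theirs for c, so they agree.
    f-cases : ∀ {i j c Y} → CandF i j (c ∷ Y) → CandF (suc i) j (c ∷ Y) ⊎ CandF i (suc j) (c ∷ Y) ⊎
              (a i ≡ b j × CandF (suc i) (suc j) Y)
    f-cases {i} {j} ((l , s) , l′ , s′) with uncons-⊆ i s | uncons-⊆ j s′
    ... | i< , skipped t | _ = inj₁ ((A< i< , t) , l′ , s′)
    ... | i< , taken e t | j< , skipped t′ = inj₂ (inj₁ ((l , s) , B< j< , t′))
    ... | i< , taken e t | j< , taken e′ t′ = inj₂ (inj₂ (trans e (sym e′) , (A< i< , t) , B< j< , t′))

    systemF : ∀ {i} → i < n → System a b n i
    systemF {i} i<n = record
      { D = List ℕ ; size = length ; cons = _∷_ ; len = 0 ; Cand = CandF ; Jump = λ _ _ → ⊥ ; Den = DenF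
      ; size-cons = λ _ _ → refl ; skipA = f-skipA ; skipB = f-skipB ; match = f-match
      ; cases = cs
      ; boundA = λ {_} {Y} c → subst (λ z → z + i ≤ n) (sym (+-identityʳ _)) (f-boundA c)
      ; boundB = λ {j} {Y} c → subst (λ z → z + j ≤ n) (sym (+-identityʳ _)) (f-boundB c)
      ; den-mono = denF-mono ; den-cons = add }
      where
      cs : ∀ {j Y} → CandF i j Y → CandF (suc i) j Y ⊎ CandF i (suc j) Y ⊎
           (a i ≡ b j × ∃[ Y′ ] (length Y ≡ suc (length Y′) × CandF (suc i) (suc j) Y′)) ⊎ ⊥
      -- The empty candidate has no first character to discuss; it moves on to the next row, which
      -- exists because i < n.
      cs {Y = []} (_ , q) = inj₁ ((i<n , minimum _) , q)
      cs {Y = c ∷ Y} x with f-cases x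
      ... | inj₁ y = inj₁ y
      ... | inj₂ (inj₁ y) = inj₂ (inj₁ y)
      ... | inj₂ (inj₂ (e , y)) = inj₂ (inj₂ (inj₁ (e , Y , refl , y)))

    lengthG : ∀ X Y → length (X ++ P ++ Y) ≡ length X + length Y + length P
    lengthG X Y = trans (length-++ X) (trans (cong (length X +_) (trans (length-++ P) (+-comm (length P) _)))
                    (sym (+-assoc (length X) (length Y) (length P))))

    JumpG : ℕ → ℕ → List ℕ × List ℕ → Set
    JumpG i j (X , Y) = X ≡ [] × CandF i j (P ++ Y)

    systemG : ∀ {i} → System a b n i
    systemG {i} = record
      { D = List ℕ × List ℕ ; size = λ (X , Y) → length X + length Y ; cons = λ c (X , Y) → c ∷ X , Y ; len = length P
      ; Cand = CandG ; Jump = JumpG i ; Den = DenG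
      ; size-cons = λ _ _ → refl ; skipA = f-skipA ; skipB = f-skipB ; match = f-match
      ; cases = λ { {d = [] , Y} c → inj₂ (inj₂ (inj₂ (refl , c)))
                  ; {d = c ∷ X , Y} x → cs x }
      ; boundA = λ { {d = X , Y} c → subst (λ z → z + i ≤ n) (lengthG X Y) (f-boundA c) }
      ; boundB = λ { {j} {d = X , Y} c → subst (λ z → z + j ≤ n) (lengthG X Y) (f-boundB c) }
      ; den-mono = denG-mono ; den-cons = add }
      where
      cs : ∀ {j c X Y} → CandG i j (c ∷ X , Y) → CandG (suc i) j (c ∷ X , Y) ⊎ CandG i (suc j) (c ∷ X , Y) ⊎
           (a i ≡ b j × ∃[ d′ ] (suc (length X + length Y) ≡ suc (length (proj₁ d′) + length (proj₂ d′)) × CandG (suc i) (suc j) d′))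
           ⊎ JumpG i j (c ∷ X , Y)
      cs {X = X} {Y} x with f-cases x
      ... | inj₁ y = inj₁ y
      ... | inj₂ (inj₁ y) = inj₂ (inj₁ y)
      ... | inj₂ (inj₂ (e , y)) = inj₂ (inj₂ (inj₁ (e , (X , Y) , refl , y)))

-- The commands of the program

module Code where

  open Language

  n r flag i p b B x hi L best key t M mt dn u z c j tb pb eo lo st ln top S po hit cur fl K hp fi gi e ri off jmp floor m mn dg dgn nd fw bw : ℕ
  n = 0
  r = 1
  flag = 2
  i = 3
  p = 4
  b = 5
  B = 6
  x = 7
  hi = 8
  L = 9
  best = 10
  key = 11
  t = 12
  M = 13
  mt = 14
  dn = 15
  u = 16
  z = 17
  c = 18
  j = 19
  tb = 20
  pb = 21
  eo = 22
  lo = 23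
  st = 24
  ln = 25
  top = 26
  S = 27
  po = 28
  hit = 29
  cur = 30
  fl = 31
  K = 32
  hp = 33
  fi = 34
  gi = 35
  e = 36
  ri = 37
  off = 38
  jmp = 39
  floor = 40
  m = 41
  mn = 42
  dg = 43
  dgn = 44
  nd = 45
  fw = 46
  bw = 47

  BM D NM MK E EW V VN NC NP AN : ℕ
  BM = 0
  D = 1
  NM = 2
  MK = 3
  E = 4
  EW = 5
  V = 6
  VN = 7
  NC = 8
  NP = 9
  AN = 10

  increment : ℕ → Cmd
  increment y = y := # 1 ⊕ v y

  greedyBody : Tape → Cmd
  greedyBody τ = cond (rd τ (v i) ≐ rd tapeP (v p)) (increment p) skip ⨾ increment i

  greedy : Tape → Cmd
  greedy τ = (i := # 0 ⨾ p := # 0) ⨾ while ((v p ⋖ v r) && (v i ⋖ v n)) (greedyBody τ)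

  blockBody : Cmd
  blockBody = B := v B ⊕ v B ⨾ increment b

  -- Doubling until B ^ 2 exceeds r makes B = 2 ^ b about the square root of r, so a table for pairs
  -- of blocks has O(r) entries.
  blockSize : Cmd
  blockSize = (b := # 0 ⨾ B := # 1) ⨾ while (v B ⊛ v B ⋖ # 1 ⊕ v r) blockBody

  -- The entry of x and `hi` follows from the entry of their halves, which has a smaller index in
  -- the table.
  conjBody : Cmd
  conjBody =
    x := v z ⊘ v B ⨾ hi := v z ⊖ v x ⊛ v B ⨾
    AN [ v z ]:= (v x ⊖ # 2 ⊛ (v x ⊘ # 2)) ⊛ (v hi ⊖ # 2 ⊛ (v hi ⊘ # 2)) ⊕
                 # 2 ⊛ ld AN ((v x ⊘ # 2) ⊛ v B ⊕ v hi ⊘ # 2) ⨾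
    increment z

  conjTable : Cmd
  conjTable = z := # 0 ⨾ while (v z ⋖ v B ⊛ v B) conjBody

  -- The key of position x of P; keys are positive and distinct, and ordered by character first.
  keyOf : Exp → Exp
  keyOf y = rd tapeP y ⊛ v r ⊕ (# 1 ⊕ y)

  scanBody : Cmd
  scanBody =
    key := keyOf (v x) ⨾
    cond (v L ⋖ v key)
      (cond (v best ≐ # 0) (best := v key) (cond (v key ⋖ v best) (best := v key) skip)) skip ⨾
    increment x

  scan : Cmd
  scan = (x := v t ⊛ v b ⨾ hi := v x ⊕ v b ⨾ best := # 0) ⨾ while ((v x ⋖ v hi) && (v x ⋖ v r)) scanBody

  minimaBody : Cmd
  minimaBody = scan ⨾ (BM [ v t ]:= v best ⨾ increment t)

  minima : Cmd
  minima = t := # 0 ⨾ while (v t ⊛ v b ⋖ v r) minimaBody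

  findBody : Cmd
  findBody =
    best := ld BM (v t) ⨾
    cond (# 0 ⋖ v best)
      (cond (v M ≐ # 0) (M := v best ⨾ mt := v t) (cond (v best ⋖ v M) (M := v best ⨾ mt := v t) skip)) skip ⨾
    increment t

  find : Cmd
  find = (M := # 0 ⨾ mt := # 0 ⨾ t := # 0) ⨾ while (v t ⊛ v b ⋖ v r) findBody

  -- Selection sort with one stored minimum per block: extracting a key means rescanning its block
  -- and comparing the minima, O(b + r / b) steps.
  sortBody : Cmd
  sortBody =
    (D [ v dn ]:= v M ⨾ increment dn ⨾ L := v M ⨾ t := v mt) ⨾ scan ⨾ BM [ v t ]:= v best ⨾ find

  sort : Cmd
  sort = L := # 0 ⨾ minima ⨾ dn := # 0 ⨾ find ⨾ while (# 0 ⋖ v M) sortBody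

  -- Strides of length b and then single steps give O(r / b + b) comparisons. The keys of c lie
  -- between c · r + 1 and c · r + r, so the last comparison tells whether c occurs in P.
  search : Cmd
  search =
    (key := v c ⊛ v r ⨾ u := # 0) ⨾
    (while ((v u ⊕ v b ⋖ v dn) && (ld D (v u ⊕ v b) ⋖ # 1 ⊕ v key)) (u := v u ⊕ v b) ⨾
     while ((v u ⋖ v dn) && (ld D (v u) ⋖ # 1 ⊕ v key)) (increment u)) ⨾
    cond ((v u ⋖ v dn) && (ld D (v u) ⋖ # 1 ⊕ (v key ⊕ v r))) skip (u := v r)

  -- The names of the characters are stored forwards from tb and backwards from pb.
  nameBody : Tape → Cmd
  nameBody τ =
    c := rd τ (v j) ⨾ search ⨾
    (NM [ v tb ⊕ v j ]:= v u ⨾ NM [ v pb ⊕ (v ln ⊖ (# 1 ⊕ v j)) ]:= v u ⨾ increment j)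

  name : Tape → Cmd
  name τ = j := # 0 ⨾ while (v j ⋖ v ln) (nameBody τ)

  names : Cmd
  names =
    (ln := v n ⨾ tb := # 0 ⨾ pb := v n) ⨾ name tapeA ⨾
    (tb := # 2 ⊛ v n ⨾ pb := # 3 ⊛ v n) ⨾ name tapeB ⨾
    (ln := v r ⨾ tb := # 4 ⊛ v n ⨾ pb := # 5 ⊛ v n) ⨾ name tapeP

  fillBody : Cmd
  fillBody = E [ v eo ⊕ v j ]:= # 1 ⨾ increment j

  maskBody : Cmd
  maskBody =
    MK [ ld NM (v pb ⊕ (v st ⊕ v x)) ]:= ld MK (ld NM (v pb ⊕ (v st ⊕ v x))) ⊕ v hi ⨾
    top := v hi ⨾ hi := v hi ⊕ v hi ⨾ increment x

  -- Array `E` is reused in place: cell j passes from the arrivals at the beginning of the block to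
  -- those at its end. A match at j leaves the block at j + 1, so its bit waits in `po` until that
  -- cell has been read.
  arrive match leave moveOn stepBody : Cmd
  arrive = cond (ld E (v eo ⊕ v j)) (S := # 1 ⊕ # 2 ⊛ (v S ⊘ # 2)) skip
  match  = E [ v eo ⊕ v j ]:= v po ⨾ hit := ld AN (v S ⊛ v B ⊕ ld MK (ld NM (v tb ⊕ v j))) ⨾ S := v S ⊖ v hit
  leave  = cond (v hit ⋖ v top) (po := # 0) (po := # 1 ⨾ hit := v hit ⊖ v top)
  moveOn = hit := v hit ⊕ v hit ⨾ S := (v S ⊕ v hit) ⊖ ld AN (v S ⊛ v B ⊕ v hit) ⨾ increment j
  stepBody = arrive ⨾ match ⨾ leave ⨾ moveOn

  clearBody : Cmd
  clearBody = MK [ ld NM (v pb ⊕ (v st ⊕ v x)) ]:= # 0 ⨾ increment x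

  runBody : Cmd
  runBody =
    (ln := v r ⊖ v st ⨾ cond (v b ⋖ v ln) (ln := v b) skip ⨾ x := # 0 ⨾ hi := # 1) ⨾
    while (v x ⋖ v ln) maskBody ⨾
    (S := # 0 ⨾ po := # 0 ⨾ j := # 0) ⨾
    while (v j ⋖ v n) stepBody ⨾
    (E [ v eo ⊕ v j ]:= v po ⨾ x := # 0) ⨾
    while (v x ⋖ v ln) clearBody ⨾
    st := v st ⊕ v ln

  run : Cmd
  run = j := # 0 ⨾ while (v j ⋖ # 1 ⊕ v n) fillBody ⨾ st := # 0 ⨾ while (v st ⋖ v r) runBody

  -- Both `j` and `cur` refer to the reversed text. The part of `E` from n + 1 on belongs to the
  -- text itself and is therefore read backwards.
  pairBody : Cmd
  pairBody =
    cond ((ld E (v j) ≐ # 0))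
      (EW [ v lo ⊕ (v n ⊖ v j) ]:= # 1 ⊕ v n ⊖ v cur ⨾ increment j)
      (cond (v fl ≐ # 0)
        (increment cur ⨾ cond (ld E (# 1 ⊕ v n ⊕ (# 1 ⊕ v n ⊖ v cur))) (fl := # 1) skip)
        (EW [ v lo ⊕ (v n ⊖ v j) ]:= # 1 ⊕ v n ⊖ v cur ⨾ increment j ⨾ fl := # 0))

  pair : Cmd
  pair = (j := # 0 ⨾ cur := # 0 ⨾ fl := # 0) ⨾ while (v j ⋖ # 1 ⊕ v n) pairBody

  windows : Cmd
  windows =
    (tb := v bw ⨾ pb := # 5 ⊛ v n ⨾ eo := # 0) ⨾ run ⨾
    (tb := v fw ⨾ pb := # 4 ⊛ v n ⨾ eo := # 1 ⊕ v n) ⨾ run ⨾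
    pair

  -- Columns run from right to left over the previous row. Before a cell is overwritten its value is
  -- saved in `dg`, for the match in the next column.
  rowStart rowLoad rowSkip rowMatch rowJump rowSave rowBody : Cmd
  rowStart =
    (j := v ri ⊕ v K ⨾ cond (v n ⋖ v j) (j := v n) skip ⨾ increment j) ⨾
    (x := v ri ⊖ v K ⨾ cond (v x ⋖ v floor) (x := v floor) skip) ⨾
    (cur := ld V (v off ⊕ v j) ⨾ nd := ld VN (v off ⊕ v j) ⨾ dg := v cur ⨾ dgn := v nd ⨾ c := rd tapeA (v ri))
  rowLoad = j := v j ⊖ # 1 ⨾ m := ld V (v off ⊕ v j) ⨾ mn := ld VN (v off ⊕ v j)
  rowSkip = cond (v cur ⋖ v m) (cur := v m ⨾ nd := v mn) skip
  rowMatch =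
    cond ((# 0 ⋖ v dg) && ((v c ≐ rd tapeB (v j)) && (v cur ⋖ # 1 ⊕ v dg)))
      (NC [ v hp ]:= # 1 ⊕ v c ⨾ NP [ v hp ]:= v dgn ⨾ cur := # 1 ⊕ v dg ⨾ nd := v hp ⨾ increment hp) skip
  rowJump =
    cond ((# 0 ⋖ v jmp) && (v cur ⋖ ld V (ld EW (# 1 ⊕ v n ⊕ v j))))
      (NC [ v hp ]:= # 0 ⨾ NP [ v hp ]:= ld VN (ld EW (# 1 ⊕ v n ⊕ v j)) ⨾
       cur := ld V (ld EW (# 1 ⊕ v n ⊕ v j)) ⨾ nd := v hp ⨾ increment hp) skip
  rowSave = dg := v m ⨾ dgn := v mn ⨾ V [ v off ⊕ v j ]:= v cur ⨾ VN [ v off ⊕ v j ]:= v nd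
  rowBody = rowLoad ⨾ rowSkip ⨾ rowMatch ⨾ rowJump ⨾ rowSave

  row : Cmd
  row = rowStart ⨾ while (v x ⋖ v j) rowBody

  -- Two rows of n + 2 cells. F begins with row n, where only the empty list is a candidate,
  -- represented by 1; G begins with row n + 1, which has none.
  resetBody : Cmd
  resetBody = V [ v t ]:= v t ⋖ # 1 ⊕ v n ⨾ VN [ v t ]:= # 0 ⨾ increment t

  -- F descends to the row `e` that the next row of G refers to, and only then G descends. If there
  -- is no window, `e` = n + 1 lets G go on at once, with jumps switched off.
  choose : Cmd
  choose =
    e := ld EW (v gi ⊖ # 1) ⨾
    cond (v e ⋖ v fi)
      (fi := v fi ⊖ # 1 ⨾ ri := v fi ⨾ off := # 0 ⨾ jmp := # 0 ⨾ floor := ld EW (# 1 ⊕ v n))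
      (gi := v gi ⊖ # 1 ⨾ ri := v gi ⨾ off := # 2 ⊕ v n ⨾ jmp := v e ⋖ # 1 ⊕ v n ⨾ floor := # 0)

  -- A positive corner value c stands for a string of length c - 1 + r; it leaves out at most `K`
  -- characters exactly if n < c + r + `K`.
  attempt : Cmd
  attempt =
    (t := # 0 ⨾ while (v t ⋖ # 2 ⊛ v n ⊕ # 4) resetBody) ⨾
    (hp := # 1 ⨾ fi := v n ⨾ gi := # 1 ⊕ v n) ⨾ while (# 0 ⋖ v gi) (choose ⨾ row) ⨾
    cur := ld V (# 2 ⊕ v n) ⨾
    cond ((# 0 ⋖ v cur) && (v n ⋖ v cur ⊕ (v r ⊕ v K))) (fl := # 1) (K := v K ⊕ v K)

  dynamic : Cmd
  dynamic = (K := # 1 ⨾ fl := # 0) ⨾ while (v fl ≐ # 0) attempt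

  emitNode : Cmd
  emitNode = put (ld NC (v p) ⊖ # 1) ⨾ p := ld NP (v p)

  emitP : Cmd
  emitP = put (rd tapeP (v i)) ⨾ increment i

  trace : Cmd
  trace =
    p := ld VN (# 2 ⊕ v n) ⨾ while (# 0 ⋖ ld NC (v p)) emitNode ⨾
    i := # 0 ⨾ while (v i ⋖ v r) emitP ⨾
    p := ld NP (v p) ⨾ while (# 0 ⋖ v p) emitNode

  solve : Cmd
  solve =
    blockSize ⨾ conjTable ⨾ sort ⨾ names ⨾
    (fw := # 0 ⨾ bw := v n ⨾ lo := # 0) ⨾ windows ⨾
    (fw := # 2 ⊛ v n ⨾ bw := # 3 ⊛ v n ⨾ lo := # 1 ⊕ v n) ⨾ windows ⨾
    dynamic ⨾ trace

  decideP : Cmd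
  decideP =
    (n := sz tapeA ⨾ r := sz tapeP) ⨾
    greedy tapeA ⨾ flag := v p ≐ v r ⨾
    cond (v flag) (greedy tapeB ⨾ flag := v p ≐ v r) skip

  main : Cmd
  main = decideP ⨾ cond (v flag) solve skip

module C = Code

-- Greedy matching of P

module Greedy-matching where

  open Language
  open Embeddings
  open Code using (greedy; greedyBody)

  record GreedySetting : Set where
    constructor greedySetting
    field
      mc : Machine
    open Machine mc public
    field
      τ : Tape
      N R : ℕ
      N<W : N < 2 ^ w
      R<W : R < 2 ^ w

  module Greedy (s : GreedySetting) where

    open GreedySetting s

    open Semantics mc
    open Embedding (charAt (input tapeP)) (charAt (input τ))

    -- `maximal` justifies the negative answer, `matched` the positive one.
    record Inv (k : ℕ) (σ : Store) : Set where
      field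
        count    : env σ C.i + k ≡ N
        p≤R      : env σ C.p ≤ R
        matched  : Emb 0 (env σ C.p) 0 (env σ C.i)
        maximal  : ∀ q → Emb 0 q 0 (env σ C.i) → q ≤ env σ C.p

    Result : Store → Set
    Result σ = (env σ C.p ≡ R × Emb 0 R 0 N) ⊎ (env σ C.p ≢ R × ¬ Emb 0 R 0 N)

    private
      test : Exp
      test = (v C.p ⋖ v C.r) && (v C.i ⋖ v C.n)

    exit : ∀ {k σ} → env σ C.n ≡ N → env σ C.r ≡ R → Inv k σ → False test σ → Result σ
    exit {k} {σ} eN eR I (inj₁ r≤p) = inj₁ (p≡R , subst (λ q → Emb 0 q 0 N) p≡R (right i≤N (Inv.matched I)))
      where
      p≡R = ≤-antisym (Inv.p≤R I) (subst (_≤ env σ C.p) eR r≤p)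
      i≤N = ≤-trans (m≤m+n _ k) (≤-reflexive (Inv.count I))
    exit {k} {σ} eN eR I (inj₂ (p<r , n≤i)) = inj₂ (<⇒≢ p<R , λ e →
      <-irrefl refl (<-≤-trans p<R (Inv.maximal I R (right (subst (_≤ env σ C.i) eN n≤i) e))))
      where p<R = subst (env σ C.p <_) eR p<r

    body : ∀ {k σ} → env σ C.n ≡ N → env σ C.r ≡ R → Inv k σ → True test σ →
           Σ[ k′ ∈ ℕ ] k′ < k × Ends (greedyBody τ) σ 30 (Inv k′)
    body {zero} {σ} eN eR I (p< , i<) =
      contradiction (subst₂ _<_ (trans (sym (+-identityʳ _)) (Inv.count I)) eN i<) (<-irrefl refl)
    body {suc k} {σ} eN eR I (p< , i<) = k , ≤-refl , straight (greedyBody τ)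
      (_ , (λ e → (_ , _ , ≤-<-trans p<R R<W) , (_ , _ , ≤-<-trans i<N N<W) , record
              { count = count′ ; p≤R = p<R ; matched = snoc (Inv.matched I) (sym e)
              -- One more character of the text lengthens an embedded prefix of P by at most one.
              ; maximal = λ { zero _ → z≤n ; (suc q) x → s≤s (Inv.maximal I q (shorten q x)) } })
         , (λ ne → (_ , _ , ≤-<-trans i<N N<W) , record
              { count = count′ ; p≤R = Inv.p≤R I ; matched = right (n≤1+n _) (Inv.matched I)
              ; maximal = λ { zero _ → z≤n ; (suc q) x → extend ne q x } }))
      where
      p<R = subst (env σ C.p <_) eR p<
      i<N = subst (env σ C.i <_) eN i<
      count′ : suc (env σ C.i) + k ≡ N
      count′ = trans (sym (+-suc _ k)) (Inv.count I)
      shorten : ∀ q → Emb 0 (suc q) 0 (suc (env σ C.i)) → Emb 0 q 0 (env σ C.i)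
      shorten q x with unsnoc z≤n x
      ... | inj₁ y = init z≤n y
      ... | inj₂ (_ , y) = y
      extend : charAt (input τ) (env σ C.i) ≢ charAt (input tapeP) (env σ C.p) →
               ∀ q → Emb 0 (suc q) 0 (suc (env σ C.i)) → suc q ≤ env σ C.p
      extend ne q x with unsnoc z≤n x
      ... | inj₁ y = Inv.maximal I (suc q) y
      ... | inj₂ (e , y) = ≤∧≢⇒< (Inv.maximal I q y) λ { refl → ne (sym e) }

    greedy-correct : ∀ {σ} → env σ C.n ≡ N → env σ C.r ≡ R → Ends (greedy τ) σ (6 + (N * 80 + 80)) Result
    greedy-correct eN eR = prefix 6 (C.i := # 0 ⨾ C.p := # 0) (_ , _ , atMost N 80 80
      (iterate test (greedyBody τ) Inv N
        (λ k σ sm I → _ , λ _ → _)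
        (λ k σ sm I → exit (trans (varₛ sm C.n) eN) (trans (varₛ sm C.r) eR) I)
        (λ k σ sm I → body (trans (varₛ sm C.n) eN) (trans (varₛ sm C.r) eR) I)
        (record { count = refl ; p≤R = z≤n ; matched = end z≤n ; maximal = λ q e → only q e })))
      where
      only : ∀ q → Emb 0 q 0 0 → q ≤ 0
      only zero    e = z≤n
      only (suc q) e = contradiction (latest-complete (suc q) 0 e) λ ()

-- Block length and the table for conjunction

module Tables where

  open import Data.Nat.DivMod using (_/_; m/n*n≤m; m/n<m; m/n≤m)
  open Defs using (module Word)
  open Language
  open BitVectors
  open Arithmetic
  open Code using (blockSize; blockBody; conjTable; conjBody)

  record TableSetting : Set where
    constructor tableSetting
    field
      mc : Machine
    open Machine mc public
    field
      R : ℕ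
      room : 5 * R + 5 ≤ lim
      lim<W : lim < 2 ^ w

  module Blocks (s : TableSetting) where

    open TableSetting s

    open Semantics mc
    open Division w
    open Word w using (quotient)

    private
      small : ∀ {x} → x ≤ 5 * R + 5 → x < W
      small l = ≤-<-trans (≤-trans l room) lim<W

    -- The last doubling starts from B ^ 2 ≤ r, hence the factor 4; the summand 1 covers r = 0,
    -- where B stays 1.
    record Sized (σ : Store) : Set where
      field
        power : env σ C.B ≡ 2 ^ env σ C.b
        upper : env σ C.B * env σ C.B ≤ 4 * R + 1

    private
      sizeTest : Exp
      sizeTest = v C.B ⊛ v C.B ⋖ # 1 ⊕ v C.r

      SizeInv : ℕ → Store → Set
      SizeInv k σ = suc R ∸ env σ C.B ≡ k × Sized σ

      sizeBody : ∀ {k σ} → env σ C.r ≡ R → SizeInv k σ → True sizeTest σ →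
                 Σ[ k′ ∈ ℕ ] k′ < k × Ends blockBody σ 20 (SizeInv k′)
      sizeBody {k} {σ} eR (e , I) tr = suc R ∸ (B + B) , subst (suc R ∸ (B + B) <_) e shrink ,
        straight blockBody ((_ , _ , small sum≤) , (_ , _ , small b≤) , refl , record
          { power = trans (cong₂ _+_ power power) (cong (2 ^ env σ C.b +_) (sym (+-identityʳ _)))
          ; upper = lin 2 (λ B R → (‵ 4 ∙ (B :* B :≤ R)) ∷ [] ⊢ (B :+ B) :* (B :+ B) :≤ ‵ 4 :* R :+ ‵ 1) B R sq })
        where
        open Sized I
        B = env σ C.B
        sq : B * B ≤ R
        sq = s≤s⁻¹ (≤-trans tr (≤-reflexive (cong suc eR)))
        0<B : 0 < B
        0<B = subst (0 <_) (sym power) (m^n>0 2 (env σ C.b))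
        B≤R : B ≤ R
        B≤R = ≤-trans (≤-trans (≤-reflexive (sym (*-identityʳ B))) (*-monoʳ-≤ B 0<B)) sq
        sum≤ : B + B ≤ 5 * R + 5
        sum≤ = lin 2 (λ B R → (B :≤ R) ∷ (B :≤ R) ∷ [] ⊢ B :+ B :≤ ‵ 5 :* R :+ ‵ 5) B R B≤R B≤R
        b≤ : suc (env σ C.b) ≤ 5 * R + 5
        b≤ = ≤-trans (≤-trans (n<2^n (env σ C.b)) (≤-trans (≤-reflexive (sym power)) B≤R))
                     (lin 1 (λ R → [] ⊢ R :≤ ‵ 5 :* R :+ ‵ 5) R)
        shrink : suc R ∸ (B + B) < suc R ∸ B
        shrink = ∸-shrink (s≤s B≤R) (≤-trans (≤-reflexive (+-comm 1 B)) (+-monoʳ-≤ B 0<B))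

    record BlockSize (σ : Store) : Set where
      field
        power : env σ C.B ≡ 2 ^ env σ C.b
        upper : env σ C.B * env σ C.B ≤ 4 * R + 1
        lower : R < env σ C.B * env σ C.B

    blockSize-correct : ∀ {σ} → env σ C.r ≡ R → Ends blockSize σ (6 + (R * 60 + 60)) BlockSize
    blockSize-correct eR = prefix 6 (C.b := # 0 ⨾ C.B := # 1) (_ , _ , atMost R 60 60
      (iterate sizeTest blockBody SizeInv R
        (λ k σ sm I → let sq = ≤-<-trans (Sized.upper (proj₂ I)) (s≤s ≤-refl) in
           (_ , _ , small (≤-trans (Sized.upper (proj₂ I)) (lin 1 (λ R → [] ⊢ ‵ 4 :* R :+ ‵ 1 :≤ ‵ 5 :* R :+ ‵ 5) R))) ,
           (_ , _ , subst (λ r → suc r < W) (sym (trans (varₛ sm C.r) eR)) (small (lin 1 (λ R → [] ⊢ ‵ 1 :+ R :≤ ‵ 5 :* R :+ ‵ 5) R))) , _)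
        (λ k σ sm I f → record { power = Sized.power (proj₂ I) ; upper = Sized.upper (proj₂ I)
                               ; lower = subst (λ r → suc r ≤ _) (trans (varₛ sm C.r) eR) f })
        (λ k σ sm I → sizeBody (trans (varₛ sm C.r) eR) I)
        (refl , record { power = refl ; upper = lin 1 (λ R → [] ⊢ ‵ 1 :≤ ‵ 4 :* R :+ ‵ 1) R })))

    module _ (β Β : ℕ) (power : Β ≡ 2 ^ β) (upper : Β * Β ≤ 4 * R + 1) where

      private
        q = λ z → quotient z Β

        0<Β : 0 < Β
        0<Β = subst (0 <_) (sym power) (m^n>0 2 β)

        entry : ℕ → ℕ
        entry z = conj β (q z) (z ∸ q z * Β)

        conjTest : Exp
        conjTest = v C.z ⋖ v C.B ⊛ v C.B

        -- Entry 0 is computed from itself, so `first` records that the memory holds 0 before it is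
        -- written.
        record ConjInv (k : ℕ) (σ : Store) : Set where
          field
            count  : env σ C.z + k ≡ Β * Β
            filled : ∀ z → z < env σ C.z → arr σ C.AN z ≡ entry z
            first  : env σ C.z ≡ 0 → arr σ C.AN 0 ≡ 0

        module Step (z : ℕ) (z< : z < Β * Β) where
          a = q z
          d = z ∸ a * Β
          z≡ : a * Β + d ≡ z
          z≡ = m+[n∸m]≡n (quotient-≤ z Β)
          d< : d < Β
          d< = quotient-rest z Β 0<Β
          a< : a < Β
          a< = quotient-< z Β Β z<
          source : ℕ
          source = a / 2 * Β + d / 2
          half< : ∀ {x} → x < Β → x / 2 < Β
          half< {x} l = ≤-<-trans (m/n≤m x 2) l
          source-entry : entry source ≡ conj β (a / 2) (d / 2)
          source-entry = cong₂ (conj β) eq (trans (cong (λ y → source ∸ y * Β) eq) (m+n∸m≡n (a / 2 * Β) (d / 2)))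
            where eq = quotient-unique (a / 2) (d / 2) Β (half< d<)
          digits : (a ∸ 2 * (a / 2)) * (d ∸ 2 * (d / 2)) + 2 * conj β (a / 2) (d / 2) ≡ entry z
          digits = trans (cong₂ (λ x y → x * y + 2 * conj β (a / 2) (d / 2)) (remainder a) (remainder d))
                         (conj-suc β a d (subst (a <_) power a<))
          source≤ : source ≤ z
          source≤ = ≤-trans (+-mono-≤ (*-monoˡ-≤ Β (m/n≤m a 2)) (m/n≤m d 2)) (≤-reflexive z≡)
          source< : 0 < z → source < z
          -- Halving shrinks positive numbers, and z > 0 means that a or d is positive.
          source< 0<z with a ≟ 0
          ... | yes e = <-≤-trans (+-mono-≤-< (*-monoˡ-≤ Β (m/n≤m a 2)) (m/n<m d 2 {{>-nonZero 0<d}} (s≤s (s≤s z≤n)))) (≤-reflexive z≡)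
            where
            0<d : 0 < d
            0<d = subst (λ y → 0 < z ∸ y * Β) (sym e) 0<z
          ... | no ne = <-≤-trans (+-mono-<-≤ (*-monoˡ-< Β {{>-nonZero 0<Β}} (m/n<m a 2 {{≢-nonZero ne}} (s≤s (s≤s z≤n)))) (m/n≤m d 2)) (≤-reflexive z≡)

        conjStep : ∀ {k σ} → env σ C.B ≡ Β → ConjInv k σ → True conjTest σ →
                   Σ[ k′ ∈ ℕ ] k′ < k × Ends conjBody σ 80 (ConjInv k′)
        conjStep {zero} {σ} refl I z< = contradiction (subst (_< Β * Β) (trans (sym (+-identityʳ _)) (ConjInv.count I)) z<) (<-irrefl refl)
        conjStep {suc k} {σ} refl I z< = k , ≤-refl , straight conjBody
          ( _ , (_ , (_ , _ , small (≤-trans (quotient-≤ z Β) (<⇒≤ zb))) , _) , _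
          , (((_ , (_ , _ , small (twice a<)) , _) , (_ , (_ , _ , small (twice d<)) , _)
              , small (≤-trans (m≤m+n _ _) total))
            , (_ , (_ , ((_ , _ , small (≤-trans (m≤m+n _ (d / 2)) (≤-trans source≤ (<⇒≤ zb)))) , _ , small (≤-trans source≤ (<⇒≤ zb)))
                  , ≤-trans (s≤s source≤) (≤-trans zb room))
                , small (≤-trans (m≤n+m _ ((a ∸ 2 * (a / 2)) * (d ∸ 2 * (d / 2)))) total))
            , small total)
          , ≤-trans zb room
          , (_ , _ , small zb)
          , record { count = trans (sym (+-suc _ k)) (ConjInv.count I) ; filled = filled′ ; first = λ () })
          where
          z = env σ C.z
          open Step z z<
          zb : suc z ≤ 5 * R + 5
          zb = ≤-trans z< (≤-trans upper (lin 1 (λ R → [] ⊢ ‵ 4 :* R :+ ‵ 1 :≤ ‵ 5 :* R :+ ‵ 5) R))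
          Β≤ : Β ≤ 5 * R + 5
          Β≤ = ≤-trans (≤-trans (≤-reflexive (sym (*-identityʳ Β))) (*-monoʳ-≤ Β 0<Β))
                 (≤-trans upper (lin 1 (λ R → [] ⊢ ‵ 4 :* R :+ ‵ 1 :≤ ‵ 5 :* R :+ ‵ 5) R))
          twice : ∀ {y} → y < Β → 2 * (y / 2) ≤ 5 * R + 5
          twice {y} l = ≤-trans (≤-trans (≤-reflexive (*-comm 2 (y / 2))) (m/n*n≤m y 2)) (≤-trans (<⇒≤ l) Β≤)
          read : arr σ C.AN source ≡ conj β (a / 2) (d / 2)
          read with z ≟ 0
          ... | no ne = trans (ConjInv.filled I source (source< (n≢0⇒n>0 ne))) source-entry
          ... | yes e = trans (cong (arr σ C.AN) (n≤0⇒n≡0 (subst (source ≤_) e source≤)))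
                          (trans (ConjInv.first I e) (sym (trans (cong (λ y → conj β y (d / 2)) a/2≡0) (conj-0 β (d / 2)))))
            where
            a/2≡0 : a / 2 ≡ 0
            a/2≡0 = n≤0⇒n≡0 (≤-trans (m/n≤m a 2) (≤-trans (≤-trans (m≤m*n a Β {{>-nonZero 0<Β}}) (quotient-≤ z Β)) (≤-reflexive e)))
          value : (a ∸ 2 * (a / 2)) * (d ∸ 2 * (d / 2)) + 2 * arr σ C.AN source ≡ entry z
          value = trans (cong (λ y → (a ∸ 2 * (a / 2)) * (d ∸ 2 * (d / 2)) + 2 * y) read) digits
          total : (a ∸ 2 * (a / 2)) * (d ∸ 2 * (d / 2)) + 2 * arr σ C.AN source ≤ 5 * R + 5
          total = ≤-trans (≤-reflexive value) (≤-trans (conj-≤ β a d) (≤-trans (<⇒≤ a<) Β≤))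
          filled′ : ∀ z′ → z′ < suc z → (arr σ C.AN Defs.[ z ≔ (a ∸ 2 * (a / 2)) * (d ∸ 2 * (d / 2)) + 2 * arr σ C.AN source ]) z′ ≡ entry z′
          filled′ z′ l with z′ ≟ z
          ... | yes refl = trans (≔-hit (arr σ C.AN) z _) value
          ... | no ne = trans (≔-miss (arr σ C.AN) _ ne) (ConjInv.filled I z′ (≤∧≢⇒< (s≤s⁻¹ l) ne))

      conjTable-correct : ∀ {σ} → env σ C.B ≡ Β → arr σ C.AN 0 ≡ 0 →
        Ends conjTable σ (3 + ((4 * R + 1) * 120 + 120))
             (λ σ′ → ∀ a d → a < Β → d < Β → arr σ′ C.AN (a * Β + d) ≡ conj β a d)
      conjTable-correct {σ₀} eB e0 = within (+-monoʳ-≤ 3 (+-monoˡ-≤ 120 (*-monoˡ-≤ 120 upper)))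
        (prefix 3 (C.z := # 0) (_ , atMost (Β * Β) 120 120
          (iterate conjTest conjBody ConjInv (Β * Β)
            (λ k σ sm I → _ , (_ , _ , subst (λ B → B * B < W) (sym (trans (varₛ sm C.B) eB))
               (small (≤-trans upper (lin 1 (λ R → [] ⊢ ‵ 4 :* R :+ ‵ 1 :≤ ‵ 5 :* R :+ ‵ 5) R)))) , _)
            (λ k σ sm I f a d a< d< → exit (trans (varₛ sm C.B) eB) I f a< d<)
            (λ k σ sm I → conjStep (trans (varₛ sm C.B) eB) I)
            (record { count = refl ; filled = λ _ () ; first = λ _ → e0 }))))
        where
        exit : ∀ {k σ a d} → env σ C.B ≡ Β → ConjInv k σ → False conjTest σ → a < Β → d < Β →
               arr σ C.AN (a * Β + d) ≡ conj β a d
        exit {k} {σ} {a} {d} refl I f a< d< = trans (ConjInv.filled I _ (<-≤-trans in-range f))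
          (cong₂ (conj β) eq (trans (cong (λ y → a * Β + d ∸ y * Β) eq) (m+n∸m≡n (a * Β) d)))
          where
          eq = quotient-unique a d Β d<
          in-range : a * Β + d < Β * Β
          in-range = ≤-trans (+-monoʳ-< (a * Β) d<) (≤-trans (≤-reflexive (+-comm (a * Β) Β)) (*-monoˡ-≤ Β a<))

-- Sorting the characters of P

module Key-sorting where

  open import Data.Nat.DivMod using (_%_; [m+kn]%n≡m%n; m<n⇒m%n≡m)
  open Language
  open Arithmetic
  open Code using (scan; scanBody; minima; minimaBody; find; findBody; sort; sortBody; increment)

  module Keys (P : ℕ → ℕ) (R : ℕ) where

    key : ℕ → ℕ
    key y = P y * R + suc y

    -- The key, less 1, has remainder y modulo R.
    key-injective : ∀ {y y′} → y < R → y′ < R → key y ≡ key y′ → y ≡ y′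
    key-injective {y} {y′} y< y′< e = trans (sym (modulo {P y} y<)) (trans (cong mod (suc-injective (trans (sym (+-suc (P y * R) y)) (trans e (+-suc (P y′ * R) y′))))) (modulo {P y′} y′<))
      where
      instance _ = >-nonZero (≤-<-trans z≤n y<)
      mod : ℕ → ℕ
      mod x = x % R
      modulo : ∀ {a y} → y < R → mod (a * R + y) ≡ y
      modulo {a} {y} l = trans (cong mod (+-comm (a * R) y)) (trans ([m+kn]%n≡m%n y a R) (m<n⇒m%n≡m l))

    -- Keys up to L count as extracted; 0, which is no key, says that none of the range is left.
    data Least (lo hi L v : ℕ) : Set where
      none : v ≡ 0 → (∀ y → lo ≤ y → y < hi → y < R → key y ≤ L) → Least lo hi L v
      some : ∀ y → key y ≡ v → lo ≤ y → y < hi → y < R → L < v →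
             (∀ y′ → lo ≤ y′ → y′ < hi → y′ < R → L < key y′ → v ≤ key y′) → Least lo hi L v

    key>0 : ∀ y → 0 < key y
    key>0 y = ≤-trans (s≤s z≤n) (m≤n+m (suc y) (P y * R))

    single-low : ∀ {x L} → key x ≤ L → Least x (suc x) L 0
    single-low l = none refl λ y a b _ → subst (λ z → key z ≤ _) (≤-antisym a (s≤s⁻¹ b)) l

    single-high : ∀ {x L} → x < R → L < key x → Least x (suc x) L (key x)
    single-high {x} x< l = some x refl ≤-refl ≤-refl x< l λ y a b _ _ → ≤-reflexive (cong key (≤-antisym a (s≤s⁻¹ b)))

    private
      both : ∀ {lo m hi} {F : ℕ → Set} → (∀ y → lo ≤ y → y < m → F y) → (∀ y → m ≤ y → y < hi → F y) → ∀ y → lo ≤ y → y < hi → F y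
      both {m = m} f g y a b with y <? m
      ... | yes l = f y a l
      ... | no nl = g y (≮⇒≥ nl) b

      positive : ∀ {lo hi L v} → Least lo hi L v → v ≢ 0 →
                 ∃[ y ] (key y ≡ v × lo ≤ y × y < hi × y < R × L < v × (∀ y′ → lo ≤ y′ → y′ < hi → y′ < R → L < key y′ → v ≤ key y′))
      positive (none e _) n = contradiction e n
      positive (some y a b c d e f) n = y , a , b , c , d , e , f

      bounds : ∀ {lo hi L v u} → Least lo hi L v → v ≡ 0 ⊎ u ≤ v → ∀ y → lo ≤ y → y < hi → y < R → L < key y → u ≤ key y
      bounds (none e f) _ y a b c d = contradiction (f y a b c) (<⇒≱ d)
      bounds (some y₀ e _ _ _ l f) (inj₁ z) y a b c d = contradiction (trans e z) (>⇒≢ (key>0 y₀))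
      bounds (some y₀ e _ _ _ l f) (inj₂ u≤) y a b c d = ≤-trans u≤ (f y a b c d)

    join-left : ∀ {lo m hi L u v} → lo ≤ m → m ≤ hi → v ≡ 0 ⊎ u ≤ v → Least lo m L u → Least m hi L v → u ≢ 0 → Least lo hi L u
    join-left lm mh v? p q u≢0 with positive p u≢0
    ... | y , e , a , b , c , l , f = some y e a (<-≤-trans b mh) c l
          (both f (bounds q v?))

    join-right : ∀ {lo m hi L u v} → lo ≤ m → m ≤ hi → u ≡ 0 ⊎ v ≤ u → Least lo m L u → Least m hi L v → v ≢ 0 → Least lo hi L v
    join-right lm mh u? p q v≢0 with positive q v≢0
    ... | y , e , a , b , c , l , f = some y e (≤-trans lm a) b c l
          (both (bounds p u?) f)

    join-none : ∀ {lo m hi L u v} → u ≡ 0 → v ≡ 0 → Least lo m L u → Least m hi L v → Least lo hi L u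
    join-none u0 v0 p q = none u0 (both (low u0 p) (low v0 q))
      where
      low : ∀ {lo hi L v} → v ≡ 0 → Least lo hi L v → ∀ y → lo ≤ y → y < hi → y < R → key y ≤ L
      low z (none _ f) = f
      low z (some y₀ e _ _ _ _ _) = contradiction (trans e z) (>⇒≢ (key>0 y₀))

    -- Extracting M lifts the bound from L to M. The minimum of a block that did not contain M
    -- exceeds M and stays valid.
    raise : ∀ {lo hi L v M} → L ≤ M → (∀ y → y < R → L < key y → M ≤ key y) → v ≢ M → Least lo hi L v → Least lo hi M v
    raise LM f ne (none z g) = none z λ y a b c → ≤-trans (g y a b c) LM
    raise LM f ne (some y e a b c l g) = some y e a b c (≤∧≢⇒< (subst (_ ≤_) e (f y c (subst (_ <_) (sym e) l))) (λ x → ne (sym x)))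
      λ y′ a′ b′ c′ l′ → g y′ a′ b′ c′ (≤-<-trans LM l′)

    -- The keys not yet extracted: the variant of the sorting loop, which also bounds what is still
    -- to be stored in `D`.
    count : ℕ → ℕ → ℕ
    count L zero    = 0
    count L (suc m) = (if L <ᵇ key m then 1 else 0) + count L m

    private
      indicator-mono : ∀ {L L′ k} → L ≤ L′ → (if L′ <ᵇ k then 1 else 0) ≤ (if L <ᵇ k then 1 else 0)
      indicator-mono {L} {L′} {k} l with L′ <ᵇ k in e
      ... | false = z≤n
      ... | true with L <ᵇ k | <⇒<ᵇ (≤-<-trans l (<ᵇ⇒< L′ k (subst T (sym e) _)))
      ... | true | _ = ≤-refl

      indicator-1 : ∀ {L k} → L < k → (if L <ᵇ k then 1 else 0) ≡ 1
      indicator-1 {L} {k} l with L <ᵇ k | <⇒<ᵇ l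
      ... | true | _ = refl

      indicator-0 : ∀ {L k} → k ≤ L → (if L <ᵇ k then 1 else 0) ≡ 0
      indicator-0 {L} {k} l with L <ᵇ k in e
      ... | false = refl
      ... | true = contradiction (<ᵇ⇒< L k (subst T (sym e) _)) (≤⇒≯ l)

    count-≤ : ∀ L m → count L m ≤ m
    count-≤ L zero = z≤n
    count-≤ L (suc m) with L <ᵇ key m
    ... | true  = s≤s (count-≤ L m)
    ... | false = m≤n⇒m≤1+n (count-≤ L m)

    count-mono : ∀ {L L′} m → L ≤ L′ → count L′ m ≤ count L m
    count-mono zero    l = z≤n
    count-mono (suc m) l = +-mono-≤ (indicator-mono {k = key m} l) (count-mono m l)

    count-strict : ∀ {L L′} m {y} → y < m → L < key y → key y ≤ L′ → count L′ m < count L m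
    count-strict {L} {L′} (suc m) {y} y< l l′ with y ≟ m
    ... | yes refl = ≤-trans (≤-reflexive (cong (λ a → suc (a + count L′ m)) (indicator-0 {L′} l′)))
                       (≤-trans (s≤s (count-mono m (<⇒≤ (<-≤-trans l l′)))) (≤-reflexive (cong (_+ count L m) (sym (indicator-1 {L} l)))))
    ... | no ne = ≤-trans (≤-reflexive (sym (+-suc _ _)))
                    (+-mono-≤ (indicator-mono {k = key m} (<⇒≤ (<-≤-trans l l′))) (count-strict m (≤∧≢⇒< (s≤s⁻¹ y<) ne) l l′))

  record SortSetting : Set where
    constructor sortSetting
    field
      sp : Space
    open Space sp public renaming (N to R)
    field
      β U : ℕ
      R≤Uβ : R ≤ U * β
      β≤ : β ≤ 4 * R + 1
      U≤ : U ≤ 4 * R + 4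
      keyW : ∀ y → y < R → charAt (input tapeP) y * R + suc y < 2 ^ w

  module Sorting (s : SortSetting) where

    open SortSetting s

    open Semantics mc
    open Keys (charAt (input tapeP)) R

    record Fixed (σ : Store) : Set where
      constructor fixed
      field
        eR : env σ C.r ≡ R
        eβ : env σ C.b ≡ β

    private
      scanTest : Exp
      scanTest = (v C.x ⋖ v C.hi) && (v C.x ⋖ v C.r)

      record ScanInv (lo L k : ℕ) (σ : Store) : Set where
        constructor scanInv
        field
          lo≤x  : lo ≤ env σ C.x
          x≤hi  : env σ C.x ≤ env σ C.hi
          left  : env σ C.hi ∸ env σ C.x ≡ k
          least : Least lo (env σ C.x) L (env σ C.best)

      scanStep : ∀ {lo L k σ} → env σ C.r ≡ R → env σ C.L ≡ L → ScanInv lo L k σ → True scanTest σ →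
                 Σ[ k′ ∈ ℕ ] k′ < k × Ends scanBody σ 60 (ScanInv lo L k′)
      scanStep {lo} {L} {k} {σ} eR refl (scanInv lo≤x _ cnt least) (x<hi , x<r) =
        env σ C.hi ∸ suc x , subst (env σ C.hi ∸ suc x <_) cnt (∸-shrink x<hi ≤-refl) ,
        straight scanBody ((inner , (_ , _ , x<W) , keyW′) , _ ,
          (λ L<key → _ , (λ b0 → _ , (_ , _ , x<W) , scanInv (m≤n⇒m≤1+n lo≤x) x<hi refl (join-right lo≤x (n≤1+n x) (inj₁ b0) least (this L<key) key≢0))
                       , (λ b≢0 → _ , (λ fewer → _ , (_ , _ , x<W) , scanInv (m≤n⇒m≤1+n lo≤x) x<hi refl (join-right lo≤x (n≤1+n x) (inj₂ (<⇒≤ fewer)) least (this L<key) key≢0))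
                                     , (λ geq → (_ , _ , x<W) , scanInv (m≤n⇒m≤1+n lo≤x) x<hi refl (join-left lo≤x (n≤1+n x) (inj₂ geq) least (this L<key) b≢0))))
          , (λ key≤L → (_ , _ , x<W) , scanInv (m≤n⇒m≤1+n lo≤x) x<hi refl (low key≤L)))
        where
        x = env σ C.x
        x<R : x < R
        x<R = subst (x <_) eR x<r
        kx : ℕ
        kx = charAt (input tapeP) x * env σ C.r + suc x
        kx≡ : kx ≡ key x
        kx≡ = cong (λ r → charAt (input tapeP) x * r + suc x) eR
        x<W : suc x < W
        x<W = small (≤-trans x<R (lin 1 (λ R → [] ⊢ R :≤ ‵ 16 :* R :+ ‵ 16) R))
        keyW′ : kx < W
        keyW′ = subst (_< W) (sym kx≡) (keyW x x<R)
        inner = _ , _ , ≤-<-trans (m≤m+n _ (suc x)) keyW′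
        key≢0 : kx ≢ 0
        key≢0 e = >⇒≢ (key>0 x) (trans (sym kx≡) e)
        this : env σ C.L < kx → Least x (suc x) (env σ C.L) kx
        this l = subst (Least x (suc x) (env σ C.L)) (sym kx≡) (single-high x<R (subst (env σ C.L <_) kx≡ l))
        low : kx ≤ env σ C.L → Least lo (suc x) (env σ C.L) (env σ C.best)
        low l with env σ C.best ≟ 0
        ... | yes b0 = join-none b0 refl least (single-low (subst (_≤ env σ C.L) kx≡ l))
        ... | no b≢0 = join-left lo≤x (n≤1+n x) (inj₁ refl) least (single-low (subst (_≤ env σ C.L) kx≡ l)) b≢0

    scan-correct : ∀ {σ} t L → Fixed σ → env σ C.t ≡ t → env σ C.L ≡ L → t * β < R →
                   Ends scan σ (20 + (β * 100 + 100)) (λ σ′ → Least (t * β) (t * β + β) L (env σ′ C.best))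
    scan-correct {σ₀} t L (fixed eR refl) refl refl tβ< = prefix 20 (C.x := v C.t ⊛ v C.b ⨾ C.hi := v C.x ⊕ v C.b ⨾ C.best := # 0)
      ((_ , _ , small (<⇒≤ bound₁)) , (_ , _ , small bound₂) , _ , atMost β 100 100
        (iterate scanTest scanBody (ScanInv lo (env σ₀ C.L)) β
          (λ k σ sm I → _ , λ _ → _)
          (λ k σ sm I f → exit (trans (varₛ sm C.r) eR) (varₛ sm C.hi) I f)
          (λ k σ sm I → scanStep (trans (varₛ sm C.r) eR) (varₛ sm C.L) I)
          (scanInv ≤-refl (m≤m+n lo β) (m+n∸m≡n lo β) (none refl λ y a b _ → contradiction b (≤⇒≯ a)))))
      where
      lo = t * β
      bound₁ : lo < 16 * R + 16
      bound₁ = <-≤-trans tβ< (lin 1 (λ R → [] ⊢ R :≤ ‵ 16 :* R :+ ‵ 16) R)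
      bound₂ : lo + β ≤ 16 * R + 16
      bound₂ = lin 3 (λ l b R → (l :< R) ∷ (b :≤ ‵ 4 :* R :+ ‵ 1) ∷ [] ⊢ l :+ b :≤ ‵ 16 :* R :+ ‵ 16) lo β R tβ< β≤
      exit : ∀ {k σ} → env σ C.r ≡ R → env σ C.hi ≡ lo + β → ScanInv lo L k σ → False scanTest σ →
             Least lo (lo + β) L (env σ C.best)
      exit {k} {σ} eR ehi (scanInv lo≤x x≤hi _ least) f = widen least
        where
        x = env σ C.x
        inside : ∀ y → y < lo + β → y < R → y < x
        inside y a b = before f
          where
          before : False scanTest σ → y < x
          before (inj₁ hi≤x) = <-≤-trans a (subst (_≤ x) ehi hi≤x)
          before (inj₂ (_ , r≤x)) = <-≤-trans b (subst (_≤ x) eR r≤x)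
        widen : ∀ {b} → Least lo x L b → Least lo (lo + β) L b
        widen (none e f) = none e λ y a b c → f y a (inside y b c) c
        widen (some y e a b c l g) = some y e a (<-≤-trans b (≤-trans x≤hi (≤-reflexive ehi))) c l λ y′ a′ b′ c′ → g y′ a′ (inside y′ b′ c′) c′

    Block : ℕ → ℕ → ℕ → Set
    Block L t best = Least (t * β) (t * β + β) L best

    private
      blockTest : Exp
      blockTest = v C.t ⊛ v C.b ⋖ v C.r

      block< : ∀ {t} → t * β < R → t < U
      block< {t} l = *-cancelʳ-< β t U (<-≤-trans l R≤Uβ)

      U≤room : U ≤ 16 * R + 16
      U≤room = ≤-trans U≤ (lin 1 (λ R → [] ⊢ ‵ 4 :* R :+ ‵ 4 :≤ ‵ 16 :* R :+ ‵ 16) R)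

      block<lim : ∀ {t} → t * β < R → t < lim
      block<lim l = <-≤-trans (block< l) (≤-trans U≤room room)

      block-suc : ∀ {t} → t * β < R → suc t < W
      block-suc l = small (≤-trans (block< l) U≤room)

      test-fine : ∀ {σ} t → Fixed σ → env σ C.t ≡ t → t * β ≤ R + β → ok blockTest σ
      test-fine t (fixed eR refl) refl l = (_ , _ , small (≤-trans l
        (lin 2 (λ R b → (b :≤ ‵ 4 :* R :+ ‵ 1) ∷ [] ⊢ R :+ b :≤ ‵ 16 :* R :+ ‵ 16) R β β≤))) , _

      moved : ∀ {c σ σ′} {_ : T (Data.Bool.Base.not (writesV c C.r))} {_ : T (Data.Bool.Base.not (writesV c C.b))} →
              Same c σ σ′ → Fixed σ → Fixed σ′
      moved {_} {_} {_} {a} {b} sm (fixed eR eβ) = fixed (trans (varₛ sm C.r {a}) eR) (trans (varₛ sm C.b {b}) eβ)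

      next-block : ∀ {t} → t * β < R → suc t * β ≤ R + β
      next-block {t} l = ≤-trans (≤-reflexive (+-comm β (t * β))) (+-monoˡ-≤ β (<⇒≤ l))

      -- The index may pass the last block once; `near` keeps the product in the loop test from
      -- overflowing then.
      record MinimaInv (L k : ℕ) (σ : Store) : Set where
        constructor minimaInv
        field
          left : U ∸ env σ C.t ≡ k
          near : env σ C.t * β ≤ R + β
          filled : ∀ t → t < env σ C.t → Block L t (arr σ C.BM t)

      minimaStep : ∀ {L k σ} → Fixed σ → env σ C.L ≡ L → MinimaInv L k σ → True blockTest σ →
                   Σ[ k′ ∈ ℕ ] k′ < k × Ends minimaBody σ (20 + (β * 100 + 100) + 20) (MinimaInv L k′)
      minimaStep {L} {k} {σ} F@(fixed refl refl) eL (minimaInv refl _ filled) tr =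
        U ∸ suc t , ∸-shrink (block< tr) ≤-refl ,
        (scan-correct t L F refl eL tr then λ {σ′} least sm →
         straight (C.BM [ v C.t ]:= v C.best ⨾ increment C.t)
          (_ , _ , subst (_< lim) (sym (varₛ sm C.t)) (block<lim tr) ,
          (_ , _ , subst (λ z → suc z < W) (sym (varₛ sm C.t)) (block-suc tr)) ,
          minimaInv (cong (λ z → U ∸ suc z) (varₛ sm C.t))
            (subst (λ z → suc z * β ≤ R + β) (sym (varₛ sm C.t)) (next-block {t} tr))
            (λ t′ l → stored-min sm least t′ (subst (λ z → t′ < suc z) (varₛ sm C.t) l))))
        where
        t = env σ C.t
        stored-min : ∀ {σ′} → Same scan σ σ′ → Block L t (env σ′ C.best) → ∀ t′ → t′ < suc t →
                     Block L t′ ((arr σ′ C.BM Defs.[ env σ′ C.t ≔ env σ′ C.best ]) t′)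
        stored-min {σ′} sm least t′ l with t′ ≟ t
        ... | yes refl = subst (Block L t) (sym (trans (cong (λ z → (arr σ′ C.BM Defs.[ z ≔ env σ′ C.best ]) t) (varₛ sm C.t))
                           (≔-hit (arr σ′ C.BM) t _))) least
        ... | no ne = subst (Block L t′) (sym (trans (≔-miss (arr σ′ C.BM) _ (λ e → ne (trans e (varₛ sm C.t)))) (arrₛ sm C.BM t′)))
                        (filled t′ (≤∧≢⇒< (s≤s⁻¹ l) ne))

    Blocks : ℕ → Store → Set
    Blocks L σ = ∀ t → t * β < R → Block L t (arr σ C.BM t)

    minima-correct : ∀ {L σ} → Fixed σ → env σ C.L ≡ L →
                     Ends minima σ (3 + (U * (40 + (20 + (β * 100 + 100) + 20)) + 40)) (Blocks L)
    minima-correct {L} (fixed eR eβ) eL = prefix 3 (C.t := # 0) (_ ,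
      (iterate blockTest minimaBody (MinimaInv L) U
        (λ k σ sm I → test-fine _ (moved sm (fixed eR eβ)) refl (MinimaInv.near I))
        (λ k σ sm I f t l → MinimaInv.filled I t (*-cancelʳ-< β t _ (<-≤-trans l
            (subst₂ (λ r b → r ≤ env σ C.t * b) (trans (varₛ sm C.r) eR) (trans (varₛ sm C.b) eβ) f))))
        (λ k σ sm I tr → minimaStep (moved sm (fixed eR eβ)) (trans (varₛ sm C.L) eL) I tr)
        (minimaInv refl z≤n λ _ ())))

    record Found (L : ℕ) (σ : Store) : Set where
      constructor found
      field
        minimum : Least 0 R L (env σ C.M)
        choice  : env σ C.M ≡ 0 ⊎ (env σ C.mt * β < R × arr σ C.BM (env σ C.mt) ≡ env σ C.M)

    private
      record FindInv (L k : ℕ) (σ : Store) : Set where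
        constructor findInv
        field
          left   : U ∸ env σ C.t ≡ k
          near   : env σ C.t * β ≤ R + β
          least  : Least 0 (env σ C.t * β) L (env σ C.M)
          choice : env σ C.M ≡ 0 ⊎ (env σ C.mt * β < R × arr σ C.BM (env σ C.mt) ≡ env σ C.M)

      findStep : ∀ {L k σ} → Fixed σ → Blocks L σ → FindInv L k σ → True blockTest σ →
                 Σ[ k′ ∈ ℕ ] k′ < k × Ends findBody σ 100 (FindInv L k′)
      findStep {L} {k} {σ} (fixed refl refl) blocks (findInv refl _ least choice) tr =
        U ∸ suc t , ∸-shrink (block< {t} tr) ≤-refl ,
        straight findBody ((_ , _ , block<lim tr) , _ ,
          (λ 0<b → _ , (λ M0 → _ , _ , (_ , _ , block-suc tr) ,
                         findInv refl (next-block {t} tr) (cast (join-right z≤n (m≤m+n _ β) (inj₁ M0) least block (>⇒≢ 0<b))) (inj₂ (tr , refl)))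
                     , (λ M≢0 → _ ,
                         (λ fewer → _ , _ , (_ , _ , block-suc tr) ,
                           findInv refl (next-block {t} tr) (cast (join-right z≤n (m≤m+n _ β) (inj₂ (<⇒≤ fewer)) least block (>⇒≢ 0<b))) (inj₂ (tr , refl)))
                       , (λ geq → (_ , _ , block-suc tr) ,
                           findInv refl (next-block {t} tr) (cast (join-left z≤n (m≤m+n _ β) (inj₂ geq) least block M≢0)) choice)))
          , (λ b≤0 → (_ , _ , block-suc tr) , findInv refl (next-block {t} tr) (cast (skip-block (n≤0⇒n≡0 b≤0))) choice))
        where
        t = env σ C.t
        block = blocks t tr
        cast : ∀ {b} → Least 0 (t * β + β) L b → Least 0 (suc t * β) L b
        cast {b} = subst (λ h → Least 0 h L b) (+-comm (t * β) β)
        skip-block : arr σ C.BM t ≡ 0 → Least 0 (t * β + β) L (env σ C.M)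
        skip-block b0 with env σ C.M ≟ 0
        ... | yes M0 = join-none M0 b0 least block
        ... | no M≢0 = join-left z≤n (m≤m+n _ β) (inj₁ b0) least block M≢0

    find-correct : ∀ {L σ} → Fixed σ → Blocks L σ → Ends find σ (10 + (U * 140 + 100)) (Found L)
    find-correct {L} {σ₀} (fixed eR eβ) blocks = prefix 10 (C.M := # 0 ⨾ C.mt := # 0 ⨾ C.t := # 0) (_ , _ , _ , atMost U 140 100
      (iterate blockTest findBody (FindInv L) U
        (λ k σ sm I → test-fine _ (moved sm (fixed eR eβ)) refl (FindInv.near I))
        (λ k σ sm I f → found (widen (subst₂ (λ r b → r ≤ env σ C.t * b) (trans (varₛ sm C.r) eR) (trans (varₛ sm C.b) eβ) f)
                                (FindInv.least I)) (FindInv.choice I))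
        (λ k σ sm I tr → findStep (moved sm (fixed eR eβ))
                           (λ t l → subst (Block L t) (sym (arrₛ sm C.BM t)) (blocks t l)) I tr)
        (findInv refl z≤n (none refl λ _ _ ()) (inj₁ refl))))
      where
      widen : ∀ {h b} → R ≤ h → Least 0 h L b → Least 0 R L b
      widen l (none e f) = none e λ y a _ c → f y a (<-≤-trans c l) c
      widen l (some y e a b c d f) = some y e a c c d λ y′ a′ _ c′ → f y′ a′ (<-≤-trans c′ l) c′

    record Sorted (σ : Store) : Set where
      field
        size   : env σ C.dn ≤ R
        order  : ∀ u u′ → u < u′ → u′ < env σ C.dn → arr σ C.D u < arr σ C.D u′
        onlyP  : ∀ u → u < env σ C.dn → ∃[ y ] (y < R × arr σ C.D u ≡ key y)
        everyP : ∀ y → y < R → ∃[ u ] (u < env σ C.dn × arr σ C.D u ≡ key y)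

    private
      -- By `everyP` the table holds all keys up to L, so it is complete when `next` finds no key
      -- above L.
      record SortInv (k : ℕ) (σ : Store) : Set where
        field
          fuel   : count (env σ C.L) R ≡ k
          size   : env σ C.dn + k ≤ R
          blocks : Blocks (env σ C.L) σ
          next   : Found (env σ C.L) σ
          order  : ∀ u u′ → u < u′ → u′ < env σ C.dn → arr σ C.D u < arr σ C.D u′
          onlyP  : ∀ u → u < env σ C.dn → ∃[ y ] (y < R × arr σ C.D u ≡ key y)
          low    : ∀ u → u < env σ C.dn → arr σ C.D u ≤ env σ C.L
          everyP : ∀ y → y < R → key y ≤ env σ C.L → ∃[ u ] (u < env σ C.dn × arr σ C.D u ≡ key y)

      sortTime : ℕ
      sortTime = 30 + ((20 + (β * 100 + 100)) + (20 + (10 + (U * 140 + 100))))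

      sortStep : ∀ {k σ} → Fixed σ → SortInv k σ → True (# 0 ⋖ v C.M) σ →
                 Σ[ k′ ∈ ℕ ] k′ < k × Ends sortBody σ sortTime (SortInv k′)
      sortStep {k} {σ} (fixed eR eβ) I 0<M with SortInv.next I
      ... | found (none M0 _) _ = contradiction M0 (>⇒≢ 0<M)
      ... | found _ (inj₁ M0) = contradiction M0 (>⇒≢ 0<M)
      ... | found (some y₀ key≡M _ _ y₀<R L<M isMin) (inj₂ (mt<R , BMmt≡M)) =
        count M R , subst (count M R <_) fuel fewer ,
        prefix 30 (C.D [ v C.dn ]:= v C.M ⨾ increment C.dn ⨾ C.L := v C.M ⨾ C.t := v C.mt)
          (_ , _ , dn<lim , (_ , _ , dn<W) , _ , _ ,
           (scan-correct mt M (fixed eR eβ) refl refl mt<R then λ {σ₁} least sm →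
            prefix 20 (C.BM [ v C.t ]:= v C.best) (_ , _ , subst (_< lim) (sym (varₛ sm C.t)) (block<lim mt<R) ,
             weaken (λ σ₂ (fd , sm₂) → finish sm sm₂ (λ t l → subst (Block M t) (sym (arrₛ sm₂ C.BM t)) (blocks′ sm least t l)) fd)
               (framed (find-correct (fixed (trans (varₛ sm C.r) eR) (trans (varₛ sm C.b) eβ)) (blocks′ sm least))))))
        where
        open SortInv I
        M = env σ C.M
        mt = env σ C.mt
        dn = env σ C.dn
        fewer : count M R < count (env σ C.L) R
        fewer = count-strict R y₀<R (subst (env σ C.L <_) (sym key≡M) L<M) (≤-reflexive key≡M)
        roomier : dn + suc (count M R) ≤ R
        roomier = ≤-trans (+-monoʳ-≤ dn (subst (suc (count M R) ≤_) fuel fewer)) size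
        dn<R : dn < R
        dn<R = ≤-trans (≤-trans (s≤s (m≤m+n dn _)) (≤-reflexive (sym (+-suc dn _)))) roomier
        dn<lim : dn < lim
        dn<lim = <-≤-trans dn<R (≤-trans (lin 1 (λ R → [] ⊢ R :≤ ‵ 16 :* R :+ ‵ 16) R) room)
        dn<W : suc dn < W
        dn<W = small (≤-trans dn<R (lin 1 (λ R → [] ⊢ R :≤ ‵ 16 :* R :+ ‵ 16) R))
        σ₀ : Store
        σ₀ = stored (((env σ Defs.[ C.dn ≔ suc dn ]) Defs.[ C.L ≔ M ]) Defs.[ C.t ≔ mt ]) (update (arr σ) C.D dn M) (out σ)
        minimal : ∀ y → y < R → env σ C.L < key y → M ≤ key y
        minimal y l l′ = isMin y z≤n l l l′
        -- Keys are distinct, so only the block of the extracted key loses its minimum.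
        separate : ∀ {t} → t * β < R → t ≢ mt → arr σ C.BM t ≢ M
        separate {t} l ne e with blocks t l | blocks mt mt<R
        ... | none z _ | _ = >⇒≢ 0<M (trans (sym e) z)
        ... | some _ _ _ _ _ _ _ | none z _ = >⇒≢ 0<M (trans (sym BMmt≡M) z)
        ... | some y k lo hi y<R _ _ | some y′ k′ lo′ hi′ y′<R _ _
          with key-injective y<R y′<R (trans k (trans e (trans (sym BMmt≡M) (sym k′))))
        ... | refl = ne (≤-antisym (same lo hi′) (same lo′ hi))
          where
          same : ∀ {t t′ y} → t * β ≤ y → y < t′ * β + β → t ≤ t′
          same {t} {t′} a b = s≤s⁻¹ (*-cancelʳ-< β t (suc t′) (≤-<-trans a (<-≤-trans b (≤-reflexive (+-comm (t′ * β) β)))))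
        blocks′ : ∀ {σ₁} → Same scan σ₀ σ₁ → Block M mt (env σ₁ C.best) →
                  ∀ t → t * β < R → Block M t ((arr σ₁ C.BM Defs.[ env σ₁ C.t ≔ env σ₁ C.best ]) t)
        blocks′ {σ₁} sm least t l with t ≟ mt
        ... | yes refl = subst (Block M mt) (sym (trans (cong (λ z → (arr σ₁ C.BM Defs.[ z ≔ env σ₁ C.best ]) mt) (varₛ sm C.t))
                           (≔-hit (arr σ₁ C.BM) mt _))) least
        ... | no ne = subst (Block M t) (sym (trans (≔-miss (arr σ₁ C.BM) _ (λ e → ne (trans e (varₛ sm C.t)))) (arrₛ sm C.BM t)))
                        (raise (<⇒≤ L<M) minimal (separate l ne) (blocks t l))
        D′ : ℕ → ℕ
        D′ = arr σ C.D Defs.[ dn ≔ M ]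
        at-dn : D′ dn ≡ M
        at-dn = ≔-hit (arr σ C.D) dn M
        before : ∀ {u} → u < dn → D′ u ≡ arr σ C.D u
        before l = ≔-miss (arr σ C.D) M (<⇒≢ l)
        view : ∀ {u} → u < suc dn → u < dn ⊎ u ≡ dn
        view l = m≤n⇒m<n∨m≡n (s≤s⁻¹ l)
        order′ : ∀ u u′ → u < u′ → u′ < suc dn → D′ u < D′ u′
        order′ u u′ l l′ with view l′
        ... | inj₁ u′< = subst₂ _<_ (sym (before (<-trans l u′<))) (sym (before u′<)) (order u u′ l u′<)
        ... | inj₂ refl = subst₂ _<_ (sym (before l)) (sym at-dn) (≤-<-trans (low u l) L<M)
        onlyP′ : ∀ u → u < suc dn → ∃[ y ] (y < R × D′ u ≡ key y)
        onlyP′ u l with view l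
        ... | inj₁ u< = let (y , y< , e) = onlyP u u< in y , y< , trans (before u<) e
        ... | inj₂ refl = y₀ , y₀<R , trans at-dn (sym key≡M)
        low′ : ∀ u → u < suc dn → D′ u ≤ M
        low′ u l with view l
        ... | inj₁ u< = subst (_≤ M) (sym (before u<)) (≤-trans (low u u<) (<⇒≤ L<M))
        ... | inj₂ refl = ≤-reflexive at-dn
        everyP′ : ∀ y → y < R → key y ≤ M → ∃[ u ] (u < suc dn × D′ u ≡ key y)
        everyP′ y y< l with key y ≤? env σ C.L
        ... | yes k≤L = let (u , u< , e) = everyP y y< k≤L in u , m<n⇒m<1+n u< , trans (before u<) e
        ... | no k≰L = dn , ≤-refl , trans at-dn (≤-antisym (minimal y y< (≰⇒> k≰L)) l)
        finish : ∀ {σ₁ σ₂} → (sm : Same scan σ₀ σ₁) →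
                 Same find (stored (env σ₁) (update (arr σ₁) C.BM (env σ₁ C.t) (env σ₁ C.best)) (out σ₁)) σ₂ →
                 (∀ t → t * β < R → Block M t (arr σ₂ C.BM t)) → Found M σ₂ → SortInv (count M R) σ₂
        finish {σ₁} {σ₂} sm sm₂ bl fd = record
          { fuel = cong (λ L → count L R) eL
          ; size = ≤-trans (≤-reflexive (trans (cong (_+ count M R) eDn) (sym (+-suc dn _)))) roomier
          ; blocks = λ t l → subst (λ L → Block L t _) (sym eL) (bl t l)
          ; next = subst (λ L → Found L σ₂) (sym eL) fd
          ; order = λ u u′ l l′ → subst₂ _<_ (sym (eD u)) (sym (eD u′)) (order′ u u′ l (in-range l′))
          ; onlyP = λ u l → let (y , y< , e) = onlyP′ u (in-range l) in y , y< , trans (eD u) e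
          ; low = λ u l → subst₂ _≤_ (sym (eD u)) (sym eL) (low′ u (in-range l))
          ; everyP = λ y y< l → let (u , u< , e) = everyP′ y y< (subst (key y ≤_) eL l) in
                                 u , subst (u <_) (sym eDn) u< , trans (eD u) e }
          where
          eL : env σ₂ C.L ≡ M
          eL = trans (varₛ sm₂ C.L) (varₛ sm C.L)
          eDn : env σ₂ C.dn ≡ suc dn
          eDn = trans (varₛ sm₂ C.dn) (varₛ sm C.dn)
          eD : ∀ u → arr σ₂ C.D u ≡ D′ u
          eD u = trans (arrₛ sm₂ C.D u) (arrₛ sm C.D u)
          in-range : ∀ {u} → u < env σ₂ C.dn → u < suc dn
          in-range = subst (_ <_) eDn

    sort-correct : ∀ {σ} → Fixed σ →
      Ends sort σ (3 + ((3 + (U * (40 + (20 + (β * 100 + 100) + 20)) + 40)) + (3 + ((10 + (U * 140 + 100)) + (R * (40 + sortTime) + 40))))) Sorted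
    sort-correct {σ} (fixed eR eβ) = prefix 3 (C.L := # 0) (_ ,
      (minima-correct (fixed eR eβ) refl then λ {σ₁} bl sm →
       prefix 3 (C.dn := # 0) (_ ,
       (find-correct (fixed (trans (varₛ sm C.r) eR) (trans (varₛ sm C.b) eβ)) bl then λ {σ₂} fd sm₂ →
        let eL = trans (varₛ sm₂ C.L) (varₛ sm C.L) ; eDn = varₛ sm₂ C.dn in
        within (+-monoˡ-≤ 40 (*-monoˡ-≤ (40 + sortTime) (count-≤ (env σ₂ C.L) R)))
        (iterate (# 0 ⋖ v C.M) sortBody SortInv (count (env σ₂ C.L) R)
          (λ k σ sm I → _)
          (λ k σ sm I f → exit I (n≤0⇒n≡0 f))
          (λ k σ sm₃ I → sortStep (moved sm₃ (moved sm₂ (fixed (trans (varₛ sm C.r) eR) (trans (varₛ sm C.b) eβ)))) I)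
          (record { fuel = refl ; size = subst (λ d → d + count (env σ₂ C.L) R ≤ R) (sym eDn) (count-≤ (env σ₂ C.L) R)
                  ; blocks = λ t l → subst₂ (λ L b → Block L t b) (sym eL) (sym (arrₛ sm₂ C.BM t)) (bl t l)
                  ; next = subst (λ L → Found L σ₂) (sym eL) fd
                  ; order = λ u u′ _ l → contradiction (subst (u′ <_) eDn l) λ ()
                  ; onlyP = λ u l → contradiction (subst (u <_) eDn l) λ ()
                  ; low = λ u l → contradiction (subst (u <_) eDn l) λ ()
                  ; everyP = λ y _ l → contradiction (<-≤-trans (key>0 y) (subst (key y ≤_) eL l)) λ () }))))))
      where
      exit : ∀ {k σ} → SortInv k σ → env σ C.M ≡ 0 → Sorted σ
      exit {k} {σ} I M0 = record
        { size = ≤-trans (m≤m+n _ k) (SortInv.size I) ; order = SortInv.order I ; onlyP = SortInv.onlyP I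
        ; everyP = λ y l → SortInv.everyP I y l (all (Found.minimum (SortInv.next I)) y l) }
        where
        all : Least 0 R (env σ C.L) (env σ C.M) → ∀ y → y < R → key y ≤ env σ C.L
        all (none _ f) y l = f y z≤n l l
        all (some y₀ e _ _ _ _ _) = contradiction (trans e M0) (>⇒≢ (key>0 y₀))

-- Names for the characters

module Character-names where

  open Language
  open Arithmetic
  open Key-sorting using (module Keys)
  open Code using (search; nameBody; name; increment)

  -- The name of a character is the first position in a sorted table D of keys whose key exceeds c * R;
  -- characters that do not occur in P are called R.
  module Naming (P : ℕ → ℕ) (R δ : ℕ) (D : ℕ → ℕ) (δ≤R : δ ≤ R)
    (order  : ∀ u u′ → u < u′ → u′ < δ → D u < D u′)
    (onlyP  : ∀ u → u < δ → ∃[ y ] (y < R × D u ≡ Keys.key P R y))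
    (everyP : ∀ y → y < R → ∃[ u ] (u < δ × D u ≡ Keys.key P R y)) where

    open Keys P R using (key)

    data Named (c u : ℕ) : Set where
      known   : u < δ → c * R < D u → D u ≤ c * R + R → (∀ u′ → u′ < u → D u′ ≤ c * R) → Named c u
      unknown : u ≡ R → (∀ y → y < R → P y ≢ c) → Named c u

    -- Characters own disjoint intervals of length R, and the key of y lies in that of its
    -- character.
    key-range : ∀ {c y} → y < R → c * R < key y → key y ≤ c * R + R → P y ≡ c
    key-range {c} {y} y< l l′ = ≤-antisym
      (s≤s⁻¹ (*-cancelʳ-< R (P y) (suc c) (<-≤-trans (≤-trans (s≤s (m≤m+n (P y * R) y)) (≤-reflexive (sym (+-suc _ y)))) (≤-trans l′ (≤-reflexive (+-comm (c * R) R))))))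
      (s≤s⁻¹ (*-cancelʳ-< R c (suc (P y)) (<-≤-trans l (≤-trans (+-monoʳ-≤ (P y * R) y<) (≤-reflexive (+-comm (P y * R) R))))))

    named-≤ : ∀ {c u} → Named c u → u ≤ R
    named-≤ (known u< _ _ _) = ≤-trans (<⇒≤ u<) δ≤R
    named-≤ (unknown e _)    = ≤-reflexive e

    private
      ≡ᵇ-true : ∀ x → (x ≡ᵇ x) ≡ true
      ≡ᵇ-true x with x ≡ᵇ x | ≡⇒≡ᵇ x x refl
      ... | true | _ = refl

      ≡ᵇ-false : ∀ {x y} → x ≢ y → (x ≡ᵇ y) ≡ false
      ≡ᵇ-false {x} {y} ne with x ≡ᵇ y in e
      ... | false = refl
      ... | true = contradiction (≡ᵇ⇒≡ x y (subst T (sym e) _)) ne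

    -- Characters foreign to P all share the name R. This does no harm, since one of the two
    -- compared is a character of P, whose name is an index of `D` and hence below R.
    named-match : ∀ {y u c u′} → y < R → Named (P y) u → Named c u′ → (u ≡ᵇ u′) ≡ (P y ≡ᵇ c)
    named-match y< (unknown _ f) _ = contradiction refl (f _ y<)
    named-match {y} {u} {c} {u′} y< (known u< a b f) (unknown e g) =
      trans (≡ᵇ-false (<⇒≢ (<-≤-trans u< (≤-trans δ≤R (≤-reflexive (sym e)))))) (sym (≡ᵇ-false (g y y<)))
    named-match {y} {u} {c} {u′} y< (known u< a b f) (known u′< a′ b′ f′) with P y ≟ c
    ... | no ne = trans (≡ᵇ-false distinct) (sym (≡ᵇ-false ne))
      where
      distinct : u ≢ u′
      distinct refl with onlyP u u<
      ... | y′ , y′< , e = ne (trans (sym (key-range y′< (subst (P y * R <_) e a) (subst (_≤ P y * R + R) e b)))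
                                (key-range y′< (subst (c * R <_) e a′) (subst (_≤ c * R + R) e b′)))
    ... | yes refl = trans (trans (cong (u ≡ᵇ_) (≤-antisym (≮⇒≥ λ l → <⇒≱ a (f′ u l)) (≮⇒≥ λ l → <⇒≱ a′ (f u′ l)))) (≡ᵇ-true u)) (sym (≡ᵇ-true (P y)))

  record NameSetting : Set where
    constructor nameSetting
    field
      sp : Space
    open Space sp public
    field
      R β U : ℕ
      R≤N : R ≤ N
      R≤Uβ : R ≤ U * β
      β≤ : β ≤ 4 * R + 1
      charW : ∀ τ i → charAt (input τ) i * R + (R + 1) < 2 ^ w
      δ : ℕ
      D : ℕ → ℕ
      δ≤R : δ ≤ R
      order : ∀ u u′ → u < u′ → u′ < δ → D u < D u′
      onlyP : ∀ u → u < δ → ∃[ y ] (y < R × D u ≡ Keys.key (charAt (input tapeP)) R y)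
      everyP : ∀ y → y < R → ∃[ u ] (u < δ × D u ≡ Keys.key (charAt (input tapeP)) R y)

  module Names (s : NameSetting) where

    open NameSetting s

    open Semantics mc
    open Keys (charAt (input tapeP)) R using (key)
    open Naming (charAt (input tapeP)) R δ D δ≤R order onlyP everyP

    record Fixed (σ : Store) : Set where
      constructor fixed
      field
        eR : env σ C.r ≡ R
        eβ : env σ C.b ≡ β
        eδ : env σ C.dn ≡ δ
        eD : ∀ u → arr σ C.D u ≡ D u

    private
      order≤ : ∀ {u u′} → u ≤ u′ → u′ < δ → D u ≤ D u′
      order≤ {u} {u′} l l′ with m≤n⇒m<n∨m≡n l
      ... | inj₁ l″ = <⇒≤ (order u u′ l″ l′)
      ... | inj₂ refl = ≤-refl

      below-lim : ∀ {u} → u < δ → u < lim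
      below-lim l = <-≤-trans (<-≤-trans l (≤-trans δ≤R R≤N)) (≤-trans (lin 1 (λ N → [] ⊢ N :≤ ‵ 16 :* N :+ ‵ 16) N) room)

      strideTest walkTest : Exp
      strideTest = (v C.u ⊕ v C.b ⋖ v C.dn) && (ld C.D (v C.u ⊕ v C.b) ⋖ # 1 ⊕ v C.key)
      walkTest   = (v C.u ⋖ v C.dn) && (ld C.D (v C.u) ⋖ # 1 ⊕ v C.key)

      record StrideInv (κ k : ℕ) (σ : Store) : Set where
        constructor strideInv
        field
          t    : ℕ
          at   : env σ C.u ≡ t * β
          left : U ∸ t ≡ k
          u≤R  : env σ C.u ≤ R
          low  : ∀ u → u < env σ C.u → D u ≤ κ

      record WalkInv (κ e k : ℕ) (σ : Store) : Set where
        constructor walkInv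
        field
          left : e ∸ env σ C.u ≡ k
          u≤R  : env σ C.u ≤ R
          low  : ∀ u → u < env σ C.u → D u ≤ κ

      Bounded : ℕ → ℕ → Set
      Bounded κ e = ∀ u → u < δ → D u ≤ κ → u < e

      stride-index : ∀ {u} → u ≤ R → u + β < W
      stride-index {u} l = small (lin 4 (λ u b R N → (u :≤ R) ∷ (b :≤ ‵ 4 :* R :+ ‵ 1) ∷ (‵ 5 ∙ (R :≤ N)) ∷ [] ⊢ u :+ b :≤ ‵ 16 :* N :+ ‵ 16) u β R N l β≤ R≤N)

      Found : ℕ → Store → Set
      Found κ σ = env σ C.u ≤ R × (∀ u → u < env σ C.u → D u ≤ κ) × False walkTest σ

    module _ (κ : ℕ) (κ< : κ + (R + 1) < W) where

      private
        suc-κ : suc κ < W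
        suc-κ = ≤-<-trans (lin 2 (λ k R → [] ⊢ ‵ 1 :+ k :≤ k :+ (R :+ ‵ 1)) κ R) κ<

        strideStep : ∀ {k σ} → Fixed σ → env σ C.key ≡ κ → StrideInv κ k σ → True strideTest σ →
                     Σ[ k′ ∈ ℕ ] k′ < k × Ends (C.u := v C.u ⊕ v C.b) σ 20 (StrideInv κ k′)
        strideStep {k} {σ} (fixed eR refl refl eD) refl (strideInv t at refl u≤R low) (in-table , small-key) =
          U ∸ suc t , ∸-shrink t<U ≤-refl ,
          straight (C.u := v C.u ⊕ v C.b) ((_ , _ , stride-index u≤R) ,
            strideInv (suc t) next refl (<⇒≤ (<-≤-trans in-table δ≤R))
              (λ u l → ≤-trans (<⇒≤ (order u _ l in-table)) (s≤s⁻¹ (subst (_< suc κ) (eD _) small-key))))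
          where
          next : env σ C.u + β ≡ suc t * β
          next = trans (cong (_+ β) at) (+-comm (t * β) β)
          t<U : t < U
          t<U = <-trans ≤-refl (*-cancelʳ-< β (suc t) U (<-≤-trans (subst (_< δ) next in-table) (≤-trans δ≤R R≤Uβ)))

        walkStep : ∀ {e k σ} → Fixed σ → env σ C.key ≡ κ → Bounded κ e → WalkInv κ e k σ → True walkTest σ →
                   Σ[ k′ ∈ ℕ ] k′ < k × Ends (increment C.u) σ 20 (WalkInv κ e k′)
        walkStep {e} {k} {σ} (fixed eR eβ refl eD) refl bounded (walkInv refl u≤R low) (in-table , small-key) =
          e ∸ suc u , ∸-shrink (bounded u in-table Du≤) ≤-refl ,
          straight (increment C.u) ((_ , _ , small (≤-trans (<-≤-trans in-table (≤-trans δ≤R R≤N)) (lin 1 (λ N → [] ⊢ N :≤ ‵ 16 :* N :+ ‵ 16) N))) ,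
            walkInv refl (<-≤-trans in-table δ≤R) low′)
          where
          u = env σ C.u
          Du≤ : D u ≤ κ
          Du≤ = s≤s⁻¹ (subst (_< suc κ) (eD u) small-key)
          low′ : ∀ u′ → u′ < suc u → D u′ ≤ κ
          low′ u′ l with m≤n⇒m<n∨m≡n (s≤s⁻¹ l)
          ... | inj₁ l′ = low u′ l′
          ... | inj₂ refl = Du≤

        refix : ∀ {c σ σ′} → (∀ u → arr σ′ C.D u ≡ arr σ C.D u) → {_ : T (not (writesV c C.r))} {_ : T (not (writesV c C.b))}
                {_ : T (not (writesV c C.dn))} → Same c σ σ′ → Fixed σ → Fixed σ′
        refix q {a} {b} {d} sm (fixed eR eβ eδ eD) =
          fixed (trans (varₛ sm C.r {a}) eR) (trans (varₛ sm C.b {b}) eβ) (trans (varₛ sm C.dn {d}) eδ) (λ u → trans (q u) (eD u))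

        stride-fine : ∀ {σ} → Fixed σ → env σ C.key ≡ κ → env σ C.u ≤ R → ok strideTest σ
        stride-fine (fixed eR refl refl eD) refl u≤R =
          ((_ , _ , stride-index u≤R) , _) , λ l → (_ , (_ , _ , stride-index u≤R) , below-lim l) , (_ , _ , suc-κ) , _

        walk-fine : ∀ {σ} → Fixed σ → env σ C.key ≡ κ → ok walkTest σ
        walk-fine (fixed eR refl refl eD) refl = _ , λ l → (_ , _ , below-lim l) , (_ , _ , suc-κ) , _

      scan-table : ∀ {σ} → Fixed σ → env σ C.key ≡ κ → env σ C.u ≡ 0 →
        Ends (while strideTest (C.u := v C.u ⊕ v C.b) ⨾ while walkTest (increment C.u)) σ
             ((U * 60 + 40) + (β * 60 + 40)) (Found κ)
      scan-table {σ₀} F eκ u0 =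
        iterate strideTest (C.u := v C.u ⊕ v C.b) (StrideInv κ)
          {Q = λ σ → Bounded κ (env σ C.u + β) × env σ C.u ≤ R × (∀ u → u < env σ C.u → D u ≤ κ)} U
          (λ k σ sm I → stride-fine (refix (arrₛ sm C.D) sm F) (trans (varₛ sm C.key) eκ) (StrideInv.u≤R I))
          (λ k σ sm I f → bounded (refix (arrₛ sm C.D) sm F) (trans (varₛ sm C.key) eκ) f , StrideInv.u≤R I , StrideInv.low I)
          (λ k σ sm I tr → strideStep (refix (arrₛ sm C.D) sm F) (trans (varₛ sm C.key) eκ) I tr)
          (strideInv 0 u0 refl (subst (_≤ R) (sym u0) z≤n) (λ u l → contradiction (subst (u <_) u0 l) λ ()))
        then λ {σ₁} (bd , u≤R , low) sm₁ →
        iterate walkTest (increment C.u) (WalkInv κ (env σ₁ C.u + β)) β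
          (λ k σ sm I → walk-fine (refix (arrₛ sm C.D) sm (refix (arrₛ sm₁ C.D) sm₁ F)) (trans (varₛ sm C.key) (trans (varₛ sm₁ C.key) eκ)))
          (λ k σ sm I f → WalkInv.u≤R I , WalkInv.low I , f)
          (λ k σ sm I tr → walkStep (refix (arrₛ sm C.D) sm (refix (arrₛ sm₁ C.D) sm₁ F)) (trans (varₛ sm C.key) (trans (varₛ sm₁ C.key) eκ)) bd I tr)
          (walkInv (m+n∸m≡n (env σ₁ C.u) β) u≤R low)
        where
        -- The refused stride shows it: either the table ends before its goal, or the key found
        -- there is too large and the table is sorted.
        bounded : ∀ {σ} → Fixed σ → env σ C.key ≡ κ → False strideTest σ → Bounded κ (env σ C.u + β)
        bounded {σ} (fixed eR refl refl eD) refl (inj₁ δ≤) u u< Du = <-≤-trans u< δ≤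
        bounded {σ} (fixed eR refl refl eD) refl (inj₂ (in-table , big)) u u< Du =
          ≰⇒> λ l → <⇒≱ (subst (suc κ ≤_) (eD _) big) (≤-trans (order≤ l u<) Du)

    search-correct : ∀ {σ} c → Fixed σ → env σ C.c ≡ c → c * R + (R + 1) < W →
      Ends search σ (20 + (((U * 60 + 40) + (β * 60 + 40)) + 60)) (λ σ′ → Named c (env σ′ C.u))
    search-correct {σ} c (fixed refl eβ eδ eD) refl c< = prefix 20 (C.key := v C.c ⊛ v C.r ⨾ C.u := # 0)
      ((_ , _ , ≤-<-trans (m≤m+n _ (R + 1)) c<) , _ ,
      (scan-table (c * R) c< (fixed refl eβ eδ eD) refl refl then λ {σ₁} (u≤R , low , f) sm →
       finish sm u≤R low f (trans (varₛ sm C.r) refl) (trans (varₛ sm C.dn) eδ) (varₛ sm C.key) (λ u → trans (arrₛ sm C.D u) (eD u))))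
      where
      choice : Cmd
      choice = cond ((v C.u ⋖ v C.dn) && (ld C.D (v C.u) ⋖ # 1 ⊕ (v C.key ⊕ v C.r))) skip (C.u := v C.r)
      key+R : suc (c * R + R) < W
      key+R = subst (_< W) (trans (cong (c * R +_) (+-comm R 1)) (+-suc (c * R) R)) c<
      finish : ∀ {σ₁} → _ → env σ₁ C.u ≤ R → (∀ u → u < env σ₁ C.u → D u ≤ c * R) → False walkTest σ₁ →
               env σ₁ C.r ≡ R → env σ₁ C.dn ≡ δ → env σ₁ C.key ≡ c * R → (∀ u → arr σ₁ C.D u ≡ D u) →
               Ends choice σ₁ 60 (λ σ′ → Named c (env σ′ C.u))
      finish {σ₁} _ u≤R low f eR eδ eκ eD = straight choice
        ((_ , λ l → (_ , _ , below-lim (subst (u <_) eδ l)) , (_ , (_ , _ , <-trans ≤-refl sum<) , sum<) , _) ,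
         (λ (l , l′) → known (subst (u <_) eδ l) (above f l) (s≤s⁻¹ (subst₂ (λ a b → a < suc b) (eD u) (cong₂ _+_ eκ eR) l′)) low) ,
         (λ g → _ , unknown eR (absent g)))
        where
        u = env σ₁ C.u
        sum< : suc (env σ₁ C.key + env σ₁ C.r) < W
        sum< = subst (λ z → suc z < W) (sym (cong₂ _+_ eκ eR)) key+R
        above : False walkTest σ₁ → u < env σ₁ C.dn → c * R < D u
        above (inj₁ δ≤u) l = contradiction l (≤⇒≯ δ≤u)
        above (inj₂ (_ , b)) l = subst₂ (λ a k → suc k ≤ a) (eD u) eκ b
        -- An occurrence of c has its key at some index x of the table. Entries before u are too
        -- small, so u ≤ x; then entry u, being at most entry x, would have passed the test.
        absent : False ((v C.u ⋖ v C.dn) && (ld C.D (v C.u) ⋖ # 1 ⊕ (v C.key ⊕ v C.r))) σ₁ →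
                 ∀ y → y < R → charAt (input tapeP) y ≢ c
        absent g y y< e with everyP y y<
        ... | x , x<δ , Dx = refute g
          where
          upper : D x ≤ c * R + R
          upper = subst₂ (λ a k → a ≤ k * R + R) (sym Dx) e (+-monoʳ-≤ (charAt (input tapeP) y * R) y<)
          lower : c * R < D x
          lower = subst₂ (λ a k → k * R < a) (sym Dx) e (m<m+n (charAt (input tapeP) y * R) (s≤s z≤n))
          u≤x : u ≤ x
          u≤x = ≮⇒≥ λ l → <⇒≱ lower (low x l)
          refute : ¬ False ((v C.u ⋖ v C.dn) && (ld C.D (v C.u) ⋖ # 1 ⊕ (v C.key ⊕ v C.r))) σ₁
          refute (inj₁ δ≤u) = <⇒≱ (≤-<-trans u≤x x<δ) (subst (_≤ u) eδ δ≤u)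
          refute (inj₂ (_ , big)) = <⇒≱ (subst₂ (λ a b → suc b ≤ a) (eD u) (cong₂ _+_ eκ eR) big) (≤-trans (order≤ u≤x x<δ) upper)

    record TextSetting : Set where
      constructor textSetting
      field
        τ : Tape
        l o o′ : ℕ
        size : o + l ≤ o′
        inside : o′ + l ≤ 16 * N + 15

    module Text (t : TextSetting) where

      open TextSetting t

      private
        tx : ℕ → ℕ
        tx j = charAt (input τ) j

        nameTest : Exp
        nameTest = v C.j ⋖ v C.ln

      record Params (σ : Store) : Set where
        constructor params
        field
          eln : env σ C.ln ≡ l
          etb : env σ C.tb ≡ o
          epb : env σ C.pb ≡ o′

      -- Texts are named in the order of their places in `NM`, so `outside` protects those named
      -- earlier.
      record Result (α : ℕ → ℕ) (j : ℕ) (β : ℕ → ℕ) : Set where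
        constructor result
        field
          forwards  : ∀ j′ → j′ < j → Named (tx j′) (β (o + j′))
          backwards : ∀ j′ → j′ < j → Named (tx j′) (β (o′ + (l ∸ suc j′)))
          outside   : ∀ z → z < o → β z ≡ α z

      private
        NameInv : (ℕ → ℕ) → ℕ → Store → Set
        NameInv α k σ = env σ C.j + k ≡ l × Result α (env σ C.j) (arr σ C.NM)

        nameTime : ℕ
        nameTime = 10 + ((20 + (((U * 60 + 40) + (β * 60 + 40)) + 60)) + 60)

        extend : ∀ {α j γ u} → j < l → Named (tx j) u → Result α j γ →
                 Result α (suc j) ((γ Defs.[ o + j ≔ u ]) Defs.[ o′ + (l ∸ suc j) ≔ u ])
        extend {α} {j} {γ} {u} j<l nm (result f b out) = result forwards′ backwards′ outside′
          where
          γ₁ = γ Defs.[ o + j ≔ u ]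
          apart : ∀ {j′ x} → j′ < l → o + j′ ≢ o′ + x
          apart {j′} {x} j′< = <⇒≢ (<-≤-trans (+-monoʳ-< o j′<) (≤-trans size (m≤m+n o′ x)))
          forwards′ : ∀ j′ → j′ < suc j → Named (tx j′) ((γ₁ Defs.[ o′ + (l ∸ suc j) ≔ u ]) (o + j′))
          forwards′ j′ j′< with m≤n⇒m<n∨m≡n (s≤s⁻¹ j′<)
          ... | inj₂ refl = subst (Named (tx j)) (sym (trans (≔-miss γ₁ u (apart j<l)) (≔-hit γ (o + j) u))) nm
          ... | inj₁ l′ = subst (Named (tx j′)) (sym (trans (≔-miss γ₁ u (apart (<-trans l′ j<l)))
                            (≔-miss γ u (λ e → <⇒≢ l′ (+-cancelˡ-≡ o j′ j e))))) (f j′ l′)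
          backwards′ : ∀ j′ → j′ < suc j → Named (tx j′) ((γ₁ Defs.[ o′ + (l ∸ suc j) ≔ u ]) (o′ + (l ∸ suc j′)))
          backwards′ j′ j′< with m≤n⇒m<n∨m≡n (s≤s⁻¹ j′<)
          ... | inj₂ refl = subst (Named (tx j)) (sym (≔-hit γ₁ (o′ + (l ∸ suc j)) u)) nm
          ... | inj₁ l′ = subst (Named (tx j′)) (sym (trans (≔-miss γ₁ u
                              (λ e → <⇒≢ l′ (suc-injective (∸-cancelˡ-≡ (<-trans l′ j<l) j<l (+-cancelˡ-≡ o′ _ _ e)))))
                            (≔-miss γ u (λ e → apart j<l (sym e))))) (b j′ l′)
          outside′ : ∀ z → z < o → ((γ₁ Defs.[ o′ + (l ∸ suc j) ≔ u ]) z) ≡ α z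
          outside′ z z< = trans (≔-miss γ₁ u (<⇒≢ (<-≤-trans z< (≤-trans (m≤m+n o l) (≤-trans size (m≤m+n o′ _))))))
            (trans (≔-miss γ u (<⇒≢ (<-≤-trans z< (m≤m+n o j)))) (out z z<))

        nameStep : ∀ {α k σ} → Fixed σ → Params σ → NameInv α k σ → True nameTest σ →
                   Σ[ k′ ∈ ℕ ] k′ < k × Ends (nameBody τ) σ nameTime (NameInv α k′)
        nameStep {α} {zero} {σ} F (params refl refl refl) (e , I) tr =
          contradiction (subst (_< l) (trans (sym (+-identityʳ _)) e) tr) (<-irrefl refl)
        nameStep {α} {suc k} {σ} (fixed eR eβ eδ eD) (params refl refl refl) (e , I) tr = k , ≤-refl ,
          prefix 10 (C.c := rd τ (v C.j)) (_ ,
           (search-correct (tx j) (fixed eR eβ eδ eD) refl (charW τ j) then λ {σ₁} nm sm →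
            let ej = varₛ sm C.j ; etb = varₛ sm C.tb ; epb = varₛ sm C.pb ; eln = varₛ sm C.ln in
            straight (C.NM [ v C.tb ⊕ v C.j ]:= v C.u ⨾ C.NM [ v C.pb ⊕ (v C.ln ⊖ (# 1 ⊕ v C.j)) ]:= v C.u ⨾ increment C.j)
             ( (_ , _ , subst₂ (λ a b → a + b < W) (sym etb) (sym ej) (small fwd))
             , _ , subst₂ (λ a b → a + b < lim) (sym etb) (sym ej) (room′ fwd′)
             , (_ , (_ , (_ , _ , subst (λ a → suc a < W) (sym ej) (small suc-j)) , _)
                 , subst (_< W) (sym (cong₂ _+_ epb (cong₂ (λ a b → a ∸ suc b) eln ej))) (small bwd))
             , _ , subst (_< lim) (sym (cong₂ _+_ epb (cong₂ (λ a b → a ∸ suc b) eln ej))) (room′ bwd′)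
             , (_ , _ , subst (λ a → suc a < W) (sym ej) (small suc-j))
             , trans (cong (λ z → suc z + k) ej) (trans (sym (+-suc j k)) e)
             , retarget sm nm ej etb epb eln)))
          where
          j = env σ C.j
          fwd′ : o + j ≤ 16 * N + 15
          fwd′ = ≤-trans (+-monoʳ-≤ o (<⇒≤ tr)) (≤-trans size (≤-trans (m≤m+n o′ l) inside))
          fwd : o + j ≤ 16 * N + 16
          fwd = ≤-trans fwd′ (+-monoʳ-≤ (16 * N) (n≤1+n 15))
          bwd′ : o′ + (l ∸ suc j) ≤ 16 * N + 15
          bwd′ = ≤-trans (+-monoʳ-≤ o′ (m∸n≤m l (suc j))) inside
          bwd : o′ + (l ∸ suc j) ≤ 16 * N + 16
          bwd = ≤-trans bwd′ (+-monoʳ-≤ (16 * N) (n≤1+n 15))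
          suc-j : suc j ≤ 16 * N + 16
          suc-j = ≤-trans tr (≤-trans (m≤n+m l o′) (≤-trans inside (+-monoʳ-≤ (16 * N) (n≤1+n 15))))
          retarget : ∀ {σ₁} → Same search _ σ₁ → Named (tx j) (env σ₁ C.u) → env σ₁ C.j ≡ j → env σ₁ C.tb ≡ o → env σ₁ C.pb ≡ o′ → env σ₁ C.ln ≡ l →
            Result α (suc (env σ₁ C.j))
              ((arr σ₁ C.NM Defs.[ env σ₁ C.tb + env σ₁ C.j ≔ env σ₁ C.u ]) Defs.[ env σ₁ C.pb + (env σ₁ C.ln ∸ suc (env σ₁ C.j)) ≔ env σ₁ C.u ])
          retarget {σ₁} sm nm ej etb epb eln rewrite ej | etb | epb | eln =
            extend tr nm (result
              (λ j′ l → subst (Named (tx j′)) (sym (arrₛ sm C.NM _)) (Result.forwards I j′ l))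
              (λ j′ l → subst (Named (tx j′)) (sym (arrₛ sm C.NM _)) (Result.backwards I j′ l))
              (λ z l → trans (arrₛ sm C.NM z) (Result.outside I z l)))

      name-correct : ∀ {σ} → Fixed σ → Params σ → Ends (name τ) σ (3 + (l * (40 + (10 + ((20 + (((U * 60 + 40) + (β * 60 + 40)) + 60)) + 60))) + 40))
                       (λ σ′ → Result (arr σ C.NM) l (arr σ′ C.NM))
      name-correct {σ₀} (fixed eR eβ eδ eD) (params eln etb epb) = prefix 3 (C.j := # 0) (_ ,
        iterate nameTest (nameBody τ) (NameInv (arr σ₀ C.NM)) l
          (λ k σ sm I → _)
          (λ k σ sm (e , I) f → subst (λ j → Result (arr σ₀ C.NM) j (arr σ C.NM))
             (≤-antisym (≤-trans (m≤m+n _ k) (≤-reflexive e)) (subst (_≤ env σ C.j) (trans (varₛ sm C.ln) eln) f)) I)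
          (λ k σ sm I tr → nameStep
             (fixed (trans (varₛ sm C.r) eR) (trans (varₛ sm C.b) eβ) (trans (varₛ sm C.dn) eδ) (λ u → trans (arrₛ sm C.D u) (eD u)))
             (params (trans (varₛ sm C.ln) eln) (trans (varₛ sm C.tb) etb) (trans (varₛ sm C.pb) epb)) I tr)
          (refl , result (λ _ ()) (λ _ ()) (λ _ _ → refl)))

-- Bit-parallel matching, block by block

module Bit-parallel-matching where

  open import Data.Sum.Base using ([_,_])
  open Language
  open Arithmetic
  open BitVectors
  open Embeddings
  open Code using (run; runBody; fillBody; maskBody; stepBody; arrive; match; leave; moveOn; clearBody)

  -- A mask other than 0 belongs to a character of the block; so clearing along the block clears
  -- every mask.
  val-nonzero : ∀ m f → val m f ≡ 0 ⊎ ∃[ y ] (y < m × f y ≡ true)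
  val-nonzero zero    f = inj₁ refl
  val-nonzero (suc m) f with f m in e
  ... | true  = inj₂ (m , ≤-refl , e)
  ... | false with val-nonzero m f
  ... | inj₁ z = inj₁ (trans (+-identityʳ _) z)
  ... | inj₂ (y , y< , e′) = inj₂ (y , m<n⇒m<1+n y< , e′)

  record RunSetting : Set where
    constructor runSetting
    field
      sp : Space
    open Space sp public
    field
      R β Β U : ℕ
      R≤N : R ≤ N
      R≤Uβ : R ≤ U * β
      power : Β ≡ 2 ^ β
      upper : Β * Β ≤ 4 * R + 1
      β>0 : 0 < R → 0 < β
      P Tx : ℕ → ℕ

  module Running (s : RunSetting) where

    open RunSetting s

    open Semantics mc
    open Embedding P Tx using (arrives; waits; stays; waits-split; arrives-suc; arrives-start)

    private

      0<Β : 0 < Β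
      0<Β = subst (0 <_) (sym power) (m^n>0 2 β)

      Β≤ : Β ≤ 4 * R + 1
      Β≤ = ≤-trans (≤-trans (≤-reflexive (sym (*-identityʳ Β))) (*-monoʳ-≤ Β 0<Β)) upper

      R≤ : 4 * R + 1 ≤ 4 * N + 1
      R≤ = +-monoˡ-≤ 1 (*-monoʳ-≤ 4 R≤N)

      Β-small : Β ≤ 4 * N + 1
      Β-small = ≤-trans Β≤ R≤

    -- Names enter only as indices and through the outcome of comparisons, so a text and its
    -- reversal are treated alike.
    record BlockSetting : Set where
      constructor blockSetting
      field
        tb pb eo : ℕ
        tb+ : tb + N ≤ 6 * N
        pb+ : pb + R ≤ 6 * N
        eo+ : eo ≤ N + 1
        NM AN : ℕ → ℕ
        conjs : ∀ a d → a < Β → d < Β → AN (a * Β + d) ≡ conj β a d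
        pn≤ : ∀ q → q < R → NM (pb + q) ≤ R
        tn≤ : ∀ j → j < N → NM (tb + j) ≤ R
        matching : ∀ q j → q < R → j < N → (NM (pb + q) ≡ᵇ NM (tb + j)) ≡ (P q ≡ᵇ Tx j)

    module Block (b : BlockSetting) where

      open BlockSetting b

      record Fixed (σ : Store) : Set where
        constructor fixed
        field
          en  : env σ C.n ≡ N
          er  : env σ C.r ≡ R
          eb  : env σ C.b ≡ β
          eB  : env σ C.B ≡ Β
          etb : env σ C.tb ≡ tb
          epb : env σ C.pb ≡ pb
          eeo : env σ C.eo ≡ eo
          eNM : ∀ z → arr σ C.NM z ≡ NM z
          eAN : ∀ z → arr σ C.AN z ≡ AN z

      refix : ∀ {c σ σ′} → (∀ z → arr σ′ C.NM z ≡ arr σ C.NM z) → (∀ z → arr σ′ C.AN z ≡ arr σ C.AN z) →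
              {_ : T (not (writesV c C.n))} {_ : T (not (writesV c C.r))} {_ : T (not (writesV c C.b))} {_ : T (not (writesV c C.B))}
              {_ : T (not (writesV c C.tb))} {_ : T (not (writesV c C.pb))} {_ : T (not (writesV c C.eo))} →
              Same c σ σ′ → Fixed σ → Fixed σ′
      refix p q {a} {b} {c} {d} {e} {f} {g} sm (fixed en er eb eB etb epb eeo eNM eAN) =
        fixed (trans (varₛ sm C.n {a}) en) (trans (varₛ sm C.r {b}) er) (trans (varₛ sm C.b {c}) eb) (trans (varₛ sm C.B {d}) eB)
              (trans (varₛ sm C.tb {e}) etb) (trans (varₛ sm C.pb {f}) epb) (trans (varₛ sm C.eo {g}) eeo)
              (λ z → trans (p z) (eNM z)) (λ z → trans (q z) (eAN z))

      -- The length is written `suc m` because digit m, the last of a nonempty block, decides what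
      -- leaves it.
      module At (st m : ℕ) (fits : st + suc m ≤ R) (narrow : suc m ≤ β) where

        private
          ln = suc m

          pn tn : ℕ → ℕ
          pn y = NM (pb + (st + y))
          tn j = NM (tb + j)

          st<R : ∀ {y} → y < ln → st + y < R
          st<R l = <-≤-trans (+-monoʳ-< st l) fits

          pn-index : ∀ {y} → y < ln → pb + (st + y) ≤ 16 * N + 15
          pn-index l = ≤-trans (≤-trans (<⇒≤ (+-monoʳ-< pb (st<R l))) pb+) (lin 1 (λ N → [] ⊢ ‵ 6 :* N :≤ ‵ 16 :* N :+ ‵ 15) N)

          pn-small : ∀ {y} → y < ln → pn y ≤ 16 * N + 15
          pn-small l = ≤-trans (pn≤ _ (st<R l)) (≤-trans R≤N (lin 1 (λ N → [] ⊢ N :≤ ‵ 16 :* N :+ ‵ 15) N))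

          st+-small : ∀ {y} → y < ln → st + y < W
          st+-small {y} l = small (≤-trans (≤-trans (<⇒≤ (st<R l)) R≤N) (lin 1 (λ N → [] ⊢ N :≤ ‵ 16 :* N :+ ‵ 16) N))

          suc-small : ∀ {y} → y < ln → suc y < W
          suc-small {y} l = small (≤-trans (≤-trans l (≤-trans (m≤n+m ln st) (≤-trans fits R≤N))) (lin 1 (λ N → [] ⊢ N :≤ ‵ 16 :* N :+ ‵ 16) N))

          2^-≤ : ∀ {x} → x ≤ ln → 2 ^ x ≤ Β
          2^-≤ l = ≤-trans (^-monoʳ-≤ 2 (≤-trans l narrow)) (≤-reflexive (sym power))

          Β-W : ∀ {x} → x ≤ Β → x < W
          Β-W l = small (≤-trans l (≤-trans Β-small (lin 1 (λ N → [] ⊢ ‵ 4 :* N :+ ‵ 1 :≤ ‵ 16 :* N :+ ‵ 16) N)))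

        mask : ℕ → ℕ → ℕ
        mask x u = val x (λ y → pn y ≡ᵇ u)

        private
          blockTest : Exp
          blockTest = v C.x ⋖ v C.ln

          record MaskInv (k : ℕ) (σ : Store) : Set where
            constructor maskInv
            field
              rest  : env σ C.x + k ≡ ln
              digit : env σ C.hi ≡ 2 ^ env σ C.x
              last  : ∀ x → env σ C.x ≡ suc x → env σ C.top ≡ 2 ^ x
              masks : ∀ u → arr σ C.MK u ≡ mask (env σ C.x) u

          maskStep : ∀ {k σ} → Fixed σ → env σ C.st ≡ st → env σ C.ln ≡ ln → MaskInv k σ → True blockTest σ →
                     Σ[ k′ ∈ ℕ ] k′ < k × Ends maskBody σ 80 (MaskInv k′)
          maskStep {zero} F est eln (maskInv rest _ _ _) tr =
            contradiction (subst₂ _<_ (trans (sym (+-identityʳ _)) rest) eln tr) (<-irrefl refl)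
          maskStep {suc k} {σ} (fixed _ _ _ _ _ refl _ eNM _) refl eln (maskInv rest hi≡ _ masks) tr = k , ≤-refl ,
            straight maskBody (okI , (((_ , okI , name<) , _ , sum<) , name< , _ , (_ , _ , double<) , (_ , _ , suc-small x<) ,
              maskInv (trans (sym (+-suc x k)) rest) (trans (cong₂ _+_ hi≡ hi≡) (cong (2 ^ x +_) (sym (+-identityʳ _))))
                (λ { _ refl → hi≡ }) masks′))
            where
            x = env σ C.x
            x< : x < ln
            x< = subst (x <_) eln tr
            okI = _ , (_ , (_ , _ , st+-small x<) , small (loosen (pn-index x<))) , room′ (pn-index x<)
            name = arr σ C.NM (pb + (st + x))
            name≡ : name ≡ pn x
            name≡ = eNM _
            name< : name < lim
            name< = subst (_< lim) (sym name≡) (room′ (pn-small x<))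
            double : 2 ^ x + 2 ^ x ≤ Β
            double = ≤-trans (≤-reflexive (cong (2 ^ x +_) (sym (+-identityʳ _)))) (2^-≤ x<)
            double< : env σ C.hi + env σ C.hi < W
            double< = Β-W (subst (λ h → h + h ≤ Β) (sym hi≡) double)
            sum< : arr σ C.MK name + env σ C.hi < W
            sum< = Β-W (subst₂ (λ a h → a + h ≤ Β) (sym (masks name)) (sym hi≡)
                     (≤-trans (+-monoˡ-≤ (2 ^ x) (<⇒≤ (val-< x _))) double))
            masks′ : ∀ u → (arr σ C.MK Defs.[ name ≔ arr σ C.MK name + env σ C.hi ]) u ≡ mask (suc x) u
            masks′ u with u ≟ name
            ... | yes refl = trans (≔-hit (arr σ C.MK) name _) (cong₂ _+_ (masks name)
                    (trans hi≡ (sym (trans (cong (λ b → bit b * 2 ^ x) (hit-name (sym name≡))) (+-identityʳ _)))))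
              where
              hit-name : ∀ {a b} → a ≡ b → (a ≡ᵇ b) ≡ true
              hit-name {a} refl with a ≡ᵇ a | ≡⇒≡ᵇ a a refl
              ... | true | _ = refl
            ... | no ne = trans (≔-miss (arr σ C.MK) _ ne) (trans (masks u)
                    (sym (trans (cong (λ b → mask x u + bit b * 2 ^ x) (miss-name λ e → ne (sym (trans name≡ e)))) (+-identityʳ _))))
              where
              miss-name : ∀ {a b} → a ≢ b → (a ≡ᵇ b) ≡ false
              miss-name {a} {b} ne with a ≡ᵇ b in e
              ... | false = refl
              ... | true = contradiction (≡ᵇ⇒≡ a b (subst T (sym e) _)) ne

        record Masked (σ : Store) : Set where
          constructor masked
          field
            masks : ∀ u → arr σ C.MK u ≡ mask ln u
            top   : env σ C.top ≡ 2 ^ m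

        mask-correct : ∀ {σ} → Fixed σ → env σ C.st ≡ st → env σ C.ln ≡ ln → env σ C.x ≡ 0 → env σ C.hi ≡ 1 →
                       (∀ u → arr σ C.MK u ≡ 0) → Ends (while blockTest maskBody) σ (β * 120 + 40) Masked
        mask-correct F est eln ex ehi MK0 = within (+-monoˡ-≤ 40 (*-monoˡ-≤ 120 narrow))
          (iterate blockTest maskBody MaskInv ln
            (λ k σ sm I → _)
            (λ k σ sm I f → let x≡ = ≤-antisym (≤-trans (m≤m+n _ k) (≤-reflexive (MaskInv.rest I))) (subst (_≤ env σ C.x) (trans (varₛ sm C.ln) eln) f) in
               masked (λ u → trans (MaskInv.masks I u) (cong (λ x → mask x u) x≡)) (MaskInv.last I m x≡))
            (λ k σ sm I tr → maskStep (refix (arrₛ sm C.NM) (arrₛ sm C.AN) sm F) (trans (varₛ sm C.st) est) (trans (varₛ sm C.ln) eln) I tr)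
            (maskInv (cong (_+ ln) ex) (trans ehi (cong (2 ^_) (sym ex))) (λ x e → contradiction (trans (sym ex) e) λ ())
              (λ u → trans (MK0 u) (cong (λ x → mask x u) (sym ex)))))

        -- The digits of S before character j is read and before pending arrivals are added.
        pending : ℕ → ℕ → Bool
        pending j zero    = stays st j
        pending j (suc x) = waits (st + suc x) j

        private
          full : ℕ → ℕ → Bool
          full j x = waits (st + x) j

          equal′ : ℕ → ℕ → Bool
          equal′ j x = P (st + x) ≡ᵇ Tx j

          moving : ℕ → ℕ → Bool
          moving j x = full j x ∧ equal′ j x

          waits-0 : ∀ j → waits st j ≡ waits (st + 0) j
          waits-0 j = cong (λ z → waits z j) (sym (+-identityʳ st))

          -- By `waits-split`, setting the lowest digit is all that an arrival has to do; the other
          -- digits are complete.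
          arrived : ∀ j → arrives st j ≡ true → ∀ x → x < ln → set0 (pending j) x ≡ full j x
          arrived j a zero    _ = sym (trans (sym (waits-0 j)) (trans (waits-split st j) (cong (_∨ stays st j) a)))
          arrived j a (suc x) _ = refl

          nothing-new : ∀ j → arrives st j ≡ false → ∀ x → x < ln → pending j x ≡ full j x
          nothing-new j a zero    _ = sym (trans (sym (waits-0 j)) (trans (waits-split st j) (cong (_∨ stays st j) a)))
          nothing-new j a (suc x) _ = refl

          ∨-comm′ : ∀ a b → a ∨ b ≡ b ∨ a
          ∨-comm′ true  true  = refl
          ∨-comm′ true  false = refl
          ∨-comm′ false true  = refl
          ∨-comm′ false false = refl

          ∨-false : ∀ a → a ∨ false ≡ a
          ∨-false true  = refl
          ∨-false false = refl

          -- Digit x + 1 is active afterwards if it stayed or if digit x moved up, by `arrives-suc`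
          -- and `waits-split`. Digit 0 only stays: its arrivals are added in the next round.
          advanced : ∀ j x → x < ln → (full j x ∧ not (equal′ j x)) ∨ shift (moving j) x ≡ pending (suc j) x
          advanced j zero    _ = trans (∨-false _) (cong (λ z → stays z (suc j)) (+-identityʳ st))
          advanced j (suc x) _ = trans (∨-comm′ _ (moving j x)) (trans (cong (_∨ stays (st + suc x) (suc j))
            (trans (sym (arrives-suc (st + x) j)) (cong (λ z → arrives z (suc j)) (sym (+-suc st x)))))
            (sym (waits-split (st + suc x) (suc j))))

          leaving : ∀ j → arrives (st + ln) (suc j) ≡ moving j m
          leaving j = trans (cong (λ z → arrives z (suc j)) (+-suc st m)) (arrives-suc (st + m) j)

          pending-0 : ∀ x → x < ln → false ≡ pending 0 x
          pending-0 zero    _ = refl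
          pending-0 (suc x) _ = sym (cong (λ z → waits z 0) (+-suc st x))

          leaving-0 : arrives (st + ln) 0 ≡ false
          leaving-0 = cong (λ z → arrives z 0) (+-suc st m)

          stepTest : Exp
          stepTest = v C.j ⋖ v C.n

          record StepInv (ε : ℕ → ℕ) (k : ℕ) (σ : Store) : Set where
            constructor stepInv
            field
              rest   : env σ C.j + k ≡ N
              digits : env σ C.S ≡ val ln (pending (env σ C.j))
              out    : env σ C.po ≡ bit (arrives (st + ln) (env σ C.j))
              past   : ∀ j → j < env σ C.j → arr σ C.E (eo + j) ≡ bit (arrives (st + ln) j)
              future : ∀ j → env σ C.j ≤ j → j ≤ N → arr σ C.E (eo + j) ≡ bit (arrives st j)
              others : ∀ z → z < eo → arr σ C.E z ≡ ε z

          bit≢0 : ∀ {b} → bit b ≢ 0 → b ≡ true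
          bit≢0 {true}  _ = refl
          bit≢0 {false} n = contradiction refl n

          bit≡0 : ∀ {b} → bit b ≡ 0 → b ≡ false
          bit≡0 {false} _ = refl

          val-Β : ∀ {x} f → x ≤ ln → val x f < Β
          val-Β {x} f l = <-≤-trans (val-< x f) (2^-≤ l)

          stepStep : ∀ {ε k σ} → Fixed σ → Masked σ → StepInv ε k σ → True stepTest σ →
                     Σ[ k′ ∈ ℕ ] k′ < k × Ends stepBody σ 200 (StepInv ε k′)
          stepStep {ε} {zero} {σ} (fixed refl _ _ _ _ _ _ _ _) M (stepInv rest _ _ _ _ _) tr =
            contradiction (subst (λ z → z < N) (trans (sym (+-identityʳ _)) rest) tr) (<-irrefl refl)
          stepStep {ε} {suc k} {σ} (fixed refl _ _ refl refl _ refl eNM eAN) (masked masks top≡) (stepInv rest digits out past future others) tr =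
            k , ≤-refl ,
            (straight arrive {40} {λ σ₁ → env σ₁ C.S ≡ val ln (full j)}
               ((_ , (_ , _ , small (loosen eo-index)) , room′ eo-index) ,
                (λ E≢0 → (_ , (_ , _ , ≤-<-trans (n≤1+n _) (arrived-W E≢0)) , arrived-W E≢0) , arrived-S E≢0) ,
                (λ E≡0 → trans digits (val-cong ln (nothing-new j (bit≡0 (trans (sym now) E≡0))))))
             then λ {σ₁} S≡ sm₁ → match-leave-move S≡ sm₁)
            where
            open import Data.Nat.DivMod using (_/_)
            j = env σ C.j
            tn-index : tb + j ≤ 16 * N + 15
            tn-index = ≤-trans (≤-trans (<⇒≤ (+-monoʳ-< tb tr)) tb+) (lin 1 (λ N → [] ⊢ ‵ 6 :* N :≤ ‵ 16 :* N :+ ‵ 15) N)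
            eo-index : eo + j ≤ 16 * N + 15
            eo-index = lin 3 (λ e j N → (e :≤ N :+ ‵ 1) ∷ (j :< N) ∷ [] ⊢ e :+ j :≤ ‵ 16 :* N :+ ‵ 15) eo j N eo+ tr
            suc-j : suc j < W
            suc-j = small (≤-trans tr (lin 1 (λ N → [] ⊢ N :≤ ‵ 16 :* N :+ ‵ 16) N))
            now : arr σ C.E (eo + j) ≡ bit (arrives st j)
            now = future j ≤-refl (<⇒≤ tr)
            arrived-S : arr σ C.E (eo + j) ≢ 0 → 1 + 2 * (env σ C.S / 2) ≡ val ln (full j)
            arrived-S E≢0 = trans (cong (λ z → 1 + 2 * (z / 2)) digits) (trans (val-set0 m (pending j))
              (val-cong ln (arrived j (bit≢0 (λ e → E≢0 (trans now e))))))
            arrived-W : arr σ C.E (eo + j) ≢ 0 → 1 + 2 * (env σ C.S / 2) < W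
            arrived-W E≢0 = Β-W (subst (_≤ Β) (sym (arrived-S E≢0)) (<⇒≤ (val-Β (full j) ≤-refl)))
            match-leave-move : ∀ {σ₁} → env σ₁ C.S ≡ val ln (full j) → Same arrive σ σ₁ →
                               Ends (match ⨾ leave ⨾ moveOn) σ₁ 160 (StepInv ε k)
            match-leave-move {σ₁} S≡ sm₁ = prefix 60 match
              ( (_ , _ , subst (λ z → z < W) (sym ej) (small (loosen eo-index)))
              , _ , subst (_< lim) (sym ej) (room′ eo-index)
              , (_ , ((_ , _ , ≤-<-trans (m≤m+n _ _) pair<) ,
                      (_ , (_ , (_ , _ , subst (_< W) (sym etj) (small (loosen tn-index))) , subst (_< lim) (sym etj) (room′ tn-index))
                         , name<) , pair<) , pair-lim)
              , _
              , (straight leave {40} {λ σ₃ → env σ₃ C.hit ≡ val m (moving j) × env σ₃ C.po ≡ bit (moving j m)}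
                   (_ , (λ low → _ , let f = top-digit-false low in
                            trans hit₂ (trans (cong (λ b → val m (moving j) + bit b * 2 ^ m) f) (+-identityʳ _)) , sym (cong bit f))
                      , (λ high → _ , _ , let t = top-digit-true high in
                            trans (cong₂ _∸_ (trans hit₂ (val-top-true m (moving j) t)) top₂) (m+n∸n≡m (val m (moving j)) (2 ^ m)) , sym (cong bit t)))
                 then λ {σ₃} (hit≡ , po≡) sm₃ →
                  let eS = trans (varₛ sm₃ C.S) S₂
                      eB = trans (varₛ sm₃ C.B) (varₛ sm₁ C.B)
                      dbl = trans (cong₂ _+_ hit≡ hit≡) (val-double m (moving j))
                      table = trans (arrₛ sm₃ C.AN _) (trans (arrₛ sm₁ C.AN _) (eAN _))
                      index = cong₂ _+_ (cong₂ _*_ eS eB) dbl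
                      -- The second lookup intersects the digits that stay with those that moved up,
                      -- as the union requires.
                      andV = trans table (trans (cong AN index) (trans (conjs _ _ (val-Β staying ≤-refl) (val-Β (shift (moving j)) ≤-refl))
                               (conj-val β ln staying (shift (moving j)) narrow)))
                      newS = trans (cong₂ _∸_ (cong₂ _+_ eS dbl) andV) (trans (val-or ln staying (shift (moving j))) (val-cong ln (advanced j)))
                      jj = trans (varₛ sm₃ C.j) (varₛ sm₁ C.j)
                  in straight moveOn
                    ( (_ , _ , subst (_< W) (sym dbl) (Β-W (<⇒≤ (val-Β (shift (moving j)) ≤-refl))))
                    , ((_ , _ , subst (_< W) (sym (cong₂ _+_ eS dbl)) (sum-W staying (shift (moving j))))
                      , (_ , ((_ , _ , ≤-<-trans (m≤m+n _ _) (subst (_< W) (sym index) (table-W staying (shift (moving j)))))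
                             , _ , subst (_< W) (sym index) (table-W staying (shift (moving j))))
                           , subst (_< lim) (sym index) (table-lim staying (shift (moving j)))) , _)
                    , (_ , _ , subst (λ z → suc z < W) (sym jj) suc-j)
                    , stepInv (trans (cong (λ z → suc z + k) jj) (trans (sym (+-suc j k)) rest))
                        (trans newS (cong (λ z → val ln (pending (suc z))) (sym jj)))
                        (trans po≡ (trans (sym (cong bit (leaving j))) (cong (λ z → bit (arrives (st + ln) (suc z))) (sym jj))))
                        (λ j′ l → trans (arrₛ sm₃ C.E (eo + j′)) (trans (E₂ (eo + j′)) (past′ j′ (subst (λ z → j′ < suc z) jj l))))
                        (λ j′ l l′ → trans (arrₛ sm₃ C.E (eo + j′)) (trans (E₂ (eo + j′)) (future′ j′ (subst (λ z → suc z ≤ j′) jj l) l′)))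
                        (λ z l → trans (arrₛ sm₃ C.E z) (trans (E₂ z) (others′ z l))))))
              where
              staying : ℕ → Bool
              staying x = full j x ∧ not (equal′ j x)
              ej : env σ₁ C.eo + env σ₁ C.j ≡ eo + j
              ej = cong₂ _+_ (varₛ sm₁ C.eo) (varₛ sm₁ C.j)
              etj : env σ₁ C.tb + env σ₁ C.j ≡ tb + j
              etj = cong₂ _+_ (varₛ sm₁ C.tb) (varₛ sm₁ C.j)
              name = arr σ₁ C.NM (env σ₁ C.tb + env σ₁ C.j)
              name≡ : name ≡ tn j
              name≡ = trans (cong (arr σ₁ C.NM) etj) (trans (arrₛ sm₁ C.NM _) (eNM _))
              name< : name < lim
              name< = subst (_< lim) (sym name≡) (room′ (≤-trans (tn≤ j tr) (≤-trans R≤N (lin 1 (λ N → [] ⊢ N :≤ ‵ 16 :* N :+ ‵ 15) N))))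
              maskV : arr σ₁ C.MK name ≡ val ln (equal′ j)
              maskV = trans (arrₛ sm₁ C.MK name) (trans (masks name) (val-cong ln λ y l →
                        trans (cong (pn y ≡ᵇ_) name≡) (matching (st + y) j (st<R l) tr)))
              index₁ : env σ₁ C.S * env σ₁ C.B + arr σ₁ C.MK name ≡ val ln (full j) * Β + val ln (equal′ j)
              index₁ = cong₂ _+_ (cong₂ _*_ S≡ (varₛ sm₁ C.B)) maskV
              table-≤ : ∀ f g → val ln f * Β + val ln g < 4 * N + 1
              table-≤ f g = <-≤-trans (<-≤-trans (+-monoʳ-< (val ln f * Β) (val-Β g ≤-refl))
                (≤-trans (≤-reflexive (+-comm _ Β)) (*-monoˡ-≤ Β (val-Β f ≤-refl)))) (≤-trans upper R≤)
              table-lim : ∀ f g → val ln f * Β + val ln g < lim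
              table-lim f g = room′ (≤-trans (<⇒≤ (table-≤ f g)) (lin 1 (λ N → [] ⊢ ‵ 4 :* N :+ ‵ 1 :≤ ‵ 16 :* N :+ ‵ 15) N))
              table-W : ∀ f g → val ln f * Β + val ln g < W
              table-W f g = <-trans (table-lim f g) lim<W
              sum-W : ∀ f g → val ln f + val ln g < W
              sum-W f g = small (≤-trans (+-mono-≤ (<⇒≤ (val-Β f ≤-refl)) (<⇒≤ (val-Β g ≤-refl)))
                (lin 2 (λ B N → (B :≤ ‵ 4 :* N :+ ‵ 1) ∷ (B :≤ ‵ 4 :* N :+ ‵ 1) ∷ [] ⊢ B :+ B :≤ ‵ 16 :* N :+ ‵ 16) Β N Β-small Β-small))
              pair< : env σ₁ C.S * env σ₁ C.B + arr σ₁ C.MK name < W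
              pair< = subst (_< W) (sym index₁) (table-W (full j) (equal′ j))
              pair-lim : env σ₁ C.S * env σ₁ C.B + arr σ₁ C.MK name < lim
              pair-lim = subst (_< lim) (sym index₁) (table-lim (full j) (equal′ j))
              hit₂ : arr σ₁ C.AN (env σ₁ C.S * env σ₁ C.B + arr σ₁ C.MK name) ≡ val ln (moving j)
              hit₂ = trans (cong (arr σ₁ C.AN) index₁) (trans (arrₛ sm₁ C.AN _) (trans (eAN _)
                       (trans (conjs _ _ (val-Β (full j) ≤-refl) (val-Β (equal′ j) ≤-refl)) (conj-val β ln (full j) (equal′ j) narrow))))
              S₂ : env σ₁ C.S ∸ arr σ₁ C.AN (env σ₁ C.S * env σ₁ C.B + arr σ₁ C.MK name) ≡ val ln staying
              S₂ = trans (cong₂ _∸_ S≡ hit₂) (val-minus ln (full j) (equal′ j))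
              top₂ : env σ₁ C.top ≡ 2 ^ m
              top₂ = trans (varₛ sm₁ C.top) top≡
              top-digit-false : arr σ₁ C.AN (env σ₁ C.S * env σ₁ C.B + arr σ₁ C.MK name) < env σ₁ C.top → moving j m ≡ false
              top-digit-false low with moving j m in e
              ... | false = refl
              ... | true = contradiction (subst₂ _<_ (trans hit₂ (val-top-true m (moving j) e)) top₂ low) (≤⇒≯ (m≤n+m (2 ^ m) _))
              top-digit-true : env σ₁ C.top ≤ arr σ₁ C.AN (env σ₁ C.S * env σ₁ C.B + arr σ₁ C.MK name) → moving j m ≡ true
              top-digit-true high with moving j m in e
              ... | true = refl
              ... | false = contradiction (subst₂ _≤_ top₂ hit₂ high) (<⇒≱ (val-top-false m (moving j) e))
              ε₂ : ℕ → ℕ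
              ε₂ = arr σ C.E Defs.[ eo + j ≔ env σ C.po ]
              E₂ : ∀ z → (arr σ₁ C.E Defs.[ env σ₁ C.eo + env σ₁ C.j ≔ env σ₁ C.po ]) z ≡ ε₂ z
              E₂ z with z ≟ eo + j
              ... | yes refl = trans (cong (λ y → (arr σ₁ C.E Defs.[ y ≔ env σ₁ C.po ]) z) ej)
                                 (trans (≔-hit (arr σ₁ C.E) z _) (trans (varₛ sm₁ C.po) (sym (≔-hit (arr σ C.E) z _))))
              ... | no ne = trans (≔-miss (arr σ₁ C.E) _ (λ e → ne (trans e ej))) (trans (arrₛ sm₁ C.E z) (sym (≔-miss (arr σ C.E) _ ne)))
              past′ : ∀ j′ → j′ < suc j → ε₂ (eo + j′) ≡ bit (arrives (st + ln) j′)
              past′ j′ l with m≤n⇒m<n∨m≡n (s≤s⁻¹ l)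
              ... | inj₂ refl = trans (≔-hit (arr σ C.E) (eo + j) _) out
              ... | inj₁ l′ = trans (≔-miss (arr σ C.E) _ (λ e → <⇒≢ l′ (+-cancelˡ-≡ eo j′ j e))) (past j′ l′)
              future′ : ∀ j′ → suc j ≤ j′ → j′ ≤ N → ε₂ (eo + j′) ≡ bit (arrives st j′)
              future′ j′ l l′ = trans (≔-miss (arr σ C.E) _ (λ e → >⇒≢ l (+-cancelˡ-≡ eo j′ j e))) (future j′ (<⇒≤ l) l′)
              others′ : ∀ z → z < eo → ε₂ z ≡ ε z
              others′ z l = trans (≔-miss (arr σ C.E) _ (<⇒≢ (<-≤-trans l (m≤m+n eo j)))) (others z l)

        step-correct : ∀ {σ} → Fixed σ → Masked σ → env σ C.j ≡ 0 → env σ C.S ≡ 0 → env σ C.po ≡ 0 →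
          (∀ j → j ≤ N → arr σ C.E (eo + j) ≡ bit (arrives st j)) →
          Ends (while stepTest stepBody) σ (N * 240 + 40)
               (λ σ′ → env σ′ C.j ≡ N × env σ′ C.po ≡ bit (arrives (st + ln) N) ×
                       (∀ j → j < N → arr σ′ C.E (eo + j) ≡ bit (arrives (st + ln) j)) ×
                       (∀ z → z < eo → arr σ′ C.E z ≡ arr σ C.E z))
        step-correct {σ₀} F@(fixed en _ _ _ _ _ _ _ _) (masked masks top≡) ej eS epo arrivals = atMost N 240 40
          (iterate stepTest stepBody (StepInv (arr σ₀ C.E)) N
            (λ k σ sm I → _)
            (λ k σ sm I f → exit (trans (varₛ sm C.n) en) I f)
            (λ k σ sm I tr → stepStep (refix (arrₛ sm C.NM) (arrₛ sm C.AN) sm F)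
               (masked (λ u → trans (arrₛ sm C.MK u) (masks u)) (trans (varₛ sm C.top) top≡)) I tr)
            (stepInv (cong (_+ N) ej)
              (trans eS (trans (sym (val-zero ln)) (trans (val-cong ln pending-0) (cong (λ z → val ln (pending z)) (sym ej)))))
              (trans epo (trans (sym (cong bit leaving-0)) (cong (λ z → bit (arrives (st + ln) z)) (sym ej))))
              (λ j l → contradiction (subst (j <_) ej l) λ ())
              (λ j _ l → arrivals j l)
              (λ z _ → refl)))
          where
          exit : ∀ {k σ} → env σ C.n ≡ N → StepInv (arr σ₀ C.E) k σ → False stepTest σ → env σ C.j ≡ N ×
                 env σ C.po ≡ bit (arrives (st + ln) N) ×
                 (∀ j → j < N → arr σ C.E (eo + j) ≡ bit (arrives (st + ln) j)) × (∀ z → z < eo → arr σ C.E z ≡ arr σ₀ C.E z)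
          exit {k} {σ} en (stepInv rest _ out past _ others) f =
            j≡ , trans out (cong (λ z → bit (arrives (st + ln) z)) j≡) , (λ j l → past j (subst (j <_) (sym j≡) l)) , others
            where
            j≡ : env σ C.j ≡ N
            j≡ = ≤-antisym (≤-trans (m≤m+n _ k) (≤-reflexive rest)) (subst (_≤ env σ C.j) en f)

        private
          ClearInv : ℕ → Store → Set
          ClearInv k σ = env σ C.x + k ≡ ln × (∀ u → arr σ C.MK u ≡ 0 ⊎ ∃[ y ] (env σ C.x ≤ y × y < ln × pn y ≡ u))

          clearStep : ∀ {k σ} → Fixed σ → env σ C.st ≡ st → env σ C.ln ≡ ln → ClearInv k σ → True blockTest σ →
                      Σ[ k′ ∈ ℕ ] k′ < k × Ends clearBody σ 80 (ClearInv k′)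
          clearStep {zero} F est eln (rest , _) tr =
            contradiction (subst₂ _<_ (trans (sym (+-identityʳ _)) rest) eln tr) (<-irrefl refl)
          clearStep {suc k} {σ} (fixed _ _ _ _ _ refl _ eNM _) refl eln (rest , cleared) tr = k , ≤-refl ,
            straight clearBody (okI , _ , name< , (_ , _ , suc-small x<) , trans (sym (+-suc x k)) rest , cleared′)
            where
            x = env σ C.x
            x< : x < ln
            x< = subst (x <_) eln tr
            okI = _ , (_ , (_ , _ , st+-small x<) , small (loosen (pn-index x<))) , room′ (pn-index x<)
            name = arr σ C.NM (pb + (st + x))
            name< : name < lim
            name< = subst (_< lim) (sym (eNM _)) (room′ (pn-small x<))
            cleared′ : ∀ u → (arr σ C.MK Defs.[ name ≔ 0 ]) u ≡ 0 ⊎ ∃[ y ] (suc x ≤ y × y < ln × pn y ≡ u)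
            cleared′ u with u ≟ name
            ... | yes refl = inj₁ (≔-hit (arr σ C.MK) name 0)
            ... | no ne with cleared u
            ... | inj₁ z = inj₁ (trans (≔-miss (arr σ C.MK) 0 ne) z)
            ... | inj₂ (y , a , b , e) = inj₂ (y , ≤∧≢⇒< a (λ { refl → ne (trans (sym e) (sym (eNM _))) }) , b , e)

        clear-correct : ∀ {σ} → Fixed σ → env σ C.st ≡ st → env σ C.ln ≡ ln → env σ C.x ≡ 0 → (∀ u → arr σ C.MK u ≡ mask ln u) →
                        Ends (while blockTest clearBody) σ (β * 120 + 40) (λ σ′ → ∀ u → arr σ′ C.MK u ≡ 0)
        clear-correct F est eln ex masks = within (+-monoˡ-≤ 40 (*-monoˡ-≤ 120 narrow))
          (iterate blockTest clearBody ClearInv ln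
            (λ k σ sm I → _)
            (λ k σ sm (_ , cleared) f u → none {σ} {u} (trans (varₛ sm C.ln) eln) f (cleared u))
            (λ k σ sm I tr → clearStep (refix (arrₛ sm C.NM) (arrₛ sm C.AN) sm F) (trans (varₛ sm C.st) est) (trans (varₛ sm C.ln) eln) I tr)
            (cong (_+ ln) ex , λ u → start u (val-nonzero ln (λ y → pn y ≡ᵇ u))))
          where
          none : ∀ {σ u} → env σ C.ln ≡ ln → False blockTest σ → arr σ C.MK u ≡ 0 ⊎ ∃[ y ] (env σ C.x ≤ y × y < ln × pn y ≡ u) → arr σ C.MK u ≡ 0
          none {σ} eln f (inj₁ z) = z
          none {σ} eln f (inj₂ (y , a , b , _)) = contradiction (<-≤-trans b (subst (_≤ env σ C.x) eln f)) (≤⇒≯ a)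
          start : ∀ u → mask ln u ≡ 0 ⊎ ∃[ y ] (y < ln × (pn y ≡ᵇ u) ≡ true) → _ ⊎ ∃[ y ] (_ ≤ y × y < ln × pn y ≡ u)
          start u (inj₁ z) = inj₁ (trans (masks u) z)
          start u (inj₂ (y , l , e)) = inj₂ (y , subst (_≤ y) (sym ex) z≤n , l , ≡ᵇ⇒≡ (pn y) u (subst T (sym e) _))

      Arrivals : (ℕ → ℕ) → ℕ → Store → Set
      Arrivals ε q σ = (∀ j → j ≤ N → arr σ C.E (eo + j) ≡ bit (arrives q j)) × (∀ z → z < eo → arr σ C.E z ≡ ε z)

      private
        runTest fillTest : Exp
        runTest  = v C.st ⋖ v C.r
        fillTest = v C.j ⋖ # 1 ⊕ v C.n

        -- The last block may be shorter than β, hence the alternative in `reach`; `t` counts the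
        -- blocks against U.
        record RunInv (ε : ℕ → ℕ) (k : ℕ) (σ : Store) : Set where
          constructor runInv
          field
            t     : ℕ
            left  : U ∸ t ≡ k
            reach : t * β ≤ env σ C.st ⊎ R ≤ env σ C.st
            st≤R  : env σ C.st ≤ R
            clean : ∀ u → arr σ C.MK u ≡ 0
            arrivals : Arrivals ε (env σ C.st) σ

        begin′ : Cmd
        begin′ = C.ln := v C.r ⊖ v C.st ⨾ cond (v C.b ⋖ v C.ln) (C.ln := v C.b) skip ⨾ C.x := # 0 ⨾ C.hi := # 1

        rest : Cmd
        rest = while (v C.x ⋖ v C.ln) maskBody ⨾
               (C.S := # 0 ⨾ C.po := # 0 ⨾ C.j := # 0) ⨾
               while (v C.j ⋖ v C.n) stepBody ⨾
               (C.E [ v C.eo ⊕ v C.j ]:= v C.po ⨾ C.x := # 0) ⨾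
               while (v C.x ⋖ v C.ln) clearBody ⨾
               C.st := v C.st ⊕ v C.ln

        restTime : ℕ
        restTime = (β * 120 + 40) + (10 + ((N * 240 + 40) + (20 + ((β * 120 + 40) + 10))))

        rest-correct : ∀ {ε σ} st m → st + suc m ≤ R → suc m ≤ β → Fixed σ → env σ C.st ≡ st → env σ C.ln ≡ suc m →
          env σ C.x ≡ 0 → env σ C.hi ≡ 1 → (∀ u → arr σ C.MK u ≡ 0) → Arrivals ε st σ →
          Ends rest σ restTime (λ σ′ → env σ′ C.st ≡ st + suc m × (∀ u → arr σ′ C.MK u ≡ 0) × Arrivals ε (st + suc m) σ′)
        rest-correct {ε} {σ₀} st m fits narrow F est eln ex ehi clean (now , others) =
          mask-correct F est eln ex ehi clean then λ {σ₁} (masked masks top≡) sm₁ →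
          let F₁ = refix (arrₛ sm₁ C.NM) (arrₛ sm₁ C.AN) sm₁ F in
          prefix 10 (C.S := # 0 ⨾ C.po := # 0 ⨾ C.j := # 0) (_ , _ , _ ,
           (step-correct (reset F₁) (masked masks top≡) refl refl refl
              (λ j l → trans (arrₛ sm₁ C.E (eo + j)) (now j l)) then λ {σ₂} (ej , out , past , oth) sm₂ →
            let F₂ = refix (arrₛ sm₂ C.NM) (arrₛ sm₂ C.AN) sm₂ (reset F₁)
                eoj = cong₂ _+_ (Fixed.eeo F₂) ej in
            prefix 20 (C.E [ v C.eo ⊕ v C.j ]:= v C.po ⨾ C.x := # 0)
             ((_ , _ , subst (_< W) (sym eoj) (small (loosen eo-N))) , _ , subst (_< lim) (sym eoj) (room′ eo-N) , _ ,
              (clear-correct (reset′ F₂) (trans (varₛ sm₂ C.st) (trans (varₛ sm₁ C.st) est)) (trans (varₛ sm₂ C.ln) (trans (varₛ sm₁ C.ln) eln)) refl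
                 (λ u → trans (arrₛ sm₂ C.MK u) (masks u)) then λ {σ₃} cleared sm₃ →
               let est₃ = trans (varₛ sm₃ C.st) (trans (varₛ sm₂ C.st) (trans (varₛ sm₁ C.st) est))
                   eln₃ = trans (varₛ sm₃ C.ln) (trans (varₛ sm₂ C.ln) (trans (varₛ sm₁ C.ln) eln)) in
               straight (C.st := v C.st ⊕ v C.ln)
                 ((_ , _ , subst (_< W) (sym (cong₂ _+_ est₃ eln₃)) (small (≤-trans fits (≤-trans R≤N (lin 1 (λ N → [] ⊢ N :≤ ‵ 16 :* N :+ ‵ 16) N))))) ,
                  cong₂ _+_ est₃ eln₃ , cleared ,
                  (λ j l → trans (arrₛ sm₃ C.E (eo + j)) (last {ε = arr σ₂ C.E} eoj out past j l)) ,
                  (λ z l → trans (arrₛ sm₃ C.E z) (trans (≔-miss (arr σ₂ C.E) _ (λ e → <⇒≢ (<-≤-trans l (m≤m+n eo N)) (trans e eoj)))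
                              (trans (oth z l) (trans (arrₛ sm₁ C.E z) (others z l))))))))))
          where
          open At st m fits narrow
          eo-N : eo + N ≤ 16 * N + 15
          eo-N = lin 2 (λ e N → (e :≤ N :+ ‵ 1) ∷ [] ⊢ e :+ N :≤ ‵ 16 :* N :+ ‵ 15) eo N eo+
          reset : ∀ {σ} → Fixed σ → Fixed (stored (((env σ Defs.[ C.S ≔ 0 ]) Defs.[ C.po ≔ 0 ]) Defs.[ C.j ≔ 0 ]) (arr σ) (out σ))
          reset (fixed a b c d e f g h i) = fixed a b c d e f g h i
          reset′ : ∀ {σ i x} → Fixed σ → Fixed (stored (env σ Defs.[ C.x ≔ 0 ]) (update (arr σ) C.E i x) (out σ))
          reset′ (fixed a b c d e f g h i) = fixed a b c d e f g h i
          last : ∀ {i x} {ε : ℕ → ℕ} → i ≡ eo + N → x ≡ bit (arrives (st + suc m) N) → (∀ j → j < N → ε (eo + j) ≡ bit (arrives (st + suc m) j)) →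
                 ∀ j → j ≤ N → (ε Defs.[ i ≔ x ]) (eo + j) ≡ bit (arrives (st + suc m) j)
          last {i} {x} {ε} refl refl past j l with m≤n⇒m<n∨m≡n l
          ... | inj₂ refl = ≔-hit ε (eo + N) _
          ... | inj₁ l′ = trans (≔-miss ε _ (λ e → <⇒≢ l′ (+-cancelˡ-≡ eo j N e))) (past j l′)

        runStep : ∀ {ε k σ} → Fixed σ → RunInv ε k σ → True runTest σ →
                  Σ[ k′ ∈ ℕ ] k′ < k × Ends runBody σ (60 + restTime) (RunInv ε k′)
        runStep {ε} {k} {σ} F@(fixed en refl refl eB etb epb eeo eNM eAN) (runInv t refl reach st≤R clean arrivals) tr =
          U ∸ suc t , ∸-shrink t<U ≤-refl ,
          prefix 60 begin′ (_ , _ , (λ β<d → _ , _ , _ , narrow-block β<d) , (λ d≤β → _ , _ , last-block d≤β))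
          where
          st = env σ C.st
          tβ≤st : t * β ≤ st
          tβ≤st = [_,_] {C = λ _ → t * β ≤ st} (λ l → l) (λ l → contradiction tr (≤⇒≯ l)) reach
          t<U : t < U
          t<U = *-cancelʳ-< β t U (<-≤-trans (≤-<-trans tβ≤st tr) R≤Uβ)
          next : ∀ {d σ₁} → 0 < d → d ≤ β → st + d ≤ R → suc t * β ≤ st + d ⊎ R ≤ st + d →
                 Fixed σ₁ → env σ₁ C.st ≡ st → env σ₁ C.ln ≡ d → env σ₁ C.x ≡ 0 → env σ₁ C.hi ≡ 1 → (∀ u → arr σ₁ C.MK u ≡ 0) →
                 Arrivals ε st σ₁ → Ends rest σ₁ restTime (RunInv ε (U ∸ suc t))
          next {suc m} _ d≤β fits reach′ F₁ est eln ex ehi cl ar = weaken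
            (λ σ₂ (est₂ , clean₂ , now , oth) → runInv (suc t) refl (subst (λ z → suc t * β ≤ z ⊎ R ≤ z) (sym est₂) reach′)
               (subst (_≤ R) (sym est₂) fits) clean₂ ((λ j l → trans (now j l) (cong (λ z → bit (arrives z j)) (sym est₂))) , oth))
            (rest-correct st m fits d≤β F₁ est eln ex ehi cl ar)
          narrow-block : β < R ∸ st → Ends rest _ restTime (RunInv ε (U ∸ suc t))
          narrow-block β<d = next (β>0 (≤-<-trans z≤n tr)) ≤-refl
            (≤-trans (+-monoʳ-≤ st (<⇒≤ β<d)) (≤-reflexive (m+[n∸m]≡n st≤R)))
            (inj₁ (≤-trans (≤-reflexive (+-comm β (t * β))) (+-monoˡ-≤ β tβ≤st)))
            (fixed en refl refl eB etb epb eeo eNM eAN) refl refl refl refl clean arrivals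
          last-block : R ∸ st ≤ β → Ends rest _ restTime (RunInv ε (U ∸ suc t))
          last-block d≤β = next (m<n⇒0<n∸m tr) d≤β (≤-reflexive (m+[n∸m]≡n st≤R)) (inj₂ (≤-reflexive (sym (m+[n∸m]≡n st≤R))))
            (fixed en refl refl eB etb epb eeo eNM eAN) refl refl refl refl clean arrivals

        FillInv : (ℕ → ℕ) → ℕ → Store → Set
        FillInv ε k σ = env σ C.j + k ≡ suc N × (∀ j → j < env σ C.j → arr σ C.E (eo + j) ≡ 1) × (∀ z → z < eo → arr σ C.E z ≡ ε z)

        fillStep : ∀ {ε k σ} → env σ C.n ≡ N → env σ C.eo ≡ eo → FillInv ε k σ → True fillTest σ →
                   Σ[ k′ ∈ ℕ ] k′ < k × Ends fillBody σ 40 (FillInv ε k′)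
        fillStep {ε} {zero} en eeo (rest , _) tr =
          contradiction (subst₂ _<_ (trans (sym (+-identityʳ _)) rest) (cong suc en) tr) (<-irrefl refl)
        fillStep {ε} {suc k} {σ} refl refl (rest , past , others) tr = k , ≤-refl , straight fillBody
          ((_ , _ , small (loosen index)) , _ , room′ index , (_ , _ , small (≤-trans tr (lin 1 (λ N → [] ⊢ ‵ 1 :+ N :≤ ‵ 16 :* N :+ ‵ 16) N))) ,
           trans (sym (+-suc j k)) rest , past′ , (λ z l → trans (≔-miss (arr σ C.E) 1 (<⇒≢ (<-≤-trans l (m≤m+n eo j)))) (others z l)))
          where
          j = env σ C.j
          index : eo + j ≤ 16 * N + 15
          index = lin 3 (λ e j N → (e :≤ N :+ ‵ 1) ∷ (j :< ‵ 1 :+ N) ∷ [] ⊢ e :+ j :≤ ‵ 16 :* N :+ ‵ 15) eo j N eo+ tr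
          past′ : ∀ j′ → j′ < suc j → (arr σ C.E Defs.[ eo + j ≔ 1 ]) (eo + j′) ≡ 1
          past′ j′ l with m≤n⇒m<n∨m≡n (s≤s⁻¹ l)
          ... | inj₂ refl = ≔-hit (arr σ C.E) (eo + j) 1
          ... | inj₁ l′ = trans (≔-miss (arr σ C.E) 1 (λ e → <⇒≢ l′ (+-cancelˡ-≡ eo j′ j e))) (past j′ l′)

      runTime : ℕ
      runTime = 3 + ((suc N * 80 + 40) + (3 + (U * (40 + (60 + restTime)) + 40)))

      run-correct : ∀ {σ} → Fixed σ → (∀ u → arr σ C.MK u ≡ 0) →
                    Ends run σ runTime (λ σ′ → Arrivals (arr σ C.E) R σ′ × (∀ u → arr σ′ C.MK u ≡ 0))
      run-correct {σ₀} (fixed en er eb eB etb epb eeo eNM eAN) clean = prefix 3 (C.j := # 0) (_ ,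
        ((iterate fillTest fillBody (FillInv (arr σ₀ C.E))
           {Q = λ σ → (∀ j → j ≤ N → arr σ C.E (eo + j) ≡ 1) × (∀ z → z < eo → arr σ C.E z ≡ arr σ₀ C.E z)} (suc N)
           (λ k σ sm I → _ , (_ , _ , subst (λ z → suc z < W) (sym (trans (varₛ sm C.n) en)) (small (lin 1 (λ N → [] ⊢ ‵ 1 :+ N :≤ ‵ 16 :* N :+ ‵ 16) N))) , _)
           (λ k σ sm (_ , past , oth) f → (λ j l → past j (<-≤-trans (s≤s l) (subst (λ z → suc z ≤ env σ C.j) (trans (varₛ sm C.n) en) f))) , oth)
           (λ k σ sm I tr → fillStep (trans (varₛ sm C.n) en) (trans (varₛ sm C.eo) eeo) I tr)
           (refl , (λ _ ()) , (λ _ _ → refl)))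
         then λ {σ₁} (ones , oth) sm₁ →
         prefix 3 (C.st := # 0) (_ ,
          iterate runTest runBody (RunInv (arr σ₀ C.E)) U
            (λ k σ sm I → _)
            (λ k σ sm I f → let st≡ = ≤-antisym (RunInv.st≤R I) (subst (_≤ env σ C.st) (trans (varₛ sm C.r) (trans (varₛ sm₁ C.r) er)) f) in
               subst (λ q → Arrivals (arr σ₀ C.E) q σ) st≡ (RunInv.arrivals I) , RunInv.clean I)
            (λ k σ sm I tr → runStep (fixed (trans (varₛ sm C.n) (trans (varₛ sm₁ C.n) en)) (trans (varₛ sm C.r) (trans (varₛ sm₁ C.r) er))
               (trans (varₛ sm C.b) (trans (varₛ sm₁ C.b) eb)) (trans (varₛ sm C.B) (trans (varₛ sm₁ C.B) eB))
               (trans (varₛ sm C.tb) (trans (varₛ sm₁ C.tb) etb)) (trans (varₛ sm C.pb) (trans (varₛ sm₁ C.pb) epb))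
               (trans (varₛ sm C.eo) (trans (varₛ sm₁ C.eo) eeo))
               (λ z → trans (arrₛ sm C.NM z) (trans (arrₛ sm₁ C.NM z) (eNM z))) (λ z → trans (arrₛ sm C.AN z) (trans (arrₛ sm₁ C.AN z) (eAN z)))) I tr)
            (runInv 0 refl (inj₁ z≤n) z≤n (λ u → trans (arrₛ sm₁ C.MK u) (clean u))
              -- The empty prefix of P arrives everywhere, because its minimal windows are empty:
              -- the initial ones are the arrivals of the first block.
              ((λ j l → trans (ones j l) (sym (cong bit (arrives-start j)))) , oth)))))

-- Pairing the starts and ends of minimal windows

module Window-ends where

  open Language
  open Arithmetic
  open BitVectors
  open Embeddings
  open Bit-parallel-matching using (RunSetting; runSetting; module Running)
  open Code using (pair; pairBody; windows)

  record PairSetting : Set where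
    constructor pairSetting
    field
      sp : Space
    open Space sp public
    field
      R : ℕ
      P T′ P′ T″ : ℕ → ℕ
      hP : ∀ x → x < R → P′ (R ∸ suc x) ≡ P x
      hT : ∀ x → x < N → T″ (N ∸ suc x) ≡ T′ x

  module Pairing (s : PairSetting) where

    open PairSetting s

    open Semantics mc
    open Reversal P T′ P′ T″ R N hP hT using (latest⇒arrives; arrives⇒latest)
    private
      module F = Embedding P T′
      module G = Embedding P′ T″

    private

      value : ℕ → ℕ
      value j = F.latest R j

      before : ℕ → ℕ
      before j = F.previous R j

      InRange : ℕ → Set
      InRange c = ∃[ j ] (j ≤ N × value j ≡ c)

      -- In phase 0 the pointer `cur` climbs from `before j` and has not met a new value of
      -- `latest R`; in phase 1 it has reached `value j`, which the next round stores.
      data Phase (j : ℕ) : ℕ → ℕ → Set where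
        searching : ∀ {cur} → before j ≤ cur → (∀ c → before j < c → c ≤ cur → ¬ InRange c) →
                    cur ≡ before j ⊎ F.arrives R j ≡ true → Phase j cur 0
        settled   : ∀ {cur} → cur ≡ value j → F.arrives R j ≡ true → Phase j cur 1

      before≤ : ∀ j → before j ≤ value j
      before≤ zero    = z≤n
      before≤ (suc j) = F.latest-mono R (n≤1+n j)

      arrives-< : ∀ {j} → F.arrives R j ≡ true → before j < value j
      arrives-< {j} e = <ᵇ⇒< _ _ (subst T (sym e) _)

      ¬arrives : ∀ {j} → F.arrives R j ≡ false → before j ≡ value j
      ¬arrives {j} e = ≤-antisym (before≤ j) (≮⇒≥ λ l → subst T e (<⇒<ᵇ l))

      still : ∀ {j cur fl} → F.arrives R j ≡ false → Phase j cur fl → cur ≡ value j × fl ≡ 0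
      still e (searching _ _ (inj₁ c)) = trans c (¬arrives e) , refl
      still e (searching _ _ (inj₂ t)) = contradiction (trans (sym t) e) λ ()
      still e (settled _ t) = contradiction (trans (sym t) e) λ ()

      fresh : ∀ {j cur} → cur ≡ value j → Phase (suc j) cur 0
      fresh refl = searching ≤-refl (λ c a b → contradiction a (≤⇒≯ b)) (inj₁ refl)

      searching-< : ∀ {j cur} → j ≤ N → F.arrives R j ≡ true → Phase j cur 0 → cur < value j
      searching-< {j} {cur} j≤N t (searching a gap _) = ≰⇒> λ l → gap (value j) (arrives-< t) l (j , j≤N , refl)

      -- `latest R` is monotone: a value above `before j` is attained from j on only, so the first
      -- that is met is `value j`.
      find-range : ∀ {j cur} → j ≤ N → F.arrives R j ≡ true → Phase j cur 0 → InRange (suc cur) → suc cur ≡ value j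
      find-range {j} {cur} j≤N t ph@(searching a gap _) (j₀ , j₀≤N , e) with m≤n⇒m<n∨m≡n (searching-< j≤N t ph)
      ... | inj₂ eq = eq
      ... | inj₁ l with j₀ <? j
      ... | no j₀≮j = contradiction l (≤⇒≯ (≤-trans (F.latest-mono R (≮⇒≥ j₀≮j)) (≤-reflexive e)))
      ... | yes j₀<j = contradiction (≤-trans (≤-reflexive (sym e)) (earlier j₀<j)) (<⇒≱ (s≤s a))
        where
        earlier : ∀ {j₀ j} → j₀ < j → value j₀ ≤ before j
        earlier {j = suc j} l = F.latest-mono R (s≤s⁻¹ l)

    module _ (lo : ℕ) (lo≤ : lo ≤ N + 1) (E : ℕ → ℕ)
      (E₁ : ∀ j → j ≤ N → E j ≡ bit (F.arrives R j)) (E₂ : ∀ j → j ≤ N → E (suc N + j) ≡ bit (G.arrives R j)) where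

      private
        pairTest : Exp
        pairTest = v C.j ⋖ # 1 ⊕ v C.n

        Stored : (ℕ → ℕ) → ℕ → (ℕ → ℕ) → Set
        Stored α j β = (∀ j′ → j′ < j → β (lo + (N ∸ j′)) ≡ suc N ∸ value j′) × (∀ z → z < lo → β z ≡ α z)

        -- Every round advances one of the two pointers, and both have N + 1 steps at most; this
        -- makes the pairing linear.
        record PairInv (α : ℕ → ℕ) (k : ℕ) (σ : Store) : Set where
          constructor pairInv
          field
            left   : (suc N ∸ env σ C.j) + (suc N ∸ env σ C.cur) ≤ k
            j≤     : env σ C.j ≤ suc N
            cur≤   : env σ C.cur ≤ suc N
            phase  : Phase (env σ C.j) (env σ C.cur) (env σ C.fl)
            values : Stored α (env σ C.j) (arr σ C.EW)

        store : ∀ {α j β cur} → j ≤ N → cur ≡ value j → Stored α j β → Stored α (suc j) (β Defs.[ lo + (N ∸ j) ≔ suc N ∸ cur ])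
        store {α} {j} {β} {cur} j≤N refl (past , others) = past′ , λ z l → trans (≔-miss β _ (<⇒≢ (<-≤-trans l (m≤m+n lo _)))) (others z l)
          where
          past′ : ∀ j′ → j′ < suc j → (β Defs.[ lo + (N ∸ j) ≔ suc N ∸ cur ]) (lo + (N ∸ j′)) ≡ suc N ∸ value j′
          past′ j′ l with m≤n⇒m<n∨m≡n (s≤s⁻¹ l)
          ... | inj₂ refl = ≔-hit β (lo + (N ∸ j)) _
          ... | inj₁ l′ = trans (≔-miss β _ (λ e → <⇒≢ l′ (∸-cancelˡ-≡ (<⇒≤ (<-≤-trans l′ j≤N)) j≤N (+-cancelˡ-≡ lo _ _ e)))) (past j′ l′)

        bit≡0 : ∀ {b} → bit b ≡ 0 → b ≡ false
        bit≡0 {false} _ = refl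

        bit≢0 : ∀ {b} → bit b ≢ 0 → b ≡ true
        bit≢0 {true}  _ = refl
        bit≢0 {false} n = contradiction refl n

        pairStep : ∀ {α k σ} → env σ C.n ≡ N → env σ C.lo ≡ lo → (∀ z → arr σ C.E z ≡ E z) → PairInv α k σ → True pairTest σ →
                   Σ[ k′ ∈ ℕ ] k′ < k × Ends pairBody σ 200 (PairInv α k′)
        pairStep {α} {zero} {σ} refl refl eE (pairInv left j≤ cur≤ phase values) tr =
          contradiction (<-≤-trans (m<n⇒0<n∸m tr) (≤-trans (m≤m+n (suc N ∸ env σ C.j) _) left)) λ ()
        pairStep {α} {suc k} {σ} refl refl eE (pairInv left j≤ cur≤ phase values) tr = k , ≤-refl , straight pairBody
          (((_ , _ , room′ j-index) , _) ,
           (λ E0 → let (c , f0) = still (quiet E0) phase in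
              (_ , _ , small (loosen lo-index)) , ((_ , _ , N-W) , _) , room′ lo-index , (_ , _ , suc-j) ,
              pairInv next-j tr cur≤ (subst (Phase (suc j) cur) (sym f0) (fresh c)) (store j≤N c values)) ,
           (λ E≢0 → _ ,
            (λ fl0 → let ph = subst (Phase j cur) fl0 phase ; lt = searching-< j≤N (active E≢0) ph ; cur< = ≤-trans lt (value≤ j≤N) in
               (_ , _ , small (≤-trans cur< suc-N)) ,
               (_ , ((_ , _ , N-W) , ((_ , _ , N-W) , _) , small (loosen second)) , room′ second) ,
               (λ hit → _ , pairInv (next-cur cur<) j≤ cur<
                  -- A value of `latest` shows up as an arrival in the opposite direction, which is
                  -- what the other half of `E` records.
                  (settled (find-range j≤N (active E≢0) ph (arrives⇒latest (s≤s⁻¹ cur<) (bit≢0 λ z → hit (trans (eE _) (trans (E₂ (N ∸ cur) (m∸n≤m N cur)) z))))) (active E≢0)) values) ,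
               (λ miss → pairInv (next-cur cur<) j≤ cur< (subst (Phase j (suc cur)) (sym fl0)
                  (continue ph (active E≢0) (bit≡0 (trans (sym (E₂ (N ∸ cur) (m∸n≤m N cur))) (trans (sym (eE _)) miss))))) values)) ,
            (λ fl≢0 → (_ , _ , small (loosen lo-index)) , ((_ , _ , N-W) , _) , room′ lo-index , (_ , _ , suc-j) , _ ,
               pairInv next-j tr cur≤ (fresh (done′ fl≢0 phase)) (store j≤N (done′ fl≢0 phase) values))))
          where
          j = env σ C.j
          cur = env σ C.cur
          j≤N : j ≤ N
          j≤N = s≤s⁻¹ tr
          suc-N : suc N ≤ 16 * N + 16
          suc-N = lin 1 (λ N → [] ⊢ ‵ 1 :+ N :≤ ‵ 16 :* N :+ ‵ 16) N
          N-W : suc N < W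
          N-W = small suc-N
          suc-j : suc j < W
          suc-j = small (≤-trans tr suc-N)
          j-index : j ≤ 16 * N + 15
          j-index = ≤-trans j≤N (lin 1 (λ N → [] ⊢ N :≤ ‵ 16 :* N :+ ‵ 15) N)
          lo-index : lo + (N ∸ j) ≤ 16 * N + 15
          lo-index = lin 3 (λ l x N → (l :≤ N :+ ‵ 1) ∷ (x :≤ N) ∷ [] ⊢ l :+ x :≤ ‵ 16 :* N :+ ‵ 15) lo (N ∸ j) N lo≤ (m∸n≤m N j)
          second : suc N + (N ∸ cur) ≤ 16 * N + 15
          second = lin 2 (λ x N → (x :≤ N) ∷ [] ⊢ ‵ 1 :+ N :+ x :≤ ‵ 16 :* N :+ ‵ 15) (N ∸ cur) N (m∸n≤m N cur)
          quiet : arr σ C.E j ≡ 0 → F.arrives R j ≡ false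
          quiet e = bit≡0 (trans (sym (E₁ j j≤N)) (trans (sym (eE j)) e))
          active : arr σ C.E j ≢ 0 → F.arrives R j ≡ true
          active n = bit≢0 λ z → n (trans (eE j) (trans (E₁ j j≤N) z))
          value≤ : j ≤ N → value j ≤ suc N
          value≤ l = ≤-trans (F.latest-≤ R j) (s≤s l)
          next-j : (suc N ∸ suc j) + (suc N ∸ cur) ≤ k
          next-j = s≤s⁻¹ (≤-trans (+-monoˡ-< (suc N ∸ cur) (∸-shrink tr ≤-refl)) left)
          next-cur : suc cur ≤ suc N → (suc N ∸ j) + (suc N ∸ suc cur) ≤ k
          next-cur l = s≤s⁻¹ (≤-trans (+-monoʳ-< (suc N ∸ j) (∸-shrink l ≤-refl)) left)
          done′ : env σ C.fl ≢ 0 → Phase j cur (env σ C.fl) → cur ≡ value j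
          done′ n ph with env σ C.fl
          done′ n (searching _ _ _) | .0 = contradiction refl n
          done′ n (settled e _)     | .1 = e
          continue : Phase j cur 0 → F.arrives R j ≡ true → G.arrives R (N ∸ cur) ≡ false → Phase j (suc cur) 0
          continue (searching a gap _) t none = searching (m≤n⇒m≤1+n a) gap′ (inj₂ t)
            where
            gap′ : ∀ c → before j < c → c ≤ suc cur → ¬ InRange c
            gap′ c b l r with m≤n⇒m<n∨m≡n l
            ... | inj₁ l′ = gap c b (s≤s⁻¹ l′) r
            gap′ c b l (j₀ , j₀≤N , e) | inj₂ refl = contradiction (trans (sym (latest⇒arrives j₀≤N e)) none) λ ()

      pair-correct : ∀ {σ} → env σ C.n ≡ N → env σ C.lo ≡ lo → (∀ z → arr σ C.E z ≡ E z) →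
        Ends pair σ (9 + ((suc N + suc N) * 240 + 40))
             (λ σ′ → (∀ j → j ≤ N → arr σ′ C.EW (lo + (N ∸ j)) ≡ suc N ∸ value j) × (∀ z → z < lo → arr σ′ C.EW z ≡ arr σ C.EW z))
      pair-correct {σ₀} en elo eE = prefix 9 (C.j := # 0 ⨾ C.cur := # 0 ⨾ C.fl := # 0) (_ , _ , _ ,
        iterate pairTest pairBody (PairInv (arr σ₀ C.EW)) (suc N + suc N)
          (λ k σ sm I → _ , (_ , _ , subst (λ z → suc z < W) (sym (trans (varₛ sm C.n) en)) (small (lin 1 (λ N → [] ⊢ ‵ 1 :+ N :≤ ‵ 16 :* N :+ ‵ 16) N))) , _)
          (λ k σ sm I f → exit (trans (varₛ sm C.n) en) I f)
          (λ k σ sm I tr → pairStep (trans (varₛ sm C.n) en) (trans (varₛ sm C.lo) elo) (λ z → trans (arrₛ sm C.E z) (eE z)) I tr)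
          (pairInv ≤-refl z≤n z≤n (searching z≤n (λ c a b → contradiction a (≤⇒≯ b)) (inj₁ refl)) ((λ _ ()) , λ _ _ → refl)))
        where
        exit : ∀ {k σ} → env σ C.n ≡ N → PairInv (arr σ₀ C.EW) k σ → False pairTest σ →
               (∀ j → j ≤ N → arr σ C.EW (lo + (N ∸ j)) ≡ suc N ∸ value j) × (∀ z → z < lo → arr σ C.EW z ≡ arr σ₀ C.EW z)
        exit refl (pairInv _ _ _ _ (past , others)) f = (λ j l → past j (<-≤-trans (s≤s l) f)) , others

  record WindowSetting : Set₁ where
    constructor windowSetting
    field
      sp : Space
    open Space sp public
    field
      R β Β U : ℕ
      R≤N : R ≤ N
      R≤Uβ : R ≤ U * β
      power : Β ≡ 2 ^ β
      upper : Β * Β ≤ 4 * R + 1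
      β>0 : 0 < R → 0 < β
      NM AN : ℕ → ℕ
      conjs : ∀ a d → a < Β → d < Β → AN (a * Β + d) ≡ conj β a d
      P Tx : ℕ → ℕ
      Named : ℕ → ℕ → Set
      named-≤ : ∀ {c u} → Named c u → u ≤ R
      named-match : ∀ {y u c u′} → y < R → Named (P y) u → Named c u′ → (u ≡ᵇ u′) ≡ (P y ≡ᵇ c)
      fw bw lo : ℕ
      fw≤ : fw + N ≤ 6 * N
      bw≤ : bw + N ≤ 6 * N
      lo≤ : lo ≤ N + 1
      fwT : ∀ j → j < N → Named (Tx j) (NM (fw + j))
      bwT : ∀ j → j < N → Named (Tx j) (NM (bw + (N ∸ suc j)))
      fwP : ∀ y → y < R → Named (P y) (NM (4 * N + y))
      bwP : ∀ y → y < R → Named (P y) (NM (5 * N + (R ∸ suc y)))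

  module Windows (s : WindowSetting) where

    open WindowSetting s

    open Semantics mc

    open Mirror P Tx R N

    private
      bwT′ : ∀ j → j < N → Named (Tʳ j) (NM (bw + j))
      bwT′ j l = subst (λ z → Named (Tʳ j) (NM (bw + z))) (mirror l) (bwT (N ∸ suc j) (mirror< l))

      bwP′ : ∀ y → y < R → Named (Pʳ y) (NM (5 * N + y))
      bwP′ y l = subst (λ z → Named (Pʳ y) (NM (5 * N + z))) (mirror l) (bwP (R ∸ suc y) (mirror< l))

      matchʳ : ∀ q j → q < R → j < N → (NM (5 * N + q) ≡ᵇ NM (bw + j)) ≡ (Pʳ q ≡ᵇ Tʳ j)
      matchʳ q j l l′ = named-match (mirror< l) (bwP′ q l) (bwT′ j l′)

      backwards onwards : RunSetting
      backwards = runSetting sp R β Β U R≤N R≤Uβ power upper β>0 Pʳ Tʳ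
      onwards   = runSetting sp R β Β U R≤N R≤Uβ power upper β>0 P Tx

      module Back  = Running backwards
      module Front = Running onwards

      fits : ∀ k → k ≤ 5 → k * N + R ≤ 6 * N
      fits k l = ≤-trans (+-mono-≤ (*-monoˡ-≤ N l) R≤N) (lin 1 (λ N → [] ⊢ ‵ 5 :* N :+ N :≤ ‵ 6 :* N) N)

      module BackRun = Back.Block (Back.blockSetting bw (5 * N) 0 bw≤ (fits 5 ≤-refl) z≤n NM AN conjs
        (λ q l → named-≤ (bwP′ q l)) (λ j l → named-≤ (bwT′ j l)) matchʳ)
      module FrontRun = Front.Block (Front.blockSetting fw (4 * N) (1 + N) fw≤ (fits 4 (n≤1+n 4)) (≤-reflexive (+-comm 1 N)) NM AN conjs
        (λ q l → named-≤ (fwP q l)) (λ j l → named-≤ (fwT j l)) (λ q j l l′ → named-match l (fwP q l) (fwT j l′)))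

    record Setup (σ : Store) : Set where
      constructor setup
      field
        en  : env σ C.n ≡ N
        er  : env σ C.r ≡ R
        eb  : env σ C.b ≡ β
        eB  : env σ C.B ≡ Β
        efw : env σ C.fw ≡ fw
        ebw : env σ C.bw ≡ bw
        elo : env σ C.lo ≡ lo
        eNM : ∀ z → arr σ C.NM z ≡ NM z
        eAN : ∀ z → arr σ C.AN z ≡ AN z

    windowsTime : ℕ
    windowsTime = 20 + (BackRun.runTime + (20 + (FrontRun.runTime + (9 + ((suc N + suc N) * 240 + 40)))))

    windows-correct : ∀ {σ} → Setup σ → (∀ u → arr σ C.MK u ≡ 0) →
      Ends windows σ windowsTime (λ σ′ → (∀ i → i ≤ N → arr σ′ C.EW (lo + i) ≡ earliest i) ×
                                         (∀ z → z < lo → arr σ′ C.EW z ≡ arr σ C.EW z) × (∀ u → arr σ′ C.MK u ≡ 0))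
    windows-correct {σ₀} (setup en er eb eB efw ebw elo eNM eAN) clean =
      prefix 20 (C.tb := v C.bw ⨾ C.pb := # 5 ⊛ v C.n ⨾ C.eo := # 0)
       (_ , (_ , _ , subst (λ z → 5 * z < W) (sym en) (small (fiveN 5 ≤-refl))) , _ ,
        (BackRun.run-correct (Back.Block.fixed en er eb eB ebw (cong (5 *_) en) refl eNM eAN) clean then λ {σ₁} ((now₁ , _) , clean₁) sm₁ →
         prefix 20 (C.tb := v C.fw ⨾ C.pb := # 4 ⊛ v C.n ⨾ C.eo := # 1 ⊕ v C.n)
          (_ , (_ , _ , subst (λ z → 4 * z < W) (sym (trans (varₛ sm₁ C.n) en)) (small (fiveN 4 (n≤1+n 4)))) ,
           (_ , _ , subst (λ z → suc z < W) (sym (trans (varₛ sm₁ C.n) en)) (small (lin 1 (λ N → [] ⊢ ‵ 1 :+ N :≤ ‵ 16 :* N :+ ‵ 16) N))) ,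
           (FrontRun.run-correct (Front.Block.fixed (trans (varₛ sm₁ C.n) en) (trans (varₛ sm₁ C.r) er) (trans (varₛ sm₁ C.b) eb) (trans (varₛ sm₁ C.B) eB)
               (trans (varₛ sm₁ C.fw) efw) (cong (4 *_) (trans (varₛ sm₁ C.n) en)) (cong suc (trans (varₛ sm₁ C.n) en))
               (λ z → trans (arrₛ sm₁ C.NM z) (eNM z)) (λ z → trans (arrₛ sm₁ C.AN z) (eAN z))) clean₁ then λ {σ₂} ((now₂ , others₂) , clean₂) sm₂ →
            weaken (λ σ₃ ((vals , oth) , sm₃) →
               (λ i l → trans (cong (λ z → arr σ₃ C.EW (lo + z)) (sym (m∸[m∸n]≡n l))) (vals (N ∸ i) (m∸n≤m N i))) ,
               (λ z l → trans (oth z l) (trans (arrₛ sm₂ C.EW z) (arrₛ sm₁ C.EW z))) ,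
               (λ u → trans (arrₛ sm₃ C.MK u) (clean₂ u)))
            (framed (pair-correct′ lo lo≤ (arr σ₂ C.E)
               (λ j l → trans (others₂ j (s≤s l)) (now₁ j l))
               (λ j l → now₂ j l)
               (trans (varₛ sm₂ C.n) (trans (varₛ sm₁ C.n) en)) (trans (varₛ sm₂ C.lo) (trans (varₛ sm₁ C.lo) elo)) (λ _ → refl)))))))
      where
      -- The roles are exchanged: the pairing computes `latest` of the reversed text, from which
      -- `earliest` is defined.
      open Pairing (pairSetting sp R Pʳ Tʳ P Tx (λ x l → refl) (λ x l → refl)) renaming (pair-correct to pair-correct′)
      fiveN : ∀ k → k ≤ 5 → k * N ≤ 16 * N + 16
      fiveN k l = ≤-trans (*-monoˡ-≤ N l) (lin 1 (λ N → [] ⊢ ‵ 5 :* N :≤ ‵ 16 :* N :+ ‵ 16) N)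

-- One row of a table

module Table-rows where

  open Language
  open Arithmetic
  open Candidate-systems
  open Code using (row; rowStart; rowBody; rowLoad; rowSkip; rowMatch; rowJump; rowSave; increment)

  record Heap : Set where
    constructor heap
    field
      nc np : ℕ → ℕ
      top   : ℕ

  heapOf : Store → Heap
  heapOf σ = heap (arr σ C.NC) (arr σ C.NP) (env σ C.hp)

  -- Allocated nodes never change, so old nodes keep denoting their lists and can be shared as
  -- tails.
  record _⊑_ (η η′ : Heap) : Set where
    constructor extends
    field
      grow : Heap.top η ≤ Heap.top η′
      nc≡  : ∀ q → q < Heap.top η → Heap.nc η′ q ≡ Heap.nc η q
      np≡  : ∀ q → q < Heap.top η → Heap.np η′ q ≡ Heap.np η q

  ⊑-refl : ∀ {η} → η ⊑ η
  ⊑-refl = extends ≤-refl (λ _ _ → refl) (λ _ _ → refl)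

  ⊑-trans : ∀ {η₁ η₂ η₃} → η₁ ⊑ η₂ → η₂ ⊑ η₃ → η₁ ⊑ η₃
  ⊑-trans (extends a b c) (extends d e f) =
    extends (≤-trans a d) (λ q l → trans (e q (<-≤-trans l a)) (b q l)) (λ q l → trans (f q (<-≤-trans l a)) (c q l))

  push : ∀ {nc np h} x y → heap nc np h ⊑ heap (nc Defs.[ h ≔ x ]) (np Defs.[ h ≔ y ]) (suc h)
  push {nc} {np} {h} x y = extends (n≤1+n h) (λ q l → ≔-miss nc x (<⇒≢ l)) (λ q l → ≔-miss np y (<⇒≢ l))

  record Shape : Set₁ where
    constructor shape
    field
      N κ  : ℕ
      {D}  : Set
      size : D → ℕ
      len  : ℕ
      Cand : ℕ → ℕ → D → Set
      Den  : (ℕ → ℕ) → (ℕ → ℕ) → ℕ → ℕ → D → Set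

  module Spec (p : Shape) where

    open Shape p

    DenH : Heap → ℕ → D → Set
    DenH (heap nc np h) = Den nc np h

    -- A cell holds 0 or one more than the size of the candidate stored at its node.
    data Cell (η : Heap) (i j x p : ℕ) : Set where
      empty  : x ≡ 0 → Cell η i j x p
      filled : ∀ d → x ≡ suc (size d) → DenH η p d → Cand i j d → Cell η i j x p

    cell-≡ : ∀ {η i j x p x′ p′} → x′ ≡ x → p′ ≡ p → Cell η i j x p → Cell η i j x′ p′
    cell-≡ refl refl c = c

    -- At most κ characters of either suffix are left out.
    Near : ℕ → ℕ → D → Set
    Near i j d = N ≤ size d + len + κ + i × N ≤ size d + len + κ + j

    -- For F, `floor` is the end of the first window of B: jumps never lead to columns on its left,
    -- and values there could exceed the optimum and with it the budget for nodes.
    record Complete (floor i j x : ℕ) : Set where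
      constructor complete
      field best : ∀ d → floor ≤ j → Cand i j d → Near i j d → size d < x

    -- The additional cell N + 1 holds 0, so a jump to the end of a window that does not exist
    -- yields nothing.
    record RowOK (η : Heap) (floor i : ℕ) (V VN : ℕ → ℕ) : Set where
      constructor rowOK
      field
        cells  : ∀ j → j ≤ N → Cell η i j (V j) (VN j)
        border : V (suc N) ≡ 0
        optima : ∀ j → j ≤ N → Complete floor i j (V j)

    transport : (∀ {η η′ p d} → η ⊑ η′ → DenH η p d → DenH η′ p d) →
      ∀ {η η′ floor i V VN V′ VN′} → η ⊑ η′ → (∀ j → j ≤ suc N → V′ j ≡ V j × VN′ j ≡ VN j) → RowOK η floor i V VN → RowOK η′ floor i V′ VN′
    transport mono {η} {η′} {i = i} x same (rowOK cells border optima) = rowOK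
      (λ j l → cell-≡ (proj₁ (same j (m≤n⇒m≤1+n l))) (proj₂ (same j (m≤n⇒m≤1+n l))) (lift (cells j l)))
      (trans (proj₁ (same (suc N) ≤-refl)) border)
      (λ j l → subst (Complete _ _ j) (sym (proj₁ (same j (m≤n⇒m≤1+n l)))) (optima j l))
      where
      lift : ∀ {j x p} → Cell η i j x p → Cell η′ i j x p
      lift (empty z) = empty z
      lift (filled d e y c) = filled d e (mono x y) c

  record RowSetting : Set₁ where
    constructor rowSetting
    field
      sp : Space
    open Space sp public
    field
      κ     : ℕ
      κ≤    : κ ≤ 2 * N + 1
      charW : ∀ τ i → suc (charAt (input τ) i) < 2 ^ w
      i     : ℕ
      i≤N   : i ≤ N
      S     : System (charAt (input tapeA)) (charAt (input tapeB)) N i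

  module Row (s : RowSetting) where

    open RowSetting s
    open Semantics mc
    open System S

    open Spec (shape N κ size len Cand Den) public

    den-⊑ : ∀ {η η′ p d} → η ⊑ η′ → DenH η p d → DenH η′ p d
    den-⊑ (extends a b c) = den-mono a b c

    cell-⊑ : ∀ {η η′ i j x p} → η ⊑ η′ → Cell η i j x p → Cell η′ i j x p
    cell-⊑ e (empty z) = empty z
    cell-⊑ e (filled d x y c) = filled d x (den-⊑ e y) c

    cell-skip : ∀ {η j x p} → Cell η (suc i) j x p → Cell η i j x p
    cell-skip (empty z) = empty z
    cell-skip (filled d e y c) = filled d e y (skipA c)

    cell-left : ∀ {η j x p} → Cell η i (suc j) x p → Cell η i j x p
    cell-left (empty z) = empty z
    cell-left (filled d e y c) = filled d e y (skipB c)

    -- The first bound in `budget` is two nodes, one by a match and one by a jump, for each of at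
    -- most 2 κ + 1 cells.
    record Region : Set where
      constructor region
      field
        off floor M β : ℕ
        off≤    : off ≤ N + 2
        Mbound  : ∀ j d → floor ≤ j → Cand i j d → size d < M
        budget  : 2 * (2 * κ + 1) ⊓ M ≤ β

    module _ (g : Region) where

      open Region g

      -- What the jump step may use: the cells of the other array at the ends of the windows.
      record Jumps (jmp : ℕ) (η : Heap) (V VN EW : ℕ → ℕ) : Set where
        constructor jumps
        field
          none   : jmp ≡ 0 → ∀ j d → ¬ Jump j d
          apart  : jmp ≢ 0 → off ≡ N + 2
          target : jmp ≢ 0 → ∀ j → j ≤ N → EW (suc N + j) ≤ suc N
          sound  : jmp ≢ 0 → ∀ j → j ≤ N → V (EW (suc N + j)) ≡ 0 ⊎ ∃[ d ] (V (EW (suc N + j)) ≡ suc (size d) × Cand i j d ×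
                     (∀ η′ q → η ⊑ η′ → 0 < q → q < Heap.top η′ → Heap.nc η′ q ≡ 0 → Heap.np η′ q ≡ VN (EW (suc N + j)) → DenH η′ q d))
          best   : jmp ≢ 0 → ∀ j d → j ≤ N → Jump j d → Near i j d → size d < V (EW (suc N + j))

      -- The loop decrements before it computes, so `top` is one column to the right of the band.
      top bot : ℕ
      top = suc (N ⊓ (i + κ))
      bot = (i ∸ κ) ⊔ floor

      private
        top≤ : top ≤ suc N
        top≤ = s≤s (m⊓n≤m N (i + κ))

        width : top ∸ bot ≤ 2 * κ + 1
        width = ≤-trans (∸-mono (s≤s (m⊓n≤n N (i + κ))) (m≤m⊔n (i ∸ κ) floor)) (m≤n+o⇒m∸n≤o (suc (i + κ)) (i ∸ κ)
          (lin 3 (λ i k d → (i :≤ k :+ d) ∷ [] ⊢ ‵ 1 :+ (i :+ k) :≤ d :+ (‵ 2 :* k :+ ‵ 1)) i κ (i ∸ κ) (m≤n+m∸n i κ)))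

      record Origin : Set where
        constructor origin
        field
          η₀        : Heap
          V₀ VN₀ EW : ℕ → ℕ
          jmp       : ℕ
          0<h₀      : 0 < Heap.top η₀
          old       : RowOK η₀ floor (suc i) (λ j → V₀ (off + j)) (λ j → VN₀ (off + j))
          Jm         : Jumps jmp η₀ V₀ VN₀ EW
          h₀+β≤     : Heap.top η₀ + β ≤ lim

      module Cells (o : Origin) where

        open Origin o

        h₀ : ℕ
        h₀ = Heap.top η₀

        record Fixed (σ : Store) : Set where
          constructor fixed
          field
            en   : env σ C.n ≡ N
            eoff : env σ C.off ≡ off
            ejmp : env σ C.jmp ≡ jmp
            ec   : env σ C.c ≡ charAt (input tapeA) i
            eEW  : ∀ z → arr σ C.EW z ≡ EW z

        -- k counts the cells of the row that may have allocated nodes.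
        record Grown (k cur : ℕ) (σ : Store) : Set where
          constructor grown
          field
            ext    : η₀ ⊑ heapOf σ
            cells≤ : env σ C.hp ≤ h₀ + k
            cur≤   : env σ C.hp ≤ h₀ + cur
            M≤     : env σ C.hp ≤ h₀ + M

        allocate : ∀ {k cur x σ} → Grown k cur σ → cur < x → x ≤ M → suc k ≤ 2 * (2 * κ + 1) →
                   suc (env σ C.hp) ≤ h₀ + suc k × suc (env σ C.hp) ≤ h₀ + x × suc (env σ C.hp) ≤ h₀ + M × env σ C.hp < lim
        allocate {k} {cur} {x} {σ} (grown _ c u m) l x≤ k≤ = a , b , b′ , ≤-trans (≤-trans (⊓-glb (≤-trans a (+-monoʳ-≤ h₀ k≤)) b′)
            (≤-reflexive (sym (+-distribˡ-⊓ h₀ (2 * (2 * κ + 1)) M)))) (≤-trans (+-monoʳ-≤ h₀ budget) h₀+β≤)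
          where
          a = ≤-trans (s≤s c) (≤-reflexive (sym (+-suc h₀ k)))
          b = ≤-trans (s≤s u) (≤-trans (≤-reflexive (sym (+-suc h₀ cur))) (+-monoʳ-≤ h₀ l))
          b′ = ≤-trans b (+-monoʳ-≤ h₀ x≤)

        cell-≤ : ∀ {η j x p} → Cell η i j x p → x ≤ suc N
        cell-≤ (empty refl) = z≤n
        cell-≤ {j = j} (filled d refl _ c) = s≤s (≤-trans (≤-trans (m≤m+n (size d) len) (m≤m+n _ i)) (boundA c))

        cell-M : ∀ {η j x p} → floor ≤ j → Cell η i j x p → x ≤ M
        cell-M l (empty refl) = z≤n
        cell-M l (filled d refl _ c) = Mbound _ d l c

        private
          x-W : ∀ {x} → x ≤ N + 2 → x < W
          x-W l = small (≤-trans l (lin 1 (λ N → [] ⊢ N :+ ‵ 2 :≤ ‵ 16 :* N :+ ‵ 16) N))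

          lim-W : ∀ {x} → x < lim → suc x < W
          lim-W l = ≤-<-trans l lim<W

        skip-correct : ∀ {σ q} → Cell (heapOf σ) i q (env σ C.cur) (env σ C.nd) → Cell (heapOf σ) i q (env σ C.m) (env σ C.mn) →
          Ends rowSkip σ 30 (λ σ′ → Cell (heapOf σ′) i q (env σ′ C.cur) (env σ′ C.nd) × env σ C.cur ≤ env σ′ C.cur × env σ C.m ≤ env σ′ C.cur)
        skip-correct x y = straight rowSkip (_ , (λ l → _ , _ , y , <⇒≤ l , ≤-refl) , (λ l → x , ≤-refl , l))

        match-correct : ∀ {σ q k} → Fixed σ → env σ C.j ≡ q → suc q ≤ suc N → floor ≤ q → suc k ≤ 2 * (2 * κ + 1) → Grown k (env σ C.cur) σ →
          Cell (heapOf σ) i q (env σ C.cur) (env σ C.nd) → Cell (heapOf σ) (suc i) (suc q) (env σ C.dg) (env σ C.dgn) →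
          Ends rowMatch σ 80 (λ σ′ → Cell (heapOf σ′) i q (env σ′ C.cur) (env σ′ C.nd) × env σ C.cur ≤ env σ′ C.cur × heapOf σ ⊑ heapOf σ′ ×
            Grown (suc k) (env σ′ C.cur) σ′ × (0 < env σ C.dg → charAt (input tapeA) i ≡ charAt (input tapeB) q → env σ C.dg < env σ′ C.cur))
        match-correct {σ} {q} {k} (fixed en eoff ejmp ec eEW) refl q≤ floor≤q k≤ g x diag = straight rowMatch
          ((_ , λ _ → _ , λ _ → _ , (_ , _ , dg-W) , _)
          , (λ (0<dg , c≡ , l) → let (a , b , b′ , h<lim) = allocate g l (cell-M floor≤q (cell 0<dg c≡)) k≤ in
               _ , (_ , _ , subst (λ z → suc z < W) (sym ec) (charW tapeA i)) , h<lim , _ , _ , h<lim , (_ , _ , dg-W) , _ , (_ , _ , lim-W h<lim) ,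
               cell 0<dg c≡ , <⇒≤ l , push (suc (env σ C.c)) (env σ C.dgn) ,
               grown (⊑-trans (Grown.ext g) (push (suc (env σ C.c)) (env σ C.dgn))) a b b′ , λ _ _ → ≤-refl)
          , (λ f → x , ≤-refl , ⊑-refl , grown (Grown.ext g) (≤-trans (Grown.cells≤ g) (+-monoʳ-≤ h₀ (n≤1+n k))) (Grown.cur≤ g) (Grown.M≤ g) ,
               λ 0<dg a≡b → failed f 0<dg a≡b))
          where
          dg-≤ : env σ C.dg ≤ suc N
          dg-≤ = cell-≤ (cell-skip diag)
          dg-W : suc (env σ C.dg) < W
          dg-W = x-W (≤-trans (s≤s dg-≤) (≤-reflexive (+-comm 2 N)))
          ση : Heap
          ση = heap (arr σ C.NC Defs.[ env σ C.hp ≔ suc (env σ C.c) ]) (arr σ C.NP Defs.[ env σ C.hp ≔ env σ C.dgn ]) (suc (env σ C.hp))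
          cell : 0 < env σ C.dg → env σ C.c ≡ charAt (input tapeB) q → Cell ση i q (suc (env σ C.dg)) (env σ C.hp)
          cell 0<dg c≡ = build diag
            where
            build : Cell (heapOf σ) (suc i) (suc q) (env σ C.dg) (env σ C.dgn) → Cell ση i q (suc (env σ C.dg)) (env σ C.hp)
            build (empty z) = contradiction z (>⇒≢ 0<dg)
            build (filled d e y cd) = filled (cons (charAt (input tapeA) i) d) (trans (cong suc e) (cong suc (sym (size-cons _ d))))
              (den-cons (<-≤-trans 0<h₀ (_⊑_.grow (Grown.ext g))) ≤-refl (trans (≔-hit (arr σ C.NC) _ _) (cong suc ec)) (≔-hit (arr σ C.NP) _ _)
                 (den-⊑ (push (suc (env σ C.c)) (env σ C.dgn)) y))
              (match (trans (sym ec) c≡) cd)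
          failed : False ((# 0 ⋖ v C.dg) && ((v C.c ≐ rd tapeB (v C.j)) && (v C.cur ⋖ # 1 ⊕ v C.dg))) σ →
                   0 < env σ C.dg → charAt (input tapeA) i ≡ charAt (input tapeB) q → env σ C.dg < env σ C.cur
          failed (inj₁ dg≤0) 0<dg _ = contradiction 0<dg (≤⇒≯ dg≤0)
          failed (inj₂ (_ , inj₁ c≢)) _ a≡b = contradiction (trans ec a≡b) c≢
          failed (inj₂ (_ , inj₂ (_ , l))) _ _ = l

        jump-correct : ∀ {σ q k} → Fixed σ → env σ C.j ≡ q → suc q ≤ suc N → floor ≤ q → suc k ≤ 2 * (2 * κ + 1) → Grown k (env σ C.cur) σ →
          Cell (heapOf σ) i q (env σ C.cur) (env σ C.nd) →
          (jmp ≢ 0 → ∀ z → z ≤ suc N → arr σ C.V z ≡ V₀ z × arr σ C.VN z ≡ VN₀ z) →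
          Ends rowJump σ 160 (λ σ′ → Cell (heapOf σ′) i q (env σ′ C.cur) (env σ′ C.nd) × env σ C.cur ≤ env σ′ C.cur × heapOf σ ⊑ heapOf σ′ ×
            Grown (suc k) (env σ′ C.cur) σ′ × (jmp ≢ 0 → V₀ (EW (suc N + q)) ≤ env σ′ C.cur))
        jump-correct {σ} {q} {k} (fixed en eoff ejmp ec eEW) refl q≤ floor≤q k≤ g x same = straight rowJump
          ((_ , λ 0<j → _ , okV (pos 0<j) , _)
          , (λ (0<j , l) → let jmp≢0 = pos 0<j ; l′ = subst (env σ C.cur <_) (V≡ jmp≢0) l
                               (a , b , b′ , h<lim) = allocate g l′ (cell-M floor≤q (cell jmp≢0 (<-≤-trans (s≤s z≤n) l′))) k≤ in
               _ , _ , h<lim , _ , okV jmp≢0 , h<lim , okV jmp≢0 , _ , (_ , _ , lim-W h<lim) ,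
               cell-≡ (V≡ jmp≢0) refl (cell jmp≢0 (<-≤-trans (s≤s z≤n) l′)) , <⇒≤ l , push 0 _ ,
               grown (⊑-trans (Grown.ext g) (push 0 _)) a (≤-trans b (≤-reflexive (cong (h₀ +_) (sym (V≡ jmp≢0))))) b′ , λ n → ≤-reflexive (sym (V≡ n)))
          , (λ f → x , ≤-refl , ⊑-refl , grown (Grown.ext g) (≤-trans (Grown.cells≤ g) (+-monoʳ-≤ h₀ (n≤1+n k))) (Grown.cur≤ g) (Grown.M≤ g) ,
               λ n → failed f n))
          where
          target = EW (suc N + q)
          slot = suc (env σ C.n) + q
          slot≡ : slot ≡ suc N + q
          slot≡ = cong (λ n → suc n + q) en
          e≡ : arr σ C.EW slot ≡ target
          e≡ = trans (cong (arr σ C.EW) slot≡) (eEW _)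
          pos : 0 < env σ C.jmp → jmp ≢ 0
          pos l refl = contradiction ejmp (>⇒≢ l)
          target≤ : jmp ≢ 0 → target ≤ suc N
          target≤ n = Jumps.target Jm n q (s≤s⁻¹ q≤)
          V≡ : jmp ≢ 0 → arr σ C.V (arr σ C.EW slot) ≡ V₀ target
          V≡ n = trans (cong (arr σ C.V) e≡) (proj₁ (same n target (target≤ n)))
          VN≡ : jmp ≢ 0 → arr σ C.VN (arr σ C.EW slot) ≡ VN₀ target
          VN≡ n = trans (cong (arr σ C.VN) e≡) (proj₂ (same n target (target≤ n)))
          slot-≤ : suc N + q ≤ 16 * N + 15
          slot-≤ = lin 2 (λ q N → (q :≤ N) ∷ [] ⊢ ‵ 1 :+ N :+ q :≤ ‵ 16 :* N :+ ‵ 15) q N (s≤s⁻¹ q≤)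
          okV : jmp ≢ 0 → ok (ld C.V (ld C.EW (# 1 ⊕ v C.n ⊕ v C.j))) σ
          okV n = _ , (_ , ((_ , _ , subst (λ n → suc n < W) (sym en) (x-W (≤-trans (n≤1+n _) (≤-reflexive (+-comm 2 N)))))
                           , _ , subst (_< W) (sym slot≡) (small (loosen slot-≤))) , subst (_< lim) (sym slot≡) (room′ slot-≤)) ,
                  subst (_< lim) (sym e≡) (room′ (≤-trans (target≤ n) (lin 1 (λ N → [] ⊢ ‵ 1 :+ N :≤ ‵ 16 :* N :+ ‵ 15) N)))
          σvn : ℕ
          σvn = arr σ C.VN (arr σ C.EW slot)
          σν : Heap
          σν = heap (arr σ C.NC Defs.[ env σ C.hp ≔ 0 ]) (arr σ C.NP Defs.[ env σ C.hp ≔ σvn ]) (suc (env σ C.hp))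
          cell : jmp ≢ 0 → 0 < V₀ target → Cell σν i q (V₀ target) (env σ C.hp)
          cell n 0<V = build (Jumps.sound Jm n q (s≤s⁻¹ q≤))
            where
            build : _ → Cell σν i q (V₀ target) (env σ C.hp)
            build (inj₁ z) = contradiction z (>⇒≢ 0<V)
            build (inj₂ (d , e , cd , mk)) = filled d e
              (mk σν (env σ C.hp) (⊑-trans (Grown.ext g) (push 0 σvn)) (<-≤-trans 0<h₀ (_⊑_.grow (Grown.ext g))) ≤-refl
                (≔-hit (arr σ C.NC) _ _) (trans (≔-hit (arr σ C.NP) _ _) (VN≡ n))) cd
          failed : False ((# 0 ⋖ v C.jmp) && (v C.cur ⋖ ld C.V (ld C.EW (# 1 ⊕ v C.n ⊕ v C.j)))) σ → jmp ≢ 0 → V₀ target ≤ env σ C.cur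
          failed (inj₁ j≤0) n = contradiction (trans (sym ejmp) (n≤0⇒n≡0 j≤0)) n
          failed (inj₂ (_ , l)) n = subst (_≤ env σ C.cur) (V≡ n) l

        refix : ∀ {c σ σ′} → (∀ z → arr σ′ C.EW z ≡ arr σ C.EW z) →
                {_ : T (not (writesV c C.n))} {_ : T (not (writesV c C.off))} {_ : T (not (writesV c C.jmp))} {_ : T (not (writesV c C.c))} →
                Same c σ σ′ → Fixed σ → Fixed σ′
        refix q {a} {b} {d} {e} sm (fixed en eoff ejmp ec eEW) =
          fixed (trans (varₛ sm C.n {a}) en) (trans (varₛ sm C.off {b}) eoff) (trans (varₛ sm C.jmp {d}) ejmp) (trans (varₛ sm C.c {e}) ec)
                (λ z → trans (q z) (eEW z))

        -- Columns from j on are new, those below j still belong to row i + 1. The alternative in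
        -- `low` is for an empty band, where j never moves.
        record RowInv (k : ℕ) (σ : Store) : Set where
          field
            left   : env σ C.j ∸ bot ≡ k
            j≤top  : env σ C.j ≤ top
            low    : bot ≤ env σ C.j ⊎ env σ C.j ≡ top
            sized  : Grown (2 * (top ∸ env σ C.j)) (env σ C.cur) σ
            right  : Cell (heapOf σ) i (env σ C.j) (env σ C.cur) (env σ C.nd)
            diag   : Cell (heapOf σ) (suc i) (env σ C.j) (env σ C.dg) (env σ C.dgn)
            rightBest : Complete floor i (env σ C.j) (env σ C.cur)
            diagBest  : Complete floor (suc i) (env σ C.j) (env σ C.dg)
            new    : ∀ j → env σ C.j ≤ j → j ≤ N → Cell (heapOf σ) i j (arr σ C.V (off + j)) (arr σ C.VN (off + j)) ×
                     Complete floor i j (arr σ C.V (off + j))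
            olds   : ∀ j → j < env σ C.j → arr σ C.V (off + j) ≡ V₀ (off + j) × arr σ C.VN (off + j) ≡ VN₀ (off + j)
            edge   : arr σ C.V (off + suc N) ≡ 0
            before : ∀ z → z < off → arr σ C.V z ≡ V₀ z × arr σ C.VN z ≡ VN₀ z
            after  : ∀ z → off + suc N < z → arr σ C.V z ≡ V₀ z × arr σ C.VN z ≡ VN₀ z

        private
          rowTest : Exp
          rowTest = v C.x ⋖ v C.j

          suc-∸ : ∀ {j} → 0 < j → suc (j ∸ 1) ≡ j
          suc-∸ {suc j} _ = refl

          same-heap : ∀ {σ σ′} → env σ′ C.hp ≡ env σ C.hp → (∀ z → arr σ′ C.NC z ≡ arr σ C.NC z) → (∀ z → arr σ′ C.NP z ≡ arr σ C.NP z) →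
                      heapOf σ ⊑ heapOf σ′
          same-heap e p q = extends (≤-reflexive (sym e)) (λ z _ → p z) (λ z _ → q z)

          regrown : ∀ {k cur cur′ σ σ′} → env σ′ C.hp ≡ env σ C.hp → heapOf σ ⊑ heapOf σ′ → cur ≤ cur′ → Grown k cur σ → Grown k cur′ σ′
          regrown {k} {cur} {cur′} e x l (grown ext a b c) =
            grown (⊑-trans ext x) (subst (_≤ h₀ + k) (sym e) a) (subst (_≤ h₀ + cur′) (sym e) (≤-trans b (+-monoʳ-≤ h₀ l))) (subst (_≤ h₀ + M) (sym e) c)

          near-A : ∀ {q d} → Near i q d → Near (suc i) q d
          near-A {q} {d} (a , b) = ≤-trans a (+-monoʳ-≤ (size d + len + κ) (n≤1+n i)) , b

          near-B : ∀ {q d} → Near i q d → Near i (suc q) d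
          near-B {q} {d} (a , b) = a , ≤-trans b (+-monoʳ-≤ (size d + len + κ) (n≤1+n q))

          near-match : ∀ {q d d′} → size d ≡ suc (size d′) → Near i q d → Near (suc i) (suc q) d′
          near-match {q} {d} {d′} e (a , b) = shift i a , shift q b
            where
            shift : ∀ x → N ≤ size d + len + κ + x → N ≤ size d′ + len + κ + suc x
            shift x l = ≤-trans l (≤-reflexive (trans (cong (λ s → s + len + κ + x) e) (sym (+-suc (size d′ + len + κ) x))))

        rowTime : ℕ
        rowTime = 60 + (30 + (80 + (160 + 60)))

        rowStep : ∀ {k σ} → Fixed σ → env σ C.x ≡ bot → RowInv k σ → True rowTest σ →
                  Σ[ k′ ∈ ℕ ] k′ < k × Ends rowBody σ rowTime (RowInv k′)
        rowStep {k} {σ} (fixed en eoff ejmp ec eEW) ex I tr =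
          q ∸ bot , subst (q ∸ bot <_) (RowInv.left I) (∸-monoˡ-< {q} {bot} {env σ C.j} (≤-reflexive sq) bot≤q) ,
          prefix 60 rowLoad (_ , (_ , (_ , _ , slot<W) , slot<lim) , (_ , (_ , _ , slot<W) , slot<lim) ,
           (skip-correct {q = q} (cell-left (subst (λ z → Cell (heapOf σ) i z (env σ C.cur) (env σ C.nd)) (sym sq) (RowInv.right I)))
                         (cell-skip (cell-≡ (cong (arr σ C.V) slot₀) (cong (arr σ C.VN) slot₀) old-cell))
            then λ {σ₁} (c₁ , cur≤₁ , m≤₁) sm₁ →
            let x₁ = same-heap {σ} {σ₁} (varₛ sm₁ C.hp) (arrₛ sm₁ C.NC) (arrₛ sm₁ C.NP)
                F₁ = refix (arrₛ sm₁ C.EW) sm₁ (fixed en eoff ejmp ec eEW)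
                g₁ = regrown {σ = σ} {σ₁} (varₛ sm₁ C.hp) x₁ cur≤₁ (RowInv.sized I) in
            match-correct F₁ (varₛ sm₁ C.j) q≤ floor≤q room₁ g₁ c₁
              (cell-≡ (varₛ sm₁ C.dg) (varₛ sm₁ C.dgn) (cell-⊑ x₁ (subst (λ z → Cell (heapOf σ) (suc i) z (env σ C.dg) (env σ C.dgn)) (sym sq) (RowInv.diag I))))
            then λ {σ₂} (c₂ , cur≤₂ , x₂ , g₂ , byMatch) sm₂ →
            let F₂ = refix (arrₛ sm₂ C.EW) sm₂ F₁ in
            jump-correct F₂ (trans (varₛ sm₂ C.j) (varₛ sm₁ C.j)) q≤ floor≤q room₂ g₂ c₂
              (λ n z l → let (a , b) = RowInv.before I z (subst (z <_) (sym (Jumps.apart Jm n)) (≤-trans (s≤s l) (≤-reflexive (+-comm 2 N)))) in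
                 trans (arrₛ sm₂ C.V z) (trans (arrₛ sm₁ C.V z) a) , trans (arrₛ sm₂ C.VN z) (trans (arrₛ sm₁ C.VN z) b))
            then λ {σ₃} (c₃ , cur≤₃ , x₃ , g₃ , byJump) sm₃ →
            let ej = trans (varₛ sm₃ C.j) (trans (varₛ sm₂ C.j) (varₛ sm₁ C.j))
                eo = trans (varₛ sm₃ C.off) (trans (varₛ sm₂ C.off) (trans (varₛ sm₁ C.off) eoff))
                em = trans (varₛ sm₃ C.m) (trans (varₛ sm₂ C.m) (trans (varₛ sm₁ C.m) (cong (arr σ C.V) slot₀)))
                emn = trans (varₛ sm₃ C.mn) (trans (varₛ sm₂ C.mn) (trans (varₛ sm₁ C.mn) (cong (arr σ C.VN) slot₀)))
                eV = λ z → trans (arrₛ sm₃ C.V z) (trans (arrₛ sm₂ C.V z) (arrₛ sm₁ C.V z))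
                eVN = λ z → trans (arrₛ sm₃ C.VN z) (trans (arrₛ sm₂ C.VN z) (arrₛ sm₁ C.VN z))
                slot = cong₂ _+_ eo ej
                x = ⊑-trans x₁ (⊑-trans x₂ x₃)
                eta = varₛ sm₁ C.dg
                best = optimal (≤-trans (≤-reflexive (cong (arr σ C.V) (sym slot₀))) (≤-trans m≤₁ (≤-trans cur≤₂ cur≤₃))) (≤-trans cur≤₁ (≤-trans cur≤₂ cur≤₃))
                         (λ p e → <-≤-trans (subst₂ _<_ eta refl (byMatch (subst (0 <_) (sym eta) p) e)) cur≤₃) byJump in
            straight rowSave (_ , _ , (_ , _ , subst (_< W) (sym slot) (small (loosen off-index))) , _ , subst (_< lim) (sym slot) (room′ off-index) ,
              (_ , _ , subst (_< W) (sym slot) (small (loosen off-index))) , _ , subst (_< lim) (sym slot) (room′ off-index) ,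
              record
              { left = cong (_∸ bot) ej
              ; j≤top = subst (_≤ top) (sym ej) (<⇒≤ q<top)
              ; low = inj₁ (subst (bot ≤_) (sym ej) bot≤q)
              ; sized = let (grown a b c d) = g₃ in grown a (≤-trans b (≤-reflexive (cong (h₀ +_) (trans count≡ (cong (λ z → 2 * (top ∸ z)) (sym ej)))))) c d
              ; right = subst (λ z → Cell (heapOf σ₃) i z (env σ₃ C.cur) (env σ₃ C.nd)) (sym ej) c₃
              ; diag = subst (λ z → Cell (heapOf σ₃) (suc i) z (env σ₃ C.m) (env σ₃ C.mn)) (sym ej) (cell-≡ em emn (cell-⊑ x old-cell))
              ; rightBest = subst (λ z → Complete floor i z (env σ₃ C.cur)) (sym ej) best
              ; diagBest = subst₂ (λ z y → Complete floor (suc i) z y) (sym ej) (sym em) old-best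
              ; new = λ j l l′ → renew eV eVN slot x c₃ best j (subst (_≤ j) ej l) l′
              ; olds = λ j l → let l′ = subst (j <_) ej l ; (a , b) = RowInv.olds I j (≤-trans l′ (≤-trans (n≤1+n q) (≤-reflexive sq))) in
                  trans (miss (eV) slot (<⇒≢ l′)) a , trans (miss (eVN) slot (<⇒≢ l′)) b
              ; edge = trans (miss eV slot (>⇒≢ q≤)) (RowInv.edge I)
              ; before = λ z l → let (a , b) = RowInv.before I z l ; ne = <⇒≢ (<-≤-trans l (m≤m+n off q)) in
                  trans (miss′ eV slot ne) a , trans (miss′ eVN slot ne) b
              ; after = λ z l → let (a , b) = RowInv.after I z l ; ne = >⇒≢ (≤-<-trans (+-monoʳ-≤ off (<⇒≤ q≤)) l) in
                  trans (miss′ eV slot ne) a , trans (miss′ eVN slot ne) b })))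
          where
          q = env σ C.j ∸ 1
          bot<j : bot < env σ C.j
          bot<j = subst (_< env σ C.j) ex tr
          sq : suc q ≡ env σ C.j
          sq = suc-∸ (≤-<-trans z≤n bot<j)
          bot≤q : bot ≤ q
          bot≤q = s≤s⁻¹ (subst (bot <_) (sym sq) bot<j)
          floor≤q : floor ≤ q
          floor≤q = ≤-trans (m≤n⊔m (i ∸ κ) floor) bot≤q
          q<top : q < top
          q<top = subst (_≤ top) (sym sq) (RowInv.j≤top I)
          q≤ : suc q ≤ suc N
          q≤ = ≤-trans q<top top≤
          q≤N : q ≤ N
          q≤N = s≤s⁻¹ q≤
          off-index : off + q ≤ 16 * N + 15
          off-index = lin 3 (λ o q N → (o :≤ N :+ ‵ 2) ∷ (q :≤ N) ∷ [] ⊢ o :+ q :≤ ‵ 16 :* N :+ ‵ 15) off q N off≤ q≤N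
          slot₀ : env σ C.off + q ≡ off + q
          slot₀ = cong (_+ q) eoff
          slot<W : env σ C.off + q < W
          slot<W = ≤-<-trans (≤-reflexive slot₀) (small (loosen off-index))
          slot<lim : env σ C.off + q < lim
          slot<lim = ≤-<-trans (≤-reflexive slot₀) (room′ off-index)
          c = 2 * (top ∸ env σ C.j)
          suc-top : top ∸ q ≡ suc (top ∸ env σ C.j)
          suc-top = trans (+-∸-assoc 1 {N ⊓ (i + κ)} {q} (s≤s⁻¹ q<top)) (cong (λ z → suc (top ∸ z)) sq)
          count≡ : suc (suc c) ≡ 2 * (top ∸ q)
          count≡ = trans (sym (*-suc 2 (top ∸ env σ C.j))) (cong (2 *_) (sym suc-top))
          room₂ : suc (suc c) ≤ 2 * (2 * κ + 1)
          room₂ = ≤-trans (≤-reflexive count≡) (*-monoʳ-≤ 2 (≤-trans (∸-monoʳ-≤ top bot≤q) width))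
          room₁ : suc c ≤ 2 * (2 * κ + 1)
          room₁ = <⇒≤ room₂
          old-V = proj₁ (RowInv.olds I q (≤-reflexive sq))
          old-VN = proj₂ (RowInv.olds I q (≤-reflexive sq))
          old-cell : Cell (heapOf σ) (suc i) q (arr σ C.V (off + q)) (arr σ C.VN (off + q))
          old-cell = cell-≡ old-V old-VN (cell-⊑ (Grown.ext (RowInv.sized I)) (RowOK.cells old q q≤N))
          old-best : Complete floor (suc i) q (arr σ C.V (off + q))
          old-best = subst (Complete floor (suc i) q) (sym old-V) (RowOK.optima old q q≤N)
          -- Each way of decomposing a candidate has been compared with the value: the old cell, the
          -- right neighbour, the saved diagonal, the jump. The smaller candidate is again near,
          -- which is what makes its cell complete for it.
          optimal : ∀ {x} → arr σ C.V (off + q) ≤ x → env σ C.cur ≤ x →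
                    (0 < env σ C.dg → charAt (input tapeA) i ≡ charAt (input tapeB) q → env σ C.dg < x) →
                    (jmp ≢ 0 → V₀ (EW (suc N + q)) ≤ x) → Complete floor i q x
          optimal {x} m≤ r≤ bm bj = complete λ d fl cd nr → by-case d fl nr (cases cd)
            where
            by-case : ∀ d → floor ≤ q → Near i q d → _ → size d < x
            by-case d fl nr (inj₁ cd) = <-≤-trans (Complete.best old-best d fl cd (near-A nr)) m≤
            by-case d fl nr (inj₂ (inj₁ cd)) =
              <-≤-trans (Complete.best (subst (λ z → Complete floor i z (env σ C.cur)) (sym sq) (RowInv.rightBest I)) d (m≤n⇒m≤1+n fl) cd (near-B nr)) r≤
            by-case d fl nr (inj₂ (inj₂ (inj₁ (ab , d′ , e , cd)))) = subst (_< x) (sym e) (≤-<-trans l′ (bm (≤-<-trans z≤n l′) ab))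
              where
              l′ : size d′ < env σ C.dg
              l′ = Complete.best (subst (λ z → Complete floor (suc i) z (env σ C.dg)) (sym sq) (RowInv.diagBest I)) d′ (m≤n⇒m≤1+n fl) cd (near-match e nr)
            by-case d fl nr (inj₂ (inj₂ (inj₂ jd))) with jmp ≟ 0
            ... | yes z = contradiction jd (Jumps.none Jm z q d)
            ... | no nz = <-≤-trans (Jumps.best Jm nz q d q≤N jd nr) (bj nz)
          miss′ : ∀ {f g : ℕ → ℕ} {y t z} → (∀ z → f z ≡ g z) → t ≡ off + q → z ≢ off + q → (f Defs.[ t ≔ y ]) z ≡ g z
          miss′ {f} e refl ne = trans (≔-miss f _ ne) (e _)
          miss : ∀ {f g : ℕ → ℕ} {y t j} → (∀ z → f z ≡ g z) → t ≡ off + q → j ≢ q → (f Defs.[ t ≔ y ]) (off + j) ≡ g (off + j)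
          miss e te ne = miss′ e te (λ x → ne (+-cancelˡ-≡ off _ _ x))
          renew : ∀ {f g : ℕ → ℕ} {t y y′ η} → (∀ z → f z ≡ arr σ C.V z) → (∀ z → g z ≡ arr σ C.VN z) → t ≡ off + q → heapOf σ ⊑ η →
                  Cell η i q y y′ → Complete floor i q y → ∀ j → q ≤ j → j ≤ N →
                  Cell η i j ((f Defs.[ t ≔ y ]) (off + j)) ((g Defs.[ t ≔ y′ ]) (off + j)) × Complete floor i j ((f Defs.[ t ≔ y ]) (off + j))
          renew {f} {g} {t} {y} {y′} {η} ef eg refl x cl bst j l l′ with m≤n⇒m<n∨m≡n l
          ... | inj₂ refl = cell-≡ (≔-hit f (off + q) y) (≔-hit g (off + q) y′) cl , subst (Complete floor i q) (sym (≔-hit f (off + q) y)) bst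
          ... | inj₁ q<j = let (a , b) = RowInv.new I j (subst (_≤ j) sq q<j) l′ in
                cell-≡ (miss ef refl (>⇒≢ q<j)) (miss eg refl (>⇒≢ q<j)) (cell-⊑ x a) ,
                subst (Complete floor i j) (sym (miss ef refl (>⇒≢ q<j))) b

        record Result (σ : Store) : Set where
          constructor result
          field
            rows   : RowOK (heapOf σ) floor i (λ j → arr σ C.V (off + j)) (λ j → arr σ C.VN (off + j))
            ext    : η₀ ⊑ heapOf σ
            heap≤  : env σ C.hp ≤ h₀ + 2 * (2 * κ + 1) ⊓ M
            before : ∀ z → z < off → arr σ C.V z ≡ V₀ z × arr σ C.VN z ≡ VN₀ z
            after  : ∀ z → off + suc N < z → arr σ C.V z ≡ V₀ z × arr σ C.VN z ≡ VN₀ z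

        rowLoop-correct : ∀ {σ} → Fixed σ → env σ C.x ≡ bot → env σ C.j ≡ top →
          (∀ z → arr σ C.V z ≡ V₀ z) → (∀ z → arr σ C.VN z ≡ VN₀ z) → (∀ z → arr σ C.NC z ≡ Heap.nc η₀ z) → (∀ z → arr σ C.NP z ≡ Heap.np η₀ z) →
          env σ C.hp ≡ h₀ → env σ C.cur ≡ V₀ (off + top) → env σ C.nd ≡ VN₀ (off + top) →
          env σ C.dg ≡ V₀ (off + top) → env σ C.dgn ≡ VN₀ (off + top) →
          Ends (while rowTest rowBody) σ ((2 * κ + 1) * (40 + rowTime) + 40) Result
        rowLoop-correct {σ₀} F ex ej eV eVN eNC eNP ehp ecur end′ edg edgn = within (+-monoˡ-≤ 40 (*-monoˡ-≤ (40 + rowTime) width))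
          (iterate rowTest rowBody RowInv (top ∸ bot)
            (λ k σ sm I → _)
            (λ k σ sm I f → finish I (subst (env σ C.j ≤_) (trans (varₛ sm C.x) ex) f))
            (λ k σ sm I tr → rowStep (refix (arrₛ sm C.EW) sm F) (trans (varₛ sm C.x) ex) I tr)
            (record
              { left = cong (_∸ bot) ej
              ; j≤top = ≤-reflexive ej
              ; low = inj₂ ej
              ; sized = grown ext₀ (≤-trans (≤-reflexive ehp) (m≤m+n h₀ _)) (≤-trans (≤-reflexive ehp) (m≤m+n h₀ _)) (≤-trans (≤-reflexive ehp) (m≤m+n h₀ _))
              ; right = subst (λ z → Cell (heapOf σ₀) i z (env σ₀ C.cur) (env σ₀ C.nd)) (sym ej) (cell-skip (cell-≡ ecur end′ top-cell))
              ; diag = subst (λ z → Cell (heapOf σ₀) (suc i) z (env σ₀ C.dg) (env σ₀ C.dgn)) (sym ej) (cell-≡ edg edgn top-cell)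
              ; rightBest = subst (λ z → Complete floor i z (env σ₀ C.cur)) (sym ej) (beyond ≤-refl)
              ; diagBest = subst₂ (λ z y → Complete floor (suc i) z y) (sym ej) (sym edg) diag-best
              -- Right of the band the cells of row i + 1 are kept; their candidates serve for row i
              -- too, and by `beyond` no near candidate competes with them.
              ; new = λ j l l′ → cell-skip (cell-≡ (eV _) (eVN _) (cell-⊑ ext₀ (RowOK.cells old j l′))) , beyond (subst (_≤ j) ej l)
              ; olds = λ j l → eV _ , eVN _
              ; edge = trans (eV _) (RowOK.border old)
              ; before = λ z l → eV z , eVN z
              ; after = λ z l → eV z , eVN z }))
          where
          ext₀ : η₀ ⊑ heapOf σ₀
          ext₀ = extends (≤-reflexive (sym ehp)) (λ q _ → eNC q) (λ q _ → eNP q)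
          top-cell : Cell (heapOf σ₀) (suc i) top (V₀ (off + top)) (VN₀ (off + top))
          top-cell with m≤n⇒m<n∨m≡n top≤
          ... | inj₁ l = cell-⊑ ext₀ (RowOK.cells old top (s≤s⁻¹ l))
          ... | inj₂ e = empty (trans (cong (λ z → V₀ (off + z)) e) (RowOK.border old))
          -- Candidates this far to the right would leave out too many characters of B.
          beyond : ∀ {j x} → top ≤ j → Complete floor i j x
          beyond {j} {x} l = complete λ d _ cd (a , _) → contradiction (boundB cd) (<⇒≱ (far d a))
            where
            far : ∀ d → N ≤ size d + len + κ + i → N < size d + len + j
            far d a with ⊓-sel N (i + κ)
            ... | inj₁ e = ≤-trans (subst (λ z → suc z ≤ j) e l) (m≤n+m j (size d + len))
            ... | inj₂ e = ≤-trans (s≤s (≤-trans a (≤-reflexive (trans (+-assoc (size d + len) κ i) (cong (size d + len +_) (+-comm κ i))))))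
                             (≤-trans (≤-reflexive (sym (+-suc (size d + len) (i + κ)))) (+-monoʳ-≤ (size d + len) (subst (λ z → suc z ≤ j) e l)))
          diag-best : Complete floor (suc i) top (V₀ (off + top))
          diag-best with m≤n⇒m<n∨m≡n top≤
          ... | inj₁ l = RowOK.optima old top (s≤s⁻¹ l)
          ... | inj₂ e = complete λ d _ cd _ → contradiction (boundB (skipA cd)) (<⇒≱ (≤-trans (≤-reflexive (sym e)) (m≤n+m top (size d + len))))
          finish : ∀ {k σ} → RowInv k σ → env σ C.j ≤ bot → Result σ
          finish {k} {σ} I j≤bot = result (rowOK cells′ (RowInv.edge I) optima′) (Grown.ext (RowInv.sized I)) heap-bound (RowInv.before I) (RowInv.after I)
            where
            untouched : ∀ {j} → j < env σ C.j → j ≤ N → Cell (heapOf σ) (suc i) j (arr σ C.V (off + j)) (arr σ C.VN (off + j))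
            untouched {j} l l′ = let (a , b) = RowInv.olds I j l in cell-≡ a b (cell-⊑ (Grown.ext (RowInv.sized I)) (RowOK.cells old j l′))
            cells′ : ∀ j → j ≤ N → Cell (heapOf σ) i j (arr σ C.V (off + j)) (arr σ C.VN (off + j))
            cells′ j l with j <? env σ C.j
            ... | yes l′ = cell-skip (untouched l′ l)
            ... | no nl = proj₁ (RowInv.new I j (≮⇒≥ nl) l)
            optima′ : ∀ j → j ≤ N → Complete floor i j (arr σ C.V (off + j))
            optima′ j l with j <? env σ C.j
            ... | no nl = proj₂ (RowInv.new I j (≮⇒≥ nl) l)
            -- Left of the band the suffix of A is too short to hold a candidate that leaves out at
            -- most κ characters of the suffix of B.
            ... | yes l′ = complete λ d fl cd (_ , b) → contradiction (left-of d fl cd b) (<⇒≱ (<-≤-trans l′ j≤bot))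
              where
              left-of : ∀ d → floor ≤ j → Cand i j d → N ≤ size d + len + κ + j → bot ≤ j
              left-of d fl cd b = ⊔-lub (m≤n+o⇒m∸n≤o i κ
                (+-cancelˡ-≤ (size d + len) i (κ + j) (≤-trans (boundA cd) (≤-trans b (≤-reflexive (+-assoc (size d + len) κ j)))))) fl
            heap-bound : env σ C.hp ≤ h₀ + 2 * (2 * κ + 1) ⊓ M
            heap-bound = ≤-trans (⊓-glb (≤-trans (Grown.cells≤ (RowInv.sized I)) (+-monoʳ-≤ h₀ counted)) (Grown.M≤ (RowInv.sized I)))
                           (≤-reflexive (sym (+-distribˡ-⊓ h₀ (2 * (2 * κ + 1)) M)))
              where
              counted : 2 * (top ∸ env σ C.j) ≤ 2 * (2 * κ + 1)
              counted with RowInv.low I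
              ... | inj₁ l = *-monoʳ-≤ 2 (≤-trans (∸-monoʳ-≤ top l) width)
              ... | inj₂ e = ≤-trans (≤-reflexive (cong (2 *_) (trans (cong (top ∸_) e) (n∸n≡0 top)))) z≤n

      row-correct : ∀ {σ} → env σ C.n ≡ N → env σ C.ri ≡ i → env σ C.K ≡ κ → env σ C.off ≡ off → env σ C.floor ≡ floor →
        (0<h : 0 < env σ C.hp) (old : RowOK (heapOf σ) floor (suc i) (λ j → arr σ C.V (off + j)) (λ j → arr σ C.VN (off + j)))
        (Jm : Jumps (env σ C.jmp) (heapOf σ) (arr σ C.V) (arr σ C.VN) (arr σ C.EW)) (h≤ : env σ C.hp + β ≤ lim) →
        Ends row σ (150 + ((2 * κ + 1) * 430 + 40)) (Cells.Result (origin (heapOf σ) (arr σ C.V) (arr σ C.VN) (arr σ C.EW) (env σ C.jmp) 0<h old Jm h≤))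
      row-correct {σ₀} en eri eK eoff efloor 0<h old Jm h≤ =
        start then λ {σ₁} (ej , ex , ecur , end′ , edg , edgn , ec) sm →
         rowLoop-correct (fixed (trans (varₛ sm C.n) en) (trans (varₛ sm C.off) eoff) (varₛ sm C.jmp) ec (arrₛ sm C.EW)) ex ej
           (arrₛ sm C.V) (arrₛ sm C.VN) (arrₛ sm C.NC) (arrₛ sm C.NP) (varₛ sm C.hp) ecur end′ edg edgn
        where
        open Cells (origin (heapOf σ₀) (arr σ₀ C.V) (arr σ₀ C.VN) (arr σ₀ C.EW) (env σ₀ C.jmp) 0<h old Jm h≤)
        big : ∀ {x} → x ≤ 4 * N + 4 → x < W
        big l = small (≤-trans l (lin 1 (λ N → [] ⊢ ‵ 4 :* N :+ ‵ 4 :≤ ‵ 16 :* N :+ ‵ 16) N))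
        index≤ : off + top ≤ 16 * N + 15
        index≤ = lin 3 (λ o t N → (o :≤ N :+ ‵ 2) ∷ (t :≤ ‵ 1 :+ N) ∷ [] ⊢ o :+ t :≤ ‵ 16 :* N :+ ‵ 15) off top N off≤ top≤
        setTop setBot load : Cmd
        setTop = C.j := v C.ri ⊕ v C.K ⨾ cond (v C.n ⋖ v C.j) (C.j := v C.n) skip ⨾ increment C.j
        setBot = C.x := v C.ri ⊖ v C.K ⨾ cond (v C.x ⋖ v C.floor) (C.x := v C.floor) skip
        load   = C.cur := ld C.V (v C.off ⊕ v C.j) ⨾ C.nd := ld C.VN (v C.off ⊕ v C.j) ⨾ C.dg := v C.cur ⨾ C.dgn := v C.nd ⨾ C.c := rd tapeA (v C.ri)
        eiK : env σ₀ C.ri + env σ₀ C.K ≡ i + κ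
        eiK = cong₂ _+_ eri eK
        start : Ends rowStart σ₀ 150 (λ σ → env σ C.j ≡ top × env σ C.x ≡ bot × env σ C.cur ≡ arr σ₀ C.V (off + top) × env σ C.nd ≡ arr σ₀ C.VN (off + top) ×
                  env σ C.dg ≡ arr σ₀ C.V (off + top) × env σ C.dgn ≡ arr σ₀ C.VN (off + top) × env σ C.c ≡ charAt (input tapeA) i)
        start =
          straight setTop {40} {λ σ → env σ C.j ≡ top}
            ((_ , _ , ≤-<-trans (≤-reflexive eiK) (big (lin 3 (λ i k N → (i :≤ N) ∷ (k :≤ ‵ 2 :* N :+ ‵ 1) ∷ [] ⊢ i :+ k :≤ ‵ 4 :* N :+ ‵ 4) i κ N i≤N κ≤))) , _ ,
             (λ N<j → _ , (_ , _ , ≤-<-trans (≤-reflexive (cong suc en)) (big (lin 1 (λ N → [] ⊢ ‵ 1 :+ N :≤ ‵ 4 :* N :+ ‵ 4) N))) ,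
               cong suc (trans en (sym (m≤n⇒m⊓n≡m (<⇒≤ (subst₂ _<_ en eiK N<j)))))) ,
             (λ j≤N → let l = subst₂ _≤_ eiK en j≤N in
               (_ , _ , ≤-<-trans (≤-reflexive (cong suc eiK)) (big (≤-trans (s≤s l) (lin 1 (λ N → [] ⊢ ‵ 1 :+ N :≤ ‵ 4 :* N :+ ‵ 4) N)))) ,
               cong suc (trans eiK (sym (m≥n⇒m⊓n≡n l)))))
          then λ {σ₁} ej sm₁ →
          let ed = cong₂ _∸_ (trans (varₛ sm₁ C.ri) eri) (trans (varₛ sm₁ C.K) eK) ; ef = trans (varₛ sm₁ C.floor) efloor in
          straight setBot {40} {λ σ → env σ C.x ≡ bot}
            (_ , _ ,
             (λ l → _ , trans ef (sym (m≤n⇒m⊔n≡n (<⇒≤ (subst₂ _<_ ed ef l))))) ,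
             (λ l → trans ed (sym (m≥n⇒m⊔n≡m (subst₂ _≤_ ef ed l)))))
          then λ {σ₂} ex sm₂ →
          let slot = cong₂ _+_ (trans (varₛ sm₂ C.off) (trans (varₛ sm₁ C.off) eoff)) (trans (varₛ sm₂ C.j) ej)
              eV = trans (cong (arr σ₂ C.V) slot) (trans (arrₛ sm₂ C.V _) (arrₛ sm₁ C.V _))
              eVN = trans (cong (arr σ₂ C.VN) slot) (trans (arrₛ sm₂ C.VN _) (arrₛ sm₁ C.VN _))
              okI = (_ , _ , subst (_< W) (sym slot) (small (loosen index≤))) , subst (_< lim) (sym slot) (room′ index≤) in
          straight load {70} ((_ , okI) , (_ , okI) , _ , _ , _ ,
            (trans (varₛ sm₂ C.j) ej , ex , eV , eVN , eV , eVN , cong (charAt (input tapeA)) (trans (varₛ sm₂ C.ri) (trans (varₛ sm₁ C.ri) eri))))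

-- The banded tables and the doubling of the band

module Doubling where

  open import Data.List.Relation.Binary.Sublist.Propositional using (_⊆_; minimum)
  open Language
  open Arithmetic
  open Embeddings
  open Embedding using (Emb)
  open Candidate-systems
  open Table-rows
  open Code using (row; choose; attempt; resetBody; dynamic)

  -- e i is the end of the shortest window of T[0..N) that starts at i and contains P[0..R); N + 1 if there is none.
  record Ends-of-windows (P T : ℕ → ℕ) (R N : ℕ) (e : ℕ → ℕ) : Set where
    field
      sound    : ∀ {i j} → i ≤ N → j ≤ N → e i ≤ j → Emb P T 0 R i j
      least    : ∀ {i j} → j ≤ N → Emb P T 0 R i j → e i ≤ j
      bounded  : ∀ i → e i ≤ suc N
      monotone : ∀ {i i′} → i ≤ i′ → i′ ≤ N → e i ≤ e i′

  record DynamicSetting : Set where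
    constructor dynamicSetting
    field
      sp : Space
    open Space sp public
    field
      charW : ∀ τ i → suc (charAt (input τ) i) < 2 ^ w
      lenA : length (input tapeA) ≡ N
      lenB : length (input tapeB) ≡ N
      R≤N : length (input tapeP) ≤ N
      eA eB : ℕ → ℕ
      windowA : Ends-of-windows (charAt (input tapeP)) (charAt (input tapeA)) (length (input tapeP)) N eA
      windowB : Ends-of-windows (charAt (input tapeP)) (charAt (input tapeB)) (length (input tapeP)) N eB

  module Dynamic (s : DynamicSetting) where

    open DynamicSetting s

    open Semantics mc
    open Candidates (input tapeA) (input tapeB) (input tapeP) N lenA lenB

    private
      module WA = Ends-of-windows windowA
      module WB = Ends-of-windows windowB
      A = input tapeA
      B = input tapeB
      P = input tapeP

    R : ℕ
    R = length P

    sizeG : List ℕ × List ℕ → ℕ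
    sizeG d = length (proj₁ d) + length (proj₂ d)

    record Found (σ : Store) : Set where
      constructor found
      field
        {pair}  : List ℕ × List ℕ
        listed  : DenG (arr σ C.NC) (arr σ C.NP) (env σ C.hp) (arr σ C.VN (2 + N)) pair
        is-cand′ : CandG 0 0 pair
        optimal : ∀ d → CandG 0 0 d → sizeG d ≤ sizeG pair
        hp≤     : env σ C.hp ≤ lim

    -- The optimum `best` appears in the bounds only. In `heap-room`, 1 is for node 0, and each of
    -- the N rows of F and N + 1 rows of G may take β nodes.
    record AttemptSetting : Set where
      constructor attemptSetting
      field
        κ : ℕ
        κ≤ : κ ≤ 2 * N + 1
        best : List ℕ × List ℕ
        is-cand : CandG 0 0 best
        is-best : ∀ d → CandG 0 0 d → sizeG d ≤ sizeG best
        β : ℕ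
        budget : 2 * (2 * κ + 1) ⊓ suc (sizeG best) ≤ β
        heap-room : 1 + (N + suc N) * β ≤ lim

    module Attempt (a : AttemptSetting) where

      open AttemptSetting a

      M : ℕ
      M = suc (sizeG best)

      φ : ℕ
      φ = eB 0

      record Fixed (σ : Store) : Set where
        constructor fixed
        field
          en  : env σ C.n ≡ N
          eK  : env σ C.K ≡ κ
          eEA : ∀ i → i ≤ N → arr σ C.EW i ≡ eA i
          eEB : ∀ j → j ≤ N → arr σ C.EW (suc N + j) ≡ eB j

      private
        module SF = Spec (shape N κ {List ℕ} length 0 CandF DenF)
        module SG = Spec (shape N κ {List ℕ × List ℕ} sizeG R CandG DenG)

        g-bound : ∀ {i} j d → 0 ≤ j → CandG i j d → sizeG d < M
        g-bound {i} j d _ ((i≤ , s) , j≤ , s′) = s≤s (is-best d ((z≤n , drop-⊆ {j = i} z≤n s) , z≤n , drop-⊆ {j = j} z≤n s′))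

        -- From row `eA 0` and column `eB 0` on, P can be put in front of a candidate of F, which
        -- then competes with `best`.
        f-bound : ∀ {i} → eA 0 ≤ i → ∀ j Y → φ ≤ j → CandF i j Y → length Y < M
        f-bound {i} l j Y l′ ((i≤ , s) , j≤ , s′) = s≤s (is-best ([] , Y)
          ((z≤n , emb-⊆ P A (WA.sound z≤n i≤ l) z≤n (≤-trans i≤ (≤-reflexive (sym lenA))) s) ,
           (z≤n , emb-⊆ P B (WB.sound z≤n j≤ l′) z≤n (≤-trans j≤ (≤-reflexive (sym lenB))) s′)))

        -- `lag` says that F has not passed a row that G still needs. With the test in `choose`, F
        -- stands exactly at the required row when G moves.
        record MainInv (k : ℕ) (σ : Store) : Set where
          constructor mainInv
          field
            fuel  : env σ C.fi + env σ C.gi ≡ k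
            fi≤   : env σ C.fi ≤ N
            gi≤   : env σ C.gi ≤ suc N
            frow  : SF.RowOK (heapOf σ) φ (env σ C.fi) (arr σ C.V) (arr σ C.VN)
            grow  : SG.RowOK (heapOf σ) 0 (env σ C.gi) (λ j → arr σ C.V (2 + N + j)) (λ j → arr σ C.VN (2 + N + j))
            lag   : ∀ i → i < env σ C.gi → eA i ≤ N → eA i ≤ env σ C.fi
            0<hp  : 0 < env σ C.hp
            heap≤ : env σ C.hp + (env σ C.fi + env σ C.gi) * β ≤ 1 + (N + suc N) * β

        mainTest : Exp
        mainTest = # 0 ⋖ v C.gi

        rowTime : ℕ
        rowTime = 150 + ((2 * κ + 1) * 430 + 40)

        f-step : ∀ {σ k} → Fixed σ → MainInv (suc k) σ → 0 < env σ C.gi → eA (env σ C.gi ∸ 1) < env σ C.fi →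
          ∀ {σ₁} → σ₁ ≡ stored (((((env σ Defs.[ C.e ≔ arr σ C.EW (env σ C.gi ∸ 1) ]) Defs.[ C.fi ≔ env σ C.fi ∸ 1 ]) Defs.[ C.ri ≔ env σ C.fi ∸ 1 ])
            Defs.[ C.off ≔ 0 ]) Defs.[ C.jmp ≔ 0 ] Defs.[ C.floor ≔ arr σ C.EW (suc (env σ C.n)) ]) (arr σ) (out σ) →
          Ends row σ₁ rowTime (MainInv k)
        f-step {σ} {k} (fixed en eK eEA eEB) I 0<gi lagging refl = weaken finish (framed
          (Rw.row-correct (Rw.region 0 φ M β z≤n (f-bound eA0≤i) budget) en refl eK refl floor≡ (MainInv.0<hp I) old
            (record { none = λ _ _ _ ff → ff ; apart = λ n → contradiction refl n ; target = λ n → contradiction refl n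
                    ; sound = λ n → contradiction refl n ; best = λ n → contradiction refl n })
            budgeted))
          where
          i = env σ C.fi ∸ 1
          g = env σ C.gi ∸ 1
          si : suc i ≡ env σ C.fi
          si = trans (sym (+-∸-assoc 1 (≤-<-trans z≤n lagging))) refl
          sg : suc g ≡ env σ C.gi
          sg = trans (sym (+-∸-assoc 1 0<gi)) refl
          i<N : i < N
          i<N = ≤-trans (≤-reflexive si) (MainInv.fi≤ I)
          g≤N : g ≤ N
          g≤N = s≤s⁻¹ (≤-trans (≤-reflexive sg) (MainInv.gi≤ I))
          eAg≤i : eA g ≤ i
          eAg≤i = s≤s⁻¹ (≤-trans lagging (≤-reflexive (sym si)))
          eA0≤i : eA 0 ≤ i
          eA0≤i = ≤-trans (WA.monotone z≤n g≤N) eAg≤i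
          module Rw = Row (rowSetting sp κ κ≤ charW i (<⇒≤ i<N) (systemF i<N))
          floor≡ : arr σ C.EW (suc (env σ C.n)) ≡ φ
          floor≡ = trans (cong (arr σ C.EW) (trans (cong suc en) (sym (+-identityʳ (suc N))))) (eEB 0 z≤n)
          old : SF.RowOK (heapOf σ) φ (suc i) (arr σ C.V) (arr σ C.VN)
          old = subst (λ z → SF.RowOK (heapOf σ) φ z (arr σ C.V) (arr σ C.VN)) (sym si) (MainInv.frow I)
          count : env σ C.hp + β + (i + env σ C.gi) * β ≤ 1 + (N + suc N) * β
          count = ≤-trans (≤-reflexive (trans (+-assoc (env σ C.hp) β _) (cong (λ z → env σ C.hp + (z + env σ C.gi) * β) si))) (MainInv.heap≤ I)
          budgeted : env σ C.hp + β ≤ lim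
          budgeted = ≤-trans (≤-trans (m≤m+n _ _) count) heap-room
          finish : ∀ σ₂ → _ → MainInv k σ₂
          finish σ₂ (r , sm) = mainInv
            (trans (cong₂ _+_ (varₛ sm C.fi) (varₛ sm C.gi)) (suc-injective (trans (cong (_+ env σ C.gi) si) (MainInv.fuel I))))
            (subst (_≤ N) (sym (varₛ sm C.fi)) (<⇒≤ i<N))
            (subst (_≤ suc N) (sym (varₛ sm C.gi)) (MainInv.gi≤ I))
            (subst (λ z → SF.RowOK (heapOf σ₂) φ z (arr σ₂ C.V) (arr σ₂ C.VN)) (sym (varₛ sm C.fi)) rows)
            (subst (λ z → SG.RowOK (heapOf σ₂) 0 z (λ j → arr σ₂ C.V (2 + N + j)) (λ j → arr σ₂ C.VN (2 + N + j))) (sym (varₛ sm C.gi))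
              (SG.transport (λ (extends a b c) → denG-mono a b c) ext (λ j _ → after (2 + N + j) (s≤s (s≤s (m≤m+n N j)))) (MainInv.grow I)))
            (λ i′ l l′ → subst (eA i′ ≤_) (sym (varₛ sm C.fi)) (≤-trans (WA.monotone (s≤s⁻¹ (≤-trans (subst (i′ <_) (varₛ sm C.gi) l) (≤-reflexive (sym sg)))) g≤N) eAg≤i))
            (<-≤-trans (MainInv.0<hp I) (_⊑_.grow ext))
            (≤-trans (+-monoˡ-≤ _ (≤-trans heap≤ (+-monoʳ-≤ (env σ C.hp) budget))) (subst₂ (λ a b → env σ C.hp + β + (a + b) * β ≤ 1 + (N + suc N) * β) (sym (varₛ sm C.fi)) (sym (varₛ sm C.gi)) count))
            where open Rw.Cells.Result r

        g-step : ∀ {σ k} → Fixed σ → MainInv (suc k) σ → 0 < env σ C.gi → env σ C.fi ≤ eA (env σ C.gi ∸ 1) →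
          ∀ {σ₁ J} → (J ≢ 0 → eA (env σ C.gi ∸ 1) ≤ N) → (J ≡ 0 → N < eA (env σ C.gi ∸ 1)) →
          σ₁ ≡ stored (((((env σ Defs.[ C.e ≔ arr σ C.EW (env σ C.gi ∸ 1) ]) Defs.[ C.gi ≔ env σ C.gi ∸ 1 ]) Defs.[ C.ri ≔ env σ C.gi ∸ 1 ])
            Defs.[ C.off ≔ 2 + env σ C.n ]) Defs.[ C.jmp ≔ J ] Defs.[ C.floor ≔ 0 ]) (arr σ) (out σ) →
          Ends row σ₁ rowTime (MainInv k)
        g-step {σ} {k} (fixed en eK eEA eEB) I 0<gi fi≤ {_} {J} jmp→ jmp← refl = weaken finish (framed
          (Rw.row-correct (Rw.region (2 + N) 0 M β (≤-reflexive (+-comm 2 N)) (g-bound {g}) budget) en refl eK (cong (2 +_) en) refl (MainInv.0<hp I) old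
            (record { none = none ; apart = λ _ → +-comm 2 N ; target = target ; sound = sound ; best = marked })
            budgeted))
          where
          i = env σ C.fi
          g = env σ C.gi ∸ 1
          sg : suc g ≡ env σ C.gi
          sg = trans (sym (+-∸-assoc 1 0<gi)) refl
          g≤N : g ≤ N
          g≤N = s≤s⁻¹ (≤-trans (≤-reflexive sg) (MainInv.gi≤ I))
          i≤N : i ≤ N
          i≤N = MainInv.fi≤ I
          module Rw = Row (rowSetting sp κ κ≤ charW g g≤N systemG)
          old : SG.RowOK (heapOf σ) 0 (suc g) (λ j → arr σ C.V (2 + N + j)) (λ j → arr σ C.VN (2 + N + j))
          old = subst (λ z → SG.RowOK (heapOf σ) 0 z (λ j → arr σ C.V (2 + N + j)) (λ j → arr σ C.VN (2 + N + j))) (sym sg) (MainInv.grow I)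
          eA≤i : J ≢ 0 → eA g ≤ i
          eA≤i n = MainInv.lag I g (≤-reflexive sg) (jmp→ n)
          -- P may be matched within the shortest window, which leaves the longest rest for Y.
          splitA : ∀ Y → g ≤ N → P ++ Y ⊆ drop g A → eA g ≤ N × Y ⊆ drop (eA g) A
          splitA Y g≤ s with ⊆-emb P A R {0} refl (≤-trans g≤ (≤-reflexive (sym lenA))) s
          ... | j , e , j≤ , s′ = ≤-trans l j≤N , drop-⊆ l s′
            where
            j≤N = ≤-trans j≤ (≤-reflexive lenA)
            l = WA.least j≤N e
          splitB : ∀ {j} Y → j ≤ N → P ++ Y ⊆ drop j B → eB j ≤ N × Y ⊆ drop (eB j) B
          splitB {j} Y j≤ s with ⊆-emb P B R {0} refl (≤-trans j≤ (≤-reflexive (sym lenB))) s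
          ... | j′ , e , j′≤ , s′ = ≤-trans l j′≤N , drop-⊆ l s′
            where
            j′≤N = ≤-trans j′≤ (≤-reflexive lenB)
            l = WB.least j′≤N e
          none : J ≡ 0 → ∀ j d → ¬ JumpG g j d
          none z j (_ , Y) (_ , (g≤ , s) , _) = contradiction (proj₁ (splitA Y g≤ s)) (<⇒≱ (jmp← z))
          target : J ≢ 0 → ∀ j → j ≤ N → arr σ C.EW (suc N + j) ≤ suc N
          target _ j l = ≤-trans (≤-reflexive (eEB j l)) (WB.bounded j)
          fcell : ∀ j → eB j ≤ N → SF.Cell (heapOf σ) i (eB j) (arr σ C.V (eB j)) (arr σ C.VN (eB j))
          fcell j l = SF.RowOK.cells (MainInv.frow I) (eB j) l
          Marked : ℕ → ℕ → Set
          Marked j t = arr σ C.V t ≡ 0 ⊎ ∃[ d ] (arr σ C.V t ≡ suc (sizeG d) × CandG g j d ×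
                     (∀ η′ q → heapOf σ ⊑ η′ → 0 < q → q < Heap.top η′ → Heap.nc η′ q ≡ 0 → Heap.np η′ q ≡ arr σ C.VN t → SG.DenH η′ q d))
          sound : J ≢ 0 → ∀ j → j ≤ N → Marked j (arr σ C.EW (suc N + j))
          sound n j j≤N = subst (Marked j) (sym (eEB j j≤N)) go
            where
            go : Marked j (eB j)
            go with m≤n⇒m<n∨m≡n (WB.bounded j)
            ... | inj₂ e = inj₁ (trans (cong (arr σ C.V) e) (SF.RowOK.border (MainInv.frow I)))
            ... | inj₁ (s≤s l) with fcell j l
            ... | SF.empty z = inj₁ z
            ... | SF.filled Y vy den ((_ , s) , _ , s′) = inj₂ (([] , Y) , vy ,
                  ((g≤N , emb-⊆ P A (WA.sound g≤N i≤N (eA≤i n)) z≤n (≤-trans i≤N (≤-reflexive (sym lenA))) s) ,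
                   (j≤N , emb-⊆ P B (WB.sound j≤N l ≤-refl) z≤n (≤-trans l (≤-reflexive (sym lenB))) s′)) ,
                  λ { η′ q (extends a b c) 0<q q< nc≡ np≡ → mark 0<q q< nc≡ np≡ (denF-mono a b c den) })
          -- By `lag` and the test the row of F in memory is row `eA g`. The target is near again: a
          -- window spans at least R characters, which makes up for P no longer being counted.
          marked : J ≢ 0 → ∀ j d → j ≤ N → JumpG g j d → SG.Near g j d → sizeG d < arr σ C.V (arr σ C.EW (suc N + j))
          marked n j (.[] , Y) j≤N (refl , (g≤ , s) , _ , s′) (near , near′) = subst (λ t → length Y < arr σ C.V t) (sym (eEB j j≤N))
            (SF.Complete.best (SF.RowOK.optima (MainInv.frow I) (eB j) eB≤) Y (WB.monotone z≤n j≤N)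
              ((i≤N , subst (λ z → Y ⊆ drop z A) (≤-antisym (eA≤i n) fi≤) (proj₂ (splitA Y g≤ s))) , eB≤ , proj₂ (splitB Y j≤N s′))
              (closer g near (≤-trans (long (WA.sound g≤N i≤N (eA≤i n))) ≤-refl) , closer j near′ (long (WB.sound j≤N eB≤ ≤-refl))))
            where
            eB≤ : eB j ≤ N
            eB≤ = proj₁ (splitB Y j≤N s′)
            long : ∀ {T a b} → Emb (charAt P) T 0 R a b → R + a ≤ b
            long {T} {a} {b} e = ≤-trans (Embedding.emb-length (charAt P) T e) (≤-reflexive (+-identityʳ b))
            closer : ∀ a {b} → N ≤ length Y + R + κ + a → R + a ≤ b → N ≤ length Y + 0 + κ + b
            closer a {b} l l′ = lin 6 (λ N y r k a b → (N :≤ y :+ r :+ k :+ a) ∷ (r :+ a :≤ b) ∷ [] ⊢ N :≤ y :+ ‵ 0 :+ k :+ b) N (length Y) R κ a b l l′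
          count : env σ C.hp + β + (i + g) * β ≤ 1 + (N + suc N) * β
          count = ≤-trans (≤-reflexive (trans (+-assoc (env σ C.hp) β _)
            (cong (λ z → env σ C.hp + z * β) (trans (sym (+-suc i g)) (cong (i +_) sg))))) (MainInv.heap≤ I)
          budgeted : env σ C.hp + β ≤ lim
          budgeted = ≤-trans (≤-trans (m≤m+n _ _) count) heap-room
          finish : ∀ σ₂ → _ → MainInv k σ₂
          finish σ₂ (r , sm) = mainInv
            (trans (cong₂ _+_ (varₛ sm C.fi) (varₛ sm C.gi)) (suc-injective (trans (trans (sym (+-suc i g)) (cong (i +_) sg)) (MainInv.fuel I))))
            (subst (_≤ N) (sym (varₛ sm C.fi)) i≤N)
            (subst (_≤ suc N) (sym (varₛ sm C.gi)) (m≤n⇒m≤1+n g≤N))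
            (subst (λ z → SF.RowOK (heapOf σ₂) φ z (arr σ₂ C.V) (arr σ₂ C.VN)) (sym (varₛ sm C.fi))
              (SF.transport (λ (extends a b c) → denF-mono a b c) ext (λ j l → before j (s≤s l)) (MainInv.frow I)))
            (subst (λ z → SG.RowOK (heapOf σ₂) 0 z (λ j → arr σ₂ C.V (2 + N + j)) (λ j → arr σ₂ C.VN (2 + N + j))) (sym (varₛ sm C.gi)) rows)
            (λ i′ l l′ → subst (eA i′ ≤_) (sym (varₛ sm C.fi)) (MainInv.lag I i′ (<-≤-trans (subst (i′ <_) (varₛ sm C.gi) l) (≤-trans (n≤1+n g) (≤-reflexive sg))) l′))
            (<-≤-trans (MainInv.0<hp I) (_⊑_.grow ext))
            (≤-trans (+-monoˡ-≤ _ (≤-trans heap≤ (+-monoʳ-≤ (env σ C.hp) budget))) (subst₂ (λ a b → env σ C.hp + β + (a + b) * β ≤ 1 + (N + suc N) * β) (sym (varₛ sm C.fi)) (sym (varₛ sm C.gi)) count))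
            where open Rw.Cells.Result r

        mainBody : Cmd
        mainBody = choose ⨾ row

        refix : ∀ {σ σ′} → Same mainBody σ σ′ → Fixed σ → Fixed σ′
        refix sm (fixed en eK eEA eEB) = fixed (trans (varₛ sm C.n) en) (trans (varₛ sm C.K) eK)
          (λ i l → trans (arrₛ sm C.EW i) (eEA i l)) (λ j l → trans (arrₛ sm C.EW (suc N + j)) (eEB j l))

        mainStep : ∀ {k σ} → Fixed σ → MainInv k σ → True mainTest σ →
          Σ[ k′ ∈ ℕ ] k′ < k × Ends mainBody σ (90 + rowTime) (MainInv k′)
        mainStep {zero}  F I 0<gi = contradiction (m+n≡0⇒n≡0 _ (MainInv.fuel I)) (>⇒≢ 0<gi)
        mainStep {suc k} {σ} F@(fixed en eK eEA eEB) I 0<gi = k , ≤-refl ,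
          prefix 90 choose ((_ , _ , g<lim) , _ ,
            (λ l → _ , _ , _ , _ , (_ , (_ , _ , ≤-<-trans (≤-reflexive (cong suc en)) (small n≤)) , ≤-<-trans (≤-reflexive (cong suc en)) (room′ n≤′)) ,
               f-step F I 0<gi (subst (_< env σ C.fi) e≡ l) refl) ,
            (λ l → let fi≤ = subst (env σ C.fi ≤_) e≡ l in
               _ , _ , (_ , _ , ≤-<-trans (≤-reflexive (cong (2 +_) en)) (small n≤₂)) , (_ , (_ , _ , ≤-<-trans (≤-reflexive (cong suc en)) (small n≤)) , _) , _ ,
               g-step F I 0<gi fi≤
                 (λ n → ≤-trans (≤-reflexive (sym e≡)) (≤-trans (s≤s⁻¹ (lt-true n)) (≤-reflexive en)))
                 (λ n → ≤-trans (s≤s (≤-reflexive (sym en))) (≤-trans (lt-false n) (≤-reflexive e≡))) refl))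
          where
          g≤N : env σ C.gi ∸ 1 ≤ N
          g≤N = ∸-monoˡ-≤ 1 (MainInv.gi≤ I)
          e≡ : arr σ C.EW (env σ C.gi ∸ 1) ≡ eA (env σ C.gi ∸ 1)
          e≡ = eEA _ g≤N
          n≤ : suc N ≤ 16 * N + 16
          n≤ = lin 1 (λ N → [] ⊢ ‵ 1 :+ N :≤ ‵ 16 :* N :+ ‵ 16) N
          n≤₂ : suc (suc N) ≤ 16 * N + 16
          n≤₂ = lin 1 (λ N → [] ⊢ ‵ 2 :+ N :≤ ‵ 16 :* N :+ ‵ 16) N
          n≤′ : suc N ≤ 16 * N + 15
          n≤′ = lin 1 (λ N → [] ⊢ ‵ 1 :+ N :≤ ‵ 16 :* N :+ ‵ 15) N
          g<lim : env σ C.gi ∸ 1 < lim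
          g<lim = room′ (≤-trans g≤N (≤-trans (n≤1+n N) n≤′))
          lt-true : ∀ {x y} → evalOp less x y ≢ 0 → x < y
          lt-true {x} {y} n with x <ᵇ y in eq
          ... | true = <ᵇ⇒< x y (subst T (sym eq) _)
          ... | false = contradiction refl n
          lt-false : ∀ {x y} → evalOp less x y ≡ 0 → y ≤ x
          lt-false {x} {y} n with x <ᵇ y in eq
          ... | false = ≮⇒≥ λ l → subst T eq (<⇒<ᵇ l)

        mainLoop : ∀ {σ} → Fixed σ → MainInv (N + suc N) σ →
          Ends (while mainTest mainBody) σ ((N + suc N) * (40 + (90 + rowTime)) + 40) (λ σ′ → Σ[ k ∈ ℕ ] MainInv k σ′ × env σ′ C.gi ≡ 0)
        mainLoop {σ₀} F I = iterate mainTest mainBody MainInv (N + suc N)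
          (λ k σ sm I → _)
          (λ k σ sm I f → k , I , n≤0⇒n≡0 f)
          (λ k σ sm I tr → mainStep (refix sm F) I tr)
          I

        record ResetInv (k : ℕ) (σ : Store) : Set where
          field
            left  : env σ C.t + k ≡ 2 * N + 4
            ones  : ∀ z → z < env σ C.t → z ≤ N → arr σ C.V z ≡ 1
            zeros : ∀ z → z < env σ C.t → N < z → arr σ C.V z ≡ 0
            nils  : ∀ z → z < env σ C.t → arr σ C.VN z ≡ 0

        resetTest : Exp
        resetTest = v C.t ⋖ # 2 ⊛ v C.n ⊕ # 4

        reset-correct : ∀ {σ} → env σ C.n ≡ N →
          Ends (C.t := # 0 ⨾ while resetTest resetBody) σ (3 + ((2 * N + 4) * 80 + 40))
            (λ σ′ → (∀ z → z ≤ N → arr σ′ C.V z ≡ 1) × (∀ z → z < 2 * N + 4 → N < z → arr σ′ C.V z ≡ 0) × (∀ z → z < 2 * N + 4 → arr σ′ C.VN z ≡ 0))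
        reset-correct {σ₀} en = prefix 3 (C.t := # 0) (_ , atMost (2 * N + 4) 80 40
          (iterate resetTest resetBody ResetInv {t = 40} (2 * N + 4)
            (λ k σ sm I → _ , ((_ , _ , ≤-<-trans (m≤m+n _ 4) (fits (trans (varₛ sm C.n) en))) , _ , fits (trans (varₛ sm C.n) en)) , _)
            (λ k σ sm I f → let l = ≤-trans (≤-reflexive (cong (λ z → 2 * z + 4) (sym (trans (varₛ sm C.n) en)))) f in
               (λ z z≤ → ResetInv.ones I z (<-≤-trans (s≤s z≤) (≤-trans (lin 1 (λ N → [] ⊢ ‵ 1 :+ N :≤ ‵ 2 :* N :+ ‵ 4) N) l)) z≤) ,
               (λ z z< N<z → ResetInv.zeros I z (<-≤-trans z< l) N<z) , (λ z z< → ResetInv.nils I z (<-≤-trans z< l)))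
            (λ k σ sm I tr → step k σ (trans (varₛ sm C.n) en) I tr)
            (record { left = refl ; ones = λ _ () ; zeros = λ _ () ; nils = λ _ () })))
          where
          fits : ∀ {n} → n ≡ N → 2 * n + 4 < W
          fits refl = small (lin 1 (λ N → [] ⊢ ‵ 2 :* N :+ ‵ 4 :≤ ‵ 16 :* N :+ ‵ 16) N)
          step : ∀ k σ → env σ C.n ≡ N → ResetInv k σ → True resetTest σ → Σ[ k′ ∈ ℕ ] k′ < k × Ends resetBody σ 40 (ResetInv k′)
          step zero σ en I tr = contradiction (trans (sym (+-identityʳ _)) (ResetInv.left I)) (<⇒≢ (subst (λ n → env σ C.t < 2 * n + 4) en tr))
          step (suc k) σ en I tr = k , ≤-refl , straight resetBody
            (_ , (_ , (_ , _ , ≤-<-trans (≤-reflexive (cong suc en)) (small (lin 1 (λ N → [] ⊢ ‵ 1 :+ N :≤ ‵ 16 :* N :+ ‵ 16) N))) , _) , t<lim ,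
             _ , _ , t<lim , (_ , _ , ≤-<-trans t<lim lim<W) , record
             { left = trans (sym (+-suc t k)) (ResetInv.left I)
             ; ones = λ z l z≤ → stored-at (λ {z} → ResetInv.ones I z) z l value-one z≤
             ; zeros = λ z l N<z → stored-at (λ {z} → ResetInv.zeros I z) z l value-zero N<z
             ; nils = nil-at })
            where
            t = env σ C.t
            t< : t < 2 * N + 4
            t< = subst (λ n → env σ C.t < 2 * n + 4) en tr
            t<lim : t < lim
            t<lim = ≤-trans t< (≤-trans (lin 1 (λ N → [] ⊢ ‵ 2 :* N :+ ‵ 4 :≤ ‵ 16 :* N :+ ‵ 16) N) room)
            value : ℕ
            value = evalOp less t (suc (env σ C.n))
            value-one : t ≤ N → value ≡ 1
            value-one l with t <ᵇ suc (env σ C.n) in eq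
            ... | true = refl
            ... | false = contradiction (<⇒<ᵇ (s≤s (≤-trans l (≤-reflexive (sym en))))) (λ y → subst T eq y)
            value-zero : N < t → value ≡ 0
            value-zero l with t <ᵇ suc (env σ C.n) in eq
            ... | false = refl
            ... | true = contradiction (s≤s⁻¹ (<ᵇ⇒< t (suc (env σ C.n)) (subst T (sym eq) _))) (<⇒≱ (≤-<-trans (≤-reflexive en) l))
            stored-at : ∀ {y} {K : ℕ → Set} → (∀ {z} → z < t → K z → arr σ C.V z ≡ y) → ∀ z → z < suc t → (K t → value ≡ y) → K z →
                        (arr σ C.V Defs.[ t ≔ value ]) z ≡ y
            stored-at f z l g kz with m≤n⇒m<n∨m≡n (s≤s⁻¹ l)
            ... | inj₁ l′ = trans (≔-miss (arr σ C.V) value (<⇒≢ l′)) (f l′ kz)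
            ... | inj₂ refl = trans (≔-hit (arr σ C.V) t value) (g kz)
            nil-at : ∀ z → z < suc t → (arr σ C.VN Defs.[ t ≔ 0 ]) z ≡ 0
            nil-at z l with m≤n⇒m<n∨m≡n (s≤s⁻¹ l)
            ... | inj₁ l′ = trans (≔-miss (arr σ C.VN) 0 (<⇒≢ l′)) (ResetInv.nils I z l′)
            ... | inj₂ refl = ≔-hit (arr σ C.VN) t 0

        start : ∀ {σ} → env σ C.fi ≡ N → env σ C.gi ≡ suc N → env σ C.hp ≡ 1 →
          (∀ z → z ≤ N → arr σ C.V z ≡ 1) → (∀ z → z < 2 * N + 4 → N < z → arr σ C.V z ≡ 0) → (∀ z → z < 2 * N + 4 → arr σ C.VN z ≡ 0) →
          MainInv (N + suc N) σ
        start {σ} refl egi ehp ones zeros nils = mainInv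
          (cong (N +_) egi) ≤-refl (≤-reflexive egi)
          (SF.rowOK
            (λ j l → SF.filled [] (ones j l) (subst (λ p → DenF (arr σ C.NC) (arr σ C.NP) (env σ C.hp) p []) (sym (nils j (≤-<-trans l (lin 1 (λ N → [] ⊢ N :< ‵ 2 :* N :+ ‵ 4) N)))) nil)
                       ((≤-refl , minimum _) , l , minimum _))
            (zeros (suc N) (lin 1 (λ N → [] ⊢ ‵ 1 :+ N :< ‵ 2 :* N :+ ‵ 4) N) ≤-refl)
            (λ j l → SF.complete λ d _ cd _ → subst (length d <_) (sym (ones j l)) (s≤s (+-cancelʳ-≤ N (length d) 0 (f-boundA cd)))))
          (subst (λ z → SG.RowOK (heapOf σ) 0 z (λ j → arr σ C.V (2 + N + j)) (λ j → arr σ C.VN (2 + N + j))) (sym egi)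
            (SG.rowOK
              (λ j l → SG.empty (zeros (2 + N + j) (lin 2 (λ N j → (j :≤ N) ∷ [] ⊢ ‵ 2 :+ N :+ j :< ‵ 2 :* N :+ ‵ 4) N j l) (s≤s (m≤n⇒m≤1+n (m≤m+n N j)))))
              (zeros (2 + N + suc N) (lin 1 (λ N → [] ⊢ ‵ 2 :+ N :+ (‵ 1 :+ N) :< ‵ 2 :* N :+ ‵ 4) N) (s≤s (m≤n⇒m≤1+n (m≤m+n N (suc N)))))
              (λ j l → SG.complete λ d _ cd _ → contradiction (proj₁ (proj₁ cd)) (<⇒≱ ≤-refl))))
          (λ _ _ l → l) (≤-reflexive (sym ehp)) (≤-reflexive (cong₂ (λ h z → h + (N + z) * β) ehp egi))

      Outcome : Store → Set
      Outcome σ = (env σ C.fl ≡ 1 × Found σ) ⊎ (env σ C.fl ≡ 0 × env σ C.K ≡ κ + κ × sizeG best + R + κ < N)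

      attemptTime : ℕ
      attemptTime = (3 + ((2 * N + 4) * 80 + 40)) + (20 + (((N + suc N) * (40 + (90 + rowTime)) + 40) + 60))

      attempt-correct : ∀ {σ} → Fixed σ → env σ C.r ≡ R → env σ C.fl ≡ 0 → Ends attempt σ attemptTime Outcome
      attempt-correct {σ} F@(fixed en eK eEA eEB) er efl =
        reset-correct en then λ {σ₁} (ones , zeros , nils) sm₁ →
        let en₁ = trans (varₛ sm₁ C.n) en in
        prefix 20 (C.hp := # 1 ⨾ C.fi := v C.n ⨾ C.gi := # 1 ⊕ v C.n)
          (_ , _ , (_ , _ , ≤-<-trans (≤-reflexive (cong suc en₁)) (small (lin 1 (λ N → [] ⊢ ‵ 1 :+ N :≤ ‵ 16 :* N :+ ‵ 16) N))) ,
           (mainLoop (fixed en₁ (trans (varₛ sm₁ C.K) eK) (λ i l → trans (arrₛ sm₁ C.EW i) (eEA i l)) (λ j l → trans (arrₛ sm₁ C.EW (suc N + j)) (eEB j l)))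
              (start en₁ (cong suc en₁) refl ones zeros nils)
            then λ {σ₂} (k , I , g0) sm₂ →
              finish I g0 (trans (varₛ sm₂ C.n) en₁) (trans (varₛ sm₂ C.r) (trans (varₛ sm₁ C.r) er))
                (trans (varₛ sm₂ C.K) (trans (varₛ sm₁ C.K) eK)) (trans (varₛ sm₂ C.fl) (trans (varₛ sm₁ C.fl) efl))))
        where
        last : Cmd
        last = C.cur := ld C.V (# 2 ⊕ v C.n) ⨾ cond ((# 0 ⋖ v C.cur) && (v C.n ⋖ v C.cur ⊕ (v C.r ⊕ v C.K))) (C.fl := # 1) (C.K := v C.K ⊕ v C.K)
        finish : ∀ {k σ} → MainInv k σ → env σ C.gi ≡ 0 → env σ C.n ≡ N → env σ C.r ≡ R → env σ C.K ≡ κ → env σ C.fl ≡ 0 →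
          Ends last σ 60 Outcome
        finish {k} {σ} I g0 en er eK efl = straight last
          ((_ , (_ , _ , ≤-<-trans (≤-reflexive (cong (2 +_) en)) (small (lin 1 (λ N → [] ⊢ ‵ 2 :+ N :≤ ‵ 16 :* N :+ ‵ 16) N))) ,
              ≤-<-trans (≤-reflexive (cong (2 +_) en)) (room′ (lin 1 (λ N → [] ⊢ ‵ 2 :+ N :≤ ‵ 16 :* N :+ ‵ 15) N))) ,
           (_ , λ _ → (_ , (_ , (_ , _ , fits₂) , fits₁) , _)) ,
           (λ (0<c , l) → _ , inj₁ (refl , success 0<c (subst₂ _<_ en (cong₂ _+_ value≡ (cong₂ _+_ er eK)) l))) ,
           (λ f → (_ , _ , fits₃) , inj₂ (efl , cong₂ _+_ eK eK , failure f)))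
          where
          value = arr σ C.V (2 + env σ C.n)
          value≡ : value ≡ arr σ C.V (2 + N)
          value≡ = cong (λ n → arr σ C.V (2 + n)) en
          zero≡ : ∀ (f : ℕ → ℕ) → f (2 + N + 0) ≡ f (2 + N)
          zero≡ f = cong f (+-identityʳ (2 + N))
          rowG : SG.RowOK (heapOf σ) 0 0 (λ j → arr σ C.V (2 + N + j)) (λ j → arr σ C.VN (2 + N + j))
          rowG = subst (λ z → SG.RowOK (heapOf σ) 0 z (λ j → arr σ C.V (2 + N + j)) (λ j → arr σ C.VN (2 + N + j))) g0 (MainInv.grow I)
          corner : SG.Cell (heapOf σ) 0 0 (arr σ C.V (2 + N)) (arr σ C.VN (2 + N))
          corner = SG.cell-≡ (sym (zero≡ (arr σ C.V))) (sym (zero≡ (arr σ C.VN))) (SG.RowOK.cells rowG 0 z≤n)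
          near⇒ : N ≤ sizeG best + R + κ → sizeG best < arr σ C.V (2 + N)
          near⇒ l = subst (sizeG best <_) (zero≡ (arr σ C.V)) (SG.Complete.best (SG.RowOK.optima rowG 0 z≤n) best z≤n is-cand (l′ , l′))
            where
            l′ : N ≤ sizeG best + R + κ + 0
            l′ = ≤-trans l (m≤m+n _ 0)
          corner≤ : arr σ C.V (2 + N) ≤ suc N
          corner≤ with corner
          ... | SG.empty z = ≤-trans (≤-reflexive z) z≤n
          ... | SG.filled d e _ cd = ≤-trans (≤-reflexive e) (s≤s (≤-trans (m≤m+n (sizeG d) R) (≤-trans (m≤m+n _ 0) (System.boundA (systemG {0}) {d = d} cd))))
          sum≤ : ∀ {x} → x ≤ 5 * N + 5 → x < W
          sum≤ l = small (≤-trans l (lin 1 (λ N → [] ⊢ ‵ 5 :* N :+ ‵ 5 :≤ ‵ 16 :* N :+ ‵ 16) N))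
          fits₁ : value + (env σ C.r + env σ C.K) < W
          fits₁ = subst₂ (λ a b → a + b < W) (sym value≡) (sym (cong₂ _+_ er eK)) (sum≤
            (lin 4 (λ c r k N → (c :≤ ‵ 1 :+ N) ∷ (r :≤ N) ∷ (k :≤ ‵ 2 :* N :+ ‵ 1) ∷ [] ⊢ c :+ (r :+ k) :≤ ‵ 5 :* N :+ ‵ 5) (arr σ C.V (2 + N)) R κ N corner≤ R≤N κ≤))
          fits₂ : env σ C.r + env σ C.K < W
          fits₂ = ≤-<-trans (m≤n+m _ value) fits₁
          fits₃ : env σ C.K + env σ C.K < W
          fits₃ = subst (_< W) (sym (cong₂ _+_ eK eK)) (sum≤ (lin 2 (λ k N → (‵ 2 ∙ (k :≤ ‵ 2 :* N :+ ‵ 1)) ∷ [] ⊢ k :+ k :≤ ‵ 5 :* N :+ ‵ 5) κ N κ≤))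
          -- A value that leaves out at most κ characters shows that the optimum, being at least as
          -- long, does so too. Hence the optimum is near, and the corner is complete for it.
          success : 0 < value → N < arr σ C.V (2 + N) + (R + κ) → Found (stored ((env σ Defs.[ C.cur ≔ value ]) Defs.[ C.fl ≔ 1 ]) (arr σ) (out σ))
          success 0<c l = build corner
            where
            build : SG.Cell (heapOf σ) 0 0 (arr σ C.V (2 + N)) (arr σ C.VN (2 + N)) → _
            build (SG.empty z) = contradiction (trans value≡ z) (>⇒≢ 0<c)
            build (SG.filled d e den cd) = found {pair = d} den cd
              (λ d′ cd′ → ≤-trans (is-best d′ cd′) (s≤s⁻¹ (subst (sizeG best <_) e (near⇒
                (lin 6 (λ N s d r k c → (N :< c :+ (r :+ k)) ∷ (c :≤ ‵ 1 :+ d) ∷ (d :≤ s) ∷ [] ⊢ N :≤ s :+ r :+ k)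
                   N (sizeG best) (sizeG d) R κ (arr σ C.V (2 + N)) l (≤-reflexive e) (is-best d cd))))))
              (≤-trans (≤-trans (m≤m+n _ _) (MainInv.heap≤ I)) heap-room)
          -- If the optimum left out at most κ characters, the corner would be complete for it and
          -- the test would succeed.
          failure : False ((# 0 ⋖ v C.cur) && (v C.n ⋖ v C.cur ⊕ (v C.r ⊕ v C.K))) (stored (env σ Defs.[ C.cur ≔ value ]) (arr σ) (out σ)) →
                    sizeG best + R + κ < N
          failure f = ≰⇒> λ l → refute f (near⇒ l) l
            where
            refute : _ → sizeG best < arr σ C.V (2 + N) → ¬ (N ≤ sizeG best + R + κ)
            refute (inj₁ c≤0) b l = contradiction (≤-trans (≤-trans (s≤s z≤n) b) (≤-trans (≤-reflexive (sym value≡)) c≤0)) λ ()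
            refute (inj₂ (_ , le)) b l = contradiction (subst₂ _≤_ (cong₂ _+_ value≡ (cong₂ _+_ er eK)) en le)
              (<⇒≱ (lin 5 (λ N s r k c → (N :≤ s :+ r :+ k) ∷ (s :< c) ∷ [] ⊢ N :< c :+ (r :+ k)) N (sizeG best) R κ (arr σ C.V (2 + N)) l b))

    -- Throughout the search κ ≤ 2 k + 1, which makes 2 (2 κ + 1) at most 8 k + 6.
    record Plan : Set where
      constructor plan
      field
        best      : List ℕ × List ℕ
        is-cand   : CandG 0 0 best
        is-best   : ∀ d → CandG 0 0 d → sizeG d ≤ sizeG best
        k         : ℕ
        slack     : sizeG best + R + k ≡ N
        β         : ℕ
        budget    : (8 * k + 6) ⊓ suc (sizeG best) ≤ β
        heap-room : 1 + (N + suc N) * β ≤ lim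

    module _ (pl : Plan) where

      open Plan pl

      private
        k≤N : k ≤ N
        k≤N = ≤-trans (m≤n+m k _) (≤-reflexive slack)

        module At (κ : ℕ) (κ≤ : κ ≤ 2 * k + 1) = Attempt (attemptSetting κ (≤-trans κ≤ (+-monoˡ-≤ 1 (*-monoʳ-≤ 2 k≤N))) best is-cand is-best β
          (≤-trans (⊓-monoˡ-≤ (suc (sizeG best)) (lin 2 (λ κ k → (‵ 4 ∙ (κ :≤ ‵ 2 :* k :+ ‵ 1)) ∷ [] ⊢ ‵ 2 :* (‵ 2 :* κ :+ ‵ 1) :≤ ‵ 8 :* k :+ ‵ 6) κ k κ≤)) budget)
          heap-room)

        unit : ℕ
        unit = 4000 * suc N

        -- A row costs at most 750 + 860 κ ≤ 1610 κ. With 2 N + 1 rows and the reset this stays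
        -- below 4000 (N + 1) κ.
        attempt-≤ : ∀ κ (l : κ ≤ 2 * k + 1) → 1 ≤ κ → 10 + At.attemptTime κ l ≤ unit * κ
        attempt-≤ (suc κ) l _ = lin 2 (λ N κ → [] ⊢ ‵ 10 :+ ((‵ 3 :+ ((‵ 2 :* N :+ ‵ 4) :* ‵ 80 :+ ‵ 40)) :+
            (‵ 20 :+ (((N :+ (‵ 1 :+ N)) :* (‵ 40 :+ (‵ 90 :+ (‵ 150 :+ ((‵ 2 :* (‵ 1 :+ κ) :+ ‵ 1) :* ‵ 430 :+ ‵ 40)))) :+ ‵ 40) :+ ‵ 60)))
            :≤ (‵ 4000 :* (‵ 1 :+ N)) :* (‵ 1 :+ κ)) N κ

      -- There are m units left. A failure spends K of them and doubles K, so m + K keeps its value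
      -- 4 k + 3, and K ≤ 2 k + 1 ensures K ≤ m.
      data Search (τ : ℕ) (σ : Store) : Set where
        over    : env σ C.fl ≡ 1 → Found σ → Search τ σ
        ongoing : ∀ m → env σ C.fl ≡ 0 → 1 ≤ env σ C.K → env σ C.K ≤ 2 * k + 1 → m + env σ C.K ≡ 4 * k + 3 → unit * m ≤ τ → Search τ σ

      -- The attempts have geometrically growing costs, all paid by the last one; a failure with κ shows κ < k.
      dynamic-correct : ∀ {σ} → env σ C.n ≡ N → env σ C.r ≡ R →
        (∀ i → i ≤ N → arr σ C.EW i ≡ eA i) → (∀ j → j ≤ N → arr σ C.EW (suc N + j) ≡ eB j) →
        Ends dynamic σ (6 + (unit * (4 * k + 2) + 9)) Found
      dynamic-correct {σ} en er eEA eEB = prefix 6 (C.K := # 1 ⨾ C.fl := # 0) (_ , _ ,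
        Loop.loop (v C.fl ≐ # 0) attempt _ Search Found
          (λ { τ σ sm (over _ f) _ → f ; τ σ sm (ongoing _ z _ _ _ _) nz → contradiction z nz })
          (λ τ σ sm I → _)
          step
          (unit * (4 * k + 2)) (ongoing (4 * k + 2) refl ≤-refl (m≤n+m 1 _) (+-assoc (4 * k) 2 1) ≤-refl))
        where
        step : ∀ τ σ₁ → Same attempt _ σ₁ → Search τ σ₁ → env σ₁ C.fl ≡ 0 →
               Σ[ t ∈ ℕ ] Σ[ τ′ ∈ ℕ ] 7 + (3 + t) + τ′ ≤ τ × Ends attempt σ₁ t (Search τ′)
        step τ σ₁ sm (over f _) z = contradiction (trans (sym z) f) λ ()
        step τ σ₁ sm (ongoing m z 1≤K K≤ m+K unit≤) _ =
          At.attemptTime κ K≤ , unit * m′ , paid ,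
          weaken after (At.attempt-correct κ K≤ (At.fixed (trans (varₛ sm C.n) en) refl (λ i l → trans (arrₛ sm C.EW i) (eEA i l)) (λ j l → trans (arrₛ sm C.EW (suc N + j)) (eEB j l)))
            (trans (varₛ sm C.r) er) z)
          where
          κ = env σ₁ C.K
          m′ = m ∸ κ
          κ≤m : κ ≤ m
          κ≤m = lin 3 (λ κ m k → (‵ 2 ∙ (κ :≤ ‵ 2 :* k :+ ‵ 1)) ∷ (‵ 4 :* k :+ ‵ 3 :≤ m :+ κ) ∷ [] ⊢ κ :≤ m) κ m k K≤ (≤-reflexive (sym m+K))
          m≡ : m′ + κ ≡ m
          m≡ = m∸n+n≡m κ≤m
          paid : 7 + (3 + At.attemptTime κ K≤) + unit * m′ ≤ τ
          paid = ≤-trans (≤-trans (+-monoˡ-≤ (unit * m′) (attempt-≤ κ K≤ 1≤K))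
                   (≤-reflexive (trans (sym (*-distribˡ-+ unit κ m′)) (cong (unit *_) (trans (+-comm κ m′) m≡))))) unit≤
          after : ∀ σ₂ → At.Outcome κ K≤ σ₂ → Search (unit * m′) σ₂
          after σ₂ (inj₁ (f , r)) = over f r
          after σ₂ (inj₂ (f , K≡ , l)) = ongoing m′ f
            (subst (1 ≤_) (sym K≡) (≤-trans 1≤K (m≤m+n κ κ)))
            (subst (_≤ 2 * k + 1) (sym K≡) (lin 4 (λ s κ k N → (‵ 2 ∙ (s :+ κ :< N)) ∷ (‵ 2 ∙ (N :≤ s :+ k)) ∷ [] ⊢ κ :+ κ :≤ ‵ 2 :* k :+ ‵ 1)
               (sizeG best + R) κ k N l (≤-reflexive (sym slack))))
            (trans (cong (m′ +_) K≡) (trans (sym (+-assoc m′ κ κ)) (trans (cong (_+ κ) m≡) m+K)))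
            ≤-refl

-- Writing out the solution

module Output where

  open import Data.List.Base using (_∷ʳ_)
  open import Data.List.Properties using (∷ʳ-++; ++-assoc; ++-identityʳ)
  open Language
  open Candidate-systems
  open Code using (trace; emitNode; emitP)

  record TraceSetting : Set where
    constructor traceSetting
    field
      sp : Space
    open Space sp public
    field
      R≤N : length (input tapeP) ≤ N

  module Trace (s : TraceSetting) where

    open TraceSetting s

    open Semantics mc

    private
      P = input tapeP

    -- The list X stops at the node that marks the place of P, the only one before P whose content
    -- is 0.
    emitsG : ∀ {σ₀ X Y} → env σ₀ C.hp ≤ lim → DenG (arr σ₀ C.NC) (arr σ₀ C.NP) (env σ₀ C.hp) (env σ₀ C.p) (X , Y) →
      Ends (while (# 0 ⋖ ld C.NC (v C.p)) emitNode) σ₀ (length X * 80 + 40)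
        (λ σ → out σ ≡ out σ₀ ++ X × DenG (arr σ₀ C.NC) (arr σ₀ C.NP) (env σ₀ C.hp) (env σ C.p) ([] , Y))
    emitsG {σ₀} {X₀} {Y} h≤ den = atMost (length X₀) 80 40 (iterate (# 0 ⋖ ld C.NC (v C.p)) emitNode I (length X₀)
      (λ { k σ sm (X , den , _) → _ , (_ , _ , <-≤-trans (denG-< den) h≤) , _ })
      (λ { k σ sm ([] , den , _ , e) f → trans (sym (++-identityʳ _)) e , den
         ; k σ sm (c ∷ X , add _ _ e _ _ , _) f → contradiction (trans (sym e) (trans (sym (arrₛ sm C.NC _)) (n≤0⇒n≡0 f))) λ () })
      (λ { .(length X) σ sm (X , den , refl , e) tr → step σ X sm den e tr })
      (X₀ , den , refl , refl))
      where
      nc = arr σ₀ C.NC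
      np = arr σ₀ C.NP
      h = env σ₀ C.hp
      denG-< : ∀ {p d} → DenG nc np h p d → p < h
      denG-< (mark _ l _ _ _) = l
      denG-< (add _ l _ _ _) = l
      I : ℕ → Store → Set
      I k σ = Σ[ X ∈ List ℕ ] DenG nc np h (env σ C.p) (X , Y) × length X ≡ k × out σ ++ X ≡ out σ₀ ++ X₀
      step : ∀ σ X → Same emitNode σ₀ σ → DenG nc np h (env σ C.p) (X , Y) → out σ ++ X ≡ out σ₀ ++ X₀ →
        0 < arr σ C.NC (env σ C.p) → Σ[ k ∈ ℕ ] k < length X × Ends emitNode σ 40 (I k)
      step σ [] sm (mark _ _ e _ _) _ tr = contradiction (trans (arrₛ sm C.NC _) e) (>⇒≢ tr)
      step σ (c ∷ X) sm (add _ p<h nc≡ np≡ den) e tr = length X , ≤-refl , straight emitNode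
        (((_ , _ , <-≤-trans p<h h≤) , _ , _) , (_ , _ , <-≤-trans p<h h≤) ,
         (X , subst (λ q → DenG nc np h q (X , Y)) (sym (trans (arrₛ sm C.NP _) np≡)) den , refl ,
          -- Characters are stored one higher, because 0 is the mark.
          trans (cong (λ c → (out σ ∷ʳ c) ++ X) (cong (_∸ 1) (trans (arrₛ sm C.NC _) nc≡))) (trans (∷ʳ-++ (out σ) c X) e)))

    emitsF : ∀ {σ₀ Y} → env σ₀ C.hp ≤ lim → DenF (arr σ₀ C.NC) (arr σ₀ C.NP) (env σ₀ C.hp) (env σ₀ C.p) Y →
      Ends (while (# 0 ⋖ v C.p) emitNode) σ₀ (length Y * 80 + 40) (λ σ → out σ ≡ out σ₀ ++ Y)
    emitsF {σ₀} {Y₀} h≤ den = atMost (length Y₀) 80 40 (iterate (# 0 ⋖ v C.p) emitNode I (length Y₀)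
      (λ k σ sm I → _)
      (λ { k σ sm ([] , den , _ , e) f → trans (sym (++-identityʳ _)) e
         ; k σ sm (c ∷ Y , add 0<p _ _ _ _ , _) f → contradiction 0<p (≤⇒≯ f) })
      (λ { .(length Y) σ sm (Y , den , refl , e) tr → step σ Y sm den e tr })
      (Y₀ , den , refl , refl))
      where
      nc = arr σ₀ C.NC
      np = arr σ₀ C.NP
      h = env σ₀ C.hp
      I : ℕ → Store → Set
      I k σ = Σ[ Y ∈ List ℕ ] DenF nc np h (env σ C.p) Y × length Y ≡ k × out σ ++ Y ≡ out σ₀ ++ Y₀
      empty⇒ : ∀ {p} → DenF nc np h p [] → p ≡ 0
      empty⇒ nil = refl
      step : ∀ σ Y → Same emitNode σ₀ σ → DenF nc np h (env σ C.p) Y → out σ ++ Y ≡ out σ₀ ++ Y₀ →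
        0 < env σ C.p → Σ[ k ∈ ℕ ] k < length Y × Ends emitNode σ 40 (I k)
      step σ [] sm den _ tr = contradiction (empty⇒ den) (>⇒≢ tr)
      step σ (c ∷ Y) sm (add _ p<h nc≡ np≡ den) e tr = length Y , ≤-refl , straight emitNode
        (((_ , _ , <-≤-trans p<h h≤) , _ , _) , (_ , _ , <-≤-trans p<h h≤) ,
         (Y , subst (λ q → DenF nc np h q Y) (sym (trans (arrₛ sm C.NP _) np≡)) den , refl ,
          trans (cong (λ c → (out σ ∷ʳ c) ++ Y) (cong (_∸ 1) (trans (arrₛ sm C.NC _) nc≡))) (trans (∷ʳ-++ (out σ) c Y) e)))

    emitsP : ∀ {σ₀} → env σ₀ C.i ≡ 0 → env σ₀ C.r ≡ length P →
      Ends (while (v C.i ⋖ v C.r) emitP) σ₀ (length P * 80 + 40) (λ σ → out σ ≡ out σ₀ ++ P)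
    emitsP {σ₀} ei er = atMost (length P) 80 40 (iterate (v C.i ⋖ v C.r) emitP I (length P)
      (λ k σ sm I → _)
      (λ k σ sm (e , _ , o) f → trans (sym (++-identityʳ _)) (trans (cong (out σ ++_) (sym (drop-nil P (env σ C.i) (≤-trans (≤-reflexive (sym (trans (varₛ sm C.r) er))) f)))) o))
      (λ k σ sm (e , l , o) tr → length P ∸ suc (env σ C.i) , subst (length P ∸ suc (env σ C.i) <_) e (∸-monoʳ-< ≤-refl (subst (env σ C.i <_) (trans (varₛ sm C.r) er) tr)) ,
         let i< = subst (env σ C.i <_) (trans (varₛ sm C.r) er) tr in
         straight emitP {40} (_ , (_ , _ , small (≤-trans i< (≤-trans R≤N (lin 1 (λ N → [] ⊢ N :≤ ‵ 16 :* N :+ ‵ 16) N)))) ,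
           refl , i< , trans (∷ʳ-++ (out σ) _ _) (trans (cong (out σ ++_) (sym (drop-cons P (env σ C.i) i<))) o)))
      (cong (length P ∸_) ei , ≤-trans (≤-reflexive ei) z≤n , cong (λ i → out σ₀ ++ drop i P) ei))
      where
      I : ℕ → Store → Set
      I k σ = length P ∸ env σ C.i ≡ k × env σ C.i ≤ length P × out σ ++ drop (env σ C.i) P ≡ out σ₀ ++ P

    traceTime : ℕ → ℕ → ℕ
    traceTime x y = 12 + ((x * 80 + 40) + (3 + ((length P * 80 + 40) + (10 + (y * 80 + 40)))))

    trace-correct : ∀ {σ X Y} → env σ C.n ≡ N → env σ C.r ≡ length P → out σ ≡ [] → env σ C.hp ≤ lim →
      DenG (arr σ C.NC) (arr σ C.NP) (env σ C.hp) (arr σ C.VN (2 + N)) (X , Y) →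
      Ends trace σ (traceTime (length X) (length Y)) (λ σ′ → out σ′ ≡ X ++ P ++ Y)
    trace-correct {σ} {X} {Y} en er eo h≤ den =
      prefix 12 (C.p := ld C.VN (# 2 ⊕ v C.n))
        ((_ , (_ , _ , small (≤-trans (n≤1+n _) at≤)) , <-≤-trans at≤ room) ,
         (emitsG h≤ (subst (λ n → DenG (arr σ C.NC) (arr σ C.NP) (env σ C.hp) (arr σ C.VN (2 + n)) (X , Y)) (sym en) den)
          then λ {σ₁} (o₁ , den₁) sm₁ →
          prefix 3 (C.i := # 0) (_ ,
           (emitsP refl (trans (varₛ sm₁ C.r) er)
            then λ {σ₂} o₂ sm₂ →
            let p≡ = varₛ sm₂ C.p
                (q , den₂ , e , p<h) = marked den₁ in
            prefix 10 (C.p := ld C.NP (v C.p))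
              ((_ , _ , <-≤-trans (≤-<-trans (≤-reflexive p≡) p<h) h≤) ,
               weaken (λ σ′ o → trans o (trans (cong (_++ Y) (trans o₂ (cong (_++ P) (trans o₁ (cong (_++ X) eo))))) (++-assoc X P Y)))
                (emitsF (≤-trans (≤-reflexive (trans (varₛ sm₂ C.hp) (varₛ sm₁ C.hp))) h≤)
                  (denF-mono (≤-reflexive (sym (trans (varₛ sm₂ C.hp) (varₛ sm₁ C.hp)))) (λ q _ → trans (arrₛ sm₂ C.NC q) (arrₛ sm₁ C.NC q))
                    (λ q _ → trans (arrₛ sm₂ C.NP q) (arrₛ sm₁ C.NP q))
                    (subst (λ q → DenF _ _ _ q Y) (sym (trans (cong (arr σ₂ C.NP) p≡) (trans (arrₛ sm₂ C.NP _) (trans (arrₛ sm₁ C.NP _) e)))) den₂))))))))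
      where
      at≤ : 2 + env σ C.n < 16 * N + 16
      at≤ = ≤-trans (≤-reflexive (cong (3 +_) en)) (lin 1 (λ N → [] ⊢ ‵ 3 :+ N :≤ ‵ 16 :* N :+ ‵ 16) N)
      marked : ∀ {nc np h p} → DenG nc np h p ([] , Y) → Σ[ q ∈ ℕ ] DenF nc np h q Y × np p ≡ q × p < h
      marked (mark _ l _ e d) = _ , d , e , l

-- The solving phase and its running time

module Solution where

  open Language
  open Arithmetic
  open BitVectors
  open Embeddings
  open Candidate-systems
  open Tables using (tableSetting; module Blocks)
  open Key-sorting using (sortSetting; module Sorting)
  open Character-names using (NameSetting; nameSetting; module Naming; module Names)
  open Window-ends using (WindowSetting; windowSetting; module Windows)
  open Doubling
  open Output using (traceSetting; module Trace)
  open Code using (names; solve; conjTable; sort; windows; dynamic; trace)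

  module Naming-texts (s : NameSetting) where

    open NameSetting s

    open Semantics mc
    open Naming (charAt (input tapeP)) R δ D δ≤R order onlyP everyP public
    open Names s public

    private
      module OnA = Text (textSetting tapeA N 0 N ≤-refl (lin 1 (λ N → [] ⊢ N :+ N :≤ ‵ 16 :* N :+ ‵ 15) N))
      module OnB = Text (textSetting tapeB N (2 * N) (3 * N) (lin 1 (λ N → [] ⊢ ‵ 2 :* N :+ N :≤ ‵ 3 :* N) N)
        (lin 1 (λ N → [] ⊢ ‵ 3 :* N :+ N :≤ ‵ 16 :* N :+ ‵ 15) N))
      module OnP = Text (textSetting tapeP R (4 * N) (5 * N) (lin 2 (λ N R → (R :≤ N) ∷ [] ⊢ ‵ 4 :* N :+ R :≤ ‵ 5 :* N) N R R≤N)
        (lin 2 (λ N R → (R :≤ N) ∷ [] ⊢ ‵ 5 :* N :+ R :≤ ‵ 16 :* N :+ ‵ 15) N R R≤N))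

      nameTime : ℕ → ℕ
      nameTime l = 3 + (l * (40 + (10 + ((20 + (((U * 60 + 40) + (β * 60 + 40)) + 60)) + 60))) + 40)

      fits : ∀ k → k ≤ 5 → k * N < W
      fits k l = ≤-<-trans (≤-trans (*-monoˡ-≤ N l) (≤-trans (lin 1 (λ N → [] ⊢ ‵ 5 :* N :≤ ‵ 16 :* N :+ ‵ 16) N) room)) lim<W

      fits′ : ∀ k {n} → k ≤ 5 → n ≡ N → k * n < W
      fits′ k l refl = fits k l

    record Texts-named (σ : Store) : Set where
      field
        fwA : ∀ j → j < N → Named (charAt (input tapeA) j) (arr σ C.NM j)
        bwA : ∀ j → j < N → Named (charAt (input tapeA) j) (arr σ C.NM (N + (N ∸ suc j)))
        fwB : ∀ j → j < N → Named (charAt (input tapeB) j) (arr σ C.NM (2 * N + j))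
        bwB : ∀ j → j < N → Named (charAt (input tapeB) j) (arr σ C.NM (3 * N + (N ∸ suc j)))
        fwP : ∀ y → y < R → Named (charAt (input tapeP) y) (arr σ C.NM (4 * N + y))
        bwP : ∀ y → y < R → Named (charAt (input tapeP) y) (arr σ C.NM (5 * N + (R ∸ suc y)))

    namesTime : ℕ
    namesTime = 12 + (nameTime N + (12 + (nameTime N + (16 + nameTime R))))

    names-correct : ∀ {σ} → env σ C.n ≡ N → Fixed σ → Ends names σ namesTime Texts-named
    names-correct {σ} en (fixed eR eβ eδ eD) =
      prefix 12 (C.ln := v C.n ⨾ C.tb := # 0 ⨾ C.pb := v C.n) (_ , _ , _ ,
        (OnA.name-correct (fixed eR eβ eδ eD) (OnA.params en refl en)
         then λ {σ₁} r₁ sm₁ →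
         let en₁ = trans (varₛ sm₁ C.n) en
             eR₁ = trans (varₛ sm₁ C.r) eR ; eβ₁ = trans (varₛ sm₁ C.b) eβ ; eδ₁ = trans (varₛ sm₁ C.dn) eδ ; eD₁ = λ u → trans (arrₛ sm₁ C.D u) (eD u) in
         prefix 12 (C.tb := # 2 ⊛ v C.n ⨾ C.pb := # 3 ⊛ v C.n)
          ((_ , _ , fits′ 2 (s≤s (s≤s z≤n)) en₁) , (_ , _ , fits′ 3 (s≤s (s≤s (s≤s z≤n))) en₁) ,
          (OnB.name-correct (fixed eR₁ eβ₁ eδ₁ eD₁)
             (OnB.params (trans (varₛ sm₁ C.ln) en) (cong (2 *_) en₁) (cong (3 *_) en₁))
           then λ {σ₂} r₂ sm₂ →
           let en₂ = trans (varₛ sm₂ C.n) en₁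
               eR₂ = trans (varₛ sm₂ C.r) eR₁ ; eβ₂ = trans (varₛ sm₂ C.b) eβ₁ ; eδ₂ = trans (varₛ sm₂ C.dn) eδ₁ ; eD₂ = λ u → trans (arrₛ sm₂ C.D u) (eD₁ u) in
           prefix 16 (C.ln := v C.r ⨾ C.tb := # 4 ⊛ v C.n ⨾ C.pb := # 5 ⊛ v C.n)
            (_ , (_ , _ , fits′ 4 (s≤s (s≤s (s≤s (s≤s z≤n)))) en₂) , (_ , _ , fits′ 5 ≤-refl en₂) ,
            weaken (λ σ₃ r₃ → record
              { fwA = λ j l → moved (Named (charAt (input tapeA) j)) (kept₂ r₂ r₃ (<-≤-trans l (m≤m+n N (1 * N)))) (OnA.Result.forwards r₁ j l)
              ; bwA = λ j l → moved (Named (charAt (input tapeA) j)) (kept₂ r₂ r₃ (+-monoʳ-< N (≤-trans (back l) (m≤m+n N 0)))) (OnA.Result.backwards r₁ j l)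
              ; fwB = λ j l → moved (Named (charAt (input tapeB) j)) (kept₃ r₃ (<-≤-trans (+-monoʳ-< (2 * N) l) (lin 1 (λ N → [] ⊢ ‵ 2 :* N :+ N :≤ ‵ 4 :* N) N))) (OnB.Result.forwards r₂ j l)
              ; bwB = λ j l → moved (Named (charAt (input tapeB) j)) (kept₃ r₃ (<-≤-trans (+-monoʳ-< (3 * N) (back l)) (lin 1 (λ N → [] ⊢ ‵ 3 :* N :+ N :≤ ‵ 4 :* N) N))) (OnB.Result.backwards r₂ j l)
              ; fwP = OnP.Result.forwards r₃
              ; bwP = OnP.Result.backwards r₃ })
            (OnP.name-correct (fixed eR₂ eβ₂ eδ₂ eD₂)
              (OnP.params eR₂ (cong (4 *_) en₂) (cong (5 *_) en₂))))))))
      where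
      moved : ∀ {x y} (F : ℕ → Set) → x ≡ y → F y → F x
      moved F refl f = f
      back : ∀ {j} → j < N → N ∸ suc j < N
      back {j} l = ∸-monoʳ-< {N} {suc j} {0} (s≤s z≤n) l
      kept₃ : ∀ {α β z} → OnP.Result α R β → z < 4 * N → β z ≡ α z
      kept₃ r₃ l = OnP.Result.outside r₃ _ l
      kept₂ : ∀ {α β γ z} → OnB.Result α N β → OnP.Result β R γ → z < 2 * N → γ z ≡ α z
      kept₂ r₂ r₃ l = trans (OnP.Result.outside r₃ _ (<-≤-trans l (*-monoˡ-≤ N {2} {4} (s≤s (s≤s z≤n))))) (OnB.Result.outside r₂ _ l)

  earliest-ends : ∀ P T R N → Ends-of-windows P T R N (Mirror.earliest P T R N)
  earliest-ends P T R N = record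
    { sound = earliest-sound ; least = earliest-complete ; bounded = λ i → earliest-≤ {i} ; monotone = earliest-mono }
    where open Mirror P T R N

  -- U bounds the number of blocks. As β is found at run time, `enough` asks for R ≤ U β for every β
  -- that may come out.
  record SolveSetting : Set where
    constructor solveSetting
    field
      sp : Space
    open Space sp public
    field
      charW : ∀ τ i → suc (charAt (input τ) i) < 2 ^ w
      keyW : ∀ τ i → charAt (input τ) i * length (input tapeP) + (length (input tapeP) + 1) < 2 ^ w
      lenA : length (input tapeA) ≡ N
      lenB : length (input tapeB) ≡ N
      R≤N : length (input tapeP) ≤ N
      U : ℕ
      U>0 : 1 ≤ U
      U≤ : U ≤ 4 * length (input tapeP) + 4
      enough : ∀ β → length (input tapeP) < 2 ^ β * 2 ^ β → length (input tapeP) ≤ U * β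

  module Solve (s : SolveSetting) where

    open SolveSetting s

    open Semantics mc
    open Candidates (input tapeA) (input tapeB) (input tapeP) N lenA lenB

    private
      P A B : ℕ → ℕ
      P = charAt (input tapeP)
      A = charAt (input tapeA)
      B = charAt (input tapeB)

      R : ℕ
      R = length (input tapeP)

      eA eB : ℕ → ℕ
      eA = Mirror.earliest P A R N
      eB = Mirror.earliest P B R N

      dynamics : DynamicSetting
      dynamics = dynamicSetting sp charW lenA lenB R≤N eA eB (earliest-ends P A R N) (earliest-ends P B R N)

      module Tr = Trace (traceSetting sp R≤N)

      room₅ : 5 * R + 5 ≤ lim
      room₅ = ≤-trans (lin 2 (λ R N → (‵ 5 ∙ (R :≤ N)) ∷ [] ⊢ ‵ 5 :* R :+ ‵ 5 :≤ ‵ 16 :* N :+ ‵ 16) R N R≤N) room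

      room₁₆ : 16 * R + 16 ≤ lim
      room₁₆ = ≤-trans (+-monoˡ-≤ 16 (*-monoʳ-≤ 16 R≤N)) room

    module Dyn = Dynamic dynamics
    open Dyn using (sizeG)

    Optimal : List ℕ × List ℕ → Set
    Optimal d = CandG 0 0 d × (∀ d′ → CandG 0 0 d′ → sizeG d′ ≤ sizeG d)

    module _ (pl : Dyn.Plan) where

      open Dyn.Plan pl

      record Emitted (σ : Store) : Set where
        constructor emitted
        field
          {pair}  : List ℕ × List ℕ
          written : out σ ≡ proj₁ pair Data.List.Base.++ input tapeP Data.List.Base.++ proj₂ pair
          is-best : Optimal pair

      lastTime : ℕ
      lastTime = (6 + (4000 * suc N * (4 * k + 2) + 9)) + (80 * N + 150)

      last-correct : ∀ {σ} → env σ C.n ≡ N → env σ C.r ≡ R → out σ ≡ [] →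
        (∀ i → i ≤ N → arr σ C.EW i ≡ eA i) → (∀ j → j ≤ N → arr σ C.EW (suc N + j) ≡ eB j) →
        Ends (dynamic ⨾ trace) σ lastTime Emitted
      last-correct en er eo eEA eEB =
        Dyn.dynamic-correct pl en er eEA eEB
        then λ { {σ} (Dyn.found {pair = X , Y} den cd opt h≤) sm →
          within (traced X Y cd) (weaken (λ σ′ o → emitted {pair = X , Y} o (cd , opt))
            (Tr.trace-correct (trans (varₛ sm C.n) en) (trans (varₛ sm C.r) er) (trans (outₛ sm) eo) h≤ den)) }
        where
        traced : ∀ X Y → CandG 0 0 (X , Y) → Tr.traceTime (length X) (length Y) ≤ 80 * N + 150
        traced X Y cd = lin 4 (λ x y r N → (‵ 80 ∙ (x :+ y :+ r :+ ‵ 0 :≤ N)) ∷ [] ⊢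
          ‵ 12 :+ ((x :* ‵ 80 :+ ‵ 40) :+ (‵ 3 :+ ((r :* ‵ 80 :+ ‵ 40) :+ (‵ 10 :+ (y :* ‵ 80 :+ ‵ 40))))) :≤ ‵ 80 :* N :+ ‵ 150)
          (length X) (length Y) R N (System.boundA (systemG {0}) {d = X , Y} cd)

      module _ (β Β : ℕ) (power : Β ≡ 2 ^ β) (upper : Β * Β ≤ 4 * R + 1) (lower : R < Β * Β) where

        private
          R≤Uβ : R ≤ U * β
          R≤Uβ = enough β (subst (λ Β → R < Β * Β) power lower)

          β<Β : β < Β
          β<Β = subst (β <_) (sym power) (n<2^n β)

          ββ≤ : β * β ≤ 4 * R + 1
          ββ≤ = ≤-trans (*-mono-≤ (<⇒≤ β<Β) (<⇒≤ β<Β)) upper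

          β≤ : β ≤ 4 * R + 1
          β≤ = ≤-trans (β≤β² β) ββ≤
            where
            β≤β² : ∀ x → x ≤ x * x
            β≤β² zero = z≤n
            β≤β² (suc x) = m≤m+n (suc x) (x * suc x)

          -- From β ^ 2 ≤ 4 R + 1 ≤ 4 U β + 1. Scanning one block is therefore as cheap, up to a
          -- constant, as scanning the list of blocks.
          β≤U : β ≤ 4 * U + 1
          β≤U = go β ββ≤ R≤Uβ
            where
            go : ∀ β → β * β ≤ 4 * R + 1 → R ≤ U * β → β ≤ 4 * U + 1
            go zero _ _ = z≤n
            go (suc β) l l′ = *-cancelʳ-≤ (suc β) (4 * U + 1) (suc β)
              (lin 3 (λ b R U → ((‵ 1 :+ b) :* (‵ 1 :+ b) :≤ ‵ 4 :* R :+ ‵ 1) ∷ (‵ 4 ∙ (R :≤ U :* (‵ 1 :+ b))) ∷ [] ⊢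
                 (‵ 1 :+ b) :* (‵ 1 :+ b) :≤ (‵ 4 :* U :+ ‵ 1) :* (‵ 1 :+ b)) β R U l l′)

          β>0 : 0 < R → 0 < β
          β>0 l = n≢0⇒n>0 λ z → contradiction (≤-trans l R≤Uβ) (<⇒≱ (s≤s (≤-reflexive (trans (cong (U *_) z) (*-zeroʳ U)))))

          keyW′ : ∀ y → y < R → P y * R + suc y < W
          keyW′ y l = ≤-<-trans (+-monoʳ-≤ (P y * R) (≤-trans l (m≤m+n R 1))) (keyW tapeP y)

        unit : ℕ
        unit = suc N * U

        module _ {Named : ℕ → ℕ → Set} (named-≤ : ∀ {c u} → Named c u → u ≤ R)
          (named-match : ∀ {y u c u′} → y < R → Named (P y) u → Named c u′ → (u ≡ᵇ u′) ≡ (P y ≡ᵇ c)) where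

          windows-phase : ∀ {σ} → env σ C.n ≡ N → env σ C.r ≡ R → env σ C.b ≡ β → env σ C.B ≡ Β → out σ ≡ [] →
            (∀ a d → a < Β → d < Β → arr σ C.AN (a * Β + d) ≡ conj β a d) → (∀ u → arr σ C.MK u ≡ 0) →
            (∀ j → j < N → Named (A j) (arr σ C.NM j)) → (∀ j → j < N → Named (A j) (arr σ C.NM (N + (N ∸ suc j)))) →
            (∀ j → j < N → Named (B j) (arr σ C.NM (2 * N + j))) → (∀ j → j < N → Named (B j) (arr σ C.NM (3 * N + (N ∸ suc j)))) →
            (∀ y → y < R → Named (P y) (arr σ C.NM (4 * N + y))) → (∀ y → y < R → Named (P y) (arr σ C.NM (5 * N + (R ∸ suc y)))) →
            Ends ((C.fw := # 0 ⨾ C.bw := v C.n ⨾ C.lo := # 0) ⨾ windows ⨾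
                  (C.fw := # 2 ⊛ v C.n ⨾ C.bw := # 3 ⊛ v C.n ⨾ C.lo := # 1 ⊕ v C.n) ⨾ windows ⨾ dynamic ⨾ trace)
                 σ (10 + (10000 * unit + (20 + (10000 * unit + lastTime)))) Emitted
          windows-phase {σ} en er eb eB eo conjs clean fwA bwA fwB bwB fwP bwP =
            prefix 10 (C.fw := # 0 ⨾ C.bw := v C.n ⨾ C.lo := # 0) (_ , _ , _ ,
             (within windows-≤ (OnA.windows-correct (OnA.setup en er eb eB refl en refl (λ _ → refl) (λ _ → refl)) clean)
              then λ {σ₁} (ends₁ , _ , clean₁) sm₁ →
              let en₁ = trans (varₛ sm₁ C.n) en ; er₁ = trans (varₛ sm₁ C.r) er in
              prefix 20 (C.fw := # 2 ⊛ v C.n ⨾ C.bw := # 3 ⊛ v C.n ⨾ C.lo := # 1 ⊕ v C.n)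
               ((_ , _ , fits 2 (s≤s (s≤s z≤n)) en₁) , (_ , _ , fits 3 (s≤s (s≤s (s≤s z≤n))) en₁) ,
                (_ , _ , ≤-<-trans (≤-reflexive (cong suc en₁)) (small (lin 1 (λ N → [] ⊢ ‵ 1 :+ N :≤ ‵ 16 :* N :+ ‵ 16) N))) ,
               (within windows-≤ (OnB.windows-correct (OnB.setup en₁ er₁ (trans (varₛ sm₁ C.b) eb) (trans (varₛ sm₁ C.B) eB)
                   (cong (2 *_) en₁) (cong (3 *_) en₁) (cong suc en₁) (arrₛ sm₁ C.NM) (arrₛ sm₁ C.AN)) clean₁)
                then λ {σ₂} (ends₂ , kept , _) sm₂ →
                last-correct (trans (varₛ sm₂ C.n) en₁) (trans (varₛ sm₂ C.r) er₁) (trans (outₛ sm₂) (trans (outₛ sm₁) eo))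
                  (λ i l → trans (kept i (s≤s l)) (ends₁ i l)) ends₂))))
            where
            overA overB : WindowSetting
            overA = windowSetting sp R β Β U R≤N R≤Uβ power upper β>0 (arr σ C.NM) (arr σ C.AN) conjs
              P A Named named-≤ named-match 0 N 0 (lin 1 (λ N → [] ⊢ ‵ 0 :+ N :≤ ‵ 6 :* N) N) (lin 1 (λ N → [] ⊢ N :+ N :≤ ‵ 6 :* N) N) z≤n
              fwA bwA fwP bwP
            overB = windowSetting sp R β Β U R≤N R≤Uβ power upper β>0 (arr σ C.NM) (arr σ C.AN) conjs
              P B Named named-≤ named-match (2 * N) (3 * N) (suc N) (lin 1 (λ N → [] ⊢ ‵ 2 :* N :+ N :≤ ‵ 6 :* N) N)
              (lin 1 (λ N → [] ⊢ ‵ 3 :* N :+ N :≤ ‵ 6 :* N) N) (≤-reflexive (+-comm 1 N))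
              fwB bwB fwP bwP
            module OnA = Windows overA
            module OnB = Windows overB
            fits : ∀ k {n} → k ≤ 5 → n ≡ N → k * n < W
            fits k l refl = small (≤-trans (*-monoˡ-≤ N l) (lin 1 (λ N → [] ⊢ ‵ 5 :* N :≤ ‵ 16 :* N :+ ‵ 16) N))
            -- Each of U blocks costs O(N + β), and β ≤ 4 R + 1 ≤ 4 N + 1. The time does not depend
            -- on the text, so the bound serves for A and for B.
            windows-≤ : OnA.windowsTime ≤ 10000 * unit
            windows-≤ = lin 4 (λ N U β R →
              let run = ‵ 3 :+ (((‵ 1 :+ N) :* ‵ 80 :+ ‵ 40) :+ (‵ 3 :+ (U :* (‵ 40 :+ (‵ 60 :+
                          ((β :* ‵ 120 :+ ‵ 40) :+ (‵ 10 :+ ((N :* ‵ 240 :+ ‵ 40) :+ (‵ 20 :+ ((β :* ‵ 120 :+ ‵ 40) :+ ‵ 10))))))) :+ ‵ 40))) in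
              ((‵ 480 :* U) ∙ (β :≤ ‵ 4 :* R :+ ‵ 1)) ∷ ((‵ 1920 :* U) ∙ (R :≤ N)) ∷ ((‵ 2000 :+ ‵ 2000 :* N) ∙ (‵ 1 :≤ U)) ∷ [] ⊢
              ‵ 20 :+ (run :+ (‵ 20 :+ (run :+ (‵ 9 :+ (((‵ 1 :+ N) :+ (‵ 1 :+ N)) :* ‵ 240 :+ ‵ 40)))))
                :≤ ‵ 10000 :* ((‵ 1 :+ N) :* U)) N U β R β≤ R≤N U>0

        rest-correct : ∀ {σ} → env σ C.n ≡ N → env σ C.r ≡ R → env σ C.b ≡ β → env σ C.B ≡ Β → out σ ≡ [] →
          arr σ C.AN 0 ≡ 0 → (∀ u → arr σ C.MK u ≡ 0) →
          Ends (conjTable ⨾ sort ⨾ names ⨾ (C.fw := # 0 ⨾ C.bw := v C.n ⨾ C.lo := # 0) ⨾ windows ⨾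
                (C.fw := # 2 ⊛ v C.n ⨾ C.bw := # 3 ⊛ v C.n ⨾ C.lo := # 1 ⊕ v C.n) ⨾ windows ⨾ dynamic ⨾ trace)
               σ (5000 * unit + (5000 * unit + (5000 * unit + (10 + (10000 * unit + (20 + (10000 * unit + lastTime))))))) Emitted
        rest-correct {σ} en er eb eB eo e0 clean =
          within table-≤ (Bl.conjTable-correct β Β power upper eB e0) then λ {σ₁} conjs sm₁ →
          within sort-≤ (So.sort-correct (So.fixed (trans (varₛ sm₁ C.r) er) (trans (varₛ sm₁ C.b) eb))) then λ {σ₂} srt sm₂ →
          let module S = So.Sorted srt
              module Na = Naming-texts (nameSetting sp R β U R≤N R≤Uβ β≤ keyW (env σ₂ C.dn) (arr σ₂ C.D) S.size S.order S.onlyP S.everyP)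
              en₂ = trans (varₛ sm₂ C.n) (trans (varₛ sm₁ C.n) en)
              er₂ = trans (varₛ sm₂ C.r) (trans (varₛ sm₁ C.r) er)
              eb₂ = trans (varₛ sm₂ C.b) (trans (varₛ sm₁ C.b) eb) in
          within names-≤ (Na.names-correct en₂ (Na.fixed er₂ eb₂ refl (λ _ → refl))) then λ {σ₃} nm sm₃ →
          let module T = Na.Texts-named nm in
          windows-phase Na.named-≤ Na.named-match (trans (varₛ sm₃ C.n) en₂) (trans (varₛ sm₃ C.r) er₂) (trans (varₛ sm₃ C.b) eb₂)
            (trans (varₛ sm₃ C.B) (trans (varₛ sm₂ C.B) (trans (varₛ sm₁ C.B) eB)))
            (trans (outₛ sm₃) (trans (outₛ sm₂) (trans (outₛ sm₁) eo)))
            (λ a d a< d< → trans (arrₛ sm₃ C.AN _) (trans (arrₛ sm₂ C.AN _) (conjs a d a< d<)))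
            (λ u → trans (arrₛ sm₃ C.MK u) (trans (arrₛ sm₂ C.MK u) (trans (arrₛ sm₁ C.MK u) (clean u))))
            T.fwA T.bwA T.fwB T.bwB T.fwP T.bwP
          where
          module Bl = Blocks (tableSetting mc R room₅ lim<W)
          module So = Sorting (sortSetting (space mc R room₁₆ lim<W) β U R≤Uβ β≤ U≤ keyW′)
          table-≤ : 3 + ((4 * R + 1) * 120 + 120) ≤ 5000 * unit
          table-≤ = lin 3 (λ N U R → (‵ 480 ∙ (R :≤ N)) ∷ ((‵ 1000 :+ ‵ 1000 :* N) ∙ (‵ 1 :≤ U)) ∷ [] ⊢
            ‵ 3 :+ ((‵ 4 :* R :+ ‵ 1) :* ‵ 120 :+ ‵ 120) :≤ ‵ 5000 :* ((‵ 1 :+ N) :* U)) N U R R≤N U>0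
          -- The products U β, U R and β R are all O(N U); for the last one this takes `β≤U`.
          sort-≤ : 3 + ((3 + (U * (40 + (20 + (β * 100 + 100) + 20)) + 40)) + (3 + ((10 + (U * 140 + 100)) +
                     (R * (40 + (30 + ((20 + (β * 100 + 100)) + (20 + (10 + (U * 140 + 100)))))) + 40)))) ≤ 5000 * unit
          sort-≤ = lin 4 (λ N U β R → ((‵ 100 :* U) ∙ (β :≤ ‵ 4 :* R :+ ‵ 1)) ∷ ((‵ 100 :* R) ∙ (β :≤ ‵ 4 :* U :+ ‵ 1)) ∷ ((‵ 1000 :+ ‵ 1000 :* U) ∙ (R :≤ N)) ∷
              ((‵ 1500 :+ ‵ 1500 :* N) ∙ (‵ 1 :≤ U)) ∷ [] ⊢
            ‵ 3 :+ ((‵ 3 :+ (U :* (‵ 40 :+ (‵ 20 :+ (β :* ‵ 100 :+ ‵ 100) :+ ‵ 20)) :+ ‵ 40)) :+ (‵ 3 :+ ((‵ 10 :+ (U :* ‵ 140 :+ ‵ 100)) :+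
                     (R :* (‵ 40 :+ (‵ 30 :+ ((‵ 20 :+ (β :* ‵ 100 :+ ‵ 100)) :+ (‵ 20 :+ (‵ 10 :+ (U :* ‵ 140 :+ ‵ 100)))))) :+ ‵ 40)))) :≤ ‵ 5000 :* ((‵ 1 :+ N) :* U))
            N U β R β≤ β≤U R≤N U>0
          names-≤ : 12 + ((3 + (N * (40 + (10 + ((20 + (((U * 60 + 40) + (β * 60 + 40)) + 60)) + 60))) + 40)) +
                    (12 + ((3 + (N * (40 + (10 + ((20 + (((U * 60 + 40) + (β * 60 + 40)) + 60)) + 60))) + 40)) +
                    (16 + (3 + (R * (40 + (10 + ((20 + (((U * 60 + 40) + (β * 60 + 40)) + 60)) + 60))) + 40)))))) ≤ 5000 * unit
          names-≤ = lin 4 (λ N U β R →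
            let one = ‵ 40 :+ (‵ 10 :+ ((‵ 20 :+ (((U :* ‵ 60 :+ ‵ 40) :+ (β :* ‵ 60 :+ ‵ 40)) :+ ‵ 60)) :+ ‵ 60)) in
            ((‵ 180 :* N) ∙ (β :≤ ‵ 4 :* U :+ ‵ 1)) ∷ (one ∙ (R :≤ N)) ∷ ((‵ 1500 :+ ‵ 1500 :* N) ∙ (‵ 1 :≤ U)) ∷ [] ⊢
            ‵ 12 :+ ((‵ 3 :+ (N :* one :+ ‵ 40)) :+ (‵ 12 :+ ((‵ 3 :+ (N :* one :+ ‵ 40)) :+ (‵ 16 :+ (‵ 3 :+ (R :* one :+ ‵ 40))))))
              :≤ ‵ 5000 :* ((‵ 1 :+ N) :* U)) N U β R β≤U R≤N U>0

      solve-correct : ∀ {σ} → env σ C.n ≡ N → env σ C.r ≡ R → out σ ≡ [] → arr σ C.AN 0 ≡ 0 → (∀ u → arr σ C.MK u ≡ 0) →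
        Ends solve σ (50000 * (suc N * U) + lastTime) Emitted
      solve-correct {σ} en er eo e0 clean = within total
        (Bl.blockSize-correct er then λ {σ₁} bs sm₁ →
         rest-correct (env σ₁ C.b) (env σ₁ C.B) (Bl.BlockSize.power bs) (Bl.BlockSize.upper bs) (Bl.BlockSize.lower bs)
           (trans (varₛ sm₁ C.n) en) (trans (varₛ sm₁ C.r) er) refl refl (trans (outₛ sm₁) eo)
           (trans (arrₛ sm₁ C.AN 0) e0) (λ u → trans (arrₛ sm₁ C.MK u) (clean u)))
        where
        module Bl = Blocks (tableSetting mc R room₅ lim<W)
        total : 6 + (R * 60 + 60) + (5000 * (suc N * U) + (5000 * (suc N * U) + (5000 * (suc N * U) + (10 + (10000 * (suc N * U) +
          (20 + (10000 * (suc N * U) + lastTime))))))) ≤ 50000 * (suc N * U) + lastTime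
        total = lin 4 (λ N U R t → let one = (‵ 1 :+ N) :* U in
          (‵ 60 ∙ (R :≤ N)) ∷ ((‵ 1000 :+ ‵ 1000 :* N) ∙ (‵ 1 :≤ U)) ∷ [] ⊢
          ‵ 6 :+ (R :* ‵ 60 :+ ‵ 60) :+ (‵ 5000 :* one :+ (‵ 5000 :* one :+ (‵ 5000 :* one :+ (‵ 10 :+ (‵ 10000 :* one :+
            (‵ 20 :+ (‵ 10000 :* one :+ t)))))))
          :≤ ‵ 50000 :* one :+ t) N U R lastTime R≤N U>0

-- Deciding whether a solution exists

module Decision where

  open Language
  open Compilation using (blank)
  open Embeddings
  open Embedding using (Emb)
  open Greedy-matching using (greedySetting; module Greedy)
  open Solution
  open Code using (main; decideP; solve)

  record MainSetting : Set where
    constructor mainSetting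
    field
      mc : Machine
    open Machine mc public
    field
      N : ℕ
      N<W : N < 2 ^ w
      R<W : length (input tapeP) < 2 ^ w
      lenA : length (input tapeA) ≡ N
      lenB : length (input tapeB) ≡ N

  module Main (s : MainSetting) where

    open MainSetting s

    open Semantics mc

    private
      R : ℕ
      R = length (input tapeP)

      In : Tape → Set
      In τ = Emb (charAt (input tapeP)) (charAt (input τ)) 0 R 0 N

      module GA = Greedy (greedySetting mc tapeA N R N<W R<W)
      module GB = Greedy (greedySetting mc tapeB N R N<W R<W)

      equal-yes : ∀ {x y} → x ≡ y → evalOp equal x y ≡ 1
      equal-yes {x} refl with x ≡ᵇ x in e
      ... | true  = refl
      ... | false = contradiction (≡⇒≡ᵇ x x refl) λ t → subst T e t

      equal-no : ∀ {x y} → x ≢ y → evalOp equal x y ≡ 0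
      equal-no {x} {y} ne with x ≡ᵇ y in e
      ... | false = refl
      ... | true  = contradiction (≡ᵇ⇒≡ x y (subst T (sym e) _)) ne

    data Decision (σ : Store) : Set where
      found  : env σ C.flag ≡ 1 → In tapeA → In tapeB → Decision σ
      absent : env σ C.flag ≡ 0 → ¬ (In tapeA × In tapeB) → Decision σ

    decideTime : ℕ
    decideTime = 6 + ((6 + (N * 80 + 80)) + (10 + (2 + (((6 + (N * 80 + 80)) + 10) + 3))))

    decide-correct : ∀ {σ} → Ends decideP σ decideTime (λ σ′ → Decision σ′ × env σ′ C.n ≡ N × env σ′ C.r ≡ R)
    decide-correct = prefix 6 (C.n := sz tapeA ⨾ C.r := sz tapeP) (_ , _ ,
      (GA.greedy-correct lenA refl then λ {σ₁} res sm₁ →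
       let en = trans (varₛ sm₁ C.n) lenA ; er = varₛ sm₁ C.r in
       prefix 10 (C.flag := v C.p ≐ v C.r) (_ ,
        branch _
         (λ nz → GB.greedy-correct en er then λ {σ₂} res₂ sm₂ →
            let er₂ = trans (varₛ sm₂ C.r) er in
            straight (C.flag := v C.p ≐ v C.r) {10}
              (_ , second res er nz res₂ er₂ , trans (varₛ sm₂ C.n) en , er₂))
         (λ z → straight skip (absent z (first res er z) , en , er)))))
      where
      first : ∀ {p r} → (p ≡ R × In tapeA) ⊎ (p ≢ R × ¬ In tapeA) → r ≡ R → evalOp equal p r ≡ 0 → ¬ (In tapeA × In tapeB)
      first (inj₁ (p≡ , _)) r≡ z = contradiction (trans (sym (equal-yes (trans p≡ (sym r≡)))) z) λ ()
      first (inj₂ (_ , no-A)) r≡ z (a , _) = no-A a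
      second : ∀ {p r σ} → (p ≡ R × In tapeA) ⊎ (p ≢ R × ¬ In tapeA) → r ≡ R → evalOp equal p r ≢ 0 →
        GB.Result σ → env σ C.r ≡ R →
        Decision (stored (env σ Defs.[ C.flag ≔ evalOp equal (env σ C.p) (env σ C.r) ]) (arr σ) (out σ))
      second (inj₂ (p≢ , _)) refl nz _ _ = contradiction (equal-no p≢) nz
      second (inj₁ (_ , a)) _ nz (inj₁ (p≡ , b)) r≡ = found (equal-yes (trans p≡ (sym r≡))) a b
      second (inj₁ (_ , a)) _ nz (inj₂ (p≢ , no-B)) r≡ = absent (equal-no (λ e → p≢ (trans e r≡))) (λ (_ , b) → no-B b)

    -- No array is accessed on this path, so it holds for every `lim`, even 0.
    reject-correct : ¬ (In tapeA × In tapeB) → Ends main blank (decideTime + (2 + (0 + 3))) (λ σ → env σ C.flag ≡ 0)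
    reject-correct nope = decide-correct then λ (d , _) sm → branch {t = 0} _
      (λ nz → contradiction (zero≡ d) nz)
      (λ z → straight skip z)
      where
      zero≡ : ∀ {σ} → Decision σ → env σ C.flag ≡ 0
      zero≡ (found _ a b) = contradiction (a , b) nope
      zero≡ (absent z _) = z

    -- Deciding writes to no array and emits nothing, so `solve` finds the memory and the output
    -- blank.
    accept-correct : ∀ {t Q} → In tapeA → In tapeB →
      (∀ {σ} → env σ C.n ≡ N → env σ C.r ≡ R → out σ ≡ [] → arr σ C.AN 0 ≡ 0 → (∀ u → arr σ C.MK u ≡ 0) → Ends solve σ t Q) →
      Ends main blank (decideTime + (2 + (t + 3))) (λ σ → env σ C.flag ≡ 1 × Q σ)
    accept-correct a b solved = decide-correct then λ (d , en , er) sm → branch _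
      (λ _ → weaken (λ σ′ (q , sm₂) → trans (varₛ sm₂ C.flag) (one≡ d) , q)
         (framed (solved en er (outₛ sm) (arrₛ sm C.AN 0) (arrₛ sm C.MK))))
      (λ z → contradiction (trans (sym (one≡ d)) z) λ ())
      where
      one≡ : ∀ {σ} → Decision σ → env σ C.flag ≡ 1
      one≡ (found e _ _) = e
      one≡ (absent _ n) = contradiction (a , b) n

-- Existence of an optimum and decoding of candidates

module Optimum where

  import Data.Maybe.Base as Maybe
  open import Data.Fin.Base using (Fin; toℕ)
  open import Data.Fin.Properties using (toℕ-injective)
  open import Data.List.Base using (map; filter; cartesianProduct)
  open import Data.List.Extrema ≤-totalOrder using (argmax; argmax-all; f[xs]≤f[argmax])
  open import Data.List.Membership.Propositional using (_∈_)
  open import Data.List.Membership.Propositional.Properties using (∈-map⁺; ∈-++⁺ˡ; ∈-++⁺ʳ; ∈-filter⁺; ∈-cartesianProduct⁺)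
  open import Data.List.Properties using (length-map; map-++)
  open import Data.List.Relation.Binary.Infix.Heterogeneous using (Infix; MkView; toView; fromView)
  open import Data.List.Relation.Binary.Pointwise as Pointwise using (Pointwise-≡⇒≡; ≡⇒Pointwise-≡)
  import Data.List.Relation.Binary.Sublist.Heterogeneous.Properties as Sublist
  open import Data.List.Relation.Binary.Sublist.DecPropositional _≟_ using (_⊆?_)
  open import Data.List.Relation.Binary.Sublist.Propositional using (_⊆_; []; _∷_; _∷ʳ_; minimum; ⊆-refl; ⊆-trans)
  import Data.List.Relation.Binary.Sublist.Heterogeneous as Heterogeneous
  open import Data.List.Relation.Binary.Sublist.Propositional.Properties using (map⁺; ++⁺ˡ; ++⁺ʳ)
  open import Data.List.Relation.Unary.All as All using ()
  open import Data.List.Relation.Unary.All.Properties using (all-filter)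
  open import Data.List.Relation.Unary.Any using (here)
  open import Relation.Nullary.Decidable using (_×-dec_)
  open Defs hiding (size; code)
  open Embeddings
  open Embedding using (Emb)
  open Candidate-systems

  private
    variable
      S : Set

  sublists : List S → List (List S)
  sublists []       = [] ∷ []
  sublists (x ∷ xs) = map (x ∷_) (sublists xs) ++ sublists xs

  ∈-sublists : ∀ {xs ys : List S} → xs ⊆ ys → xs ∈ sublists ys
  ∈-sublists []                = here refl
  ∈-sublists {ys = y ∷ ys} (.y ∷ʳ s)  = ∈-++⁺ʳ (map (y ∷_) (sublists ys)) (∈-sublists s)
  ∈-sublists {ys = y ∷ ys} (refl ∷ s) = ∈-++⁺ˡ (∈-map⁺ (y ∷_) (∈-sublists s))

  ⊆-++ˡ : ∀ (xs ys : List S) → xs ⊆ xs ++ ys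
  ⊆-++ˡ xs ys = ++⁺ʳ ys ⊆-refl

  ⊆-++ʳ : ∀ (xs ys : List S) → ys ⊆ xs ++ ys
  ⊆-++ʳ xs ys = ++⁺ˡ xs ⊆-refl

  module Best (A B P : List ℕ) (n : ℕ) (lenA : length A ≡ n) (lenB : length B ≡ n) where

    open Candidates A B P n lenA lenB

    size : List ℕ × List ℕ → ℕ
    size d = length (proj₁ d) + length (proj₂ d)

    candG? : ∀ d → Dec (CandG 0 0 d)
    candG? (X , Y) = (0 ≤? n ×-dec (X ++ P ++ Y) ⊆? A) ×-dec (0 ≤? n ×-dec (X ++ P ++ Y) ⊆? B)

    -- Both parts of a candidate are sublists of A, so finitely many pairs are to be compared. The
    -- optimum has to be at hand before the run, since the memory granted depends on its length.
    best-exists : ∀ {d₀} → CandG 0 0 d₀ → Σ[ d ∈ _ ] CandG 0 0 d × (∀ d′ → CandG 0 0 d′ → size d′ ≤ size d)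
    best-exists {d₀} c₀ = argmax size d₀ candidates , argmax-all size c₀ (all-filter candG? pairs) ,
      λ { (X , Y) c@((_ , s) , _) → All.lookup (f[xs]≤f[argmax] d₀ candidates) (∈-filter⁺ candG?
          (∈-cartesianProduct⁺ (∈-sublists (⊆-trans (⊆-++ˡ X (P ++ Y)) s))
                               (∈-sublists (⊆-trans (⊆-trans (⊆-++ʳ P Y) (⊆-++ʳ X (P ++ Y))) s))) c) }
      where
      pairs candidates : List (List ℕ × List ℕ)
      pairs = cartesianProduct (sublists A) (sublists A)
      candidates = filter candG? pairs

  module _ {σ : ℕ} where

    private
      code : List (Fin σ) → List ℕ
      code = map toℕ

    code-⊆⁻ : ∀ {xs ys} → code xs ⊆ code ys → xs ⊆ ys
    code-⊆⁻ s = Heterogeneous.map toℕ-injective (Sublist.map⁻ toℕ toℕ s)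

    -- The program works with numbers; being subsequences of encoded texts, its strings are
    -- encodings again.
    code-preimage : ∀ {xs} ys → xs ⊆ code ys → ∃[ zs ] code zs ≡ xs
    code-preimage []       []         = [] , refl
    code-preimage (y ∷ ys) (_ ∷ʳ s)   = code-preimage ys s
    code-preimage (y ∷ ys) (refl ∷ s) with code-preimage ys s
    ... | zs , e = y ∷ zs , cong (toℕ y ∷_) e

    code-++ : ∀ xs ys zs → code (xs ++ ys ++ zs) ≡ code xs ++ code ys ++ code zs
    code-++ xs ys zs = trans (map-++ toℕ xs (ys ++ zs)) (cong (code xs ++_) (map-++ toℕ ys zs))

    module Decode (A B P : List (Fin σ)) (n : ℕ) (lenA : length (code A) ≡ n) (lenB : length (code B) ≡ n) where

      open Candidates (code A) (code B) (code P) n lenA lenB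
      open Best (code A) (code B) (code P) n lenA lenB using (size)

      decode : ∀ {d} → CandG 0 0 d → ∃[ Z ] (Candidate A B P Z × code Z ≡ proj₁ d ++ code P ++ proj₂ d × length Z ≡ size d + length (code P))
      decode {X , Y} ((_ , s) , _ , s′)
        with code-preimage A (⊆-trans (⊆-++ˡ X (code P ++ Y)) s)
           | code-preimage A (⊆-trans (⊆-trans (⊆-++ʳ (code P) Y) (⊆-++ʳ X (code P ++ Y))) s)
      ... | X′ , refl | Y′ , refl = X′ ++ P ++ Y′ ,
        (fromView (MkView X′ (≡⇒Pointwise-≡ refl) Y′) ,
         code-⊆⁻ (subst (_⊆ code A) (sym e) s) , code-⊆⁻ (subst (_⊆ code B) (sym e) s′)) , e ,
        trans (sym (length-map toℕ (X′ ++ P ++ Y′))) (trans (cong length e) (lengthG (code X′) (code Y′)))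
        where
        e = code-++ X′ P Y′

      recode : ∀ {Z} → Candidate A B P Z → ∃[ d ] (CandG 0 0 d × length Z ≡ size d + length (code P))
      recode (inf , sA , sB) with toView inf
      ... | MkView X pw Y with Pointwise-≡⇒≡ pw
      ... | refl = (code X , code Y) ,
        ((z≤n , subst (_⊆ code A) e (map⁺ toℕ sA)) , z≤n , subst (_⊆ code B) e (map⁺ toℕ sB)) ,
        trans (sym (length-map toℕ (X ++ P ++ Y))) (trans (cong length e) (lengthG (code X) (code Y)))
        where
        e = code-++ X P Y

      optimal-decode : ∀ {d} → CandG 0 0 d → (∀ d′ → CandG 0 0 d′ → size d′ ≤ size d) →
        ∃[ Z ] (IsSTR-IC-LCS A B P (Maybe.just Z) × code Z ≡ proj₁ d ++ code P ++ proj₂ d × length Z ≡ size d + length (code P))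
      optimal-decode {d} c best with decode {d} c
      ... | Z , cand , e , l = Z , (cand , longest) , e , l
        where
        longest : ∀ Z′ → Candidate A B P Z′ → length Z′ ≤ length Z
        longest Z′ c′ with recode c′
        ... | d′ , cd′ , l′ = subst₂ _≤_ (sym l′) (sym l) (+-monoˡ-≤ (length (code P)) (best d′ cd′))

  module _ (P T : List ℕ) (n : ℕ) (lenT : length T ≡ n) where

    emb⇒⊆ : Emb (charAt P) (charAt T) 0 (length P) 0 n → P ++ [] ⊆ T
    emb⇒⊆ e = emb-⊆ P T e z≤n (≤-reflexive (sym lenT)) (minimum _)

    ⊆⇒emb : ∀ X Y → X ++ P ++ Y ⊆ T → Emb (charAt P) (charAt T) 0 (length P) 0 n
    ⊆⇒emb X Y s with ⊆-emb P T (length P) {0} {0} refl z≤n (⊆-trans (⊆-++ʳ X (P ++ Y)) s)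
    ... | j , e , j≤ , _ = Embedding.right (charAt P) (charAt T) (≤-trans j≤ (≤-reflexive lenT)) e

    -- Tells the proof, before the run, which of the two answers to verify.
    emb? : Dec (Emb (charAt P) (charAt T) 0 (length P) 0 n)
    emb? with earliest 0 ≤? n
      where open Mirror (charAt P) (charAt T) (length P) n
    ... | yes l = yes (Mirror.earliest-sound (charAt P) (charAt T) (length P) n z≤n ≤-refl l)
    ... | no nl = no λ e → nl (Mirror.earliest-complete (charAt P) (charAt T) (length P) n ≤-refl e)

-- Time, space and word size

module Resources where

  open import Data.Fin.Base using (Fin; toℕ)
  open import Data.Fin.Properties using (toℕ<n)
  open import Data.Integer.Base as ℤ using (ℤ; +_; +≤+; 1ℤ)
  import Data.Integer.Properties as ℤ
  open import Data.List.Base using (map)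
  open import Data.List.Properties using (length-map)
  import Data.Maybe.Base as Maybe
  open import Data.Nat.DivMod using (_/_; m≡m%n+[m/n]*n; m%n<n; m/n*n≤m; m/n≤m)
  open import Data.Nat.Logarithm using (⌊log₂_⌋; ⌊log₂⌋-mono-≤; ⌊log₂[2^n]⌋≡n)
  open import Relation.Nullary.Decidable using (_×-dec_)
  open Defs hiding (size; code)
  open Language using (space; Machine; machine; arrays; env; out)
  open Compilation using (hardware; assemble; assemble-correct; answer)
  open Embeddings
  open Embedding using (Emb)
  open Candidate-systems
  open Solution using (SolveSetting; solveSetting; module Solve)
  open Decision using (mainSetting; module Main)
  open Optimum

  n<2^suc⌊log₂n⌋ : ∀ n → n < 2 ^ suc ⌊log₂ n ⌋
  n<2^suc⌊log₂n⌋ n = ≰⇒> λ l → 1+n≰n (≤-trans (≤-reflexive (sym (⌊log₂[2^n]⌋≡n (suc ⌊log₂ n ⌋)))) (⌊log₂⌋-mono-≤ l))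

  m<suc[m/n]*n : ∀ m n .{{_ : NonZero n}} → m < suc (m / n) * n
  m<suc[m/n]*n m n = ≤-trans (s≤s (≤-reflexive (m≡m%n+[m/n]*n m n))) (+-monoˡ-≤ (m / n * n) (m%n<n m n))

  -- The number of blocks of length β that cover P, whatever β with R < 4 ^ β is.
  blocks : ℕ → ℕ
  blocks R = suc (3 * R / suc ⌊log₂ R ⌋)

  -- R < 4 ^ β gives ⌊log₂ R⌋ ≤ 2 β, and one more is at most 3 β for β ≥ 1: the origin of the factor
  -- 3. For β = 0 the string P is empty.
  blocks-enough : ∀ R β → R < 2 ^ β * 2 ^ β → R ≤ blocks R * β
  blocks-enough R zero    l = ≤-trans (s≤s⁻¹ l) z≤n
  blocks-enough R (suc β) l = *-cancelˡ-≤ 3 (<⇒≤ (<-≤-trans (m<suc[m/n]*n (3 * R) (suc ⌊log₂ R ⌋))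
    (lin 3 (λ U L β → (U ∙ (L :≤ ‵ 2 :+ (β :+ β))) ∷ [] ⊢ U :* (‵ 1 :+ L) :≤ ‵ 3 :* (U :* (‵ 1 :+ β))) (blocks R) ⌊log₂ R ⌋ β log≤)))
    where
    log≤ : ⌊log₂ R ⌋ ≤ 2 + (β + β)
    log≤ = ≤-trans (⌊log₂⌋-mono-≤ (<⇒≤ l)) (≤-trans (≤-reflexive (trans (cong ⌊log₂_⌋ (sym (^-distribˡ-+-* 2 (suc β) (suc β)))) (⌊log₂[2^n]⌋≡n (suc β + suc β))))
             (≤-reflexive (cong suc (+-suc β β))))

  -- The number of blocks is rounded before it is multiplied by N, the time bound only afterwards;
  -- rounding up the latter quotient absorbs the difference.
  scaled-quotient : ∀ N R L .{{_ : NonZero L}} → N * (3 * R / L) ≤ 3 * (N * R / L) + 3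
  scaled-quotient N R L = <⇒≤ (*-cancelʳ-< L (N * q) (3 * m + 3) (begin-strict
    N * q * L           ≡⟨ *-assoc N q L ⟩
    N * (q * L)         ≤⟨ *-monoʳ-≤ N (m/n*n≤m (3 * R) L) ⟩
    N * (3 * R)         ≡⟨ trans (sym (*-assoc N 3 R)) (trans (cong (_* R) (*-comm N 3)) (*-assoc 3 N R)) ⟩
    3 * (N * R)         <⟨ *-monoʳ-< 3 (m<suc[m/n]*n (N * R) L) ⟩
    3 * (suc m * L)     ≡⟨ trans (sym (*-assoc 3 (suc m) L)) (cong (_* L) (trans (*-suc 3 m) (+-comm 3 (3 * m)))) ⟩
    (3 * m + 3) * L     ∎))
    where
    open ≤-Reasoning
    q = 3 * R / L
    m = N * R / L

  charAt-< : ∀ {σ} (xs : List (Fin σ)) i {b} → 0 < b → σ ≤ b → charAt (map toℕ xs) i < b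
  charAt-< []       zero    0<b _ = 0<b
  charAt-< []       (suc i) 0<b _ = 0<b
  charAt-< (x ∷ xs) zero    _ l = <-≤-trans (toℕ<n x) l
  charAt-< (x ∷ xs) (suc i) 0<b l = charAt-< xs i 0<b l

  difference : ∀ {n ℓ k} → ℓ + k ≡ n → + n ℤ.- + ℓ ≡ + k
  difference {ℓ = ℓ} {k} refl = trans (ℤ.[+m]-[+n]≡m⊖n (ℓ + k) ℓ) (trans (ℤ.⊖-≥ (m≤m+n ℓ k)) (cong +_ (m+n∸m≡n ℓ k)))

  lift-bound : ∀ {x} c {f g} → f ≡ + g → x ≤ c * (g + 1) → x ≤ c ·O[ f ]
  lift-bound {x} c {g = g} refl l = ℤ.≤-trans (+≤+ l) (ℤ.≤-reflexive (ℤ.pos-* c (g + 1)))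

  -- The large coefficients are variables: products by literals of this size would be unfolded.
  module Bounds (N R k : ℕ) (k≤N : k ≤ N) (R≤N : R ≤ N) {a b c : ℕ} (a≤ : a ≤ 50000) (b≤ : b ≤ 4000) (≤c : 1000000 ≤ c) where

    private
      m U decideTime : ℕ
      m = N * R / suc ⌊log₂ R ⌋
      U = blocks R
      decideTime = 6 + ((6 + (N * 80 + 80)) + (10 + (2 + (((6 + (N * 80 + 80)) + 10) + 3))))

      N*U≤ : N * U ≤ 3 * m + 3 + N
      N*U≤ = ≤-trans (≤-reflexive (trans (*-suc N _) (+-comm N _))) (+-monoˡ-≤ N (scaled-quotient N R (suc ⌊log₂ R ⌋)))

      U≤ : U ≤ 1 + 3 * R
      U≤ = s≤s (m/n≤m (3 * R) _)

    -- Matching accounts for the multiple of (N + 1) U, the tables for that of (N + 1)(4 k + 2). In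
    -- N U ≤ 3 m + 3 + N the last summand is covered by N (k + 1).
    accept-≤ : decideTime + (2 + ((a * (suc N * U) + ((6 + (b * suc N * (4 * k + 2) + 9)) + (80 * N + 150))) + 3)) + 3 ≤ c * (m + N * (k + 1) + 1)
    accept-≤ = lin 8 (λ N R k U m a b c →
      (((‵ 1 :+ N) :* U) ∙ (a :≤ ‵ 50000)) ∷ (((‵ 1 :+ N) :* (‵ 4 :* k :+ ‵ 2)) ∙ (b :≤ ‵ 4000)) ∷ ((m :+ N :* (k :+ ‵ 1) :+ ‵ 1) ∙ (‵ 1000000 :≤ c)) ∷
      (‵ 50000 ∙ (N :* U :≤ ‵ 3 :* m :+ ‵ 3 :+ N)) ∷ (‵ 50000 ∙ (U :≤ ‵ 1 :+ ‵ 3 :* R)) ∷ (‵ 150000 ∙ (R :≤ N)) ∷ (‵ 16000 ∙ (k :≤ N)) ∷ [] ⊢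
      (‵ 6 :+ ((‵ 6 :+ (N :* ‵ 80 :+ ‵ 80)) :+ (‵ 10 :+ (‵ 2 :+ (((‵ 6 :+ (N :* ‵ 80 :+ ‵ 80)) :+ ‵ 10) :+ ‵ 3))))) :+
        (‵ 2 :+ ((a :* ((‵ 1 :+ N) :* U) :+ ((‵ 6 :+ (b :* (‵ 1 :+ N) :* (‵ 4 :* k :+ ‵ 2) :+ ‵ 9)) :+ (‵ 80 :* N :+ ‵ 150))) :+ ‵ 3)) :+ ‵ 3
      :≤ c :* (m :+ N :* (k :+ ‵ 1) :+ ‵ 1)) N R k U m a b c a≤ b≤ ≤c N*U≤ U≤ R≤N k≤N

    -- For ⊥ the length is -1, so n - ℓ′ + 1 is n + 2.
    reject-≤ : decideTime + (2 + (0 + 3)) + 3 ≤ c * (m + N * (N + 1 + 1) + 1)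
    reject-≤ = lin 3 (λ N m c → ((m :+ N :* (N :+ ‵ 1 :+ ‵ 1) :+ ‵ 1) ∙ (‵ 1000000 :≤ c)) ∷ [] ⊢
      (‵ 6 :+ ((‵ 6 :+ (N :* ‵ 80 :+ ‵ 80)) :+ (‵ 10 :+ (‵ 2 :+ (((‵ 6 :+ (N :* ‵ 80 :+ ‵ 80)) :+ ‵ 10) :+ ‵ 3))))) :+ (‵ 2 :+ (‵ 0 :+ ‵ 3)) :+ ‵ 3
      :≤ c :* (m :+ N :* (N :+ ‵ 1 :+ ‵ 1) :+ ‵ 1)) N m c ≤c

    -- With γ nodes for each of the 2 N + 1 rows.
    space-≤ : ∀ {ℓ γ used} → ℓ + k ≡ N → γ ≤ 8 * k + 6 → γ ≤ suc ℓ → used ≤ ((16 * N + 16) + (1 + (N + suc N) * γ)) * 11 →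
      56 + used ≤ c * ((ℓ + 1) * (k + 1) + 1)
    space-≤ {ℓ} {γ} {used} refl l l′ u = lin 5 (λ ℓ k γ u c →
      let N = ℓ :+ k in
      (((ℓ :+ ‵ 1) :* (k :+ ‵ 1) :+ ‵ 1) ∙ (‵ 1000000 :≤ c)) ∷ ((‵ 22 :* ℓ :+ ‵ 11) ∙ (γ :≤ ‵ 8 :* k :+ ‵ 6)) ∷ ((‵ 22 :* k) ∙ (γ :≤ ‵ 1 :+ ℓ)) ∷
      (u :≤ ((‵ 16 :* N :+ ‵ 16) :+ (‵ 1 :+ (N :+ (‵ 1 :+ N)) :* γ)) :* ‵ 11) ∷ [] ⊢
      ‵ 56 :+ u :≤ c :* ((ℓ :+ ‵ 1) :* (k :+ ‵ 1) :+ ‵ 1)) ℓ k γ used c ≤c l l′ u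

  program : Program
  program = assemble C.main C.flag

  module Assembly (c : ℕ) (≤c : 1000000 ≤ c) {σ : ℕ} (A B P : List (Fin σ))
    (lb : length B ≡ length A) (rn : length P ≤ length A) where

    private
      N R X w : ℕ
      N = length A
      R = length (map toℕ P)
      X = 2 ^ suc ⌊log₂ (N ⊔ σ) ⌋
      w = wordSize 10 σ N

      input : Input
      input = encode A B P

      lenA : length (map toℕ A) ≡ N
      lenA = length-map toℕ A

      lenB : length (map toℕ B) ≡ N
      lenB = trans (length-map toℕ B) lb

      R≡ : R ≡ length P
      R≡ = length-map toℕ P

      R≤N : R ≤ N
      R≤N = ≤-trans (≤-reflexive R≡) rn

      -- The origin of the factor 10 in the word size: 256 X ^ 2 suffices for addresses and keys,
      -- and 256 ≤ X ^ 8 since X ≥ 2.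
      big : 256 * (X * X) ≤ 2 ^ w
      big = begin
        2 ^ 8 * (X * X)          ≤⟨ *-monoˡ-≤ (X * X) (^-monoˡ-≤ 8 {2} {X} 2≤X) ⟩
        X ^ 8 * (X * X)          ≡⟨ cong (λ y → X ^ 8 * (X * y)) (sym (*-identityʳ X)) ⟩
        X ^ 8 * X ^ 2            ≡⟨ sym (^-distribˡ-+-* X 8 2) ⟩
        X ^ 10                   ≡⟨ ^-*-assoc 2 (suc ⌊log₂ (N ⊔ σ) ⌋) 10 ⟩
        2 ^ (suc ⌊log₂ (N ⊔ σ) ⌋ * 10) ≡⟨ cong (2 ^_) (*-comm (suc ⌊log₂ (N ⊔ σ) ⌋) 10) ⟩
        2 ^ w                    ∎
        where
        open ≤-Reasoning
        2≤X : 2 ≤ X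
        2≤X = *-monoʳ-≤ 2 (m^n>0 2 ⌊log₂ (N ⊔ σ) ⌋)

      X>0 : 1 ≤ X
      X>0 = m^n>0 2 (suc ⌊log₂ (N ⊔ σ) ⌋)

      N<X : N < X
      N<X = ≤-<-trans (m≤m⊔n N σ) (n<2^suc⌊log₂n⌋ (N ⊔ σ))

      R<X : R < X
      R<X = ≤-<-trans R≤N N<X

      σ≤X : σ ≤ X
      σ≤X = ≤-trans (m≤n⊔m N σ) (<⇒≤ (n<2^suc⌊log₂n⌋ (N ⊔ σ)))

      char<X : ∀ τ i → charAt (input τ) i < X
      char<X tapeA i = charAt-< A i X>0 σ≤X
      char<X tapeB i = charAt-< B i X>0 σ≤X
      char<X tapeP i = charAt-< P i X>0 σ≤X

      fits : ∀ {x} → x ≤ 256 * (X * X) → x ≤ 2 ^ w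
      fits l = ≤-trans l big

      linear : ∀ {x} → x < X → suc x < 2 ^ w
      linear {x} l = fits (lin 2 (λ x X → (x :< X) ∷ ((‵ 1 :+ ‵ 2 :* X) ∙ (‵ 1 :≤ X)) ∷ [] ⊢ ‵ 2 :+ x :≤ ‵ 256 :* (X :* X)) x X l X>0)

      256≤W : 256 ≤ 2 ^ w
      256≤W = fits (lin 1 (λ X → ((‵ 256 :+ ‵ 256 :* X) ∙ (‵ 1 :≤ X)) ∷ [] ⊢ ‵ 256 :≤ ‵ 256 :* (X :* X)) X X>0)

      chars : ∀ τ i → charAt (input τ) i < 2 ^ w
      chars τ i = <-trans (n<1+n _) (linear (char<X τ i))

      keys : ∀ τ i → charAt (input τ) i * R + (R + 1) < 2 ^ w
      keys τ i = fits (lin 3 (λ c R X → (R ∙ (c :< X)) ∷ ((X :+ ‵ 1) ∙ (R :< X)) ∷ ((‵ 2 :+ ‵ 2 :* X) ∙ (‵ 1 :≤ X)) ∷ [] ⊢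
        ‵ 1 :+ (c :* R :+ (R :+ ‵ 1)) :≤ ‵ 256 :* (X :* X)) (charAt (input τ) i) R X (char<X τ i) R<X X>0)

      sizes : ∀ τ → length (input τ) < 2 ^ w
      sizes tapeA = <-trans (n<1+n _) (linear (≤-<-trans (≤-reflexive lenA) N<X))
      sizes tapeB = <-trans (n<1+n _) (linear (≤-<-trans (≤-reflexive lenB) N<X))
      sizes tapeP = <-trans (n<1+n _) (linear R<X)

      N<W : N < 2 ^ w
      N<W = <-trans (n<1+n _) (linear N<X)

      a b : ℕ → ℕ
      a = charAt (map toℕ A)
      b = charAt (map toℕ B)

      In : List ℕ → Set
      In T = Emb (charAt (map toℕ P)) (charAt T) 0 R 0 N

      open Candidates (map toℕ A) (map toℕ B) (map toℕ P) N lenA lenB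
      open Best (map toℕ A) (map toℕ B) (map toℕ P) N lenA lenB
      open Decode A B P N lenA lenB

    Solved : Set
    Solved = ∃[ Z ] ∃[ time ] ∃[ space ]
      ( IsSTR-IC-LCS A B P Z × Computes program w input (Maybe.map (map toℕ) Z) time space ×
        time ≤ c ·O[ timeBound N (length P) ∣ Z ∣⊥ ] × space ≤ c ·O[ spaceBound N ∣ Z ∣⊥ ] )

    Run : ℕ → ℕ → (ℕ → List ℕ → Set) → Set
    Run t cells Q = ∃[ σ′ ] ∃[ time ] ∃[ used ] (Q (env σ′ C.flag) (out σ′) × time ≤ t × used ≤ cells ×
      runFor w input program time ≡ halted (answer (env σ′ C.flag) (out σ′)) used)

    -- There are 56 registers, 48 for variables and 8 for temporaries.
    computes : ∀ {xs used time} → runFor w input program time ≡ halted xs used → Computes program w input xs time (56 + used)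
    computes run = record { used = _ ; halts = run ; space≡ = refl }

    rejects : ¬ (In (map toℕ A) × In (map toℕ B)) → Solved
    -- The run is verified with `lim` = 0, so that it uses no memory beyond the registers.
    rejects nope = conclude (assemble-correct (hardware (machine w 0 input) 256≤W chars sizes z≤n) {flag = C.flag} (s≤s (s≤s (s≤s z≤n)))
                      (Main.reject-correct (mainSetting (machine w 0 input) N N<W (sizes tapeP) lenA lenB) nope))
      where
      module Bd = Bounds N R 0 z≤n R≤N {50000} {4000} ≤-refl ≤-refl ≤c
      none : ∀ Z → ¬ Candidate A B P Z
      none Z cand with recode cand
      ... | (X , Y) , ((_ , s) , _ , s′) , _ = nope (⊆⇒emb (map toℕ P) (map toℕ A) N lenA X Y s , ⊆⇒emb (map toℕ P) (map toℕ B) N lenB X Y s′)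
      conclude : Run _ 0 (λ f _ → f ≡ 0) → Solved
      conclude (σ′ , time , used , flag≡ , time≤ , used≤ , run) = Maybe.nothing , time , 56 + used , none ,
        computes (trans run (cong (λ f → halted (answer f (out σ′)) used) flag≡)) ,
        subst (λ r → time ≤ c ·O[ timeBound N r ∣ Maybe.nothing {A = List (Fin σ)} ∣⊥ ]) R≡
          (lift-bound c (cong (λ z → + (N * R / suc ⌊log₂ R ⌋) ℤ.+ z) (sym (ℤ.pos-* N (N + 1 + 1)))) (≤-trans time≤ Bd.reject-≤)) ,
        -- The factor ℓ′ + 1 vanishes for ⊥, which leaves the constant c for the registers.
        lift-bound c {g = 0} (ℤ.*-zeroˡ (+ N ℤ.- ℤ.-1ℤ ℤ.+ 1ℤ)) (≤-trans (+-monoʳ-≤ 56 used≤)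
          (lin 1 (λ c → (‵ 1000000 :≤ c) ∷ [] ⊢ ‵ 56 :+ ‵ 0 :≤ c :* (‵ 0 :+ ‵ 1)) c ≤c))

    module Accepts (embA : In (map toℕ A)) (embB : In (map toℕ B))
      (best : List ℕ × List ℕ) (cand : CandG 0 0 best) (optimal : ∀ d → CandG 0 0 d → size d ≤ size best) where

      private
        -- Here k = n - ℓ′, and γ bounds the nodes of one row. The two parts of `lim` are for the
        -- arrays of linear length and for the heap.
        s k γ lim : ℕ
        s = size best
        k = N ∸ (s + R)
        γ = (8 * k + 6) ⊓ suc s
        lim = (16 * N + 16) + (1 + (N + suc N) * γ)

        s+R≤N : s + R ≤ N
        s+R≤N = ≤-trans (m≤m+n _ 0) (System.boundA (systemG {0}) {d = best} cand)

        slack : s + R + k ≡ N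
        slack = m+[n∸m]≡n s+R≤N

        module Bd = Bounds N R k (m∸n≤m N (s + R)) R≤N {50000} {4000} ≤-refl ≤-refl ≤c

        -- With γ ≤ s + 1 ≤ N + 1 the heap has O(N ^ 2) nodes, so addresses are quadratic in X.
        memory : lim * arrays ≤ 2 ^ w
        memory = fits (lin 4 (λ N γ s X → (‵ 11 :* (‵ 2 :* N :+ ‵ 1) ∙ (γ :≤ ‵ 1 :+ s)) ∷ (‵ 11 :* (‵ 2 :* N :+ ‵ 1) ∙ (s :≤ N)) ∷
            ((‵ 187 :+ ‵ 22 :* N :+ ‵ 22 :* X) ∙ (N :< X)) ∷ ((‵ 11 :+ ‵ 176 :* X) ∙ (‵ 1 :≤ X)) ∷ [] ⊢
            ((‵ 16 :* N :+ ‵ 16) :+ (‵ 1 :+ (N :+ (‵ 1 :+ N)) :* γ)) :* ‵ 11 :≤ ‵ 256 :* (X :* X))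
          N γ s X (m⊓n≤n (8 * k + 6) (suc s)) (≤-trans (m≤m+n s R) s+R≤N) N<X X>0)

        lim<W : lim < 2 ^ w
        lim<W = ≤-trans (lin 1 (λ l → (‵ 10 ∙ (‵ 1 :≤ l)) ∷ [] ⊢ ‵ 1 :+ l :≤ l :* ‵ 11) lim (≤-trans (s≤s z≤n) (m≤n+m _ (16 * N + 16)))) memory

        mc : Machine
        mc = machine w lim input

        setting : SolveSetting
        setting = solveSetting (space mc N (m≤m+n _ _) lim<W) (λ τ i → linear (char<X τ i)) keys lenA lenB R≤N
          (blocks R) (s≤s z≤n) (≤-trans (s≤s (m/n≤m (3 * R) _)) (lin 1 (λ R → [] ⊢ ‵ 1 :+ ‵ 3 :* R :≤ ‵ 4 :* R :+ ‵ 4) R))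
          (blocks-enough R)

        module So = Solve setting

        goal : So.Dyn.Plan
        goal = So.Dyn.plan best cand optimal k slack γ ≤-refl (m≤n+m _ (16 * N + 16))

        module Ma = Main (mainSetting mc N N<W (sizes tapeP) lenA lenB)

        -- The string emitted may differ from `best`, but both are optimal and so of equal length.
        report : ∀ {d time used} (Z : List (Fin σ)) → So.Optimal d → IsSTR-IC-LCS A B P (Maybe.just Z) → length Z ≡ size d + R →
          runFor w input program time ≡ halted (Maybe.just (map toℕ Z)) used →
          time ≤ c * (N * R / suc ⌊log₂ R ⌋ + N * (k + 1) + 1) → used ≤ lim * arrays → Solved
        report {d} {time} {used} Z (cand′ , optimal′) is-lcs ℓ≡ run time≤ used≤ = Maybe.just Z , time , 56 + used , is-lcs , computes run ,
          subst (λ r → time ≤ c ·O[ timeBound N r (+ length Z) ]) R≡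
            (lift-bound c (trans (cong (λ z → + (N * R / suc ⌊log₂ R ⌋) ℤ.+ + N ℤ.* (z ℤ.+ 1ℤ)) (difference left))
               (cong (λ z → + (N * R / suc ⌊log₂ R ⌋) ℤ.+ z) (sym (ℤ.pos-* N (k + 1))))) time≤) ,
          lift-bound c (trans (cong (λ z → (+ length Z ℤ.+ 1ℤ) ℤ.* (z ℤ.+ 1ℤ)) (difference left)) (sym (ℤ.pos-* (length Z + 1) (k + 1))))
            (Bd.space-≤ left (m⊓n≤m (8 * k + 6) (suc s))
              (≤-trans (m⊓n≤n (8 * k + 6) (suc s)) (s≤s (≤-trans (m≤m+n s R) (≤-reflexive (sym ℓ≡′))))) used≤)
          where
          ℓ≡′ : length Z ≡ s + R
          ℓ≡′ = trans ℓ≡ (cong (_+ R) (≤-antisym (optimal d cand′) (optimal′ best cand)))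
          left : length Z + k ≡ N
          left = trans (cong (_+ k) ℓ≡′) slack

        conclude : ∀ {t} → t + 3 ≤ c * (N * R / suc ⌊log₂ R ⌋ + N * (k + 1) + 1) →
          ∃[ σ′ ] ∃[ time ] ∃[ used ] ((env σ′ C.flag ≡ 1 × So.Emitted goal σ′) ×
            time ≤ t + 3 × used ≤ lim * arrays × runFor w input program time ≡ halted (answer (env σ′ C.flag) (out σ′)) used) → Solved
        conclude t≤ (σ′ , time , used , (flag≡ , So.emitted {pair = d} written opt) , time≤ , used≤ , run) =
          let Z , is-lcs , Z≡ , ℓ≡ = optimal-decode {d} (proj₁ opt) (proj₂ opt) in
          report {d} Z opt is-lcs ℓ≡ (trans run (cong₂ (λ f o → halted (answer f o) used) flag≡ (trans written (sym Z≡)))) (≤-trans time≤ t≤) used≤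

      accepts : Solved
      accepts = conclude {Ma.decideTime + (2 + ((50000 * (suc N * blocks R) + So.lastTime goal) + 3))} Bd.accept-≤
        (assemble-correct (hardware mc 256≤W chars sizes memory) {flag = C.flag} (s≤s (s≤s (s≤s z≤n)))
          (Ma.accept-correct embA embB (So.solve-correct goal)))

    solved : Solved
    solved with emb? (map toℕ P) (map toℕ A) N lenA ×-dec emb? (map toℕ P) (map toℕ B) N lenB
    ... | yes (embA , embB) =
      let best , cand , optimal = best-exists {[] , []} ((z≤n , emb⇒⊆ (map toℕ P) (map toℕ A) N lenA embA) , z≤n , emb⇒⊆ (map toℕ P) (map toℕ B) N lenB embB) in
      Accepts.accepts embA embB best cand optimal
    ... | no nope = rejects nope

  solvable : ∀ c → 1000000 ≤ c → ∀ (σ n r : ℕ) (A B P : List (Fin σ)) →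
    length A ≡ n → length B ≡ n → length P ≡ r → r ≤ n →
    ∃[ Z ] ∃[ time ] ∃[ space ]
      ( IsSTR-IC-LCS A B P Z
      × Computes program (wordSize 10 σ n) (encode A B P) (Maybe.map (map toℕ) Z) time space
      × time ≤ c ·O[ timeBound n r ∣ Z ∣⊥ ]
      × space ≤ c ·O[ spaceBound n ∣ Z ∣⊥ ] )
  solvable c ≤c σ _ _ A B P refl lenB refl r≤n = Assembly.solved c ≤c A B P lenB r≤n

open import Defs
open import Data.Fin.Base using (Fin; toℕ)
open import Data.List.Base using (List; length; map)
import Data.Maybe.Base as Maybe
open import Data.Nat.Base using (ℕ; _≤_)
open import Data.Product.Base using (Σ-syntax; ∃-syntax; _×_)
open import Relation.Binary.PropositionalEquality.Core using (_≡_)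

theorem3 : Σ[ M ∈ Program ] Σ[ κ ∈ ℕ ] Σ[ c ∈ ℕ ]
    (∀ (σ n r : ℕ) (A B P : List (Fin σ)) →
    length A ≡ n → length B ≡ n → length P ≡ r → r ≤ n →
    ∃[ Z ] ∃[ time ] ∃[ space ]
    ( IsSTR-IC-LCS A B P Z
    × Computes M (wordSize κ σ n) (encode A B P) (Maybe.map (map toℕ) Z) time space
    × time ≤ c ·O[ timeBound n r ∣ Z ∣⊥ ]
    × space ≤ c ·O[ spaceBound n ∣ Z ∣⊥ ] ))
theorem3 = Resources.program , 10 , 1000000 , Resources.solvable 1000000 ≤-refl
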